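{- A positive integer $n$ is $\lambda$-practical if and only if every integer $m$ with $1 \le m \le n$ can be written in the form $m = \sum_{d \mid n} \lambda(d)\, m_d$, where each $m_d$ is an integer with $0 \le m_d \le \frac{\varphi(d)}{\lambda(d)}$.
   Context: For a prime $p$, a positive integer $n$ is $p$-practical if $x^n-1$ has a divisor in $\mathbb{F}_p[x]$ of every degree $1,\dots,n$; $n$ is $\lambda$-practical if it is $p$-practical for every prime $p$. $\lambda(d)$ denotes the Carmichael function, the exponent of the group $(\mathbb{Z}/d\mathbb{Z})^\times$ (with $\lambda(1)=1$), and $\varphi$ is Euler's totient function. -}

module Defs where

open import Data.Nat as ℕ using (ℕ; zero; suc; _≤_; _^_; _%_; _≡ᵇ_; _∸_)
open import Data.Nat.Primality using (Prime)
open import Data.Nat.GCD using (gcd)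
open import Data.Nat.Divisibility using (_∣?_)
open import Data.Integer as ℤ using (ℤ; +_; -[1+_])
open import Data.Integer.Divisibility renaming (_∣_ to _∣ℤ_)
open import Data.List using (List; []; _∷_; map; filter; length; upTo; replicate; _++_; [_])
open import Data.Bool.ListAction using (all)
open import Data.Bool using (Bool; true; false; if_then_else_)
open import Data.Product using (Σ; ∃; _×_)
open import Relation.Nullary using (¬_)
open import Relation.Binary.PropositionalEquality using (_≡_)

-- Polynomials over F_p, represented by integer coefficient lists
-- (constant term first); equality in F_p[x] is coefficientwise
-- congruence modulo p.

Poly : Set
Poly = List ℤ

_+P_ : Poly → Poly → Poly
[] +P q = q
(a ∷ p) +P [] = a ∷ p
(a ∷ p) +P (b ∷ q) = (a ℤ.+ b) ∷ (p +P q)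

_*P_ : Poly → Poly → Poly
[] *P q = []
(a ∷ p) *P q = map (a ℤ.*_) q +P (+ 0 ∷ (p *P q))

coeff : Poly → ℕ → ℤ
coeff [] _ = + 0
coeff (a ∷ p) zero = a
coeff (a ∷ p) (suc i) = coeff p i

_≡_[modℤ_] : ℤ → ℤ → ℕ → Set
a ≡ b [modℤ p ] = (+ p) ∣ℤ (a ℤ.- b)

_≈P_[mod_] : Poly → Poly → ℕ → Set
f ≈P g [mod p ] = ∀ i → coeff f i ≡ coeff g i [modℤ p ]

xⁿ-1 : ℕ → Poly
xⁿ-1 n = (replicate n (+ 0) ++ [ + 1 ]) +P [ -[1+ 0 ] ]

-- x^n - 1 has a divisor of degree k in F_p[x]:
-- g has degree exactly k over F_p (coefficients above k vanish since
-- length g = k+1, and the coefficient of x^k is nonzero mod p),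
-- and g * h = x^n - 1 in F_p[x].
HasDivisorOfDegree : ℕ → ℕ → ℕ → Set
HasDivisorOfDegree p n k =
  Σ Poly λ g → Σ Poly λ h →
    (length g ≡ suc k) × (¬ ((+ p) ∣ℤ coeff g k)) × ((g *P h) ≈P xⁿ-1 n [mod p ])

pPractical : ℕ → ℕ → Set
pPractical p n = ∀ k → 1 ≤ k → k ≤ n → HasDivisorOfDegree p n k

lambdaPractical : ℕ → Set
lambdaPractical n = ∀ p → Prime p → pPractical p n

oneTo : ℕ → List ℕ
oneTo d = map suc (upTo d)

units : ℕ → List ℕ
units d = filter (λ a → gcd a d ℕ.≟ 1) (oneTo d)

φ : ℕ → ℕ
φ d = length (units d)

firstTrue : (ℕ → Bool) → List ℕ → ℕ
firstTrue P [] = 0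
firstTrue P (e ∷ es) = if P e then e else firstTrue P es

-- Carmichael function: exponent of (ℤ/dℤ)^×, i.e. the least e ≥ 1 with
-- a^e ≡ 1 (mod d) for all units a.  Since the exponent divides the group
-- order φ(d) ≤ d, it suffices to search e ∈ {1,…,d}.  carmichael 1 = 1.
-- (carmichael 0 = 0 is a junk value, never used.)
carmichael : ℕ → ℕ
carmichael zero = 0
carmichael (suc d) =
  firstTrue (λ e → all (λ a → ((a ^ e) % suc d) ≡ᵇ (1 % suc d)) (units (suc d)))
            (oneTo (suc d))

divisors : ℕ → List ℕ
divisors n = filter (_∣? n) (oneTo n)

{-# OPTIONS --safe #-}
-- Over 𝔽ₚ with p ∤ d, the irreducible factors modulo which x has order d all have degree
-- ord_d(p), and together they have degree φ(d). For n = pᵛ n′ with p ∤ n′ the factors of xⁿ - 1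
-- are those of x^n′ - 1, each pᵛ times, so the degrees of the divisors of xⁿ - 1 are the subsums of
-- an explicit multiset. As ord_d′(p) divides λ(d) for the p-free part d′ of d, every admissible sum
-- of multiples of λ(d) is such a subsum. Conversely some unit a modulo n has order λ(d) modulo
-- every d ∣ n; by Dirichlet's theorem a prime p lies in its class, and for this p the multiset
-- consists of the numbers λ(d).
--
-- Dirichlet's theorem is proved by Selberg's method in rational arithmetic: on an initial segment
-- log is replaced by an additive function approximating log₂. If the class of a contained no
-- prime, Selberg's formula would force every class to have either almost none or twice its share of
-- Σ log p / p. The classes of the first kind then form a subgroup of index 2, that is, a quadratic
-- character χ with Σ χ(p) log p / p very negative, contradicting Monsky's bound L(1, χ) > 0.
module Submission where

-- No limit is ever taken: `N` fixes one bound `B`, and all sums live on 1, ..., B. Of the logarithm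
-- only additivity, monotonicity, the value 1 at 2 and increments of at most 4 / n survive; these
-- carry all estimates with bounded error. Selberg's formula is used with the weights Λ(n) / n,
-- where its main term is (log x)² and its error O(log x). By itself it cannot exclude that the
-- primes avoid half of the classes and fill the other half twice; this parity obstacle is why a
-- lower bound for L(1, χ) has to enter. The alternative is rigid only up to the error of the sieve
-- bound, which is about log Y / log z₀ + log z₀. It is balanced by giving log z₀ the order of the
-- square root J of log Y. Hence densities have size J², errors have size J, and `B` is exponential
-- in J². On the algebraic side, when p divides n, several divisors d of n have the same p-free part
-- and draw on the same irreducible factors. That the supply is large enough follows from comparing
-- divisor sums of φ.

open import Algebra using (CommutativeRing; IsCommutativeRing; IsCommutativeSemiring)

-- A reflective solver for ring identities with integer coefficients.

module IntSolver {c ℓ} (R : CommutativeRing c ℓ) where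

 open CommutativeRing R
 open import Algebra.Properties.Ring ring using (-‿distribˡ-*; -‿distribʳ-*; -0#≈0#)
 open import Algebra.Properties.AbelianGroup +-abelianGroup using (⁻¹-∙-comm; ⁻¹-involutive)
 open import Algebra.Properties.Semiring.Mult.TCOptimised semiring using (×-homo-+; ×1-homo-*; 1+×) renaming (_×_ to _·_)
 open import Data.Integer as ℤ using (ℤ; +_; -[1+_])
 import Data.Integer.Properties as ℤ
 open import Data.Bool using (Bool; true; false; T; _∧_; if_then_else_)
 open import Data.List using (List; []; _∷_; map)
 open import Data.Product using (_×_; _,_)
 open import Data.Nat as ℕ using (ℕ; zero; suc; _<ᵇ_; _≡ᵇ_)
 import Data.Nat.Properties as ℕ
 open import Relation.Binary.PropositionalEquality as ≡ using (_≡_)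
 open import Relation.Binary.Reasoning.Setoid setoid
 open import Data.Unit using (tt)

 # : ℕ → Carrier
 # n = n · 1#

 fromℤ : ℤ → Carrier
 fromℤ (+ n) = # n
 fromℤ -[1+ n ] = - # (suc n)

 private
   cancel1 : ∀ a b → (1# + a) - (1# + b) ≈ a - b
   cancel1 a b = begin
     (1# + a) + - (1# + b) ≈⟨ +-cong (+-comm 1# a) (sym (⁻¹-∙-comm 1# b)) ⟩
     (a + 1#) + (- 1# + - b) ≈⟨ +-assoc a 1# _ ⟩
     a + (1# + (- 1# + - b)) ≈⟨ +-congˡ (sym (+-assoc 1# (- 1#) (- b))) ⟩
     a + ((1# + - 1#) + - b) ≈⟨ +-congˡ (+-congʳ (-‿inverseʳ 1#)) ⟩
     a + (0# + - b) ≈⟨ +-congˡ (+-identityˡ (- b)) ⟩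
     a + - b ∎

   ⊖-homo : ∀ m n → fromℤ (m ℤ.⊖ n) ≈ # m - # n
   ⊖-homo m zero = begin
     fromℤ (m ℤ.⊖ 0) ≡⟨ ≡.cong fromℤ (ℤ.⊖-≥ {m} ℕ.z≤n) ⟩
     # m ≈⟨ sym (+-identityʳ _) ⟩
     # m + 0# ≈⟨ +-congˡ (sym -0#≈0#) ⟩
     # m - 0# ∎
   ⊖-homo zero (suc n) = sym (+-identityˡ _)
   ⊖-homo (suc m) (suc n) = begin
     fromℤ (suc m ℤ.⊖ suc n) ≡⟨ ≡.cong fromℤ (ℤ.[1+m]⊖[1+n]≡m⊖n m n) ⟩
     fromℤ (m ℤ.⊖ n) ≈⟨ ⊖-homo m n ⟩
     # m - # n ≈⟨ sym (cancel1 (# m) (# n)) ⟩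
     (1# + # m) - (1# + # n) ≈⟨ +-cong (sym (1+× m 1#)) (-‿cong (sym (1+× n 1#))) ⟩
     # (suc m) - # (suc n) ∎

   neg-homo : ∀ i → fromℤ (ℤ.- i) ≈ - fromℤ i
   neg-homo (+ zero) = sym -0#≈0#
   neg-homo (+ suc n) = refl
   neg-homo -[1+ n ] = sym (⁻¹-involutive _)

   +-homo : ∀ i j → fromℤ (i ℤ.+ j) ≈ fromℤ i + fromℤ j
   +-homo (+ m) (+ n) = ×-homo-+ 1# m n
   +-homo (+ m) -[1+ n ] = ⊖-homo m (suc n)
   +-homo -[1+ m ] (+ n) = trans (⊖-homo n (suc m)) (+-comm _ _)
   +-homo -[1+ m ] -[1+ n ] = begin
     - # (suc (suc (m ℕ.+ n))) ≡⟨ ≡.cong (λ k → - # (suc k)) (≡.sym (ℕ-suc m n)) ⟩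
     - # (suc m ℕ.+ suc n) ≈⟨ -‿cong (×-homo-+ 1# (suc m) (suc n)) ⟩
     - (# (suc m) + # (suc n)) ≈⟨ sym (⁻¹-∙-comm _ _) ⟩
     - # (suc m) + - # (suc n) ∎
     where
     ℕ-suc : ∀ m n → m ℕ.+ suc n ≡ suc (m ℕ.+ n)
     ℕ-suc zero n = ≡.refl
     ℕ-suc (suc m) n = ≡.cong suc (ℕ-suc m n)

   *-homo⁺ : ∀ m j → fromℤ (+ m ℤ.* j) ≈ # m * fromℤ j
   *-homo⁺ m (+ n) = trans (reflexive (≡.cong fromℤ (≡.sym (ℤ.pos-* m n)))) (×1-homo-* m n)
   *-homo⁺ m -[1+ n ] = begin
     fromℤ (+ m ℤ.* ℤ.- (+ suc n)) ≡⟨ ≡.cong fromℤ (≡.sym (ℤ.neg-distribʳ-* (+ m) (+ suc n))) ⟩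
     fromℤ (ℤ.- (+ m ℤ.* + suc n)) ≈⟨ neg-homo (+ m ℤ.* + suc n) ⟩
     - fromℤ (+ m ℤ.* + suc n) ≈⟨ -‿cong (*-homo⁺ m (+ suc n)) ⟩
     - (# m * # (suc n)) ≈⟨ -‿distribʳ-* (# m) (# (suc n)) ⟩
     # m * - # (suc n) ∎

   *-homo : ∀ i j → fromℤ (i ℤ.* j) ≈ fromℤ i * fromℤ j
   *-homo (+ m) j = *-homo⁺ m j
   *-homo -[1+ m ] j = begin
     fromℤ (ℤ.- (+ suc m) ℤ.* j) ≡⟨ ≡.cong fromℤ (≡.sym (ℤ.neg-distribˡ-* (+ suc m) j)) ⟩
     fromℤ (ℤ.- (+ suc m ℤ.* j)) ≈⟨ neg-homo (+ suc m ℤ.* j) ⟩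
     - fromℤ (+ suc m ℤ.* j) ≈⟨ -‿cong (*-homo⁺ (suc m) j) ⟩
     - (# (suc m) * fromℤ j) ≈⟨ -‿distribˡ-* (# (suc m)) (fromℤ j) ⟩
     - # (suc m) * fromℤ j ∎

 #-+ : ∀ m n → # (m ℕ.+ n) ≈ # m + # n
 #-+ = ×-homo-+ 1#

 #-* : ∀ m n → # (m ℕ.* n) ≈ # m * # n
 #-* = ×1-homo-*

 #-suc : ∀ n → # (suc n) ≈ 1# + # n
 #-suc n = 1+× n 1#

 infixl 6 _:+_ _:-_
 infixl 7 _:*_
 infix 8 :-_

 data Expr : Set where
   con : ℤ → Expr
   var : ℕ → Expr
   _:+_ _:*_ : Expr → Expr → Expr
   :-_ : Expr → Expr

 _:-_ : Expr → Expr → Expr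
 a :- b = a :+ (:- b)

 cn : ℕ → Expr
 cn n = con (+ n)

 c0 c1 c2 c4 c6 c8 v0 v1 v2 v3 v4 v5 v6 v7 v8 v9 v10 v11 v12 v13 : Expr
 c0 = cn 0
 c1 = cn 1
 c2 = cn 2
 c4 = cn 4
 c6 = cn 6
 c8 = cn 8
 v0 = var 0
 v1 = var 1
 v2 = var 2
 v3 = var 3
 v4 = var 4
 v5 = var 5
 v6 = var 6
 v7 = var 7
 v8 = var 8
 v9 = var 9
 v10 = var 10
 v11 = var 11
 v12 = var 12
 v13 = var 13

 lookup : List Carrier → ℕ → Carrier
 lookup [] _ = 0#
 lookup (x ∷ xs) zero = x
 lookup (x ∷ xs) (suc i) = lookup xs i

 ⟦_⟧ : Expr → List Carrier → Carrier
 ⟦ con c ⟧ ρ = fromℤ c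
 ⟦ var i ⟧ ρ = lookup ρ i
 ⟦ a :+ b ⟧ ρ = ⟦ a ⟧ ρ + ⟦ b ⟧ ρ
 ⟦ a :* b ⟧ ρ = ⟦ a ⟧ ρ * ⟦ b ⟧ ρ
 ⟦ :- a ⟧ ρ = - ⟦ a ⟧ ρ

 private
   -- Sparse polynomials: lists of terms, each a sorted list of variables with a coefficient.
   Mono Poly : Set
   Mono = List ℕ
   Poly = List (Mono × ℤ)

   _≡ᵐ_ _<ᵐ_ : Mono → Mono → Bool
   [] ≡ᵐ [] = true
   [] ≡ᵐ (_ ∷ _) = false
   (_ ∷ _) ≡ᵐ [] = false
   (i ∷ m) ≡ᵐ (j ∷ n) = (i ≡ᵇ j) ∧ (m ≡ᵐ n)
   [] <ᵐ [] = false
   [] <ᵐ (_ ∷ _) = true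
   (_ ∷ _) <ᵐ [] = false
   (i ∷ m) <ᵐ (j ∷ n) = if i ≡ᵇ j then m <ᵐ n else i <ᵇ j

   ≡ᵐ⇒≡ : ∀ m n → m ≡ᵐ n ≡ true → m ≡ n
   ≡ᵐ⇒≡ [] [] _ = ≡.refl
   ≡ᵐ⇒≡ (i ∷ m) (j ∷ n) e with i ≡ᵇ j in ij
   ... | true = ≡.cong₂ _∷_ (ℕ.≡ᵇ⇒≡ i j (≡.subst T (≡.sym ij) tt)) (≡ᵐ⇒≡ m n e)

   mulᵐ : Mono → Mono → Mono
   mulᵐ [] n = n
   mulᵐ (i ∷ m) n = ins i (mulᵐ m n)
     where
     ins : ℕ → Mono → Mono
     ins i [] = i ∷ []
     ins i (j ∷ n) = if i <ᵇ j then i ∷ j ∷ n else j ∷ ins i n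

   add₁ : Mono → ℤ → Poly → Poly
   add₁ m c [] = (m , c) ∷ []
   add₁ m c ((n , d) ∷ q) with m ≡ᵐ n
   ... | true = (m , c ℤ.+ d) ∷ q
   ... | false = if m <ᵐ n then (m , c) ∷ (n , d) ∷ q else (n , d) ∷ add₁ m c q

   add : Poly → Poly → Poly
   add [] q = q
   add ((m , c) ∷ p) q = add₁ m c (add p q)

   mul₁ : Mono → ℤ → Poly → Poly
   mul₁ m c = map λ (n , d) → mulᵐ m n , c ℤ.* d

   mul : Poly → Poly → Poly
   mul [] q = []
   mul ((m , c) ∷ p) q = add (mul₁ m c q) (mul p q)

   norm : Expr → Poly
   norm (con c) = ([] , c) ∷ []
   norm (var i) = (i ∷ [] , + 1) ∷ []
   norm (a :+ b) = add (norm a) (norm b)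
   norm (a :* b) = mul (norm a) (norm b)
   norm (:- a) = map (λ (m , c) → m , ℤ.- c) (norm a)

   -- Terms that cancel stay in the list with coefficient `+ 0`, so vanishing is read off the
   -- coefficients and not from the list being empty.
   zero? : Poly → Bool
   zero? [] = true
   zero? ((_ , + 0) ∷ p) = zero? p
   zero? ((_ , _) ∷ p) = false

   module _ (ρ : List Carrier) where

     ⟦_⟧ᵐ : Mono → Carrier
     ⟦ [] ⟧ᵐ = 1#
     ⟦ i ∷ m ⟧ᵐ = lookup ρ i * ⟦ m ⟧ᵐ

     ⟦_⟧ᵖ : Poly → Carrier
     ⟦ [] ⟧ᵖ = 0#
     ⟦ (m , c) ∷ p ⟧ᵖ = fromℤ c * ⟦ m ⟧ᵐ + ⟦ p ⟧ᵖ

     swap : ∀ x y z → x * (y * z) ≈ y * (x * z)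
     swap x y z = trans (sym (*-assoc x y z)) (trans (*-congʳ (*-comm x y)) (*-assoc y x z))

     swap+ : ∀ x y z → x + (y + z) ≈ y + (x + z)
     swap+ x y z = trans (sym (+-assoc x y z)) (trans (+-congʳ (+-comm x y)) (+-assoc y x z))

     mulᵐ-sound : ∀ m n → ⟦ mulᵐ m n ⟧ᵐ ≈ ⟦ m ⟧ᵐ * ⟦ n ⟧ᵐ
     mulᵐ-sound [] n = sym (*-identityˡ _)
     mulᵐ-sound (i ∷ m) n = trans (ins-sound m n i (mulᵐ m n)) (trans (*-congˡ (mulᵐ-sound m n)) (sym (*-assoc _ _ _)))
       where
       ins-sound : ∀ m n i k → ⟦ mulᵐ (i ∷ []) k ⟧ᵐ ≈ lookup ρ i * ⟦ k ⟧ᵐ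
       ins-sound m n i [] = refl
       ins-sound m n i (j ∷ k) with i <ᵇ j
       ... | true = refl
       ... | false = trans (*-congˡ (ins-sound m n i k)) (swap _ _ _)

     add₁-sound : ∀ m c q → ⟦ add₁ m c q ⟧ᵖ ≈ fromℤ c * ⟦ m ⟧ᵐ + ⟦ q ⟧ᵖ
     add₁-sound m c [] = refl
     add₁-sound m c ((n , d) ∷ q) with m ≡ᵐ n in eq
     ... | true with ≡ᵐ⇒≡ m n eq
     ... | ≡.refl = trans (+-congʳ (trans (*-congʳ (+-homo c d)) (distribʳ _ _ _))) (+-assoc _ _ _)
     add₁-sound m c ((n , d) ∷ q) | false with m <ᵐ n
     ... | true = refl
     ... | false = trans (+-congˡ (add₁-sound m c q)) (swap+ _ _ _)

     add-sound : ∀ p q → ⟦ add p q ⟧ᵖ ≈ ⟦ p ⟧ᵖ + ⟦ q ⟧ᵖ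
     add-sound [] q = sym (+-identityˡ _)
     add-sound ((m , c) ∷ p) q = trans (add₁-sound m c (add p q)) (trans (+-congˡ (add-sound p q)) (sym (+-assoc _ _ _)))

     mul₁-sound : ∀ m c q → ⟦ mul₁ m c q ⟧ᵖ ≈ (fromℤ c * ⟦ m ⟧ᵐ) * ⟦ q ⟧ᵖ
     mul₁-sound m c [] = sym (zeroʳ _)
     mul₁-sound m c ((n , d) ∷ q) = trans (+-cong (trans (*-cong (*-homo c d) (mulᵐ-sound m n))
         (trans (*-assoc _ _ _) (trans (*-congˡ (swap _ _ _)) (sym (*-assoc _ _ _))))) (mul₁-sound m c q)) (sym (distribˡ _ _ _))

     mul-sound : ∀ p q → ⟦ mul p q ⟧ᵖ ≈ ⟦ p ⟧ᵖ * ⟦ q ⟧ᵖ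
     mul-sound [] q = sym (zeroˡ _)
     mul-sound ((m , c) ∷ p) q = trans (add-sound (mul₁ m c q) (mul p q)) (trans (+-cong (mul₁-sound m c q) (mul-sound p q)) (sym (distribʳ _ _ _)))

     neg-sound : ∀ p → ⟦ map (λ (m , c) → m , ℤ.- c) p ⟧ᵖ ≈ - ⟦ p ⟧ᵖ
     neg-sound [] = sym -0#≈0#
     neg-sound ((m , c) ∷ p) = trans (+-cong (trans (*-congʳ (neg-homo c)) (sym (-‿distribˡ-* _ _))) (neg-sound p)) (⁻¹-∙-comm _ _)

     norm-sound : ∀ e → ⟦ norm e ⟧ᵖ ≈ ⟦ e ⟧ ρ
     norm-sound (con c) = trans (+-identityʳ _) (*-identityʳ _)
     norm-sound (var i) = trans (+-identityʳ _) (trans (*-identityˡ _) (*-identityʳ _))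
     norm-sound (a :+ b) = trans (add-sound (norm a) (norm b)) (+-cong (norm-sound a) (norm-sound b))
     norm-sound (a :* b) = trans (mul-sound (norm a) (norm b)) (*-cong (norm-sound a) (norm-sound b))
     norm-sound (:- a) = trans (neg-sound (norm a)) (-‿cong (norm-sound a))

     zero-sound : ∀ p → T (zero? p) → ⟦ p ⟧ᵖ ≈ 0#
     zero-sound [] _ = refl
     zero-sound ((_ , + 0) ∷ p) e = trans (+-cong (zeroˡ _) (zero-sound p e)) (+-identityˡ 0#)

 -- The implicit argument has a type that evaluates to the unit type exactly when the normal form of
 -- the difference vanishes, so a valid identity is accepted by computation alone.
 solve : ∀ ρ a b {_ : T (zero? (norm (a :- b)))} → ⟦ a ⟧ ρ ≈ ⟦ b ⟧ ρ
 solve ρ a b {t} = begin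
   x ≈⟨ sym (+-identityʳ x) ⟩
   x + 0# ≈⟨ +-congˡ (sym (-‿inverseˡ y)) ⟩
   x + (- y + y) ≈⟨ sym (+-assoc x (- y) y) ⟩
   (x - y) + y ≈⟨ +-congʳ (trans (sym (norm-sound ρ (a :- b))) (zero-sound ρ (norm (a :- b)) t)) ⟩
   0# + y ≈⟨ +-identityˡ y ⟩
   y ∎
   where
   x = ⟦ a ⟧ ρ
   y = ⟦ b ⟧ ρ

open import Relation.Binary.PropositionalEquality as ≡ using (_≡_; _≢_; refl; sym; trans; cong; cong₂; subst; subst₂; module ≡-Reasoning)

-- Sums over 1, ..., n and indicators in a commutative semiring.

module BigSum {A : Set} (_+_ _*_ : A → A → A) (0# 1# : A)
 (isCS : IsCommutativeSemiring _≡_ _+_ _*_ 0# 1#) where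

 open import Data.Nat as ℕ using (ℕ; zero; suc; z≤n; s≤s)
 import Data.Nat.Properties as ℕ
 open import Data.Empty using (⊥-elim)
 open import Data.Product using (_,_)
 open import Relation.Nullary using (¬_; Dec; yes; no)

 open IsCommutativeSemiring isCS
   using (+-assoc; +-comm; +-identityˡ; +-identityʳ; distribˡ; distribʳ; zeroˡ; zeroʳ; *-identityˡ; *-comm)
 open ≡-Reasoning

 ∑ : ℕ → (ℕ → A) → A
 ∑ zero f = 0#
 ∑ (suc n) f = ∑ n f + f (suc n)

 ∑-cong : ∀ n {f g} → (∀ i → 1 ℕ.≤ i → i ℕ.≤ n → f i ≡ g i) → ∑ n f ≡ ∑ n g
 ∑-cong zero h = refl
 ∑-cong (suc n) h = cong₂ _+_ (∑-cong n λ i p q → h i p (ℕ.m≤n⇒m≤1+n q)) (h (suc n) (s≤s z≤n) ℕ.≤-refl)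

 ∑-ext : ∀ n {f g} → (∀ i → f i ≡ g i) → ∑ n f ≡ ∑ n g
 ∑-ext n h = ∑-cong n λ i _ _ → h i

 ∑-0 : ∀ n {f} → (∀ i → 1 ℕ.≤ i → i ℕ.≤ n → f i ≡ 0#) → ∑ n f ≡ 0#
 ∑-0 zero h = refl
 ∑-0 (suc n) h = trans (cong₂ _+_ (∑-0 n λ i p q → h i p (ℕ.m≤n⇒m≤1+n q)) (h (suc n) (s≤s z≤n) ℕ.≤-refl)) (+-identityˡ 0#)

 private
   interchange : ∀ a b c d → (a + b) + (c + d) ≡ (a + c) + (b + d)
   interchange a b c d = begin
     (a + b) + (c + d) ≡⟨ +-assoc a b _ ⟩
     a + (b + (c + d)) ≡⟨ cong (a +_) (sym (+-assoc b c d)) ⟩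
     a + ((b + c) + d) ≡⟨ cong (λ z → a + (z + d)) (+-comm b c) ⟩
     a + ((c + b) + d) ≡⟨ cong (a +_) (+-assoc c b d) ⟩
     a + (c + (b + d)) ≡⟨ sym (+-assoc a c _) ⟩
     (a + c) + (b + d) ∎

 ∑-+ : ∀ n f g → ∑ n (λ i → f i + g i) ≡ ∑ n f + ∑ n g
 ∑-+ zero f g = sym (+-identityˡ 0#)
 ∑-+ (suc n) f g = trans (cong (_+ _) (∑-+ n f g)) (interchange _ _ _ _)

 ∑-*ˡ : ∀ n c f → c * ∑ n f ≡ ∑ n (λ i → c * f i)
 ∑-*ˡ zero c f = zeroʳ c
 ∑-*ˡ (suc n) c f = trans (distribˡ c _ _) (cong (_+ _) (∑-*ˡ n c f))

 ∑-*ʳ : ∀ n c f → ∑ n f * c ≡ ∑ n (λ i → f i * c)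
 ∑-*ʳ zero c f = zeroˡ c
 ∑-*ʳ (suc n) c f = trans (distribʳ c _ _) (cong (_+ _) (∑-*ʳ n c f))

 ∑-swap : ∀ m n (f : ℕ → ℕ → A) → ∑ m (λ i → ∑ n (λ j → f i j)) ≡ ∑ n (λ j → ∑ m (λ i → f i j))
 ∑-swap zero n f = sym (∑-0 n λ _ _ _ → refl)
 ∑-swap (suc m) n f = trans (cong (_+ ∑ n (f (suc m))) (∑-swap m n f)) (sym (∑-+ n _ _))

 ∑-++ : ∀ m n f → ∑ (m ℕ.+ n) f ≡ ∑ m f + ∑ n (λ i → f (m ℕ.+ i))
 ∑-++ m zero f = trans (cong (λ k → ∑ k f) (ℕ.+-identityʳ m)) (sym (+-identityʳ _))
 ∑-++ m (suc n) f = begin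
   ∑ (m ℕ.+ suc n) f ≡⟨ cong (λ k → ∑ k f) (ℕ.+-suc m n) ⟩
   ∑ (m ℕ.+ n) f + f (suc (m ℕ.+ n)) ≡⟨ cong₂ _+_ (∑-++ m n f) (cong f (sym (ℕ.+-suc m n))) ⟩
   (∑ m f + ∑ n (λ i → f (m ℕ.+ i))) + f (m ℕ.+ suc n) ≡⟨ +-assoc _ _ _ ⟩
   ∑ m f + ∑ (suc n) (λ i → f (m ℕ.+ i)) ∎

 ∑-trunc : ∀ {m n} f → n ℕ.≤ m → (∀ i → n ℕ.< i → i ℕ.≤ m → f i ≡ 0#) → ∑ m f ≡ ∑ n f
 ∑-trunc {m} {n} f n≤m h with ℕ.m≤n⇒∃[o]m+o≡n n≤m
 ... | o , refl = trans (∑-++ n o f) (trans (cong (∑ n f +_) (∑-0 o λ i p q →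
         h (n ℕ.+ i) (ℕ.≤-trans (ℕ.≤-reflexive (ℕ.+-comm 1 n)) (ℕ.+-monoʳ-≤ n p)) (ℕ.+-monoʳ-≤ n q))) (+-identityʳ _))

 -- The Iverson bracket; sums over subsets of 1, ..., n carry it as a factor.
 ι : ∀ {P : Set} → Dec P → A
 ι (yes _) = 1#
 ι (no _) = 0#

 ι-yes : ∀ {P : Set} (d : Dec P) → P → ι d ≡ 1#
 ι-yes (yes _) _ = refl
 ι-yes (no ¬p) p = ⊥-elim (¬p p)

 ι-no : ∀ {P : Set} (d : Dec P) → ¬ P → ι d ≡ 0#
 ι-no (yes p) ¬p = ⊥-elim (¬p p)
 ι-no (no _) _ = refl

 ι-⇔ : ∀ {P Q : Set} (d : Dec P) (e : Dec Q) → (P → Q) → (Q → P) → ι d ≡ ι e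
 ι-⇔ (yes p) e f g = sym (ι-yes e (f p))
 ι-⇔ (no ¬p) e f g = sym (ι-no e λ q → ¬p (g q))

 ι-*-cong : ∀ {P : Set} (d : Dec P) {x y} → (P → x ≡ y) → ι d * x ≡ ι d * y
 ι-*-cong (yes p) h = cong (1# *_) (h p)
 ι-*-cong (no _) h = trans (zeroˡ _) (sym (zeroˡ _))

 ι-*-yes : ∀ {P : Set} (d : Dec P) {x} → P → ι d * x ≡ x
 ι-*-yes d p = trans (cong (_* _) (ι-yes d p)) (*-identityˡ _)

 ι-*-no : ∀ {P : Set} (d : Dec P) {x} → ¬ P → ι d * x ≡ 0#
 ι-*-no d ¬p = trans (cong (_* _) (ι-no d ¬p)) (zeroˡ _)

 ∑-δ : ∀ n k (f : ℕ → A) → 1 ℕ.≤ k → k ℕ.≤ n → ∑ n (λ i → ι (i ℕ.≟ k) * f i) ≡ f k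
 ∑-δ (suc n) k f 1≤k k≤1+n with k ℕ.≟ suc n
 ... | yes refl = trans (cong₂ _+_ (∑-0 n λ i _ i≤n → ι-*-no (i ℕ.≟ suc n) λ { refl → ℕ.1+n≰n i≤n })
                                   (ι-*-yes (suc n ℕ.≟ suc n) refl))
                        (+-identityˡ _)
 ... | no k≢ = trans (cong₂ _+_ (∑-δ n k f 1≤k (ℕ.≤-pred (ℕ.≤∧≢⇒< k≤1+n k≢)))
                                (ι-*-no (suc n ℕ.≟ k) λ e → k≢ (sym e)))
                     (+-identityʳ _)
 ∑-δ zero k f 1≤k k≤0 = ⊥-elim (ℕ.<⇒≱ 1≤k k≤0)

 ∑-δ-0 : ∀ n k (f : ℕ → A) → (∀ i → 1 ℕ.≤ i → i ℕ.≤ n → i ≢ k) → ∑ n (λ i → ι (i ℕ.≟ k) * f i) ≡ 0#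
 ∑-δ-0 n k f h = ∑-0 n λ i p q → ι-*-no (i ℕ.≟ k) (h i p q)

open import Defs
open import Level using (0ℓ)
open import Data.Nat as ℕ using (ℕ; zero; suc; z≤n; s≤s)
import Data.Nat.Properties as ℕ
import Data.Nat.DivMod as ℕ
open import Data.Nat.Divisibility as ℕ using (divides)
open import Data.Nat.Primality using (Prime; euclidsLemma; prime[2])
open import Data.Nat.Coprimality using (Coprime; coprime-divisor)
open import Data.Nat.Induction using (<-rec)
open import Data.Nat.Tactic.RingSolver using (solve-∀)
import Data.Integer as ℤ
import Data.Integer.Properties as ℤ
open import Data.List using (List; []; _∷_; length; map)
open import Data.Product using (∃; _×_; _,_; proj₁; proj₂)
open import Data.Sum using (_⊎_; inj₁; inj₂; [_,_]′)
open import Data.Empty using (⊥; ⊥-elim)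
open import Relation.Nullary using (¬_; Dec; yes; no)
open import Relation.Nullary.Decidable using (map′; _×-dec_)

-- Congruences, multiplicative orders and the Carmichael function.

module Arithmetic where

 open import Data.Nat using (_+_; _*_; _^_; _∸_; pred; _≤_; _<_; NonZero; >-nonZero; _≟_; _≡ᵇ_)
 open import Data.Nat.Properties
 open import Data.Nat.DivMod using (_%_; _/_; m≡m%n+[m/n]*n; m%n<n; [m+kn]%n≡m%n; n%n≡0; m<n⇒m%n≡m)
 open import Data.Nat.Divisibility hiding (_∣?_)
 open import Data.Nat.GCD using (module Bézout; gcd; gcd[m,n]∣m; gcd[m,n]∣n; gcd-greatest)
 open import Data.Nat.ListAction using (product)
 import Data.Nat.Primality as Primality
 open import Data.Nat.Primality using (prime⇒irreducible; prime⇒nonZero; ¬prime[1])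
 open import Data.Nat.Primality.Factorisation using (factorise; module PrimeFactorisation)
 import Data.Nat.Coprimality as Coprimality
 open import Data.Nat.Coprimality using (coprime-Bézout; coprime⇒gcd≡1; gcd≡1⇒coprime)
 open import Data.Integer using (ℤ; +_; -[1+_])
 import Data.Integer.Divisibility.Signed as ℤS
 import Data.Integer.Tactic.RingSolver as ℤSolver
 open import Data.Bool using (Bool; true; false)
 open import Data.Bool.ListAction using (all)
 open import Data.Bool.Properties using (T-≡)
 open import Data.Fin using (Fin; toℕ; fromℕ<)
 open import Data.Fin.Properties using (pigeonhole; toℕ-fromℕ<; toℕ<n)
 open import Data.List using (applyUpTo)
 open import Data.List.Properties using (map-upTo)
 open import Data.List.Membership.Propositional using (_∈_)
 open import Data.List.Membership.Propositional.Properties using (∈-filter⁺; ∈-filter⁻; ∈-map⁺; ∈-upTo⁺)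
 open import Data.List.Relation.Unary.All as All using (All; []; _∷_)
 open import Data.List.Relation.Unary.All.Properties using (all⁺; all⁻)
 open import Function.Bundles using (module Equivalence)

 -- Opaque, so that normalisation never unfolds the decision procedures.
 opaque
   infix 4 _∣?_

   _∣?_ : ∀ m n → Dec (m ∣ n)
   _∣?_ = ℕ._∣?_

   prime? : ∀ n → Dec (Prime n)
   prime? = Primality.prime?

   coprime? : ∀ m n → Dec (Coprime m n)
   coprime? = Coprimality.coprime?

 prime≥2 : ∀ {p} → Prime p → 2 ≤ p
 prime≥2 {zero} pr with prime⇒nonZero pr
 ... | ()
 prime≥2 {suc zero} pr = ⊥-elim (¬prime[1] pr)
 prime≥2 {suc (suc p)} pr = s≤s (s≤s z≤n)

 prime-≥1 : ∀ {p} → Prime p → 1 ≤ p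
 prime-≥1 pr = ≤-trans (s≤s z≤n) (prime≥2 pr)

 prime-rec : (P : ℕ → Set) → P 1 → (∀ q m → Prime q → 1 ≤ m → P m → P (q * m)) → ∀ n → 1 ≤ n → P n
 prime-rec P P1 step n@(suc _) _ = subst P (sym isFactorisation) (proj₂ (go factors factorsPrime))
   where
   open PrimeFactorisation (factorise n)
   go : ∀ qs → All Prime qs → 1 ≤ product qs × P (product qs)
   go [] [] = ≤-refl , P1
   go (q ∷ qs) (pq ∷ pqs) with go qs pqs
   ... | 1≤m , Pm = *-mono-≤ (prime-≥1 pq) 1≤m , step q (product qs) pq 1≤m Pm

 opaque
   ∃-prime-factor : ∀ n → 2 ≤ n → ∃ λ q → Prime q × q ∣ n
   ∃-prime-factor n 2≤n = [ (λ { refl → ⊥-elim (<⇒≱ 2≤n ≤-refl) }) , (λ x → x) ]′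
     (prime-rec (λ n → n ≡ 1 ⊎ ∃ λ q → Prime q × q ∣ n) (inj₁ refl)
       (λ q m pq _ _ → inj₂ (q , pq , m∣m*n m)) n (≤-trans (s≤s z≤n) 2≤n))

 coprime-*ˡ : ∀ {a b n} → Coprime a n → Coprime b n → Coprime (a * b) n
 coprime-*ˡ {a} {b} a⊥n b⊥n {d} (d∣ab , d∣n) =
   b⊥n (coprime-divisor (λ (e∣d , e∣a) → a⊥n (e∣a , ∣-trans e∣d d∣n)) d∣ab , d∣n)

 coprime-^ˡ : ∀ {a n} k → Coprime a n → Coprime (a ^ k) n
 coprime-^ˡ zero a⊥n (d∣1 , _) = ∣1⇒≡1 d∣1
 coprime-^ˡ (suc k) a⊥n = coprime-*ˡ a⊥n (coprime-^ˡ k a⊥n)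

 coprime-∣ʳ : ∀ {a d n} → d ∣ n → Coprime a n → Coprime a d
 coprime-∣ʳ d∣n a⊥n (e∣a , e∣d) = a⊥n (e∣a , ∣-trans e∣d d∣n)

 coprime-∣ˡ : ∀ {a b n} → a ∣ b → Coprime b n → Coprime a n
 coprime-∣ˡ a∣b b⊥n (e∣a , e∣n) = b⊥n (∣-trans e∣a a∣b , e∣n)

 coprime-sym : ∀ {a b} → Coprime a b → Coprime b a
 coprime-sym a⊥b (x , y) = a⊥b (y , x)

 1-coprime : ∀ {n} → Coprime 1 n
 1-coprime (d∣1 , _) = ∣1⇒≡1 d∣1

 coprime-∣* : ∀ {d e n} → Coprime d e → d ∣ n → e ∣ n → d * e ∣ n
 coprime-∣* {d} {e} d⊥e (divides k refl) e∣n with coprime-divisor (coprime-sym d⊥e) (subst (e ∣_) (*-comm k d) e∣n)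
 ... | divides l refl = divides l (trans (*-assoc l e d) (cong (l *_) (*-comm e d)))

 opaque
   gcd-split : ∀ m n → 1 ≤ m → ∃ λ g → ∃ λ m′ → ∃ λ n′ → m ≡ m′ * g × n ≡ n′ * g × Coprime m′ n′ × 1 ≤ g
   gcd-split m n 1≤m = g , m′ , n′ , m≡ , n≡ , m′⊥n′ , 1≤g
     where
     g m′ n′ : ℕ
     g = gcd m n
     m′ = quotient (gcd[m,n]∣m m n)
     n′ = quotient (gcd[m,n]∣n m n)
     m≡ : m ≡ m′ * g
     m≡ = _∣_.equality (gcd[m,n]∣m m n)
     n≡ : n ≡ n′ * g
     n≡ = _∣_.equality (gcd[m,n]∣n m n)
     1≤g : 1 ≤ g
     1≤g = n≢0⇒n>0 λ e → <⇒≱ 1≤m (≤-reflexive (trans m≡ (trans (cong (m′ *_) e) (*-zeroʳ m′))))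
     m′⊥n′ : Coprime m′ n′
     m′⊥n′ {e} (divides x m′≡ , divides y n′≡) = ∣1⇒≡1 (*-cancelʳ-∣ g {{>-nonZero 1≤g}} (subst (e * g ∣_) (sym (*-identityˡ g))
       (gcd-greatest (divides x (trans m≡ (trans (cong (_* g) m′≡) (*-assoc x e g)))) (divides y (trans n≡ (trans (cong (_* g) n′≡) (*-assoc y e g)))))))

 prime∤⇒coprime : ∀ {p n} → Prime p → ¬ p ∣ n → Coprime p n
 prime∤⇒coprime pr p∤n (d∣p , d∣n) with prime⇒irreducible pr d∣p
 ... | inj₁ d≡1 = d≡1
 ... | inj₂ refl = ⊥-elim (p∤n d∣n)

 coprime⇒∤ : ∀ {p n} → 2 ≤ p → Coprime p n → ¬ p ∣ n
 coprime⇒∤ 2≤p p⊥n p∣n with p⊥n (∣-refl , p∣n)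
 ... | refl = <⇒≱ 2≤p ≤-refl

 primes-coprime : ∀ {p q} → Prime p → Prime q → p ≢ q → Coprime p q
 primes-coprime pp pq p≢q = prime∤⇒coprime pp λ p∣q →
   [ (λ { refl → ¬prime[1] pp }) , p≢q ]′ (prime⇒irreducible pq p∣q)

 n<2^n : ∀ n → n < 2 ^ n
 n<2^n zero = s≤s z≤n
 n<2^n (suc n) = begin-strict
   suc n ≡⟨ +-comm 1 n ⟩
   n + 1 <⟨ +-mono-<-≤ (n<2^n n) (m^n>0 2 n) ⟩
   2 ^ n + 2 ^ n ≡⟨ cong (_+_ (2 ^ n)) (sym (+-identityʳ (2 ^ n))) ⟩
   2 ^ suc n ∎
   where open ≤-Reasoning

 infix 4 _≋_[_] _≋?_[_]

 -- Congruence with an explicit quotient: matching on `by k refl` turns each closure property into a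
 -- polynomial identity for the ring solver.
 data _≋_[_] (a b : ℤ) (N : ℕ) : Set where
   by : ∀ k → a ≡ b ℤ.+ k ℤ.* + N → a ≋ b [ N ]

 ≋⇒∣ : ∀ {a b N} → a ≋ b [ N ] → a ≡ b [modℤ N ]
 ≋⇒∣ {a} {b} {N} (by k refl) = ℤS.∣⇒∣ᵤ (ℤS.divides k (lem b k (+ N)))
   where
   lem : ∀ b k n → (b ℤ.+ k ℤ.* n) ℤ.- b ≡ k ℤ.* n
   lem = ℤSolver.solve-∀

 ∣⇒≋ : ∀ {a b N} → a ≡ b [modℤ N ] → a ≋ b [ N ]
 ∣⇒≋ {a} {b} {N} p with ℤS.∣ᵤ⇒∣ p
 ... | ℤS.divides k e = by k (trans (lem a b) (cong (ℤ._+_ b) e))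
   where
   lem : ∀ a b → a ≡ b ℤ.+ (a ℤ.- b)
   lem = ℤSolver.solve-∀

 opaque
   _≋?_[_] : ∀ a b N → Dec (a ≋ b [ N ])
   a ≋? b [ N ] = map′ ∣⇒≋ ≋⇒∣ (N ∣? ℤ.∣ a ℤ.- b ∣)

 module _ {N : ℕ} where

   ≋-reflexive : ∀ {a b} → a ≡ b → a ≋ b [ N ]
   ≋-reflexive {a} refl = by (+ 0) (lem a (+ N))
     where
     lem : ∀ a n → a ≡ a ℤ.+ + 0 ℤ.* n
     lem = ℤSolver.solve-∀

   ≋-refl : ∀ {a} → a ≋ a [ N ]
   ≋-refl = ≋-reflexive refl

   ≋-sym : ∀ {a b} → a ≋ b [ N ] → b ≋ a [ N ]
   ≋-sym {a} {b} (by k refl) = by (ℤ.- k) (lem b k (+ N))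
     where
     lem : ∀ b k n → b ≡ (b ℤ.+ k ℤ.* n) ℤ.+ ℤ.- k ℤ.* n
     lem = ℤSolver.solve-∀

   ≋-trans : ∀ {a b c} → a ≋ b [ N ] → b ≋ c [ N ] → a ≋ c [ N ]
   ≋-trans {c = c} (by k refl) (by l refl) = by (k ℤ.+ l) (lem c k l (+ N))
     where
     lem : ∀ c k l n → (c ℤ.+ l ℤ.* n) ℤ.+ k ℤ.* n ≡ c ℤ.+ (k ℤ.+ l) ℤ.* n
     lem = ℤSolver.solve-∀

   ≋-+ : ∀ {a b c d} → a ≋ b [ N ] → c ≋ d [ N ] → a ℤ.+ c ≋ b ℤ.+ d [ N ]
   ≋-+ {b = b} {d = d} (by k refl) (by l refl) = by (k ℤ.+ l) (lem b d k l (+ N))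
     where
     lem : ∀ b d k l n → (b ℤ.+ k ℤ.* n) ℤ.+ (d ℤ.+ l ℤ.* n) ≡ (b ℤ.+ d) ℤ.+ (k ℤ.+ l) ℤ.* n
     lem = ℤSolver.solve-∀

   ≋-neg : ∀ {a b} → a ≋ b [ N ] → ℤ.- a ≋ ℤ.- b [ N ]
   ≋-neg {b = b} (by k refl) = by (ℤ.- k) (lem b k (+ N))
     where
     lem : ∀ b k n → ℤ.- (b ℤ.+ k ℤ.* n) ≡ ℤ.- b ℤ.+ ℤ.- k ℤ.* n
     lem = ℤSolver.solve-∀

   ≋-* : ∀ {a b c d} → a ≋ b [ N ] → c ≋ d [ N ] → a ℤ.* c ≋ b ℤ.* d [ N ]
   ≋-* {b = b} {d = d} (by k refl) (by l refl) = by (b ℤ.* l ℤ.+ k ℤ.* d ℤ.+ k ℤ.* l ℤ.* + N) (lem b d k l (+ N))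
     where
     lem : ∀ b d k l n → (b ℤ.+ k ℤ.* n) ℤ.* (d ℤ.+ l ℤ.* n) ≡ b ℤ.* d ℤ.+ (b ℤ.* l ℤ.+ k ℤ.* d ℤ.+ k ℤ.* l ℤ.* n) ℤ.* n
     lem = ℤSolver.solve-∀

 infix 4 _≅_[_] _≅?_[_]

 _≅_[_] : ℕ → ℕ → ℕ → Set
 a ≅ b [ N ] = + a ≋ + b [ N ]

 _≅?_[_] : ∀ a b N → Dec (a ≅ b [ N ])
 a ≅? b [ N ] = (+ a) ≋? (+ b) [ N ]

 module _ {N : ℕ} where

   ≅-* : ∀ {a b c d} → a ≅ b [ N ] → c ≅ d [ N ] → a * c ≅ b * d [ N ]
   ≅-* {a} {b} {c} {d} p q = subst₂ (_≋_[ N ]) (sym (ℤ.pos-* a c)) (sym (ℤ.pos-* b d)) (≋-* p q)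

   ≅-+ : ∀ {a b c d} → a ≅ b [ N ] → c ≅ d [ N ] → a + c ≅ b + d [ N ]
   ≅-+ p q = ≋-+ p q

   ≅-^ : ∀ {a b} k → a ≅ b [ N ] → a ^ k ≅ b ^ k [ N ]
   ≅-^ zero p = ≋-refl
   ≅-^ (suc k) p = ≅-* p (≅-^ k p)

   ≅-≡ : ∀ {a b} → a ≡ b → a ≅ b [ N ]
   ≅-≡ refl = ≋-refl

 ≅-0 : ∀ {n N} → N ∣ n → n ≅ 0 [ N ]
 ≅-0 {n} {N} (divides k refl) = by (+ k) (trans (ℤ.pos-* k N) (sym (ℤ.+-identityˡ _)))

 ≅-0⁻¹ : ∀ {n N} → n ≅ 0 [ N ] → N ∣ n
 ≅-0⁻¹ {n} {N} p = subst (λ z → N ∣ ℤ.∣ z ∣) (ℤ.+-identityʳ (+ n)) (≋⇒∣ p)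

 ≅-∣ : ∀ {a b d N} → d ∣ N → a ≋ b [ N ] → a ≋ b [ d ]
 ≅-∣ {a} {b} {d} (divides m refl) (by k refl) = by (k ℤ.* + m) (cong (ℤ._+_ b) (trans (cong (k ℤ.*_) (ℤ.pos-* m d)) (sym (ℤ.*-assoc k (+ m) (+ d)))))

 ≅-+N : ∀ {n N} → N + n ≅ n [ N ]
 ≅-+N {n} {N} = ≋-trans (≅-+ {N} {N} {0} (≅-0 ∣-refl) ≋-refl) ≋-refl

 ≅-∸ : ∀ {a b N} → b ≤ a → a ≅ b [ N ] → N ∣ a ∸ b
 ≅-∸ {a} {b} {N} b≤a p = ≅-0⁻¹ (subst (λ z → z ≋ + 0 [ N ]) lem (≋-trans (≋-+ p (≋-refl {a = ℤ.- + b})) (≋-reflexive (ℤ.+-inverseʳ (+ b)))))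
   where
   lem : + a ℤ.- + b ≡ + (a ∸ b)
   lem = trans (ℤ.[+m]-[+n]≡m⊖n a b) (ℤ.⊖-≥ b≤a)

 ∸-≅ : ∀ {a b N} → b ≤ a → N ∣ a ∸ b → a ≅ b [ N ]
 ∸-≅ {a} {b} {N} b≤a p = subst (λ z → z ≅ b [ N ]) (m+[n∸m]≡n b≤a) (≋-trans (≅-+ {N} {b} {b} ≋-refl (≅-0 p)) (≅-≡ (+-identityʳ b)))

 %⇒≅ : ∀ {a b N} .{{_ : NonZero N}} → a % N ≡ b % N → a ≅ b [ N ]
 %⇒≅ {a} {b} {N} e = ≋-trans (lem a) (≋-trans (≅-≡ e) (≋-sym (lem b)))
   where
   lem : ∀ a → a ≅ a % N [ N ]
   lem a = ≋-trans (≅-≡ (m≡m%n+[m/n]*n a N)) (≋-trans (≅-+ {N} {a % N} ≋-refl (≅-0 (n∣m*n (a / N)))) (≅-≡ (+-identityʳ _)))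

 ≅⇒% : ∀ {a b N} .{{_ : NonZero N}} → a ≅ b [ N ] → a % N ≡ b % N
 ≅⇒% {a} {b} {N} p = [ (λ b≤a → go b≤a p) , (λ a≤b → sym (go a≤b (≋-sym p))) ]′ (≤-total b a)
   where
   go : ∀ {a b} → b ≤ a → a ≅ b [ N ] → a % N ≡ b % N
   go {a} {b} b≤a p with ≅-∸ b≤a p
   ... | divides k e = trans (cong (_% N) (trans (sym (m+[n∸m]≡n b≤a)) (cong (_+_ b) e))) ([m+kn]%n≡m%n b k N)

 ≅-coprime : ∀ {a b N} → a ≅ b [ N ] → Coprime b N → Coprime a N
 ≅-coprime {a} {b} {N} a≅b b⊥N {d} (d∣a , d∣N) =
   b⊥N (≅-0⁻¹ (≋-trans (≋-sym (≅-∣ d∣N a≅b)) (≅-0 d∣a)) , d∣N)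

 opaque
   inverse : ∀ {b N} → Coprime b N → ∃ λ i → b * i ≅ 1 [ N ]
   inverse {b} {N} b⊥N with coprime-Bézout b⊥N
   ... | Bézout.+- x y e = x , ≋-trans (≅-≡ (trans (*-comm b x) (sym e))) (≋-trans (≅-+ {N} {1} ≋-refl (≅-0 (n∣m*n y))) ≋-refl)
   -- In this case Bézout gives b x ≡ -1; its square is 1, so x (b x) is the inverse of b.
   ... | Bézout.-+ x y e = x * (b * x) , ≋-trans (≅-≡ (sym (*-assoc b x (b * x)))) (subst₂ (_≋_[ N ]) (sym (ℤ.pos-* (b * x) (b * x))) refl (≋-* -1≋ -1≋))
     where
     -1≋ : + (b * x) ≋ -[1+ 0 ] [ N ]
     -1≋ = by (+ y) (begin
       + (b * x) ≡⟨ lem (+ (b * x)) ⟩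
       -[1+ 0 ] ℤ.+ (+ (1 + b * x)) ≡⟨ cong (λ z → -[1+ 0 ] ℤ.+ + z) (trans (cong suc (*-comm b x)) e) ⟩
       -[1+ 0 ] ℤ.+ + (y * N) ≡⟨ cong (ℤ._+_ -[1+ 0 ]) (ℤ.pos-* y N) ⟩
       -[1+ 0 ] ℤ.+ + y ℤ.* + N ∎)
       where
       open ≡-Reasoning
       lem : ∀ z → z ≡ -[1+ 0 ] ℤ.+ (+ 1 ℤ.+ z)
       lem = ℤSolver.solve-∀

 inverse-coprime : ∀ {b i N} → b * i ≅ 1 [ N ] → Coprime i N
 inverse-coprime {b} {i} e = coprime-∣ˡ (n∣m*n b) (≅-coprime e 1-coprime)

 ≅-cancelˡ : ∀ {a b c N} → Coprime a N → a * b ≅ a * c [ N ] → b ≅ c [ N ]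
 ≅-cancelˡ {a} {b} {c} {N} a⊥N p with inverse a⊥N
 ... | i , ai≅1 = ≋-trans (≋-sym (lem b)) (≋-trans (≅-* {N} {i} ≋-refl p) (lem c))
   where
   lem : ∀ b → i * (a * b) ≅ b [ N ]
   lem b = ≋-trans (≅-≡ (trans (sym (*-assoc i a b)) (cong (_* b) (*-comm i a))))
                   (≋-trans (≅-* {N} ai≅1 ≋-refl) (≅-≡ (*-identityˡ b)))

 ≅-coprime-* : ∀ {a b d e} → Coprime d e → a ≅ b [ d ] → a ≅ b [ e ] → a ≅ b [ d * e ]
 ≅-coprime-* {a} {b} d⊥e p q with ≤-total b a
 ... | inj₁ b≤a = ∸-≅ b≤a (coprime-∣* d⊥e (≅-∸ b≤a p) (≅-∸ b≤a q))
 ... | inj₂ a≤b = ≋-sym (∸-≅ a≤b (coprime-∣* d⊥e (≅-∸ a≤b (≋-sym p)) (≅-∸ a≤b (≋-sym q))))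

 crt : ∀ {d e} a b → Coprime d e → ∃ λ x → x ≅ a [ d ] × x ≅ b [ e ]
 crt {d} {e} a b d⊥e with inverse d⊥e | inverse (coprime-sym d⊥e)
 ... | i , di≅1 | j , ej≅1 = a * (e * j) + b * (d * i) ,
   ≋-trans (≅-+ {d} (≅-* {d} {a} ≋-refl ej≅1) (≅-0 (∣n⇒∣m*n b (m∣m*n i)))) (≅-≡ (trans (+-identityʳ _) (*-identityʳ a))) ,
   ≋-trans (≅-+ {e} (≅-0 (∣n⇒∣m*n a (m∣m*n j))) (≅-* {e} {b} ≋-refl di≅1)) (≅-≡ (*-identityʳ b))

 least : ∀ {Q : ℕ → Set} → (∀ k → Dec (Q k)) → ∀ n → Q n → ∃ λ m → Q m × m ≤ n × (∀ k → k < m → ¬ Q k)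
 least {Q} Q? = <-rec (λ n → Q n → ∃ λ m → Q m × m ≤ n × (∀ k → k < m → ¬ Q k)) step
   where
   below : ∀ n → (∃ λ k → k < n × Q k) ⊎ (∀ k → k < n → ¬ Q k)
   below zero = inj₂ λ k ()
   below (suc n) with Q? n
   ... | yes q = inj₁ (n , ≤-refl , q)
   ... | no ¬q with below n
   ... | inj₁ (k , k<n , q) = inj₁ (k , m≤n⇒m≤1+n k<n , q)
   ... | inj₂ none = inj₂ λ k k<1+n qk → [ (λ k<n → none k k<n qk) , (λ { refl → ¬q qk }) ]′ (m≤n⇒m<n∨m≡n (≤-pred k<1+n))
   step : ∀ n → (∀ {k} → k < n → Q k → ∃ λ m → Q m × m ≤ k × (∀ j → j < m → ¬ Q j)) →
          Q n → ∃ λ m → Q m × m ≤ n × (∀ k → k < m → ¬ Q k)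
   step n rec Qn with below n
   ... | inj₂ none = n , Qn , ≤-refl , none
   ... | inj₁ (k , k<n , Qk) with rec k<n Qk
   ... | m , Qm , m≤k , min = m , Qm , ≤-trans m≤k (<⇒≤ k<n) , min

 -- Division with remainder by the least positive element of `Q`, as for ideals of ℤ. It serves for
 -- the exponents at which a unit becomes 1 modulo d and for those at which the variable becomes 1
 -- modulo an irreducible polynomial.
 period : ∀ {Q : ℕ → Set} → (∀ k → Dec (Q k)) → Q 0 →
          (∀ {a b} → Q a → Q b → Q (a + b)) → (∀ {a b} → Q a → Q (a + b) → Q b) →
          ∀ n → 1 ≤ n → Q n →
          ∃ λ d → 1 ≤ d × d ≤ n × (∀ m → Q m → d ∣ m) × (∀ m → d ∣ m → Q m)
 period {Q} Q? Q0 Q+ Q- (suc n) _ Qn with least (λ k → Q? (suc k)) n Qn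
 ... | d-1 , Qd , d≤n , min = d , s≤s z≤n , s≤s d≤n , to , from
   where
   d = suc d-1
   Q* : ∀ k → Q (k * d)
   Q* zero = Q0
   Q* (suc k) = Q+ Qd (Q* k)
   from : ∀ m → d ∣ m → Q m
   from m (divides k refl) = Q* k
   to : ∀ m → Q m → d ∣ m
   to m Qm with m % d in eq
   ... | zero = divides (m / d) (trans (m≡m%n+[m/n]*n m d) (cong (_+ (m / d) * d) eq))
   ... | suc r = ⊥-elim (min r (≤-pred (subst (_< d) eq (m%n<n m d)))
                   (Q- (Q* (m / d)) (subst Q (trans (m≡m%n+[m/n]*n m d) (trans (cong (_+ (m / d) * d) eq) (+-comm (suc r) _))) Qm)))

 half : ∀ n → ∃ λ j → n ≡ 2 * j ⊎ n ≡ suc (2 * j)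
 half zero = 0 , inj₁ refl
 half (suc n) with half n
 ... | j , inj₁ refl = j , inj₂ refl
 ... | j , inj₂ refl = suc j , inj₁ (lem j)
   where
   lem : ∀ j → suc (suc (2 * j)) ≡ 2 * suc j
   lem = solve-∀

 opaque
   strip : ∀ p → Prime p → ∀ n → 1 ≤ n → ∃ λ v → ∃ λ m → n ≡ p ^ v * m × ¬ p ∣ m × 1 ≤ m
   strip p pp = <-rec (λ n → 1 ≤ n → ∃ λ v → ∃ λ m → n ≡ p ^ v * m × ¬ p ∣ m × 1 ≤ m) step
     where
     step : ∀ n → (∀ {k} → k < n → 1 ≤ k → ∃ λ v → ∃ λ m → k ≡ p ^ v * m × ¬ p ∣ m × 1 ≤ m) →
            1 ≤ n → ∃ λ v → ∃ λ m → n ≡ p ^ v * m × ¬ p ∣ m × 1 ≤ m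
     step n rec 1≤n with p ∣? n
     ... | no p∤n = 0 , n , sym (*-identityˡ n) , p∤n , 1≤n
     ... | yes (divides zero refl) = ⊥-elim (<⇒≱ 1≤n z≤n)
     ... | yes (divides k@(suc _) refl) with rec (m<m*n k p (prime≥2 pp)) (s≤s z≤n)
     ... | v , m , e , p∤m , 1≤m = suc v , m , trans (*-comm k p) (trans (cong (p *_) e) (sym (*-assoc p (p ^ v) m))) , p∤m , 1≤m

 module Representatives (N : ℕ) (1≤N : 1 ≤ N) where

   private
     instance
       N≢0 : NonZero N
       N≢0 = >-nonZero 1≤N

   opaque
     rep : ∀ n → ∃ λ m → 1 ≤ m × m ≤ N × m ≅ n [ N ]
     rep n with n % N in eq
     ... | zero = N , 1≤N , ≤-refl , %⇒≅ (trans (n%n≡0 N) (sym eq))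
     ... | suc k = suc k , s≤s z≤n , <⇒≤ k<N , %⇒≅ (trans (m<n⇒m%n≡m k<N) (sym eq))
       where
       k<N : suc k < N
       k<N = subst (_< N) eq (m%n<n n N)

   rep-unique : ∀ {m n} → 1 ≤ m → m ≤ N → 1 ≤ n → n ≤ N → m ≅ n [ N ] → m ≡ n
   rep-unique {m} {n} 1≤m m≤N 1≤n n≤N p = [ (λ n≤m → go n≤m 1≤n m≤N p) , (λ m≤n → sym (go m≤n 1≤m n≤N (≋-sym p))) ]′ (≤-total n m)
     where
     go : ∀ {m n} → n ≤ m → 1 ≤ n → m ≤ N → m ≅ n [ N ] → m ≡ n
     go {m} {n} n≤m 1≤n m≤N p with m ∸ n in eq
     ... | zero = ≤-antisym (m∸n≡0⇒m≤n eq) n≤m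
     ... | suc k = ⊥-elim (<⇒≱ (<-≤-trans (∸-monoʳ-< {m} 1≤n n≤m) m≤N)
                     (≤-trans (∣⇒≤ (subst (N ∣_) eq (≅-∸ n≤m p))) (≤-reflexive (sym eq))))

 ^-distrib : ∀ a b k → (a * b) ^ k ≡ a ^ k * b ^ k
 ^-distrib a b zero = refl
 ^-distrib a b (suc k) = trans (cong (a * b *_) (^-distrib a b k)) (lem a b (a ^ k) (b ^ k))
   where
   lem : ∀ a b x y → a * b * (x * y) ≡ a * x * (b * y)
   lem = solve-∀

 ≅-^+ : ∀ {d} a m n → a ^ m ≅ 1 [ d ] → a ^ n ≅ 1 [ d ] → a ^ (m + n) ≅ 1 [ d ]
 ≅-^+ a m n p q = ≋-trans (≅-≡ (^-distribˡ-+-* a m n)) (≋-trans (≅-* p q) ≋-refl)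

 ≅-^∸ : ∀ {d} a m n → a ^ m ≅ 1 [ d ] → a ^ (m + n) ≅ 1 [ d ] → a ^ n ≅ 1 [ d ]
 ≅-^∸ {d} a m n p q = ≋-trans (≅-≡ (sym (*-identityˡ (a ^ n)))) (≋-trans (≅-* {d} (≋-sym p) (≋-refl {a = + (a ^ n)}))
   (≋-trans (≅-≡ (sym (^-distribˡ-+-* a m n))) q))

 ≅-^* : ∀ {d} a m k → a ^ m ≅ 1 [ d ] → a ^ (m * k) ≅ 1 [ d ]
 ≅-^* a m k p = ≋-trans (≅-≡ (sym (^-*-assoc a m k))) (≋-trans (≅-^ k p) (≅-≡ (^-zeroˡ k)))

 opaque
   -- The powers with exponents 0, ..., d - 1 are units and avoid the residue 0, so d of them share
   -- d - 1 residues. The resulting exponent is strictly below d, which later shows that a prime q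
   -- does not divide an order modulo q.
   power-≅1 : ∀ d a → 2 ≤ d → Coprime a d → ∃ λ k → 1 ≤ k × k < d × a ^ k ≅ 1 [ d ]
   power-≅1 d@(suc (suc d-2)) a _ a⊥d with pigeonhole {suc d-2} {d} ≤-refl f
     where
     f : Fin d → Fin (suc d-2)
     f i = fromℕ< {pred (a ^ toℕ i % d)} (lem (a ^ toℕ i % d) (m%n<n (a ^ toℕ i) d))
       where
       lem : ∀ r → r < d → pred r < suc d-2
       lem zero _ = s≤s z≤n
       lem (suc r) (s≤s q) = q
   ... | i , j , i<j , fi≡fj = toℕ j ∸ toℕ i , m<n⇒0<n∸m i<j , ≤-<-trans (m∸n≤m (toℕ j) (toℕ i)) (toℕ<n j) ,
       ≅-cancelˡ (coprime-^ˡ (toℕ i) a⊥d) (≋-trans (≅-≡ (trans (sym (^-distribˡ-+-* a (toℕ i) (toℕ j ∸ toℕ i))) (cong (a ^_) (m+[n∸m]≡n (<⇒≤ i<j)))))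
         (≋-trans (≋-sym (%⇒≅ e)) (≅-≡ (sym (*-identityʳ (a ^ toℕ i))))))
     where
     pos : ∀ k → 1 ≤ a ^ k % d
     pos k with a ^ k % d in eq
     ... | suc _ = s≤s z≤n
     ... | zero = ⊥-elim (<⇒≱ (s≤s (s≤s (z≤n {d-2}))) (≤-reflexive (coprime-^ˡ k a⊥d (≅-0⁻¹ {a ^ k} {d} (%⇒≅ {a ^ k} {0} eq) , ∣-refl))))
     pred-inj : ∀ {x y} → 1 ≤ x → 1 ≤ y → pred x ≡ pred y → x ≡ y
     pred-inj {suc x} {suc y} _ _ refl = refl
     e : a ^ toℕ i % d ≡ a ^ toℕ j % d
     e = pred-inj (pos (toℕ i)) (pos (toℕ j)) (trans (sym (toℕ-fromℕ< _)) (trans (cong toℕ fi≡fj) (toℕ-fromℕ< _)))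

   power-≅1 (suc zero) a (s≤s ()) _

 record Order (d a o : ℕ) : Set where
   field
     pos : 1 ≤ o
     to : ∀ m → a ^ m ≅ 1 [ d ] → o ∣ m
     from : ∀ m → o ∣ m → a ^ m ≅ 1 [ d ]
   self : a ^ o ≅ 1 [ d ]
   self = from o ∣-refl

 opaque
   order : ∀ d a → 1 ≤ d → Coprime a d → ∃ λ o → Order d a o × o ≤ d × (2 ≤ d → o < d)
   order d a 1≤d a⊥d with d ≟ 1
   ... | yes refl = 1 , record { pos = ≤-refl ; to = λ m _ → 1∣ m ; from = λ m _ → ≋-trans (≅-0 (1∣ (a ^ m))) (≋-sym (≅-0 (1∣ 1))) } , ≤-refl , λ { (s≤s ()) }
   ... | no d≢1 with power-≅1 d a 2≤d a⊥d
     where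
     2≤d : 2 ≤ d
     2≤d = ≤∧≢⇒< 1≤d (λ e → d≢1 (sym e))
   ... | k , 1≤k , k<d , ak with period {λ k → a ^ k ≅ 1 [ d ]} (λ k → a ^ k ≅? 1 [ d ]) ≋-refl (λ {m} {n} → ≅-^+ a m n) (λ {m} {n} → ≅-^∸ a m n) k 1≤k ak
   ... | o , 1≤o , o≤k , to , from = o , record { pos = 1≤o ; to = to ; from = from } , <⇒≤ (≤-<-trans o≤k k<d) , λ _ → ≤-<-trans o≤k k<d

 -- The order of a modulo d is a multiple of the order of every unit modulo d.
 Universal : ℕ → ℕ → Set
 Universal a d = ∀ b k → Coprime b d → a ^ k ≅ 1 [ d ] → b ^ k ≅ 1 [ d ]

 module _ (d : ℕ) (1≤d : 1 ≤ d) where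

   open Representatives d 1≤d using (rep)

   private
     -- Pick a prime `l` whose power in the order `s` of `b` exceeds its power `l ^ j` in `r`. Then
     -- `x` has order `r₀` and `y` has order `l ^ suc j`; these are coprime, so the order of `x * y`
     -- is a multiple of `r * l`.
     larger : ∀ a b r → Order d a r → Coprime a d → Coprime b d → ¬ b ^ r ≅ 1 [ d ] →
              ∃ λ c → ∃ λ R → Coprime c d × Order d c R × r < R
     larger a b r oa a⊥d b⊥d b^r≇1 with order d b 1≤d b⊥d
     ... | s , ob , _ with gcd-split r s (Order.pos oa)
     ... | g , r′ , s′ , r≡′ , s≡′ , r′⊥s′ , 1≤g with ∃-prime-factor s′ 2≤s′
       where
       2≤s′ : 2 ≤ s′
       2≤s′ = ≤∧≢⇒< (n≢0⇒n>0 λ { refl → <⇒≱ (Order.pos ob) (≤-reflexive s≡′) })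
         λ { refl → b^r≇1 (Order.from ob r (divides r′ (trans r≡′ (cong (r′ *_) (trans (sym (*-identityˡ g)) (sym s≡′)))))) }
     ... | l , pl , divides t s′≡tl with strip l pl r (Order.pos oa)
     ... | j , r₀ , r≡ , l∤r₀ , 1≤r₀ with l^j∣g
       where
       l∤r′ : ¬ l ∣ r′
       l∤r′ l∣r′ = <⇒≱ (prime≥2 pl) (≤-reflexive (r′⊥s′ (l∣r′ , divides t s′≡tl)))
       l^j∣g : l ^ j ∣ g
       l^j∣g = coprime-divisor (coprime-^ˡ j (prime∤⇒coprime pl l∤r′)) (subst (l ^ j ∣_) (trans (sym r≡) r≡′) (m∣m*n r₀))
     ... | divides u g≡ = c , R , (λ {_} → c⊥d) , oc , r<R
       where
       s≡ : s ≡ t * u * (l ^ suc j)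
       s≡ = trans s≡′ (trans (cong₂ _*_ s′≡tl g≡) (lem t l u (l ^ j)))
         where
         lem : ∀ t l u x → t * l * (u * x) ≡ t * u * (l * x)
         lem = solve-∀
       L₁ = l ^ suc j
       x = a ^ (l ^ j)
       y = b ^ (t * u)
       c = x * y
       c⊥d : Coprime c d
       c⊥d = coprime-*ˡ (coprime-^ˡ (l ^ j) a⊥d) (coprime-^ˡ (t * u) b⊥d)
       ord-c = order d c 1≤d c⊥d
       R = proj₁ ord-c
       oc : Order d c R
       oc = proj₁ (proj₂ ord-c)
       xy : ∀ k → c ^ (R * k) ≅ 1 [ d ]
       xy k = ≅-^* c R k (Order.self oc)
       -- The exponent `L₁` makes the power of `y` trivial, so what is known about `c` becomes a
       -- statement about `x` alone; below, `r₀` does the same with the roles exchanged.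
       x-part : x ^ (R * L₁) ≅ 1 [ d ]
       x-part = ≋-trans (≅-≡ (sym (*-identityʳ _))) (≋-trans (≅-* {d} (≋-refl {a = + (x ^ (R * L₁))}) (≋-sym y1)) (≋-trans (≅-≡ (sym (^-distrib x y (R * L₁)))) (xy L₁)))
         where
         y1 : y ^ (R * L₁) ≅ 1 [ d ]
         y1 = ≋-trans (≅-≡ (trans (^-*-assoc b (t * u) (R * L₁)) (cong (b ^_) (lem (t * u) R L₁)))) (Order.from ob (t * u * L₁ * R) (subst (_∣ t * u * L₁ * R) (sym s≡) (m∣m*n R)))
           where
           lem : ∀ a b c → a * (b * c) ≡ a * c * b
           lem = solve-∀
       y-part : y ^ (R * r₀) ≅ 1 [ d ]
       y-part = ≋-trans (≅-≡ (sym (*-identityˡ _))) (≋-trans (≅-* {d} (≋-sym x1) (≋-refl {a = + (y ^ (R * r₀))})) (≋-trans (≅-≡ (sym (^-distrib x y (R * r₀)))) (xy r₀)))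
         where
         x1 : x ^ (R * r₀) ≅ 1 [ d ]
         x1 = ≋-trans (≅-≡ (trans (^-*-assoc a (l ^ j) (R * r₀)) (cong (a ^_) (lem (l ^ j) R r₀)))) (Order.from oa (l ^ j * r₀ * R) (subst (_∣ l ^ j * r₀ * R) (sym r≡) (m∣m*n R)))
           where
           lem : ∀ a b c → a * (b * c) ≡ a * c * b
           lem = solve-∀
       r₀⊥L₁ : Coprime r₀ L₁
       r₀⊥L₁ = coprime-sym (coprime-^ˡ (suc j) (prime∤⇒coprime pl l∤r₀))
       l^j≢0 : NonZero (l ^ j)
       l^j≢0 = m^n≢0 l j {{>-nonZero (prime-≥1 pl)}}
       r₀∣R : r₀ ∣ R
       r₀∣R = coprime-divisor r₀⊥L₁ (subst (r₀ ∣_) (*-comm R L₁) (*-cancelˡ-∣ (l ^ j) {{l^j≢0}}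
         (subst (_∣ l ^ j * (R * L₁)) r≡ (Order.to oa (l ^ j * (R * L₁)) (≋-trans (≅-≡ (sym (^-*-assoc a (l ^ j) (R * L₁)))) x-part)))))
       tu≢0 : NonZero (t * u)
       tu≢0 = >-nonZero (n≢0⇒n>0 λ e → <⇒≱ (Order.pos ob) (≤-reflexive (trans s≡ (cong (_* L₁) e))))
       L₁∣R : L₁ ∣ R
       L₁∣R = coprime-divisor (coprime-sym r₀⊥L₁) (subst (L₁ ∣_) (*-comm R r₀) (*-cancelˡ-∣ (t * u) {{tu≢0}}
         (subst (_∣ t * u * (R * r₀)) s≡ (Order.to ob (t * u * (R * r₀)) (≋-trans (≅-≡ (sym (^-*-assoc b (t * u) (R * r₀)))) y-part)))))
       r<R : r < R
       r<R = <-≤-trans (subst₂ _<_ (sym r≡) (lem l (l ^ j) r₀) (m<m*n (l ^ j * r₀) l {{>-nonZero (subst (1 ≤_) r≡ (Order.pos oa))}} (prime≥2 pl)))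
               (∣⇒≤ {{>-nonZero (Order.pos oc)}} (coprime-∣* r₀⊥L₁ r₀∣R L₁∣R))
         where
         lem : ∀ l x r → x * r * l ≡ r * (l * x)
         lem = solve-∀

     bad-or-all : ∀ r n → (∃ λ b → Coprime b d × ¬ b ^ r ≅ 1 [ d ]) ⊎ (∀ b → 1 ≤ b → b ≤ n → Coprime b d → b ^ r ≅ 1 [ d ])
     bad-or-all r zero = inj₂ λ { zero () _ _ ; (suc _) _ () _ }
     bad-or-all r (suc n) with bad-or-all r n | coprime? (suc n) d | suc n ^ r ≅? 1 [ d ]
     ... | inj₁ e | _ | _ = inj₁ e
     ... | inj₂ ok | yes c | no ¬q = inj₁ (suc n , (λ {_} → c) , ¬q)
     ... | inj₂ ok | no ¬c | _ = inj₂ λ b 1≤b b≤ c → [ (λ b< → ok b 1≤b (≤-pred b<) c) , (λ { refl → ⊥-elim (¬c (λ {_} → c)) }) ]′ (m≤n⇒m<n∨m≡n b≤)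
     ... | inj₂ ok | yes _ | yes q = inj₂ λ b 1≤b b≤ c → [ (λ b< → ok b 1≤b (≤-pred b<) c) , (λ { refl → q }) ]′ (m≤n⇒m<n∨m≡n b≤)

   opaque
     -- As long as some unit is not killed by the current order `r`, pass to an element of larger
     -- order. Orders are at most `d`, and the fuel `n` is kept so that `d ≤ r + n`.
     exponent-element : ∃ λ a → Coprime a d × Universal a d
     exponent-element = go d 1 1 1-coprime o1 (m≤n+m d 1)
       where
       o1 : Order d 1 1
       o1 = record { pos = ≤-refl ; to = λ m _ → 1∣ m ; from = λ m _ → ≅-≡ (^-zeroˡ m) }
       kill : ∀ b r k → b ^ r ≅ 1 [ d ] → r ∣ k → b ^ k ≅ 1 [ d ]
       kill b r k br (divides m refl) = ≋-trans (≅-≡ (cong (b ^_) (*-comm m r))) (≅-^* b r m br)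
       finish : ∀ a r → Order d a r → (∀ b → 1 ≤ b → b ≤ d → Coprime b d → b ^ r ≅ 1 [ d ]) → Universal a d
       finish a r oa ok b k b⊥d ak = reduce (rep b)
         where
         reduce : (∃ λ b′ → 1 ≤ b′ × b′ ≤ d × b′ ≅ b [ d ]) → b ^ k ≅ 1 [ d ]
         reduce (b′ , 1≤b′ , b′≤d , b′≅b) = ≋-trans (≅-^ k (≋-sym b′≅b)) (kill b′ r k (ok b′ 1≤b′ b′≤d (≅-coprime b′≅b b⊥d)) (Order.to oa k ak))
       order≤ : ∀ c R → Coprime c d → Order d c R → R ≤ d
       order≤ c R c⊥d oc = ≤-trans (∣⇒≤ {{>-nonZero (Order.pos oc′)}} (Order.to oc o (Order.self oc′))) (proj₁ (proj₂ (proj₂ (order d c 1≤d c⊥d))))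
         where
         o : ℕ
         o = proj₁ (order d c 1≤d c⊥d)
         oc′ : Order d c o
         oc′ = proj₁ (proj₂ (order d c 1≤d c⊥d))
       go : ∀ n a r → Coprime a d → Order d a r → d ≤ r + n → ∃ λ a → Coprime a d × Universal a d
       continue : ∀ n r → d ≤ r + n → (∃ λ c → ∃ λ R → Coprime c d × Order d c R × r < R) → ∃ λ a → Coprime a d × Universal a d
       go n a r a⊥d oa d≤r+n = [ (λ (b , b⊥d , bad) → continue n r d≤r+n (larger a b r oa a⊥d b⊥d bad)) , (λ ok → a , (λ {_} → a⊥d) , finish a r oa ok) ]′ (bad-or-all r d)
       continue zero r d≤r+0 (c , R , c⊥d , oc , r<R) = ⊥-elim (<⇒≱ (≤-<-trans (≤-trans d≤r+0 (≤-reflexive (+-identityʳ r))) r<R) (order≤ c R c⊥d oc))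
       continue (suc n) r d≤r+n (c , R , c⊥d , oc , r<R) = go n c R c⊥d oc (≤-trans d≤r+n (≤-trans (≤-reflexive (+-suc r n)) (+-monoˡ-≤ n r<R)))

 -- (1 + z) ^ m to second order; t is the binomial coefficient m(m-1)/2.
 binomial₂ : ∀ z m → ∃ λ t → ∃ λ w → (1 + z) ^ m ≡ 1 + m * z + t * (z * z) + w * (z * z * z) × 2 * t + m ≡ m * m
 binomial₂ z zero = 0 , 0 , refl , refl
 binomial₂ z (suc m) with binomial₂ z m
 ... | t , w , e , e₂ = t + m , w + t + w * z , trans (cong ((1 + z) *_) e) (lem z m t w) , trans (lem₂ t m) (trans (cong (λ k → k + (m + m + 1)) e₂) (lem₃ m))
   where
   lem : ∀ z m t w → (1 + z) * (1 + m * z + t * (z * z) + w * (z * z * z)) ≡ 1 + suc m * z + (t + m) * (z * z) + (w + t + w * z) * (z * z * z)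
   lem = solve-∀
   lem₂ : ∀ t m → 2 * (t + m) + suc m ≡ (2 * t + m) + (m + m + 1)
   lem₂ = solve-∀
   lem₃ : ∀ m → m * m + (m + m + 1) ≡ suc m * suc m
   lem₃ = solve-∀

 ≅1⇒ : ∀ {d x} → 1 ≤ x → x ≅ 1 [ d ] → ∃ λ t → x ≡ 1 + d * t
 ≅1⇒ {d} {x} 1≤x p with ≅-∸ 1≤x p
 ... | divides t e = t , trans (sym (m+[n∸m]≡n 1≤x)) (cong suc (trans e (*-comm t d)))

 ⇒≅1 : ∀ d t → 1 + d * t ≅ 1 [ d ]
 ⇒≅1 d t = ≋-trans (≅-+ {d} {1} {1} ≋-refl (≅-0 (m∣m*n t))) ≋-refl

 -- From `i₀` on, the q-adic valuation of x - 1 grows by exactly one under x ↦ x^q. Odd squares are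
 -- 1 modulo 8, which is why the case q = 2 starts at 3.
 LiftsExactly : ℕ → ℕ → Set
 LiftsExactly q i₀ = ∀ i s → i₀ ≤ i → ¬ q ∣ s → ∃ λ s′ → (1 + q ^ i * s) ^ q ≡ 1 + q ^ suc i * s′ × ¬ q ∣ s′

 ∤-+ : ∀ {q s u} → ¬ q ∣ s → ¬ q ∣ s + q * u
 ∤-+ {q} {s} {u} q∤s h = q∤s (∣m+n∣m⇒∣n (subst (q ∣_) (+-comm s (q * u)) h) (m∣m*n u))

 odd-lifts : ∀ q → Prime q → q ≢ 2 → LiftsExactly q 1
 odd-lifts q pq q≢2 (suc i) s _ q∤s with binomial₂ (q ^ suc i * s) q | half q
 ... | t , w , e , _ | h , inj₁ q≡2h = ⊥-elim ([ (λ q∣2 → q≢2 (sym (2≡q q∣2))) , (λ q∣h → <⇒≱ (h<q) (∣⇒≤ {{>-nonZero 1≤h}} q∣h)) ]′ (euclidsLemma 2 h pq (∣-reflexive q≡2h)))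
   where
   2≡q : q ∣ 2 → 2 ≡ q
   2≡q q∣2 = ≤-antisym (prime≥2 pq) (∣⇒≤ q∣2)
   1≤h : 1 ≤ h
   1≤h = n≢0⇒n>0 λ { refl → <⇒≱ (prime-≥1 pq) (≤-reflexive q≡2h) }
   h<q : h < q
   h<q = subst (h <_) (sym q≡2h) (m<m+n h (≤-trans 1≤h (m≤m+n h 0)))
 ... | t , w , e , e₂ | h , inj₂ q≡ = s + q * (h * Q * (s * s) + w * (Q * Q) * (s * s * s)) , trans e (trans (cong (λ k → 1 + q * (q * Q * s) + k * (q * Q * s * (q * Q * s)) + w * (q * Q * s * (q * Q * s) * (q * Q * s))) t≡) (lem q Q s h w)) , ∤-+ q∤s
   where
   Q = q ^ i
   -- This is where `q` must be odd: the binomial coefficient q (q - 1) / 2 is then divisible by q.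
   t≡ : t ≡ q * h
   t≡ = *-cancelˡ-≡ t (q * h) 2 (+-cancelʳ-≡ q (2 * t) (2 * (q * h)) (trans e₂ (trans (cong (q *_) q≡) (lem₂ q h))))
     where
     lem₂ : ∀ q h → q * suc (2 * h) ≡ 2 * (q * h) + q
     lem₂ = solve-∀
   lem : ∀ q Q s h w → 1 + q * (q * Q * s) + q * h * (q * Q * s * (q * Q * s)) + w * (q * Q * s * (q * Q * s) * (q * Q * s)) ≡ 1 + q * (q * Q) * (s + q * (h * Q * (s * s) + w * (Q * Q) * (s * s * s)))
   lem = solve-∀

 two-lifts : LiftsExactly 2 3
 two-lifts (suc (suc (suc i))) s _ 2∤s = s + 2 * (2 * Q * (s * s)) , lem Q s , ∤-+ {2} {s} {2 * Q * (s * s)} 2∤s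
   where
   Q = 2 ^ i
   lem : ∀ Q s → (1 + 2 * (2 * (2 * Q)) * s) * ((1 + 2 * (2 * (2 * Q)) * s) * 1) ≡ 1 + 2 * (2 * (2 * (2 * Q))) * (s + 2 * (2 * Q * (s * s)))
   lem = solve-∀
 two-lifts (suc zero) s (s≤s ())
 two-lifts (suc (suc zero)) s (s≤s (s≤s ()))

 module Lifting (q i₀ : ℕ) (pq : Prime q) (1≤i₀ : 1 ≤ i₀) where

   private
     instance
       q≢0 : NonZero q
       q≢0 = >-nonZero (prime-≥1 pq)

   -- By induction m = m′ q^j, and the q^j-th power of the base is 1 + z with z of exact valuation
   -- i₀ + j. Modulo q^(i₀ + j + 1) the number (1 + z)^m′ equals 1 + m′ z, which forces q to divide
   -- m′.
   power-divides : LiftsExactly q i₀ → ∀ s → ¬ q ∣ s → ∀ j m → (1 + q ^ i₀ * s) ^ m ≅ 1 [ q ^ (i₀ + j) ] → q ^ j ∣ m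
   power-divides lifts s q∤s zero m _ = 1∣ m
   power-divides lifts s q∤s (suc j) m h with power-divides lifts s q∤s j m (≅-∣ (divides q (trans (cong (q ^_) (+-suc i₀ j)) refl)) h)
   ... | divides m′ refl = subst (_∣ m′ * q ^ j) (*-comm (q ^ j) q) (subst (q ^ j * q ∣_) (*-comm (q ^ j) m′) (*-monoʳ-∣ (q ^ j) q∣m′))
     where
     tower : ∀ j → ∃ λ sⱼ → (1 + q ^ i₀ * s) ^ (q ^ j) ≡ 1 + q ^ (i₀ + j) * sⱼ × ¬ q ∣ sⱼ
     tower zero = s , trans (*-identityʳ _) (cong (λ k → 1 + q ^ k * s) (sym (+-identityʳ i₀))) , q∤s
     tower (suc j) with tower j
     ... | sⱼ , e , q∤sⱼ with lifts (i₀ + j) sⱼ (m≤m+n i₀ j) q∤sⱼ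
     ... | s′ , e′ , q∤s′ = s′ , trans (trans (cong ((1 + q ^ i₀ * s) ^_) (*-comm q (q ^ j))) (trans (sym (^-*-assoc (1 + q ^ i₀ * s) (q ^ j) q)) (cong (_^ q) e))) (trans e′ (cong (λ k → 1 + q ^ k * s′) (sym (+-suc i₀ j)))) , q∤s′
     sⱼ = proj₁ (tower j)
     M = q ^ (i₀ + j)
     z = M * sⱼ
     b = binomial₂ z m′
     t = proj₁ b
     w = proj₁ (proj₂ b)
     qM∣zz : q * M ∣ z * z
     qM∣zz = subst (q * M ∣_) (lem M sⱼ) (∣m⇒∣m*n (sⱼ * sⱼ) (*-monoˡ-∣ M (q∣M)))
       where
       lem : ∀ M s → M * M * (s * s) ≡ M * s * (M * s)
       lem = solve-∀
       q∣M : q ∣ M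
       q∣M = subst (q ∣_) refl (lem₂ (i₀ + j) (≤-trans 1≤i₀ (m≤m+n i₀ j)))
         where
         lem₂ : ∀ k → 1 ≤ k → q ∣ q ^ k
         lem₂ (suc k) _ = m∣m*n (q ^ k)
     y≡ : (1 + q ^ i₀ * s) ^ (m′ * q ^ j) ≡ 1 + (m′ * z + (t + w * z) * (z * z))
     y≡ = trans (trans (cong ((1 + q ^ i₀ * s) ^_) (*-comm m′ (q ^ j))) (trans (sym (^-*-assoc (1 + q ^ i₀ * s) (q ^ j) m′)) (cong (_^ m′) (proj₁ (proj₂ (tower j))))))
       (trans (proj₁ (proj₂ (proj₂ b))) (lem m′ z t w))
       where
       lem : ∀ m z t w → 1 + m * z + t * (z * z) + w * (z * z * z) ≡ 1 + (m * z + (t + w * z) * (z * z))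
       lem = solve-∀
     qM∣ : q * M ∣ m′ * z
     qM∣ = ∣m+n∣m⇒∣n (subst (q * M ∣_) (+-comm (m′ * z) _) (subst (_∣ m′ * z + (t + w * z) * (z * z)) (cong (q ^_) (+-suc i₀ j))
             (≅-∸ (s≤s z≤n) (≋-trans (≅-≡ (sym y≡)) h)))) (∣n⇒∣m*n (t + w * z) qM∣zz)
     q∣m′ : q ∣ m′
     q∣m′ = [ (λ d → d) , (λ d → ⊥-elim (proj₂ (proj₂ (tower j)) d)) ]′ (euclidsLemma m′ sⱼ pq
       (*-cancelˡ-∣ M {{m^n≢0 q (i₀ + j)}} (subst₂ _∣_ (*-comm q M) (lem m′ M sⱼ) qM∣)))
       where
       lem : ∀ m M s → m * (M * s) ≡ M * (m * s)
       lem = solve-∀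

   power-≅ : ∀ t j m → q ^ j ∣ m → (1 + q ^ i₀ * t) ^ m ≅ 1 [ q ^ (i₀ + j) ]
   power-≅ t j m (divides m′ refl) = ≋-trans (≅-≡ (trans (cong ((1 + q ^ i₀ * t) ^_) (*-comm m′ (q ^ j))) (sym (^-*-assoc (1 + q ^ i₀ * t) (q ^ j) m′))))
       (≋-trans (≅-^ m′ (≋-trans (≅-≡ (proj₂ (tower j))) (⇒≅1 (q ^ (i₀ + j)) (proj₁ (tower j))))) (≅-≡ (^-zeroˡ m′)))
     where
     tower : ∀ j → ∃ λ tⱼ → (1 + q ^ i₀ * t) ^ (q ^ j) ≡ 1 + q ^ (i₀ + j) * tⱼ
     tower zero = t , trans (*-identityʳ _) (cong (λ k → 1 + q ^ k * t) (sym (+-identityʳ i₀)))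
     tower (suc j) with tower j
     ... | tⱼ , e with binomial₂ (q ^ (i₀ + j) * tⱼ) q
     ... | u , w , e′ , _ = tⱼ + (u + w * z) * (Q * (tⱼ * tⱼ)) , trans (trans (cong ((1 + q ^ i₀ * t) ^_) (*-comm q (q ^ j))) (trans (sym (^-*-assoc (1 + q ^ i₀ * t) (q ^ j) q)) (cong (_^ q) e)))
               (trans e′ (trans (cong (λ M → 1 + q * (M * tⱼ) + u * (M * tⱼ * (M * tⱼ)) + w * (M * tⱼ * (M * tⱼ) * (M * tⱼ))) M≡) (trans (cong (λ z′ → 1 + q * (q * Q * tⱼ) + u * (q * Q * tⱼ * (q * Q * tⱼ)) + w * (q * Q * tⱼ * (q * Q * tⱼ) * z′)) (sym z≡)) (trans (lem q Q tⱼ u w z) (cong (λ M → 1 + M * (tⱼ + (u + w * z) * (Q * (tⱼ * tⱼ)))) (sym qM≡))))))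
       where
       z = q ^ (i₀ + j) * tⱼ
       k = i₀ + j
       Q = q ^ (k ∸ 1)
       1≤k = ≤-trans 1≤i₀ (m≤m+n i₀ j)
       M≡ : q ^ k ≡ q * Q
       M≡ = cong (q ^_) (sym (m+[n∸m]≡n 1≤k))
       z≡ : z ≡ q * Q * tⱼ
       z≡ = cong (_* tⱼ) M≡
       qM≡ : q ^ (i₀ + suc j) ≡ q * (q * Q)
       qM≡ = trans (cong (q ^_) (+-suc i₀ j)) (cong (q *_) M≡)
       lem : ∀ q Q t u w z → 1 + q * (q * Q * t) + u * (q * Q * t * (q * Q * t)) + w * (q * Q * t * (q * Q * t) * z) ≡ 1 + q * (q * Q) * (t + (u + w * z) * (Q * (t * t)))
       lem = solve-∀

 prime-power-divisor : ∀ q e d → Prime q → d ∣ q ^ e → ∃ λ f → d ≡ q ^ f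
 prime-power-divisor q zero d pq d∣1 = 0 , ∣1⇒≡1 d∣1
 prime-power-divisor q (suc e) d pq d∣ with q ∣? d
 ... | no q∤d = prime-power-divisor q e d pq (coprime-divisor (coprime-sym (prime∤⇒coprime pq q∤d)) d∣)
 ... | yes (divides k refl) with prime-power-divisor q e k pq (*-cancelˡ-∣ q {{>-nonZero (prime-≥1 pq)}} (subst (_∣ q ^ suc e) (*-comm k q) d∣))
 ... | f , refl = suc f , *-comm (q ^ f) q

 ≅-[1] : ∀ {a b} → a ≅ b [ 1 ]
 ≅-[1] {a} {b} = ≋-trans (≅-0 (1∣ a)) (≋-sym (≅-0 (1∣ b)))

 pow≥1 : ∀ {q b} → 2 ≤ q → Coprime b q → ∀ k → 1 ≤ b ^ k
 pow≥1 {q} {zero} 2≤q c k with c (_∣0 q , ∣-refl)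
 ... | refl = ⊥-elim (<⇒≱ 2≤q ≤-refl)
 pow≥1 {q} {suc b} _ _ k = m^n>0 (suc b) k

 -- The bad case is a₁^o ≡ 1 modulo q². Replacing `a₁` by a₁ (1 + q) then changes the coefficient of
 -- q in a₁^o by o, which is prime to q because 1 ≤ o < q. Afterwards a^o - 1 has valuation exactly
 -- 1, the least possible.
 lift-universal : ∀ q → Prime q → q ≢ 2 → ∀ a₁ o t → Coprime a₁ q → Universal a₁ q → Order q a₁ o → o < q → a₁ ^ o ≡ 1 + q * t →
                  ∃ λ a → Coprime a q × (∀ f → Universal a (q ^ f))
 lift-universal q pq q≢2 a₁ o t a₁⊥q ua₁ oa o<q a₁^o≡ = conclude (generator (q ∣? t))
   where
   Generator = ∃ λ a → a ≅ a₁ [ q ] × ∃ λ s → a ^ o ≡ 1 + q * s × ¬ q ∣ s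
   q∤o : ¬ q ∣ o
   q∤o d = <⇒≱ o<q (∣⇒≤ {{>-nonZero (Order.pos oa)}} d)
   lem : ∀ q t o u w → (1 + q * (t * q)) * (1 + o * q + u * (q * q) + w * (q * q * q)) ≡ 1 + q * (o + q * (t + (u + w * q) + t * q * (o + (u + w * q) * q)))
   lem = solve-∀
   adjust : ∀ t′ → t ≡ t′ * q → (∃ λ u → ∃ λ w → (1 + q) ^ o ≡ 1 + o * q + u * (q * q) + w * (q * q * q) × 2 * u + o ≡ o * o) → Generator
   adjust t′ t≡ (u , w , e , _) = a₁ * (1 + q) ,
     ≋-trans (≅-* {q} (≋-refl {a = + a₁}) (≋-trans (≅-≡ (cong suc (sym (*-identityʳ q)))) (⇒≅1 q 1))) (≅-≡ (*-identityʳ a₁)) ,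
     o + q * r , trans (^-distrib a₁ (1 + q) o) (trans (cong₂ _*_ (trans a₁^o≡ (cong (λ t → 1 + q * t) t≡)) e) (lem q t′ o u w)) ,
     (λ d → q∤o (∣m+n∣n⇒∣m o (q * r) d (m∣m*n r)))
     where
     r = t′ + (u + w * q) + t′ * q * (o + (u + w * q) * q)
     ∣m+n∣n⇒∣m : ∀ m n → q ∣ m + n → q ∣ n → q ∣ m
     ∣m+n∣n⇒∣m m n d e = ∣m+n∣m⇒∣n (subst (q ∣_) (+-comm m n) d) e
   generator : Dec (q ∣ t) → Generator
   generator (no q∤t) = a₁ , ≋-refl , t , a₁^o≡ , q∤t
   generator (yes (divides t′ t≡)) = adjust t′ t≡ (binomial₂ q o)
   open Lifting q 1 pq ≤-refl
   conclude : Generator → ∃ λ a → Coprime a q × (∀ f → Universal a (q ^ f))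
   conclude (a , a≅a₁ , s , a^o≡ , q∤s) = a , (λ {_} → ≅-coprime a≅a₁ a₁⊥q) , univ
     where
     univ : ∀ f → Universal a (q ^ f)
     univ zero b k _ _ = ≅-[1]
     univ (suc f) b k b⊥ ak = lift (Order.to oa k (≋-trans (≅-^ k (≋-sym a≅a₁)) (≅-∣ (m∣m*n (q ^ f)) ak))) (≅1⇒ (pow≥1 (prime≥2 pq) b⊥q o) (ua₁ b o b⊥q (Order.self oa)))
       where
       b⊥q : Coprime b q
       b⊥q = coprime-∣ʳ (m∣m*n (q ^ f)) b⊥
       lift : o ∣ k → (∃ λ y → b ^ o ≡ 1 + q * y) → b ^ k ≅ 1 [ q ^ suc f ]
       lift (divides m k≡) (y , b^o≡) = ≋-trans (≅-≡ (trans (trans (cong (b ^_) (trans k≡ (*-comm m o))) (sym (^-*-assoc b o m))) (cong (_^ m) (trans b^o≡ (cong (λ z → 1 + z * y) (sym (*-identityʳ q))))))) (power-≅ y f m q^f∣m)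
         where
         q^f∣m : q ^ f ∣ m
         q^f∣m = power-divides (odd-lifts q pq q≢2) s q∤s f m (≋-trans (≅-≡ (trans (cong (_^ m) (trans (cong (λ z → 1 + z * s) (*-identityʳ q)) (sym a^o≡))) (trans (^-*-assoc a o m) (cong (a ^_) (trans (*-comm o m) (sym k≡)))))) ak)

 universal-odd : ∀ q → Prime q → q ≢ 2 → ∃ λ a → Coprime a q × (∀ f → Universal a (q ^ f))
 universal-odd q pq q≢2 = from-element (exponent-element q (prime-≥1 pq))
   where
   from-element : (∃ λ a → Coprime a q × Universal a q) → ∃ λ a → Coprime a q × (∀ f → Universal a (q ^ f))
   from-element (a₁ , a₁⊥q , ua₁) = from-order (order q a₁ (prime-≥1 pq) a₁⊥q)
     where
     from-order : (∃ λ o → Order q a₁ o × o ≤ q × (2 ≤ q → o < q)) → ∃ λ a → Coprime a q × (∀ f → Universal a (q ^ f))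
     from-order (o , oa , _ , o<q) = lift-universal q pq q≢2 a₁ o (proj₁ t) a₁⊥q ua₁ oa (o<q (prime≥2 pq)) (proj₂ t)
       where t = ≅1⇒ (pow≥1 (prime≥2 pq) a₁⊥q o) (Order.self oa)

 odd-square : ∀ b → Coprime b 2 → ∃ λ t → b * b ≡ 1 + 8 * t
 odd-square b b⊥2 with half b
 ... | c , inj₁ refl = ⊥-elim (coprime⇒∤ ≤-refl (coprime-sym b⊥2) (m∣m*n c))
 ... | c , inj₂ refl with half c
 ... | e , inj₁ refl = e * (2 * e + 1) , lem e
   where
   lem : ∀ e → suc (2 * (2 * e)) * suc (2 * (2 * e)) ≡ 1 + 8 * (e * (2 * e + 1))
   lem = solve-∀
 ... | e , inj₂ refl = (2 * e + 1) * (e + 1) , lem e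
   where
   lem : ∀ e → suc (2 * suc (2 * e)) * suc (2 * suc (2 * e)) ≡ 1 + 8 * ((2 * e + 1) * (e + 1))
   lem = solve-∀

 -- An exponent that kills 3 modulo 4 is even, and 3² - 1 = 8 has the least 2-adic valuation that b²
 -- - 1 can have for odd b.
 universal-two : ∀ f → Universal 3 (2 ^ f)
 universal-two zero b k _ _ = ≅-[1]
 universal-two (suc zero) b k b⊥2 _ = ≋-trans (≅-^ k b≅1) (≅-≡ (^-zeroˡ k))
   where
   b≅1 : b ≅ 1 [ 2 ]
   b≅1 with half b
   ... | c , inj₁ refl = ⊥-elim (coprime⇒∤ ≤-refl (coprime-sym b⊥2) (m∣m*n c))
   ... | c , inj₂ refl = ⇒≅1 2 c
 universal-two (suc (suc f)) b k b⊥ 3^k with half k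
 ... | m , inj₂ refl = ⊥-elim (3≇1 (≋-trans (≋-sym 3^≅3) (≅-∣ (divides (2 ^ f) (lem₄ (2 ^ f))) 3^k)))
   where
   lem₄ : ∀ x → 2 * (2 * x) ≡ x * 4
   lem₄ = solve-∀
   3^≅3 : 3 ^ suc (2 * m) ≅ 3 [ 4 ]
   3^≅3 = ≋-trans (≅-* {4} {3} {3} ≋-refl (≋-trans (≅-≡ (sym (^-*-assoc 3 2 m))) (≋-trans (≅-^ m (⇒≅1 4 2)) (≅-≡ (^-zeroˡ m))))) ≋-refl
   3≇1 : ¬ 3 ≅ 1 [ 4 ]
   3≇1 p with ≅-∸ {3} {1} {4} (s≤s z≤n) p
   ... | divides zero ()
   ... | divides (suc j) ()
 ... | m , inj₁ refl = go f 3^k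
   where
   b⊥2 : Coprime b 2
   b⊥2 = coprime-∣ʳ (m∣m*n (2 ^ suc f)) b⊥
   t = proj₁ (odd-square b b⊥2)
   b²≡ : b ^ (2 * m) ≡ (1 + 2 ^ 3 * t) ^ m
   b²≡ = trans (sym (^-*-assoc b 2 m)) (cong (_^ m) (trans (cong (b *_) (*-identityʳ b)) (proj₂ (odd-square b b⊥2))))
   open Lifting 2 3 prime[2] (s≤s z≤n)
   go : ∀ f → 3 ^ (2 * m) ≅ 1 [ 2 ^ suc (suc f) ] → b ^ (2 * m) ≅ 1 [ 2 ^ suc (suc f) ]
   go zero _ = ≋-trans (≅-≡ b²≡) (≅-∣ (divides 2 refl) (power-≅ t 0 m (1∣ m)))
   go (suc f) h = ≋-trans (≅-≡ b²≡) (power-≅ t f m (power-divides two-lifts 1 (λ d → <⇒≱ (s≤s (s≤s z≤n)) (∣⇒≤ d)) f m (≋-trans (≅-≡ (^-*-assoc 3 2 m)) h)))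

 -- One unit must serve all divisors at once, because later a single prime in its class has to have
 -- order λ(d) modulo each of them.
 Good : ℕ → Set
 Good n = ∃ λ a → Coprime a n × (∀ d → d ∣ n → Universal a d)

 universal-cong : ∀ {a a′ d} → a ≅ a′ [ d ] → Universal a′ d → Universal a d
 universal-cong e u b k b⊥d ak = u b k b⊥d (≋-trans (≅-^ k (≋-sym e)) ak)

 good-power : ∀ q e a → Prime q → Coprime a q → (∀ f → Universal a (q ^ f)) → Good (q ^ e)
 good-power q e a pq a⊥q u = a , (λ {_} → coprime-sym (coprime-^ˡ e (coprime-sym a⊥q))) , univ
   where
   univ : ∀ d → d ∣ q ^ e → Universal a d
   univ d d∣ = subst (Universal a) (sym (proj₂ f)) (u (proj₁ f))
     where f = prime-power-divisor q e d pq d∣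

 good-prime-power : ∀ q e → Prime q → Good (q ^ e)
 good-prime-power q e pq = cases (q ≟ 2)
   where
   2∤3 : ¬ 2 ∣ 3
   2∤3 (divides zero ())
   2∤3 (divides (suc zero) ())
   2∤3 (divides (suc (suc _)) ())
   odd : (∃ λ a → Coprime a q × (∀ f → Universal a (q ^ f))) → Good (q ^ e)
   odd (a , a⊥q , u) = good-power q e a pq a⊥q u
   cases : Dec (q ≡ 2) → Good (q ^ e)
   cases (yes q≡2) = subst (λ q → Good (q ^ e)) (sym q≡2) (good-power 2 e 3 prime[2] (coprime-sym (prime∤⇒coprime prime[2] 2∤3)) universal-two)
   cases (no q≢2) = odd (universal-odd q pq q≢2)

 split-divisor : ∀ {d m n} → 1 ≤ m → Coprime m n → d ∣ m * n → ∃ λ d₁ → ∃ λ d₂ → d ≡ d₁ * d₂ × d₁ ∣ m × d₂ ∣ n × Coprime d₁ d₂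
 split-divisor {d} {m} {n} 1≤m m⊥n d∣mn with gcd-split m d 1≤m
 ... | d₁ , m′ , d₂ , m≡ , d≡ , m′⊥d₂ , 1≤d₁ = d₁ , d₂ , trans d≡ (*-comm d₂ d₁) , divides m′ m≡ , d₂∣n , λ {_} → coprime-∣ˡ (divides m′ m≡) (coprime-∣ʳ d₂∣n m⊥n)
   where
   d₂∣n : d₂ ∣ n
   d₂∣n = coprime-divisor (coprime-sym m′⊥d₂) (*-cancelʳ-∣ d₁ {{>-nonZero 1≤d₁}} (subst₂ _∣_ d≡ (trans (cong (_* n) m≡) (lem m′ d₁ n)) d∣mn))
     where
     lem : ∀ x y z → x * y * z ≡ x * z * y
     lem = solve-∀

 good-* : ∀ {m n} → 1 ≤ m → Coprime m n → Good m → Good n → Good (m * n)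
 good-* {m} {n} 1≤m m⊥n (a₁ , a₁⊥ , u₁) (a₂ , a₂⊥ , u₂) = combine (crt a₁ a₂ m⊥n)
   where
   combine : (∃ λ x → x ≅ a₁ [ m ] × x ≅ a₂ [ n ]) → Good (m * n)
   combine (a , a≅a₁ , a≅a₂) = a , (λ {_} → a⊥) , λ d d∣ → univ d (split-divisor 1≤m m⊥n d∣)
     where
     a⊥ : Coprime a (m * n)
     a⊥ = coprime-sym (coprime-*ˡ (coprime-sym (≅-coprime a≅a₁ a₁⊥)) (coprime-sym (≅-coprime a≅a₂ a₂⊥)))
     univ : ∀ d → (∃ λ d₁ → ∃ λ d₂ → d ≡ d₁ * d₂ × d₁ ∣ m × d₂ ∣ n × Coprime d₁ d₂) → Universal a d
     univ d (d₁ , d₂ , d≡ , d₁∣m , d₂∣n , d₁⊥d₂) = subst (Universal a) (sym d≡) λ b k b⊥ ak → ≅-coprime-* d₁⊥d₂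
       (universal-cong (≅-∣ d₁∣m a≅a₁) (u₁ d₁ d₁∣m) b k (coprime-∣ʳ (m∣m*n d₂) b⊥) (≅-∣ (m∣m*n d₂) ak))
       (universal-cong (≅-∣ d₂∣n a≅a₂) (u₂ d₂ d₂∣n) b k (coprime-∣ʳ (n∣m*n d₁) b⊥) (≅-∣ (n∣m*n d₁) ak))

 opaque
   good : ∀ n → 1 ≤ n → Good n
   good = <-rec (λ n → 1 ≤ n → Good n) step
     where
     step : ∀ n → (∀ {k} → k < n → 1 ≤ k → Good k) → 1 ≤ n → Good n
     step n rec 1≤n = cases (n ≟ 1)
       where
       with-power : ∀ q → Prime q → q ∣ n → (∃ λ v → ∃ λ m → n ≡ q ^ v * m × ¬ q ∣ m × 1 ≤ m) → Good n
       with-power q pq q∣n (zero , m , n≡ , q∤m , _) = ⊥-elim (q∤m (subst (q ∣_) (trans n≡ (*-identityˡ m)) q∣n))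
       with-power q pq q∣n (suc v , m , n≡ , q∤m , 1≤m) = subst Good (sym n≡)
           (good-* (m^n>0 q {{>-nonZero (prime-≥1 pq)}} (suc v)) (coprime-^ˡ (suc v) (prime∤⇒coprime pq q∤m)) (good-prime-power q (suc v) pq) (rec (subst (m <_) (sym n≡) m<) 1≤m))
         where
         m< : m < q ^ suc v * m
         m< = subst (m <_) (*-comm m (q ^ suc v)) (m<m*n m (q ^ suc v) {{>-nonZero 1≤m}} (≤-trans (prime≥2 pq) (m≤m*n q (q ^ v) {{m^n≢0 q v {{>-nonZero (prime-≥1 pq)}}}})))
       cases : Dec (n ≡ 1) → Good n
       cases (yes n≡1) = 1 , 1-coprime , λ d d∣n b k _ _ → subst (λ d → b ^ k ≅ 1 [ d ]) (sym (∣1⇒≡1 (subst (d ∣_) n≡1 d∣n))) ≅-[1]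
       cases (no n≢1) = factor (∃-prime-factor n (≤∧≢⇒< 1≤n (λ e → n≢1 (sym e))))
         where
         factor : (∃ λ q → Prime q × q ∣ n) → Good n
         factor (q , pq , q∣n) = with-power q pq q∣n (strip q pq n 1≤n)

 firstTrue-applyUpTo : ∀ (P : ℕ → Bool) f n i → i < n → P (f i) ≡ true →
                       ∃ λ j → j ≤ i × firstTrue P (applyUpTo f n) ≡ f j × P (f j) ≡ true
 firstTrue-applyUpTo P f (suc n) i i<n Pi with P (f 0) in eq
 ... | true = 0 , z≤n , refl , eq
 firstTrue-applyUpTo P f (suc n) zero _ Pi | false = ⊥-elim (absurd (trans (sym eq) Pi))
   where
   absurd : false ≡ true → ⊥
   absurd ()
 firstTrue-applyUpTo P f (suc n) (suc i) (s≤s i<n) Pi | false with firstTrue-applyUpTo P (λ k → f (suc k)) n i i<n Pi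
 ... | j , j≤i , e , Pj = suc j , s≤s j≤i , e , Pj

 ∈-oneTo⁺ : ∀ {b n} → 1 ≤ b → b ≤ n → b ∈ oneTo n
 ∈-oneTo⁺ {suc b} _ b≤n = ∈-map⁺ suc (∈-upTo⁺ b≤n)

 ∈-units⁺ : ∀ {b d} → 1 ≤ b → b ≤ d → Coprime b d → b ∈ units d
 ∈-units⁺ {b} {d} 1≤b b≤d b⊥d = ∈-filter⁺ (λ a → gcd a d ≟ 1) (∈-oneTo⁺ 1≤b b≤d) (coprime⇒gcd≡1 b⊥d)

 ∈-units⁻ : ∀ {b d} → b ∈ units d → Coprime b d
 ∈-units⁻ {b} {d} b∈ = gcd≡1⇒coprime (proj₂ (∈-filter⁻ (λ a → gcd a d ≟ 1) {xs = oneTo d} b∈))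

 module Carmichael (d-1 : ℕ) where

   d : ℕ
   d = suc d-1

   open Representatives d (s≤s z≤n) using (rep)

   private
     test : ℕ → Bool
     test e = all (λ a → ((a ^ e) % d) ≡ᵇ (1 % d)) (units d)

     test⁺ : ∀ e → (∀ b → Coprime b d → b ^ e ≅ 1 [ d ]) → test e ≡ true
     test⁺ e h = Equivalence.to T-≡ (all⁻ (λ a → ((a ^ e) % d) ≡ᵇ (1 % d)) (All.tabulate λ {b} b∈ → ≡⇒≡ᵇ (b ^ e % d) (1 % d) (≅⇒% (h b (∈-units⁻ b∈)))))

     test⁻ : ∀ e → test e ≡ true → ∀ b → Coprime b d → b ^ e ≅ 1 [ d ]
     test⁻ e h b b⊥d with rep b
     ... | b′ , 1≤b′ , b′≤d , b′≅b = ≋-trans (≅-^ e (≋-sym b′≅b)) (%⇒≅ (≡ᵇ⇒≡ _ _ (All.lookup (all⁺ (λ a → ((a ^ e) % d) ≡ᵇ (1 % d)) (units d) (Equivalence.from T-≡ h)) (∈-units⁺ 1≤b′ b′≤d (≅-coprime b′≅b b⊥d)))))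

   opaque
     -- The search stops no later than at the order of `a`, since by universality that exponent
     -- kills every unit. Where it stops it kills `a` in particular, so it stops at a multiple of
     -- that order. Hence it finds the order itself.
     spec : ∀ a → Coprime a d → Universal a d →
            1 ≤ carmichael d × (∀ b → Coprime b d → b ^ carmichael d ≅ 1 [ d ]) × (∀ k → a ^ k ≅ 1 [ d ] → carmichael d ∣ k)
     spec a a⊥d ua = from-order (order d a (s≤s z≤n) a⊥d)
       where
       Spec : Set
       Spec = 1 ≤ carmichael d × (∀ b → Coprime b d → b ^ carmichael d ≅ 1 [ d ]) × (∀ k → a ^ k ≅ 1 [ d ] → carmichael d ∣ k)
       from-first : ∀ e-1 → Order d a (suc e-1) → (∃ λ j → j ≤ e-1 × firstTrue test (applyUpTo suc d) ≡ suc j × test (suc j) ≡ true) → Spec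
       from-first e-1 oa (j , j≤ , c≡ , cTrue) = subst (1 ≤_) (sym carm≡) (s≤s z≤n) , kills , λ k ak → subst (_∣ k) (sym (trans carm≡ (≤-antisym (s≤s j≤) (∣⇒≤ e∣)))) (Order.to oa k ak)
         where
         carm≡ : carmichael d ≡ suc j
         carm≡ = trans (cong (firstTrue test) (map-upTo suc d)) c≡
         kills : ∀ b → Coprime b d → b ^ carmichael d ≅ 1 [ d ]
         kills b b⊥d = subst (λ c → b ^ c ≅ 1 [ d ]) (sym carm≡) (test⁻ (suc j) cTrue b b⊥d)
         e∣ : suc e-1 ∣ suc j
         e∣ = Order.to oa (suc j) (test⁻ (suc j) cTrue a a⊥d)
       from-order : (∃ λ o → Order d a o × o ≤ d × (2 ≤ d → o < d)) → Spec
       from-order (zero , oa , _) = ⊥-elim (<⇒≱ (Order.pos oa) z≤n)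
       from-order (suc e-1 , oa , e≤d , _) = from-first e-1 oa (firstTrue-applyUpTo test suc d e-1 e≤d (test⁺ (suc e-1) (λ b b⊥d → ua b (suc e-1) b⊥d (Order.self oa))))

 carmichael-kills : ∀ d → 1 ≤ d → 1 ≤ carmichael d × (∀ b → Coprime b d → b ^ carmichael d ≅ 1 [ d ])
 carmichael-kills (suc d-1) 1≤d = from-good (good (suc d-1) 1≤d)
   where
   from-good : Good (suc d-1) → 1 ≤ carmichael (suc d-1) × (∀ b → Coprime b (suc d-1) → b ^ carmichael (suc d-1) ≅ 1 [ suc d-1 ])
   from-good (a , a⊥d , u) = proj₁ s , proj₁ (proj₂ s)
     where s = Carmichael.spec d-1 a a⊥d (u (suc d-1) ∣-refl)

 universal-unit : ∀ n → 1 ≤ n → ∃ λ a → Coprime a n × (∀ d → 1 ≤ d → d ∣ n → ∀ k → a ^ k ≅ 1 [ d ] → carmichael d ∣ k)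
 universal-unit n 1≤n = from-good (good n 1≤n)
   where
   from-good : Good n → ∃ λ a → Coprime a n × (∀ d → 1 ≤ d → d ∣ n → ∀ k → a ^ k ≅ 1 [ d ] → carmichael d ∣ k)
   from-good (a , a⊥n , u) = a , (λ {_} → a⊥n) , λ { (suc d-1) _ d∣n k ak → proj₂ (proj₂ (Carmichael.spec d-1 a (coprime-∣ʳ d∣n a⊥n) (u (suc d-1) d∣n))) k ak }

open Arithmetic

-- Dirichlet's theorem: inequalities and sums in ℚ.

module PrimesInProgressions where

 open import Data.Nat using (_^_) renaming (_+_ to _∔_; _*_ to _·_; _≤_ to _≼_; _≤?_ to _≼?_)
 open import Data.Nat.Properties using () renaming (≤-refl to ≼-refl; ≤-reflexive to ≼-reflexive; ≤-trans to ≼-trans)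
 open import Data.Nat.Divisibility using (_∣_)
 open import Data.Rational using (ℚ; 0ℚ; 1ℚ; _≤_)
 import Data.Rational as ℚ
 import Data.Rational.Properties as ℚ
 open import Data.Rational.Properties using (≤-refl; ≤-trans; ≤-reflexive; ≤-total; ≤-antisym)
 open import Relation.Binary.Definitions using (tri<; tri≈; tri>)

 infixl 6 _+_ _-_
 infixl 7 _*_
 infix 8 -_
 infixl 5 _⊕_ _⊕≡_
 infixr 6 _⊗_

 -- Opaque copies of the operations: unification may then decompose a sum or a product.
 opaque
   _+_ _*_ : ℚ → ℚ → ℚ
   _+_ = ℚ._+_
   _*_ = ℚ._*_

   -_ : ℚ → ℚ
   -_ = ℚ.-_

 opaque
   unfolding _+_

   +-*-isCommutativeRing : IsCommutativeRing _≡_ _+_ _*_ -_ 0ℚ 1ℚ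
   +-*-isCommutativeRing = ℚ.+-*-isCommutativeRing

   _⊕_ : ∀ {a b c d} → a ≤ b → c ≤ d → a + c ≤ b + d
   _⊕_ = ℚ.+-mono-≤

   _⊗_ : ∀ {c a b} → 0ℚ ≤ c → a ≤ b → c * a ≤ c * b
   _⊗_ {c} p q = ℚ.*-monoˡ-≤-nonNeg c {{ℚ.nonNegative p}} q

   inv : ℚ → ℚ
   inv q with q ℚ.≟ 0ℚ
   ... | yes _ = 0ℚ
   ... | no q≢0 = ℚ.1/_ q {{ℚ.≢-nonZero q≢0}}

   inv-r : ∀ q → ¬ q ≤ 0ℚ → q * inv q ≡ 1ℚ
   inv-r q ¬q≤0 with q ℚ.≟ 0ℚ
   ... | yes refl = ⊥-elim (¬q≤0 ≤-refl)
   ... | no q≢0 = ℚ.*-inverseʳ q {{ℚ.≢-nonZero q≢0}}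

 _-_ : ℚ → ℚ → ℚ
 x - y = x + (- y)

 +-*-commutativeRing : CommutativeRing _ _
 +-*-commutativeRing = record { isCommutativeRing = +-*-isCommutativeRing }

 open CommutativeRing +-*-commutativeRing
   using (+-comm; +-assoc; *-comm; *-assoc; +-identityˡ; +-identityʳ; *-identityˡ; *-identityʳ; distribˡ; distribʳ; zeroˡ; zeroʳ)

 open IntSolver +-*-commutativeRing
 open BigSum _+_ _*_ 0ℚ 1ℚ (CommutativeRing.isCommutativeSemiring +-*-commutativeRing)

 _⊕≡_ : ∀ {a b c d : ℚ} → a ≡ b → c ≡ d → a + c ≡ b + d
 _⊕≡_ = cong₂ _+_

 ≡⇒≤ : ∀ {a b : ℚ} → a ≡ b → a ≤ b
 ≡⇒≤ = ≤-reflexive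

 -- The form of all linear estimates below: hypotheses, scaled by nonnegative factors with `_⊗_` and
 -- added with `_⊕_`, give `x ≤ y`, and the solver confirms that this certificate and the goal
 -- differ by a ring identity.
 ≤-by : ∀ {a b x y} → x ≤ y → b + x ≡ a + y → a ≤ b
 ≤-by {a} {b} {x} {y} x≤y e = subst₂ _≤_ (solve (a ∷ x ∷ []) (v0 :- v1 :+ v1) v0) lem (≤-refl {a - x} ⊕ x≤y)
   where
   lem : (a - x) + y ≡ b
   lem = trans (solve (a ∷ x ∷ y ∷ []) (v0 :- v1 :+ v2) (v0 :+ v2 :- v1)) (trans (cong (_- x) (sym e)) (solve (b ∷ x ∷ []) (v0 :+ v1 :- v1) v0))

 ≡-by : ∀ {a b x y : ℚ} → x ≡ y → b + x ≡ a + y → a ≡ b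
 ≡-by {a} {b} {x} {y} refl e = trans (solve (a ∷ x ∷ []) v0 (v0 :+ v1 :- v1)) (trans (cong (_- x) (sym e)) (solve (b ∷ x ∷ []) (v0 :+ v1 :- v1) v0))

 0≤1 : 0ℚ ≤ 1ℚ
 0≤1 = ℚ.nonNegative⁻¹ 1ℚ

 1≰0 : ¬ 1ℚ ≤ 0ℚ
 1≰0 p = ℚ.1≢0 (ℚ.≤-antisym p 0≤1)

 0≤+ : ∀ {a b} → 0ℚ ≤ a → 0ℚ ≤ b → 0ℚ ≤ a + b
 0≤+ {a} {b} p q = (≤-by (p ⊕ q) (solve (a ∷ b ∷ []) (v0 :+ v1 :+ (c0 :+ c0)) (c0 :+ (v0 :+ v1))))

 0≤* : ∀ {a b} → 0ℚ ≤ a → 0ℚ ≤ b → 0ℚ ≤ a * b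
 0≤* {a} {b} p q = subst (_≤ a * b) (zeroʳ a) (p ⊗ q)

 0≤# : ∀ n → 0ℚ ≤ # n
 0≤# zero = ≤-refl
 0≤# (suc n) = subst (0ℚ ≤_) (sym (#-suc n)) (0≤+ 0≤1 (0≤# n))

 #-mono : ∀ {m n} → m ≼ n → # m ≤ # n
 #-mono {m} {n} m≤n with ℕ.m≤n⇒∃[o]m+o≡n m≤n
 ... | o , refl = (≤-by ((0≤# o) ⊕ (≡⇒≤ (sym (#-+ m o)))) (solve (# (m ∔ o) ∷ # m ∷ # o ∷ []) (v0 :+ (c0 :+ (v1 :+ v2))) (v1 :+ (v2 :+ v0))))

 infixr 6 _⊛_

 _⊛_ : ∀ {a b c d} → 0ℚ ≤ c → 0ℚ ≤ b → c ≤ d → a ≤ b → c * a ≤ d * b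
 _⊛_ {a} {b} {c} {d} 0≤c 0≤b c≤d a≤b =
   (≤-by ((0≤c ⊗ a≤b) ⊕ (0≤b ⊗ c≤d)) (solve (d ∷ b ∷ c ∷ a ∷ []) (v0 :* v1 :+ (v2 :* v3 :+ v1 :* v2)) (v2 :* v3 :+ (v2 :* v1 :+ v1 :* v0))))

 <⇒≰ : ∀ {a b} → 1ℚ + a ≤ b → ¬ b ≤ a
 <⇒≰ {a} {b} p q = 1≰0 (≤-by (p ⊕ q) (solve (a ∷ b ∷ []) (c0 :+ (c1 :+ v0 :+ v1)) (c1 :+ (v1 :+ v0))))

 0≤inv : ∀ q → ¬ q ≤ 0ℚ → 0ℚ ≤ q → 0ℚ ≤ inv q
 0≤inv q q≰0 0≤q with ≤-total 0ℚ (inv q)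
 ... | inj₁ p = p
 ... | inj₂ p = ⊥-elim (1≰0 (≤-by ((0≤q ⊗ p) ⊕ (≡⇒≤ (sym (inv-r q q≰0)))) (solve (q ∷ inv q ∷ []) (c0 :+ (v0 :* v1 :+ c1)) (c1 :+ (v0 :* c0 :+ v0 :* v1)))))

 cancel-≤ : ∀ {c a b} → ¬ c ≤ 0ℚ → 0ℚ ≤ c → c * a ≤ c * b → a ≤ b
 cancel-≤ {c} {a} {b} c≰0 0≤c p =
   subst₂ _≤_ (lem a) (lem b) (0≤inv c c≰0 0≤c ⊗ p)
   where
   lem : ∀ a → inv c * (c * a) ≡ a
   lem a = (≡-by (cong ((a) *_) (inv-r c c≰0)) (solve (a ∷ c ∷ inv c ∷ []) (v0 :+ v0 :* (v1 :* v2)) (v2 :* (v1 :* v0) :+ v0 :* c1)))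

 ∣_∣≤_ : ℚ → ℚ → Set
 ∣ x ∣≤ c = (- c ≤ x) × (x ≤ c)

 infix 4 ∣_∣≤_

 ∑-mono : ∀ n {f g} → (∀ i → 1 ≼ i → i ≼ n → f i ≤ g i) → ∑ n f ≤ ∑ n g
 ∑-mono zero h = ≤-refl
 ∑-mono (suc n) h = ∑-mono n (λ i p q → h i p (ℕ.m≤n⇒m≤1+n q)) ⊕ h (suc n) (s≤s z≤n) ≼-refl

 0≤∑ : ∀ n {f} → (∀ i → 1 ≼ i → i ≼ n → 0ℚ ≤ f i) → 0ℚ ≤ ∑ n f
 0≤∑ n {f} h = subst (_≤ ∑ n f) (∑-0 n λ _ _ _ → refl) (∑-mono n {λ _ → 0ℚ} h)

 ∑-neg : ∀ n f → ∑ n (λ i → - f i) ≡ - ∑ n f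
 ∑-neg zero f = (solve [] c0 (:- c0))
 ∑-neg (suc n) f = (≡-by (∑-neg n f) (solve (∑ n f ∷ f (suc n) ∷ ∑ n (λ i → - f i) ∷ []) (:- (v0 :+ v1) :+ v2) (v2 :+ (:- v1) :+ (:- v0))))

 ∑-sub : ∀ n f g → ∑ n (λ i → f i - g i) ≡ ∑ n f - ∑ n g
 ∑-sub n f g = trans (∑-+ n f (λ i → - g i)) (cong (∑ n f +_) (∑-neg n g))

 ∑-const : ∀ n c → ∑ n (λ _ → c) ≡ # n * c
 ∑-const zero c = (solve (c ∷ []) c0 (c0 :* v0))
 ∑-const (suc n) c = (≡-by ((∑-const n c) ⊕≡ (cong ((c) *_) (sym (#-suc n)))) (solve (# (suc n) ∷ c ∷ ∑ n (λ _ → c) ∷ # n ∷ []) (v0 :* v1 :+ (v2 :+ v1 :* (c1 :+ v3))) (v2 :+ v1 :+ (v3 :* v1 :+ v1 :* v0))))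

 0≤ι : ∀ {P : Set} (d : Dec P) → 0ℚ ≤ ι d
 0≤ι (yes _) = 0≤1
 0≤ι (no _) = ≤-refl

 ι≤1 : ∀ {P : Set} (d : Dec P) → ι d ≤ 1ℚ
 ι≤1 (yes _) = ≤-refl
 ι≤1 (no _) = 0≤1

 -- The support condition lets both sums run to the same bound `B`, although `d · m` passes it.
 ∑-multiples : ∀ B d (H : ℕ → ℚ) → 1 ≼ d → (∀ n → B ℕ.< n → H n ≡ 0ℚ) →
               ∑ B (λ m → H (d · m)) ≡ ∑ B (λ n → ι (d ∣? n) * H n)
 ∑-multiples B d@(suc d-1) H 1≤d H-supp = sym (begin
   ∑ B (λ n → ι (d ∣? n) * H n) ≡⟨ ∑-cong B (λ n 1≤n n≤B → cong (_* H n) (lem n 1≤n n≤B)) ⟩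
   ∑ B (λ n → ∑ B (λ m → ι (n ℕ.≟ d · m)) * H n) ≡⟨ ∑-ext B (λ n → ∑-*ʳ B (H n) _) ⟩
   ∑ B (λ n → ∑ B (λ m → ι (n ℕ.≟ d · m) * H n)) ≡⟨ ∑-swap B B (λ n m → ι (n ℕ.≟ d · m) * H n) ⟩
   ∑ B (λ m → ∑ B (λ n → ι (n ℕ.≟ d · m) * H n)) ≡⟨ ∑-cong B (λ m 1≤m _ → lem₂ m 1≤m) ⟩
   ∑ B (λ m → H (d · m)) ∎)
   where
   open ≡-Reasoning
   lem : ∀ n → 1 ≼ n → n ≼ B → ι (d ∣? n) ≡ ∑ B (λ m → ι (n ℕ.≟ d · m))
   lem n 1≤n n≤B with d ∣? n
   ... | no d∤n = sym (∑-0 B λ m _ _ → ι-no (n ℕ.≟ d · m) λ e → d∤n (divides m (trans e (ℕ.*-comm d m))))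
   ... | yes (divides zero refl) = ⊥-elim (ℕ.<⇒≱ 1≤n z≤n)
   ... | yes (divides k@(suc _) refl) = sym (trans
           (∑-ext B λ m → trans (ι-⇔ (k · d ℕ.≟ d · m) (m ℕ.≟ k)
              (λ e → ℕ.*-cancelˡ-≡ m k d (trans (sym e) (ℕ.*-comm k d))) (λ { refl → ℕ.*-comm k d }))
              (sym (*-identityʳ _)))
           (∑-δ B k (λ _ → 1ℚ) (s≤s z≤n) (≼-trans (ℕ.m≤m*n k d) n≤B)))
   lem₂ : ∀ m → 1 ≼ m → ∑ B (λ n → ι (n ℕ.≟ d · m) * H n) ≡ H (d · m)
   lem₂ m 1≤m with d · m ≼? B
   ... | yes dm≤B = ∑-δ B (d · m) H (ℕ.*-mono-≤ 1≤d 1≤m) dm≤B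
   ... | no dm≰B = trans (∑-δ-0 B (d · m) H λ { i _ i≤B refl → dm≰B i≤B }) (sym (H-supp (d · m) (ℕ.≰⇒> dm≰B)))

 -- Additive logarithms and von Mangoldt's function.

 module Log (B : ℕ) (ℓ : ℕ → ℚ) where

   -- For a prime p and 1 ≤ n ≤ B this is the p-adic valuation of n, as p^k ∣ n forces k < p^k ≤ B.
   val : ℕ → ℕ → ℚ
   val p n = ∑ B (λ k → ι (p ^ k ∣? n))

   lg : ℕ → ℚ
   lg n = ∑ B (λ p → ι (prime? p) * (val p n * ℓ p))

   -- Von Mangoldt's function on 1, ..., B, with `ℓ p` in place of log p.
   Λ : ℕ → ℚ
   Λ n = ∑ B (λ p → ι (prime? p) * ∑ B (λ k → ι (n ℕ.≟ p ^ k) * ℓ p))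

   private
     p^k≥1 : ∀ {p} k → Prime p → 1 ≼ p ^ k
     p^k≥1 {p} k pr = ℕ.m^n>0 p {{ℕ.>-nonZero (prime-≥1 pr)}} k

   ∑-Λ : ∀ (F : ℕ → ℚ) → ∑ B (λ n → Λ n * F n) ≡
               ∑ B (λ p → ι (prime? p) * ∑ B (λ k → ι (p ^ k ≼? B) * (ℓ p * F (p ^ k))))
   ∑-Λ F = begin
     ∑ B (λ n → Λ n * F n)
       ≡⟨ ∑-ext B (λ n → trans (∑-*ʳ B (F n) _) (∑-ext B λ p →
            trans (*-assoc _ _ (F n)) (cong (ι (prime? p) *_) (∑-*ʳ B (F n) _)))) ⟩
     ∑ B (λ n → ∑ B (λ p → ι (prime? p) * ∑ B (λ k → (ι (n ℕ.≟ p ^ k) * ℓ p) * F n)))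
       ≡⟨ ∑-swap B B _ ⟩
     ∑ B (λ p → ∑ B (λ n → ι (prime? p) * ∑ B (λ k → (ι (n ℕ.≟ p ^ k) * ℓ p) * F n)))
       ≡⟨ ∑-ext B (λ p → trans (sym (∑-*ˡ B (ι (prime? p)) _)) (cong (ι (prime? p) *_) (∑-swap B B _))) ⟩
     ∑ B (λ p → ι (prime? p) * ∑ B (λ k → ∑ B (λ n → (ι (n ℕ.≟ p ^ k) * ℓ p) * F n)))
       ≡⟨ ∑-ext B (λ p → ι-*-cong (prime? p) λ pr → ∑-ext B λ k → lem p k pr) ⟩
     ∑ B (λ p → ι (prime? p) * ∑ B (λ k → ι (p ^ k ≼? B) * (ℓ p * F (p ^ k)))) ∎
     where
     open ≡-Reasoning
     lem : ∀ p k → Prime p → ∑ B (λ n → (ι (n ℕ.≟ p ^ k) * ℓ p) * F n) ≡ ι (p ^ k ≼? B) * (ℓ p * F (p ^ k))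
     lem p k pr = trans (∑-ext B λ n → *-assoc _ (ℓ p) (F n)) (go (p ^ k ≼? B))
       where
       go : (d : Dec (p ^ k ≼ B)) → ∑ B (λ n → ι (n ℕ.≟ p ^ k) * (ℓ p * F n)) ≡ ι d * (ℓ p * F (p ^ k))
       go (yes q) = trans (∑-δ B (p ^ k) (λ n → ℓ p * F n) (p^k≥1 k pr) q) (sym (*-identityˡ _))
       go (no ¬q) = trans (∑-δ-0 B (p ^ k) (λ n → ℓ p * F n) λ { i _ i≤B refl → ¬q i≤B }) (sym (zeroˡ _))

   Λ-∣ : ∀ n → 1 ≼ n → n ≼ B → ∑ B (λ d → Λ d * ι (d ∣? n)) ≡ lg n
   Λ-∣ n@(suc _) 1≤n n≤B = trans (∑-Λ (λ d → ι (d ∣? n)))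
     (∑-ext B λ p → cong (ι (prime? p) *_) (trans (∑-ext B λ k → lem p k) (sym (∑-*ʳ B (ℓ p) _))))
     where
     lem : ∀ p k → ι (p ^ k ≼? B) * (ℓ p * ι (p ^ k ∣? n)) ≡ ι (p ^ k ∣? n) * ℓ p
     lem p k with p ^ k ∣? n
     ... | yes q = trans (ι-*-yes (p ^ k ≼? B) (≼-trans (ℕ.∣⇒≤ q) n≤B)) (*-comm _ _)
     ... | no _ = (solve (ι (p ^ k ≼? B) ∷ ℓ p ∷ []) (v0 :* (v1 :* c0)) (c0 :* v1))

   -- The convolution identity log = Λ * 1, tested against `H`. All convolution identities are used
   -- in this weak form, which keeps every sum finite with the same bound.
   ∑-lg : ∀ (H : ℕ → ℚ) → (∀ n → B ℕ.< n → H n ≡ 0ℚ) →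
          ∑ B (λ n → lg n * H n) ≡ ∑ B (λ d → Λ d * ∑ B (λ m → H (d · m)))
   ∑-lg H H-supp = begin
     ∑ B (λ n → lg n * H n) ≡⟨ ∑-cong B (λ n p q → trans (cong (_* H n) (sym (Λ-∣ n p q))) (∑-*ʳ B (H n) _)) ⟩
     ∑ B (λ n → ∑ B (λ d → (Λ d * ι (d ∣? n)) * H n)) ≡⟨ ∑-swap B B _ ⟩
     ∑ B (λ d → ∑ B (λ n → (Λ d * ι (d ∣? n)) * H n)) ≡⟨ ∑-ext B (λ d → trans (∑-ext B λ n → *-assoc (Λ d) _ (H n)) (sym (∑-*ˡ B (Λ d) _))) ⟩
     ∑ B (λ d → Λ d * ∑ B (λ n → ι (d ∣? n) * H n)) ≡⟨ ∑-cong B (λ d 1≤d _ → cong (Λ d *_) (sym (∑-multiples B d H 1≤d H-supp))) ⟩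
     ∑ B (λ d → Λ d * ∑ B (λ m → H (d · m))) ∎
     where open ≡-Reasoning

   lg-1 : lg 1 ≡ 0ℚ
   lg-1 = ∑-0 B λ p _ _ → lem p (prime? p)
     where
     lem : ∀ p (d : Dec (Prime p)) → ι d * (val p 1 * ℓ p) ≡ 0ℚ
     lem p (no _) = zeroˡ _
     lem p (yes pr) = trans (*-identityˡ _) (trans (cong (_* ℓ p) (∑-0 B λ { (suc k) _ _ → ι-no (p ^ suc k ∣? 1)
       λ q → ℕ.<⇒≱ (≼-trans (prime≥2 pr) (ℕ.m≤m*n p (p ^ k) {{ℕ.>-nonZero (p^k≥1 k pr)}})) (ℕ.∣⇒≤ q) })) (zeroˡ (ℓ p)))

   lg-prime-* : ∀ q m → Prime q → q ≼ B → 1 ≼ m → m ≼ B → lg (q · m) ≡ ℓ q + lg m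
   lg-prime-* q m@(suc _) pq q≤B 1≤m m≤B = begin
     lg (q · m)
       ≡⟨ ∑-ext B (λ p → trans (ι-*-cong (prime? p) (λ pp → lem p pp (p ℕ.≟ q))) (dist (ι (prime? p)) (ι (p ℕ.≟ q)) (ℓ p) (val p m))) ⟩
     ∑ B (λ p → ι (p ℕ.≟ q) * (ι (prime? p) * ℓ p) + ι (prime? p) * (val p m * ℓ p))
       ≡⟨ ∑-+ B _ _ ⟩
     ∑ B (λ p → ι (p ℕ.≟ q) * (ι (prime? p) * ℓ p)) + lg m
       ≡⟨ cong (_+ lg m) (trans (∑-δ B q _ (prime-≥1 pq) q≤B) (ι-*-yes (prime? q) pq)) ⟩
     ℓ q + lg m ∎
     where
     open ≡-Reasoning
     dist : ∀ a b c d → a * ((b + d) * c) ≡ b * (a * c) + a * (d * c)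
     dist a b c d = (solve (a ∷ b ∷ d ∷ c ∷ []) (v0 :* ((v1 :+ v2) :* v3)) (v1 :* (v0 :* v3) :+ v0 :* (v2 :* v3)))
     val-q : Prime q → val q (q · m) ≡ 1ℚ + val q m
     val-q pq = shift B m≤B
       where
       q^B∤m : ∀ {b} → m ≼ b → ¬ q ^ b ∣ m
       q^B∤m {b} m≤b d = ℕ.<⇒≱ (n<2^n b) (≼-trans (≼-trans (ℕ.^-monoˡ-≤ b (prime≥2 pq)) (ℕ.∣⇒≤ d)) m≤b)
       iff : ∀ k → ι (q ^ suc k ∣? q · m) ≡ ι (q ^ k ∣? m)
       iff k = ι-⇔ (q ^ suc k ∣? q · m) (q ^ k ∣? m) (ℕ.*-cancelˡ-∣ q {{ℕ.>-nonZero (prime-≥1 pq)}}) (ℕ.*-monoʳ-∣ q)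
       go : ∀ b → ∑ (suc b) (λ k → ι (q ^ k ∣? q · m)) ≡ 1ℚ + ∑ b (λ k → ι (q ^ k ∣? m))
       go zero = (≡-by (trans (iff 0) (ι-yes (1 ∣? m) (ℕ.1∣ m))) (solve (ι (q ^ 1 ∣? q · m) ∷ []) (c1 :+ c0 :+ v0) (c0 :+ v0 :+ c1)))
       go (suc b) = trans (cong₂ _+_ (go b) (iff (suc b))) (+-assoc _ _ _)
       shift : ∀ b → m ≼ b → ∑ b (λ k → ι (q ^ k ∣? q · m)) ≡ 1ℚ + ∑ b (λ k → ι (q ^ k ∣? m))
       shift zero ()
       shift (suc b) m≤1+b = trans (go b) (cong (1ℚ +_) (trans (sym (+-identityʳ _)) (cong (∑ b (λ k → ι (q ^ k ∣? m)) +_) (sym (ι-no (q ^ suc b ∣? m) (q^B∤m m≤1+b))))))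
     val-p : ∀ p → Prime p → p ≢ q → val p (q · m) ≡ val p m
     val-p p pp p≢q = ∑-ext B λ k → ι-⇔ (p ^ k ∣? q · m) (p ^ k ∣? m)
       (coprime-divisor (coprime-^ˡ k (primes-coprime pp pq p≢q))) (λ d → ℕ.∣n⇒∣m*n q d)
     lem : ∀ p → Prime p → (d : Dec (p ≡ q)) → val p (q · m) * ℓ p ≡ (ι d + val p m) * ℓ p
     lem p pp (yes refl) = cong (_* ℓ p) (val-q pp)
     lem p pp (no p≢q) = cong (_* ℓ p) (trans (val-p p pp p≢q) (sym (+-identityˡ _)))

   lg-prime : ∀ q → Prime q → q ≼ B → lg q ≡ ℓ q
   lg-prime q pq q≤B = trans (cong lg (sym (ℕ.*-identityʳ q)))
     (trans (lg-prime-* q 1 pq q≤B ≼-refl (≼-trans (prime-≥1 pq) q≤B)) (trans (cong (ℓ q +_) lg-1) (+-identityʳ _)))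

   lg-* : ∀ m n → 1 ≼ m → 1 ≼ n → m · n ≼ B → lg (m · n) ≡ lg m + lg n
   lg-* m n 1≤m 1≤n = prime-rec (λ m → m · n ≼ B → lg (m · n) ≡ lg m + lg n) base step m 1≤m
     where
     base : 1 · n ≼ B → lg (1 · n) ≡ lg 1 + lg n
     base _ = trans (cong lg (ℕ.*-identityˡ n)) (trans (sym (+-identityˡ _)) (cong (_+ lg n) (sym lg-1)))
     step : ∀ q m → Prime q → 1 ≼ m → (m · n ≼ B → lg (m · n) ≡ lg m + lg n) →
            q · m · n ≼ B → lg (q · m · n) ≡ lg (q · m) + lg n
     step q m pq 1≤m IH qmn≤B = begin
       lg (q · m · n) ≡⟨ cong lg (ℕ.*-assoc q m n) ⟩
       lg (q · (m · n)) ≡⟨ lg-prime-* q (m · n) pq q≤B 1≤mn mn≤B ⟩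
       ℓ q + lg (m · n) ≡⟨ cong (ℓ q +_) (IH mn≤B) ⟩
       ℓ q + (lg m + lg n) ≡⟨ sym (+-assoc _ _ _) ⟩
       (ℓ q + lg m) + lg n ≡⟨ cong (_+ lg n) (sym (lg-prime-* q m pq q≤B 1≤m (≼-trans (ℕ.m≤m*n m n {{ℕ.>-nonZero 1≤n}}) mn≤B))) ⟩
       lg (q · m) + lg n ∎
       where
       open ≡-Reasoning
       1≤mn = ℕ.*-mono-≤ 1≤m 1≤n
       q[mn]≤B = subst (ℕ._≤ B) (ℕ.*-assoc q m n) qmn≤B
       q≤B = ≼-trans (ℕ.m≤m*n q (m · n) {{ℕ.>-nonZero 1≤mn}}) q[mn]≤B
       mn≤B = ≼-trans (ℕ.m≤n*m (m · n) q {{ℕ.>-nonZero (prime-≥1 pq)}}) q[mn]≤B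

   0≤Λ : (∀ p → 0ℚ ≤ ℓ p) → ∀ n → 0ℚ ≤ Λ n
   0≤Λ 0≤ℓ n = 0≤∑ B λ p _ _ → 0≤* (0≤ι (prime? p)) (0≤∑ B λ k _ _ → 0≤* (0≤ι (n ℕ.≟ p ^ k)) (0≤ℓ p))

 -- The Möbius function.

 ∏ : ℕ → (ℕ → ℚ) → ℚ
 ∏ zero f = 1ℚ
 ∏ (suc n) f = ∏ n f * f (suc n)

 ∏-cong : ∀ n {f g} → (∀ i → 1 ≼ i → i ≼ n → f i ≡ g i) → ∏ n f ≡ ∏ n g
 ∏-cong zero h = refl
 ∏-cong (suc n) h = cong₂ _*_ (∏-cong n λ i p q → h i p (ℕ.m≤n⇒m≤1+n q)) (h (suc n) (s≤s z≤n) ≼-refl)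

 ∏-1 : ∀ n {f} → (∀ i → 1 ≼ i → i ≼ n → f i ≡ 1ℚ) → ∏ n f ≡ 1ℚ
 ∏-1 zero h = refl
 ∏-1 (suc n) h = trans (cong₂ _*_ (∏-1 n λ i p q → h i p (ℕ.m≤n⇒m≤1+n q)) (h (suc n) (s≤s z≤n) ≼-refl)) (*-identityˡ 1ℚ)

 ∏-change : ∀ n {f g} k c → (∀ i → i ≢ k → f i ≡ g i) → f k ≡ c * g k → 1 ≼ k → k ≼ n → ∏ n f ≡ c * ∏ n g
 ∏-change zero k c h hk 1≤k k≤0 = ⊥-elim (ℕ.<⇒≱ 1≤k k≤0)
 ∏-change (suc n) {f} {g} k c h hk 1≤k k≤1+n with k ℕ.≟ suc n
 ... | yes refl = trans (cong₂ _*_ (∏-cong n λ { i _ i≤n → h i λ { refl → ℕ.1+n≰n i≤n } }) hk)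
                        (solve (∏ n g ∷ c ∷ g (suc n) ∷ []) (v0 :* (v1 :* v2)) (v1 :* (v0 :* v2)))
 ... | no k≢ = trans (cong₂ _*_ (∏-change n k c h hk 1≤k (ℕ.≤-pred (ℕ.≤∧≢⇒< k≤1+n k≢))) (h (suc n) λ e → k≢ (sym e)))
                     (*-assoc c _ _)

 Sign : ℚ → Set
 Sign x = x ≡ 1ℚ ⊎ x ≡ 0ℚ ⊎ x ≡ - 1ℚ

 Sign-* : ∀ {x y} → Sign x → Sign y → Sign (x * y)
 Sign-* (inj₁ refl) (inj₁ refl) = inj₁ (*-identityˡ 1ℚ)
 Sign-* (inj₁ refl) (inj₂ (inj₁ refl)) = inj₂ (inj₁ (*-identityˡ 0ℚ))
 Sign-* (inj₁ refl) (inj₂ (inj₂ refl)) = inj₂ (inj₂ (*-identityˡ (- 1ℚ)))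
 Sign-* {y = y} (inj₂ (inj₁ refl)) _ = inj₂ (inj₁ (zeroˡ y))
 Sign-* (inj₂ (inj₂ refl)) (inj₁ refl) = inj₂ (inj₂ (*-identityʳ (- 1ℚ)))
 Sign-* (inj₂ (inj₂ refl)) (inj₂ (inj₁ refl)) = inj₂ (inj₁ (zeroʳ (- 1ℚ)))
 Sign-* (inj₂ (inj₂ refl)) (inj₂ (inj₂ refl)) = inj₁ (solve [] ((:- c1) :* (:- c1)) c1)

 Sign-∏ : ∀ n {f} → (∀ i → Sign (f i)) → Sign (∏ n f)
 Sign-∏ zero h = inj₁ refl
 Sign-∏ (suc n) h = Sign-* (Sign-∏ n h) (h (suc n))

 Sign-bound : ∀ {x y c} → Sign x → ∣ y ∣≤ c → ∣ x * y ∣≤ c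
 Sign-bound {x} {y} {c} (inj₁ refl) (p , q) = subst (∣_∣≤ c) (sym (*-identityˡ y)) (p , q)
 Sign-bound {x} {y} {c} (inj₂ (inj₁ refl)) (p , q) = subst (∣_∣≤ c) (sym (zeroˡ y)) ((≤-by 0≤c (solve (c ∷ []) (c0 :+ c0) (:- v0 :+ v0))) , 0≤c)
   where
   0≤2c : 0ℚ ≤ c + c
   0≤2c = (≤-by (p ⊕ q) (solve (c ∷ y ∷ []) (v0 :+ v0 :+ (:- v0 :+ v1)) (c0 :+ (v1 :+ v0))))
   0≤c : 0ℚ ≤ c
   0≤c with ≤-total 0ℚ c
   ... | inj₁ h = h
   ... | inj₂ h = (≤-by (0≤2c ⊕ h) (solve (c ∷ []) (v0 :+ (c0 :+ v0)) (c0 :+ (v0 :+ v0 :+ c0))))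
 Sign-bound {x} {y} {c} (inj₂ (inj₂ refl)) (p , q) =
   (≤-by q (solve (y ∷ c ∷ []) ((:- c1) :* v0 :+ v0) (:- v1 :+ v1))) , (≤-by p (solve (c ∷ y ∷ []) (v0 :+ (:- v0)) ((:- c1) :* v1 :+ v1)))

 module Möbius (B : ℕ) where

   -- The local factor of μ at a prime q: 1 if q does not divide n, -1 if it divides n exactly once,
   -- 0 if its square divides n.
   fac : ℕ → ℕ → ℚ
   fac q n = 1ℚ - ι (prime? q) * (# 2 * ι (q ∣? n) - ι (q · q ∣? n))

   μ : ℕ → ℚ
   μ n = ∏ B (λ q → fac q n)

   private

     fac-val : ∀ q n {a b} → Prime q → ι (q ∣? n) ≡ a → ι (q · q ∣? n) ≡ b → fac q n ≡ 1ℚ - 1ℚ * (# 2 * a - b)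
     fac-val q n pq refl refl = cong (λ z → 1ℚ - z * (# 2 * ι (q ∣? n) - ι (q · q ∣? n))) (ι-yes (prime? q) pq)

     q∣q²∣ : ∀ {q n} → q · q ∣ n → q ∣ n
     q∣q²∣ {q} = ℕ.m*n∣⇒m∣ q q

     fac-∤ : ∀ q n → ¬ q ∣ n → fac q n ≡ 1ℚ
     fac-∤ q n q∤n = trans (cong₂ (λ a b → 1ℚ - ι (prime? q) * (# 2 * a - b)) (ι-no (q ∣? n) q∤n) (ι-no (q · q ∣? n) λ d → q∤n (q∣q²∣ d)))
       (solve (ι (prime? q) ∷ []) (c1 :- v0 :* (c2 :* c0 :- c0)) c1)

     fac-∣∣ : ∀ q n → Prime q → q ∣ n → ¬ q · q ∣ n → fac q n ≡ - 1ℚ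
     fac-∣∣ q n pq q∣n q²∤n = trans (fac-val q n pq (ι-yes (q ∣? n) q∣n) (ι-no (q · q ∣? n) q²∤n)) (solve [] (c1 :- c1 :* (c2 :* c1 :- c0)) (:- c1))

     fac-q² : ∀ q n → Prime q → q · q ∣ n → fac q n ≡ 0ℚ
     fac-q² q n pq q²∣n = trans (fac-val q n pq (ι-yes (q ∣? n) (q∣q²∣ q²∣n)) (ι-yes (q · q ∣? n) q²∣n)) (solve [] (c1 :- c1 :* (c2 :* c1 :- c1)) c0)

     fac-sign : ∀ n q → Sign (fac q n)
     fac-sign n q with prime? q in eq
     ... | no _ = inj₁ (solve (ι (q ∣? n) ∷ ι (q · q ∣? n) ∷ []) (c1 :- c0 :* (c2 :* v0 :- v1)) c1)
     ... | yes pq with q ∣? n | q · q ∣? n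
     ... | no q∤n | yes d = ⊥-elim (q∤n (q∣q²∣ d))
     ... | no _ | no _ = inj₁ (solve [] (c1 :- c1 :* (c2 :* c0 :- c0)) c1)
     ... | yes _ | no _ = inj₂ (inj₂ (solve [] (c1 :- c1 :* (c2 :* c1 :- c0)) (:- c1)))
     ... | yes _ | yes _ = inj₂ (inj₁ (solve [] (c1 :- c1 :* (c2 :* c1 :- c1)) c0))

   μ-sign : ∀ n → Sign (μ n)
   μ-sign n = Sign-∏ B (fac-sign n)

   μ-1 : μ 1 ≡ 1ℚ
   μ-1 = ∏-1 B λ q _ _ → lem q (prime? q)
     where
     lem : ∀ q (d : Dec (Prime q)) → 1ℚ - ι d * (# 2 * ι (q ∣? 1) - ι (q · q ∣? 1)) ≡ 1ℚ
     lem q (no _) = (solve (ι (q ∣? 1) ∷ ι (q · q ∣? 1) ∷ []) (c1 :- c0 :* (c2 :* v0 :- v1)) c1)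
     lem q (yes pq) = trans (cong₂ (λ a b → 1ℚ - 1ℚ * (# 2 * a - b)) (ι-no (q ∣? 1) q∤1) (ι-no (q · q ∣? 1) λ d → q∤1 (q∣q²∣ d)))
       (solve [] (c1 :- c1 :* (c2 :* c0 :- c0)) c1)
       where
       q∤1 : ¬ q ∣ 1
       q∤1 d = ℕ.<⇒≱ (prime≥2 pq) (ℕ.∣⇒≤ d)

   -- The right side expresses without case distinction that the value is `- μ d` for q ∤ d and 0
   -- for q ∣ d.
   μ-q : ∀ q d → Prime q → q ≼ B → 1 ≼ d → μ (q · d) ≡ - (ι (q ∣? d) * - μ d + μ d)
   μ-q q d pq q≤B 1≤d with q ∣? d
   ... | yes q∣d = trans (∏-change B {g = λ i → fac i (q · d)} q 0ℚ (λ _ _ → refl)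
           (trans (fac-q² q _ pq (ℕ.*-monoʳ-∣ q q∣d)) (sym (zeroˡ _))) (prime-≥1 pq) q≤B)
           (solve (μ (q · d) ∷ μ d ∷ []) (c0 :* v0) (:- (c1 :* (:- v1) :+ v1)))
   ... | no q∤d = trans (∏-change B {g = λ i → fac i d} q (- 1ℚ) other
           (trans (fac-∣∣ q (q · d) pq (ℕ.m∣m*n d) λ q²∣qd → q∤d (ℕ.*-cancelˡ-∣ q {{ℕ.>-nonZero (prime-≥1 pq)}} q²∣qd))
             (trans (sym (*-identityʳ (- 1ℚ))) (cong (- 1ℚ *_) (sym (fac-∤ q d q∤d))))) (prime-≥1 pq) q≤B)
           (solve (μ d ∷ []) ((:- c1) :* v0) (:- (c0 :* (:- v0) :+ v0)))
     where
     other : ∀ i → i ≢ q → fac i (q · d) ≡ fac i d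
     other i i≢q with prime? i in eq
     ... | no _ = (solve (ι (i ∣? q · d) ∷ ι (i · i ∣? q · d) ∷ ι (i ∣? d) ∷ ι (i · i ∣? d) ∷ []) (c1 :- c0 :* (c2 :* v0 :- v1)) (c1 :- c0 :* (c2 :* v2 :- v3)))
     ... | yes pi = cong₂ (λ a b → 1ℚ - 1ℚ * (# 2 * a - b))
             (ι-⇔ (i ∣? q · d) (i ∣? d) (coprime-divisor i⊥q) (λ x → ℕ.∣n⇒∣m*n q x))
             (ι-⇔ (i · i ∣? q · d) (i · i ∣? d) (coprime-divisor (coprime-*ˡ i⊥q i⊥q)) (λ x → ℕ.∣n⇒∣m*n q x))
       where
       i⊥q = primes-coprime pi pq i≢q

   -- For a prime q dividing n the term at d with q ∤ d cancels against the term at q d; the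
   -- remaining multiples of q are not squarefree at q.
   μ-∣ : ∀ n → 1 ≼ n → n ≼ B → ∑ B (λ d → μ d * ι (d ∣? n)) ≡ ι (n ℕ.≟ 1)
   μ-∣ n@(suc n-1) 1≤n n≤B with n ℕ.≟ 1
   ... | yes refl = trans (∑-ext B λ d → trans (*-comm _ _) (cong (_* μ d) (ι-⇔ (d ∣? 1) (d ℕ.≟ 1) ℕ.∣1⇒≡1 λ { refl → ℕ.∣-refl })))
                      (trans (∑-δ B 1 μ ≼-refl n≤B) μ-1)
   ... | no n≢1 with ∃-prime-factor n (ℕ.≤∧≢⇒< 1≤n λ e → n≢1 (sym e))
   ... | q , pq , q∣n = begin
     ∑ B (λ d → μ d * ι (d ∣? n))
       ≡⟨ ∑-ext B (λ d → (solve (μ d ∷ ι (d ∣? n) ∷ ι (q ∣? d) ∷ []) (v0 :* v1) (v2 :* (v0 :* v1) :+ (c1 :- v2) :* (v0 :* v1)))) ⟩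
     ∑ B (λ d → ι (q ∣? d) * G d + (1ℚ - ι (q ∣? d)) * G d)
       ≡⟨ ∑-+ B _ _ ⟩
     ∑ B (λ d → ι (q ∣? d) * G d) + ∑ B (λ d → (1ℚ - ι (q ∣? d)) * G d)
       ≡⟨ cong₂ _+_ (sym (∑-multiples B q G (prime-≥1 pq) G-supp)) refl ⟩
     ∑ B (λ d → G (q · d)) + ∑ B (λ d → (1ℚ - ι (q ∣? d)) * G d)
       ≡⟨ sym (∑-+ B _ _) ⟩
     ∑ B (λ d → G (q · d) + (1ℚ - ι (q ∣? d)) * G d)
       ≡⟨ ∑-0 B (λ d 1≤d _ → trans (cong (λ z → z * ι (q · d ∣? n) + (1ℚ - ι (q ∣? d)) * G d) (μ-q q d pq q≤B 1≤d)) (cancel d (q ∣? d))) ⟩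
     0ℚ ∎
     where
     open ≡-Reasoning
     G : ℕ → ℚ
     G d = μ d * ι (d ∣? n)
     q≤B = ≼-trans (ℕ.∣⇒≤ q∣n) n≤B
     G-supp : ∀ d → B ℕ.< d → G d ≡ 0ℚ
     G-supp d B<d = trans (cong (μ d *_) (ι-no (d ∣? n) λ d∣n → ℕ.<⇒≱ B<d (≼-trans (ℕ.∣⇒≤ d∣n) n≤B))) (zeroʳ (μ d))
     cancel : ∀ d (e : Dec (q ∣ d)) → - (ι e * - μ d + μ d) * ι (q · d ∣? n) + (1ℚ - ι e) * G d ≡ 0ℚ
     cancel d (yes _) = (solve (μ d ∷ ι (q · d ∣? n) ∷ ι (d ∣? n) ∷ []) ((:- (c1 :* (:- v0) :+ v0)) :* v1 :+ (c1 :- c1) :* (v0 :* v2)) c0)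
     cancel d (no q∤d) = trans (cong (λ z → - (0ℚ * - μ d + μ d) * z + (1ℚ - 0ℚ) * G d)
       (ι-⇔ (q · d ∣? n) (d ∣? n) (ℕ.m*n∣⇒n∣ q d) (λ d∣n → coprime-∣* (prime∤⇒coprime pq q∤d) q∣n d∣n)))
       (solve (μ d ∷ ι (d ∣? n) ∷ []) ((:- (c0 :* (:- v0) :+ v0)) :* v1 :+ (c1 :- c0) :* (v0 :* v1)) c0)

   ∑-μ : 1 ≼ B → ∀ (H : ℕ → ℚ) → (∀ n → B ℕ.< n → H n ≡ 0ℚ) → ∑ B (λ d → μ d * ∑ B (λ k → H (d · k))) ≡ H 1
   ∑-μ 1≤B H H-supp = begin
     ∑ B (λ d → μ d * ∑ B (λ k → H (d · k))) ≡⟨ ∑-cong B (λ d 1≤d _ → trans (cong (μ d *_) (∑-multiples B d H 1≤d H-supp)) (∑-*ˡ B (μ d) _)) ⟩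
     ∑ B (λ d → ∑ B (λ n → μ d * (ι (d ∣? n) * H n))) ≡⟨ ∑-swap B B _ ⟩
     ∑ B (λ n → ∑ B (λ d → μ d * (ι (d ∣? n) * H n))) ≡⟨ ∑-cong B (λ n p q → trans (∑-ext B λ d → sym (*-assoc (μ d) _ (H n))) (trans (sym (∑-*ʳ B (H n) _)) (cong (_* H n) (μ-∣ n p q)))) ⟩
     ∑ B (λ n → ι (n ℕ.≟ 1) * H n) ≡⟨ ∑-δ B 1 H ≼-refl 1≤B ⟩
     H 1 ∎
     where open ≡-Reasoning

 -- Selberg's identity.

 module Selberg (B : ℕ) (1≤B : 1 ≼ B) (ℓ : ℕ → ℚ) where

   open Log B ℓ
   open Möbius B

   private
     supp-* : ∀ (H : ℕ → ℚ) d → 1 ≼ d → (∀ n → B ℕ.< n → H n ≡ 0ℚ) → ∀ n → B ℕ.< n → H (d · n) ≡ 0ℚ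
     supp-* H d 1≤d H-supp n B<n = H-supp (d · n) (ℕ.<-≤-trans B<n (ℕ.m≤n*m n d {{ℕ.>-nonZero 1≤d}}))

     swap-* : ∀ a b c → a · (b · c) ≡ b · (a · c)
     swap-* a b c = trans (sym (ℕ.*-assoc a b c)) (trans (cong (ℕ._* c) (ℕ.*-comm a b)) (ℕ.*-assoc b a c))

     pull : ∀ (u v : ℕ → ℚ) (w : ℕ → ℕ → ℚ) →
            ∑ B (λ d → u d * ∑ B (λ b → v b * w d b)) ≡ ∑ B (λ b → v b * ∑ B (λ d → u d * w d b))
     pull u v w = begin
       ∑ B (λ d → u d * ∑ B (λ b → v b * w d b)) ≡⟨ ∑-ext B (λ d → ∑-*ˡ B (u d) _) ⟩
       ∑ B (λ d → ∑ B (λ b → u d * (v b * w d b))) ≡⟨ ∑-swap B B _ ⟩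
       ∑ B (λ b → ∑ B (λ d → u d * (v b * w d b))) ≡⟨ ∑-ext B (λ b → trans (∑-ext B λ d → (solve (u d ∷ v b ∷ w d b ∷ []) (v0 :* (v1 :* v2)) (v1 :* (v0 :* v2)))) (sym (∑-*ˡ B (v b) _))) ⟩
       ∑ B (λ b → v b * ∑ B (λ d → u d * w d b)) ∎
       where open ≡-Reasoning

   μ*lg : ∀ (H : ℕ → ℚ) → (∀ n → B ℕ.< n → H n ≡ 0ℚ) →
          ∑ B (λ d → μ d * ∑ B (λ k → lg k * H (d · k))) ≡ ∑ B (λ b → Λ b * H b)
   μ*lg H H-supp = begin
     ∑ B (λ d → μ d * ∑ B (λ k → lg k * H (d · k)))
       ≡⟨ ∑-cong B (λ d 1≤d _ → cong (μ d *_) (trans (∑-lg (λ k → H (d · k)) (supp-* H d 1≤d H-supp))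
            (∑-ext B λ b → cong (Λ b *_) (∑-ext B λ m → cong H (swap-* d b m))))) ⟩
     ∑ B (λ d → μ d * ∑ B (λ b → Λ b * ∑ B (λ m → H (b · (d · m)))))
       ≡⟨ pull μ Λ (λ d b → ∑ B (λ m → H (b · (d · m)))) ⟩
     ∑ B (λ b → Λ b * ∑ B (λ d → μ d * ∑ B (λ m → H (b · (d · m)))))
       ≡⟨ ∑-cong B (λ b 1≤b _ → cong (Λ b *_) (trans (∑-μ 1≤B (λ n → H (b · n)) (supp-* H b 1≤b H-supp)) (cong H (ℕ.*-identityʳ b)))) ⟩
     ∑ B (λ b → Λ b * H b) ∎
     where open ≡-Reasoning

   -- This is μ * log² = Λ log + Λ * Λ. One factor log is expanded as Λ * 1, the other splits by
   -- additivity into log e + log k; then μ * 1 collapses to the unit and μ * log to Λ.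
   selberg-identity : ∀ (H : ℕ → ℚ) → (∀ n → B ℕ.< n → H n ≡ 0ℚ) →
     ∑ B (λ d → μ d * ∑ B (λ m → (lg m * lg m) * H (d · m))) ≡
     ∑ B (λ e → Λ e * (lg e * H e)) + ∑ B (λ e → Λ e * ∑ B (λ b → Λ b * H (e · b)))
   selberg-identity H H-supp = begin
     ∑ B (λ d → μ d * ∑ B (λ m → (lg m * lg m) * H (d · m)))
       ≡⟨ ∑-cong B (λ d 1≤d _ → cong (μ d *_) (trans (∑-ext B λ m → *-assoc (lg m) (lg m) _)
            (trans (∑-lg (λ m → lg m * H (d · m)) (λ n B<n → trans (cong (lg n *_) (supp-* H d 1≤d H-supp n B<n)) (zeroʳ (lg n))))
              (∑-cong B λ e 1≤e _ → cong (Λ e *_) (inner d e 1≤d 1≤e))))) ⟩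
     ∑ B (λ d → μ d * ∑ B (λ e → Λ e * (lg e * S d e + T d e)))
       ≡⟨ pull μ Λ (λ d e → lg e * S d e + T d e) ⟩
     ∑ B (λ e → Λ e * ∑ B (λ d → μ d * (lg e * S d e + T d e)))
       ≡⟨ ∑-cong B (λ e 1≤e _ → trans (cong (Λ e *_) (outer e 1≤e)) (distribˡ (Λ e) _ _)) ⟩
     ∑ B (λ e → Λ e * (lg e * H e) + Λ e * ∑ B (λ b → Λ b * H (e · b)))
       ≡⟨ ∑-+ B _ _ ⟩
     ∑ B (λ e → Λ e * (lg e * H e)) + ∑ B (λ e → Λ e * ∑ B (λ b → Λ b * H (e · b))) ∎
     where
     open ≡-Reasoning
     S T : ℕ → ℕ → ℚ
     S d e = ∑ B (λ k → H (e · (d · k)))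
     T d e = ∑ B (λ k → lg k * H (e · (d · k)))
     inner : ∀ d e → 1 ≼ d → 1 ≼ e → ∑ B (λ k → lg (e · k) * H (d · (e · k))) ≡ lg e * S d e + T d e
     inner d e 1≤d 1≤e = trans (∑-cong B λ k 1≤k _ → lem k 1≤k) (trans (∑-+ B _ _) (cong (_+ T d e) (sym (∑-*ˡ B (lg e) _))))
       where
       lem : ∀ k → 1 ≼ k → lg (e · k) * H (d · (e · k)) ≡ lg e * H (e · (d · k)) + lg k * H (e · (d · k))
       -- Additivity of `lg` is available only up to `B`; beyond it both sides vanish together with
       -- `H`.
       lem k 1≤k with e · k ≼? B
       ... | yes ek≤B = trans (cong₂ _*_ (lg-* e k 1≤e 1≤k ek≤B) (cong H (swap-* d e k))) (distribʳ _ _ _)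
       ... | no ek≰B = trans (trans (cong (lg (e · k) *_) z) (zeroʳ _))
               (sym (trans (cong₂ _+_ (trans (cong (lg e *_) z′) (zeroʳ _)) (trans (cong (lg k *_) z′) (zeroʳ _))) (+-identityˡ 0ℚ)))
         where
         z = supp-* H d 1≤d H-supp (e · k) (ℕ.≰⇒> ek≰B)
         z′ = trans (cong H (swap-* e d k)) z
     outer : ∀ e → 1 ≼ e → ∑ B (λ d → μ d * (lg e * S d e + T d e)) ≡ lg e * H e + ∑ B (λ b → Λ b * H (e · b))
     outer e 1≤e = begin
       ∑ B (λ d → μ d * (lg e * S d e + T d e))
         ≡⟨ ∑-ext B (λ d → (solve (μ d ∷ lg e ∷ S d e ∷ T d e ∷ []) (v0 :* (v1 :* v2 :+ v3)) (v1 :* (v0 :* v2) :+ v0 :* v3))) ⟩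
       ∑ B (λ d → lg e * (μ d * S d e) + μ d * T d e)
         ≡⟨ trans (∑-+ B _ _) (cong₂ _+_ (sym (∑-*ˡ B (lg e) _)) refl) ⟩
       lg e * ∑ B (λ d → μ d * S d e) + ∑ B (λ d → μ d * T d e)
         ≡⟨ cong₂ _+_ (cong (lg e *_) (trans (∑-μ 1≤B He He-supp) (cong H (ℕ.*-identityʳ e)))) (μ*lg He He-supp) ⟩
       lg e * H e + ∑ B (λ b → Λ b * H (e · b)) ∎
       where
       He : ℕ → ℚ
       He n = H (e · n)
       He-supp = supp-* H e 1≤e H-supp

 -- A rational approximation of log₂.

 ⌊log₂⌋ : ∀ x → 1 ≼ x → ∃ λ L → 2 ^ L ≼ x × x ℕ.< 2 ^ suc L
 ⌊log₂⌋ x 1≤x with least {λ k → x ℕ.< 2 ^ k} (λ k → x ℕ.<? 2 ^ k) x (n<2^n x)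
 ... | zero , x<1 , _ , _ = ⊥-elim (ℕ.<⇒≱ x<1 1≤x)
 ... | suc L , x<2^ , _ , min = L , ℕ.≮⇒≥ (min L ≼-refl) , x<2^

 2^-cancel-≤ : ∀ a b → 2 ^ a ≼ 2 ^ b → a ≼ b
 2^-cancel-≤ a b h with a ≼? b
 ... | yes p = p
 ... | no ¬p = ⊥-elim (ℕ.<⇒≱ (ℕ.^-monoʳ-< 2 (s≤s (s≤s z≤n)) (ℕ.≰⇒> ¬p)) h)

 bernoulli : ∀ n K → n ^ K · (n ∔ K) ≼ suc n ^ K · n
 bernoulli n zero = ≼-reflexive (lem n)
   where
   lem : ∀ n → 1 · (n ∔ 0) ≡ 1 · n
   lem = solve-∀
 bernoulli n (suc K) = begin
   n · n ^ K · (n ∔ suc K) ≤⟨ ℕ.m≤m+n _ (n ^ K · K) ⟩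
   n · n ^ K · (n ∔ suc K) ∔ n ^ K · K ≡⟨ lem n (n ^ K) K ⟩
   suc n · (n ^ K · (n ∔ K)) ≤⟨ ℕ.*-monoʳ-≤ (suc n) (bernoulli n K) ⟩
   suc n · (suc n ^ K · n) ≡⟨ sym (ℕ.*-assoc (suc n) (suc n ^ K) n) ⟩
   suc n ^ suc K · n ∎
   where
   open ℕ.≤-Reasoning
   lem : ∀ n x K → n · x · (n ∔ suc K) ∔ x · K ≡ suc n · (x · (n ∔ K))
   lem = solve-∀

 -- A reverse Bernoulli inequality, (1 + 1/n)^j ≤ 1 + 2j/n: in the range 2j ≤ n the slack in the
 -- factor 2 absorbs the second-order terms.
 bernoulli-upper : ∀ n j → 2 · j ≼ n → suc n ^ j · n ≼ n ^ j · (n ∔ 2 · j)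
 bernoulli-upper n zero _ = ≼-reflexive (lem n)
   where
   lem : ∀ n → 1 · n ≡ 1 · (n ∔ 2 · 0)
   lem = solve-∀
 bernoulli-upper n (suc j) 2j+2≤n = begin
   suc n ^ suc j · n ≡⟨ ℕ.*-assoc (suc n) (suc n ^ j) n ⟩
   suc n · (suc n ^ j · n) ≤⟨ ℕ.*-monoʳ-≤ (suc n) (bernoulli-upper n j 2j≤n) ⟩
   suc n · (n ^ j · (n ∔ 2 · j)) ≡⟨ lem₁ n (n ^ j) j ⟩
   n ^ j · (n · (n ∔ 2 · j ∔ 1) ∔ 2 · j) ≤⟨ ℕ.*-monoʳ-≤ (n ^ j) (ℕ.+-monoʳ-≤ (n · (n ∔ 2 · j ∔ 1)) 2j≤n) ⟩
   n ^ j · (n · (n ∔ 2 · j ∔ 1) ∔ n) ≡⟨ lem₂ n (n ^ j) j ⟩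
   n · n ^ j · (n ∔ 2 · suc j) ∎
   where
   open ℕ.≤-Reasoning
   2j≤n : 2 · j ≼ n
   2j≤n = ≼-trans (ℕ.*-monoʳ-≤ 2 (ℕ.n≤1+n j)) 2j+2≤n
   lem₁ : ∀ n x j → suc n · (x · (n ∔ 2 · j)) ≡ x · (n · (n ∔ 2 · j ∔ 1) ∔ 2 · j)
   lem₁ = solve-∀
   lem₂ : ∀ n x j → x · (n · (n ∔ 2 · j ∔ 1) ∔ n) ≡ n · x · (n ∔ 2 · suc j)
   lem₂ = solve-∀

 -- The reverse Bernoulli inequality gives at most 2 for the exponent ⌊n/2⌋. Squaring gives 4, and
 -- an odd n costs one more factor 1 + 1/n ≤ 2.
 [1+1/n]^n≤8 : ∀ n → 1 ≼ n → suc n ^ n ≼ 8 · n ^ n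
 [1+1/n]^n≤8 n 1≤n with half n
 ... | j , e = go e
   where
   open ℕ.≤-Reasoning
   sq : ∀ m → 2 · j ≼ m → suc m ^ j · m ≼ 2 · m ^ j · m
   sq m h = ≼-trans (bernoulli-upper m j h) (≼-trans (ℕ.*-monoʳ-≤ (m ^ j) (ℕ.+-monoʳ-≤ m h)) (≼-reflexive (lem m (m ^ j))))
     where
     lem : ∀ m x → x · (m ∔ m) ≡ 2 · x · m
     lem = solve-∀
   sq′ : 2 · j ≼ n → suc n ^ j ≼ 2 · n ^ j
   sq′ h = ℕ.*-cancelʳ-≤ (suc n ^ j) (2 · n ^ j) n {{ℕ.>-nonZero 1≤n}} (sq n h)
   pow2 : ∀ m → m ^ (2 · j) ≡ m ^ j · m ^ j
   pow2 m = trans (cong (m ^_) (cong (j ℕ.+_) (ℕ.+-identityʳ j))) (ℕ.^-distribˡ-+-* m j j)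
   main : 2 · j ≼ n → suc n ^ (2 · j) ≼ 4 · n ^ (2 · j)
   main h = begin
     suc n ^ (2 · j) ≡⟨ pow2 (suc n) ⟩
     suc n ^ j · suc n ^ j ≤⟨ ℕ.*-mono-≤ (sq′ h) (sq′ h) ⟩
     2 · n ^ j · (2 · n ^ j) ≡⟨ lem (n ^ j) ⟩
     4 · (n ^ j · n ^ j) ≡⟨ cong (4 ·_) (sym (pow2 n)) ⟩
     4 · n ^ (2 · j) ∎
     where
     lem : ∀ x → 2 · x · (2 · x) ≡ 4 · (x · x)
     lem = solve-∀
   go : n ≡ 2 · j ⊎ n ≡ suc (2 · j) → suc n ^ n ≼ 8 · n ^ n
   go (inj₁ e) = begin
     suc n ^ n ≡⟨ cong (suc n ^_) e ⟩
     suc n ^ (2 · j) ≤⟨ main (≼-reflexive (sym e)) ⟩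
     4 · n ^ (2 · j) ≤⟨ ℕ.*-monoˡ-≤ (n ^ (2 · j)) {4} {8} (ℕ.m≤m+n 4 4) ⟩
     8 · n ^ (2 · j) ≡⟨ cong (λ z → 8 · n ^ z) (sym e) ⟩
     8 · n ^ n ∎
   go (inj₂ e) = begin
     suc n ^ n ≡⟨ cong (suc n ^_) e ⟩
     suc n · suc n ^ (2 · j) ≤⟨ ℕ.*-mono-≤ (ℕ.+-monoˡ-≤ n 1≤n) (main (≼-trans (ℕ.n≤1+n _) (≼-reflexive (sym e)))) ⟩
     (n ∔ n) · (4 · n ^ (2 · j)) ≡⟨ lem n (n ^ (2 · j)) ⟩
     8 · (n · n ^ (2 · j)) ≡⟨ cong (λ z → 8 · n ^ z) (sym e) ⟩
     8 · n ^ n ∎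
     where
     lem : ∀ n x → (n ∔ n) · (4 · x) ≡ 8 · (n · x)
     lem = solve-∀

 module Build (B : ℕ) (2≤B : 2 ≼ B) where

   -- The resolution 1 / K has to be finer than the distance of about 1 / B between logarithms of
   -- neighbours, even after the rounding errors of all prime factors have accumulated; B² achieves
   -- this.
   K : ℕ
   K = B · B

   1≤B : 1 ≼ B
   1≤B = ≼-trans (s≤s z≤n) 2≤B

   1≤K : 1 ≼ K
   1≤K = ℕ.*-mono-≤ 1≤B 1≤B

   private
     1≤n^K : ∀ n → 1 ≼ n → 1 ≼ n ^ K
     1≤n^K n 1≤n = ℕ.m^n>0 n {{ℕ.>-nonZero 1≤n}} K

   L : ℕ → ℕ
   L zero = 0
   L (suc n) = proj₁ (⌊log₂⌋ (suc n ^ K) (1≤n^K (suc n) (s≤s z≤n)))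

   -- The prime q gets the weight ⌊K log₂ q⌋ / K.
   ℓ : ℕ → ℚ
   ℓ n = # (L n) * inv (# K)

   L-spec : ∀ n → 1 ≼ n → 2 ^ L n ≼ n ^ K × n ^ K ℕ.< 2 ^ suc (L n)
   L-spec (suc n) _ = proj₂ (⌊log₂⌋ (suc n ^ K) (1≤n^K (suc n) (s≤s z≤n)))

   private
     K≰0 : ¬ # K ≤ 0ℚ
     K≰0 h = 1≰0 (≤-trans (#-mono 1≤K) h)

     ℓK : ∀ n → ℓ n * # K ≡ # (L n)
     ℓK n = (≡-by (cong ((# (L n)) *_) (inv-r (# K) K≰0)) (solve (# (L n) ∷ # K ∷ inv (# K) ∷ []) (v0 :+ v0 :* (v1 :* v2)) (v0 :* v2 :* v1 :+ v0 :* c1)))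

   0≤ℓ : ∀ n → 0ℚ ≤ ℓ n
   0≤ℓ n = 0≤* (0≤# (L n)) (0≤inv (# K) K≰0 (0≤# K))

   open Log B ℓ

   -- Here `w` counts prime factors with multiplicity: each of them loses less than 1 in the
   -- exponent by rounding, and 2^w ≤ n because every prime is at least 2.
   record Approx (n : ℕ) : Set where
     field
       l w : ℕ
       lg≡ : lg n * # K ≡ # l
       lower : 2 ^ l ≼ n ^ K
       upper : n ^ K ≼ 2 ^ (l ∔ w)
       small : 2 ^ w ≼ n

   approx : ∀ n → 1 ≼ n → n ≼ B → Approx n
   approx = prime-rec (λ n → n ≼ B → Approx n) base step
     where
     base : 1 ≼ B → Approx 1
     base _ = record { l = 0 ; w = 0 ; lg≡ = trans (cong (_* # K) lg-1) (zeroˡ _)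
                     ; lower = 1≤n^K 1 ≼-refl ; upper = ≼-reflexive (ℕ.^-zeroˡ K) ; small = ≼-refl }
     step : ∀ q m → Prime q → 1 ≼ m → (m ≼ B → Approx m) → q · m ≼ B → Approx (q · m)
     step q m pq 1≤m IH qm≤B = record
       { l = L q ∔ l ; w = suc w
       ; lg≡ = trans (cong (_* # K) (lg-prime-* q m pq q≤B 1≤m m≤B))
                 (trans (distribʳ (# K) (ℓ q) (lg m)) (trans (cong₂ _+_ (ℓK q) lg≡) (sym (#-+ (L q) l))))
       ; lower = subst₂ ℕ._≤_ (sym (ℕ.^-distribˡ-+-* 2 (L q) l)) (sym (^-distrib q m K)) (ℕ.*-mono-≤ (proj₁ sp) lower)
       ; upper = subst₂ ℕ._≤_ (sym (^-distrib q m K))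
                   (trans (sym (ℕ.^-distribˡ-+-* 2 (suc (L q)) (l ∔ w))) (cong (2 ^_) (lem (L q) l w)))
                   (ℕ.*-mono-≤ (ℕ.<⇒≤ (proj₂ sp)) upper)
       ; small = ℕ.*-mono-≤ (prime≥2 pq) small }
       where
       q≤B = ≼-trans (ℕ.m≤m*n q m {{ℕ.>-nonZero 1≤m}}) qm≤B
       m≤B = ≼-trans (ℕ.m≤n*m m q {{ℕ.>-nonZero (prime-≥1 pq)}}) qm≤B
       open Approx (IH m≤B)
       sp = L-spec q (prime-≥1 pq)
       lem : ∀ a l w → suc a ∔ (l ∔ w) ≡ a ∔ l ∔ suc w
       lem = solve-∀

   private
     from-K : ∀ {a b} → a * # K ≤ b * # K → a ≤ b
     from-K {a} {b} h = cancel-≤ K≰0 (0≤# K) (subst₂ _≤_ (*-comm a _) (*-comm b _) h)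

   -- If the rounded exponent dropped from n to n + 1, the error bounds would give (n + 1)^K ≤ n^K
   -- (n + 1) / 2. Bernoulli's inequality excludes this, because n (n + 1) ≤ K.
   lg-mono : ∀ n → 1 ≼ n → suc n ≼ B → lg n ≤ lg (suc n)
   lg-mono n 1≤n n<B = from-K (subst₂ _≤_ (sym A.lg≡) (sym A′.lg≡) (#-mono l≤l′))
     where
     module A = Approx (approx n 1≤n (ℕ.<⇒≤ n<B))
     module A′ = Approx (approx (suc n) (s≤s z≤n) n<B)
     open ℕ.≤-Reasoning
     instance
       n^K≢0 : ℕ.NonZero (n ^ K)
       n^K≢0 = ℕ.>-nonZero (1≤n^K n 1≤n)
     l≤l′ : A.l ≼ A′.l
     l≤l′ with A.l ≼? A′.l
     ... | yes p = p
     ... | no ¬p = ⊥-elim (ℕ.<⇒≱ bad (ℕ.*-cancelˡ-≤ (n ^ K) chain))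
       where
       chain : n ^ K · (2 · (n ∔ K)) ≼ n ^ K · (n · suc n)
       chain = begin
         n ^ K · (2 · (n ∔ K)) ≡⟨ lem₁ (n ^ K) n K ⟩
         2 · (n ^ K · (n ∔ K)) ≤⟨ ℕ.*-monoʳ-≤ 2 (bernoulli n K) ⟩
         2 · (suc n ^ K · n) ≤⟨ ℕ.*-monoʳ-≤ 2 (ℕ.*-monoˡ-≤ n A′.upper) ⟩
         2 · (2 ^ (A′.l ∔ A′.w) · n) ≡⟨ cong (λ z → 2 · (z · n)) (ℕ.^-distribˡ-+-* 2 A′.l A′.w) ⟩
         2 · (2 ^ A′.l · 2 ^ A′.w · n) ≡⟨ lem₂ (2 ^ A′.l) (2 ^ A′.w) n ⟩
         2 ^ suc A′.l · (n · 2 ^ A′.w) ≤⟨ ℕ.*-mono-≤ (ℕ.^-monoʳ-≤ 2 (ℕ.≰⇒> ¬p)) (ℕ.*-monoʳ-≤ n A′.small) ⟩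
         2 ^ A.l · (n · suc n) ≤⟨ ℕ.*-monoˡ-≤ (n · suc n) A.lower ⟩
         n ^ K · (n · suc n) ∎
         where
         lem₁ : ∀ x n K → x · (2 · (n ∔ K)) ≡ 2 · (x · (n ∔ K))
         lem₁ = solve-∀
         lem₂ : ∀ x y n → 2 · (x · y · n) ≡ 2 · x · (n · y)
         lem₂ = solve-∀
       bad : n · suc n ℕ.< 2 · (n ∔ K)
       bad = begin-strict
         n · suc n ≤⟨ ℕ.*-mono-≤ (ℕ.<⇒≤ n<B) n<B ⟩
         K <⟨ ℕ.+-monoˡ-≤ K 1≤n ⟩
         n ∔ K ≤⟨ ℕ.m≤m+n (n ∔ K) _ ⟩
         2 · (n ∔ K) ∎

   -- Of the constant 4, three units come from (1 + 1/n)^n ≤ 2³, and one pays for the rounding error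
   -- n · n ≤ K.
   lg-incr : ∀ n → 1 ≼ n → suc n ≼ B → # n * (lg (suc n) - lg n) ≤ # 4
   lg-incr n 1≤n n<B = from-K (≤-by (bound ⊕ ((0≤# n) ⊗ (≡⇒≤ A′.lg≡)) ⊕ ((0≤# n) ⊗ (≡⇒≤ (sym A.lg≡)))) (solve (# K ∷ # n ∷ # A′.l ∷ lg (suc n) ∷ # A.l ∷ lg n ∷ []) (c4 :* v0 :+ (v1 :* v2 :+ v1 :* (v3 :* v0) :+ v1 :* v4)) (v1 :* (v3 :- v5) :* v0 :+ (c4 :* v0 :+ v1 :* v4 :+ v1 :* v2 :+ v1 :* (v5 :* v0)))))
     where
     module A = Approx (approx n 1≤n (ℕ.<⇒≤ n<B))
     module A′ = Approx (approx (suc n) (s≤s z≤n) n<B)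
     open ℕ.≤-Reasoning
     swap : ∀ a b c → (a ^ b) ^ c ≡ (a ^ c) ^ b
     swap a b c = trans (ℕ.^-*-assoc a b c) (trans (cong (a ^_) (ℕ.*-comm b c)) (sym (ℕ.^-*-assoc a c b)))
     chain : 2 ^ (n · A′.l) ≼ 2 ^ (3 · K ∔ (n · A.l ∔ n · n))
     chain = begin
       2 ^ (n · A′.l) ≡⟨ trans (cong (2 ^_) (ℕ.*-comm n A′.l)) (sym (ℕ.^-*-assoc 2 A′.l n)) ⟩
       (2 ^ A′.l) ^ n ≤⟨ ℕ.^-monoˡ-≤ n A′.lower ⟩
       (suc n ^ K) ^ n ≡⟨ swap (suc n) K n ⟩
       (suc n ^ n) ^ K ≤⟨ ℕ.^-monoˡ-≤ K ([1+1/n]^n≤8 n 1≤n) ⟩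
       (8 · n ^ n) ^ K ≡⟨ ^-distrib 8 (n ^ n) K ⟩
       8 ^ K · (n ^ n) ^ K ≡⟨ cong₂ _·_ (ℕ.^-*-assoc 2 3 K) (swap n n K) ⟩
       2 ^ (3 · K) · (n ^ K) ^ n ≤⟨ ℕ.*-monoʳ-≤ (2 ^ (3 · K)) (ℕ.^-monoˡ-≤ n n^K≤) ⟩
       2 ^ (3 · K) · (2 ^ (A.l ∔ n)) ^ n ≡⟨ cong (2 ^ (3 · K) ·_) (ℕ.^-*-assoc 2 (A.l ∔ n) n) ⟩
       2 ^ (3 · K) · 2 ^ ((A.l ∔ n) · n) ≡⟨ sym (ℕ.^-distribˡ-+-* 2 (3 · K) _) ⟩
       2 ^ (3 · K ∔ (A.l ∔ n) · n) ≡⟨ cong (λ z → 2 ^ (3 · K ∔ z)) (lem A.l n) ⟩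
       2 ^ (3 · K ∔ (n · A.l ∔ n · n)) ∎
       where
       lem : ∀ l n → (l ∔ n) · n ≡ n · l ∔ n · n
       lem = solve-∀
       n^K≤ : n ^ K ≼ 2 ^ (A.l ∔ n)
       n^K≤ = ≼-trans A.upper (ℕ.^-monoʳ-≤ 2 (ℕ.+-monoʳ-≤ A.l (≼-trans (ℕ.<⇒≤ (n<2^n A.w)) A.small)))
     bound′ : n · A′.l ≼ 4 · K ∔ n · A.l
     bound′ = begin
       n · A′.l ≤⟨ 2^-cancel-≤ _ _ chain ⟩
       3 · K ∔ (n · A.l ∔ n · n) ≤⟨ ℕ.+-monoʳ-≤ (3 · K) (ℕ.+-monoʳ-≤ (n · A.l) (ℕ.*-mono-≤ (ℕ.<⇒≤ n<B) (ℕ.<⇒≤ n<B))) ⟩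
       3 · K ∔ (n · A.l ∔ K) ≡⟨ lem K (n · A.l) ⟩
       4 · K ∔ n · A.l ∎
       where
       lem : ∀ K x → 3 · K ∔ (x ∔ K) ≡ 4 · K ∔ x
       lem = solve-∀
     bound : # n * # A′.l ≤ # 4 * # K + # n * # A.l
     bound = subst₂ _≤_ (#-* n A′.l) (trans (#-+ (4 · K) (n · A.l)) (cong₂ _+_ (#-* 4 K) (#-* n A.l))) (#-mono bound′)

   lg-2 : lg 2 ≡ 1ℚ
   lg-2 = trans (lg-prime 2 prime[2] 2≤B) (trans (cong (λ z → # z * inv (# K)) L2≡K) (inv-r (# K) K≰0))
     where
     sp = L-spec 2 (s≤s z≤n)
     L2≡K : L 2 ≡ K
     L2≡K = ℕ.≤-antisym (2^-cancel-≤ (L 2) K (proj₁ sp)) (ℕ.≤-pred (ℕ.≰⇒> λ h → ℕ.<⇒≱ (proj₂ sp) (ℕ.^-monoʳ-≤ 2 h)))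

 -- Reciprocals, integer quotients and partial summation.

 r : ℕ → ℚ
 r n = inv (# n)

 #≰0 : ∀ {n} → 1 ≼ n → ¬ # n ≤ 0ℚ
 #≰0 1≤n h = 1≰0 (≤-trans (#-mono 1≤n) h)

 r-inv : ∀ n → 1 ≼ n → # n * r n ≡ 1ℚ
 r-inv n 1≤n = inv-r (# n) (#≰0 1≤n)

 0≤r : ∀ n → 1 ≼ n → 0ℚ ≤ r n
 0≤r n 1≤n = 0≤inv (# n) (#≰0 1≤n) (0≤# n)

 r-1 : r 1 ≡ 1ℚ
 r-1 = trans (sym (*-identityˡ (r 1))) (r-inv 1 ≼-refl)

 r-* : ∀ m n → 1 ≼ m → 1 ≼ n → r (m · n) ≡ r m * r n
 r-* m n 1≤m 1≤n = (≡-by ((cong ((r m * r n) *_) e) ⊕≡ (cong ((- (r n * # n * r (m · n))) *_) (r-inv m 1≤m)) ⊕≡ (cong ((- r (m · n)) *_) (r-inv n 1≤n))) (solve (r m ∷ r n ∷ # m ∷ # n ∷ r (m · n) ∷ []) (v0 :* v1 :+ (v0 :* v1 :* (v2 :* v3 :* v4) :+ (:- (v1 :* v3 :* v4)) :* (v2 :* v0) :+ (:- v4) :* (v3 :* v1))) (v4 :+ (v0 :* v1 :* c1 :+ (:- (v1 :* v3 :* v4)) :* c1 :+ (:- v4) :* c1))))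
   where
   e : (# m * # n) * r (m · n) ≡ 1ℚ
   e = trans (cong (_* r (m · n)) (sym (#-* m n))) (r-inv (m · n) (ℕ.*-mono-≤ 1≤m 1≤n))

 r-diff : ∀ m → 1 ≼ m → r m - r (suc m) ≡ r m * r (suc m)
 r-diff m 1≤m = (≡-by ((cong ((r (suc m)) *_) (r-inv m 1≤m)) ⊕≡ (cong ((- r m) *_) e)) (solve (r m ∷ r (suc m) ∷ # m ∷ []) (v0 :* v1 :+ (v1 :* (v2 :* v0) :+ (:- v0) :* ((c1 :+ v2) :* v1))) (v0 :- v1 :+ (v1 :* c1 :+ (:- v0) :* c1))))
   where
   e : (1ℚ + # m) * r (suc m) ≡ 1ℚ
   e = trans (cong (_* r (suc m)) (sym (#-suc m))) (r-inv (suc m) (s≤s z≤n))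

 r-anti : ∀ {m n} → 1 ≼ m → m ≼ n → r n ≤ r m
 r-anti {m} {n} 1≤m m≤n = (≤-by (((0≤* (0≤r m 1≤m) (0≤r n 1≤n)) ⊗ (#-mono m≤n)) ⊕ ((0≤r n 1≤n) ⊗ (≡⇒≤ (sym (r-inv m 1≤m)))) ⊕ ((0≤r m 1≤m) ⊗ (≡⇒≤ (r-inv n 1≤n)))) (solve (r m ∷ r n ∷ # m ∷ # n ∷ []) (v0 :+ (v0 :* v1 :* v2 :+ v1 :* c1 :+ v0 :* (v3 :* v1))) (v1 :+ (v0 :* v1 :* v3 :+ v1 :* (v2 :* v0) :+ v0 :* c1))))
   where
   1≤n = ≼-trans 1≤m m≤n

 infixl 7 _÷_

 -- Floor of x / d, with the junk value x ÷ 0 = 0.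
 _÷_ : ℕ → ℕ → ℕ
 x ÷ zero = 0
 x ÷ suc d = x ℕ./ suc d

 ÷-≤ : ∀ d x m → 1 ≼ d → m ≼ x ÷ d → d · m ≼ x
 ÷-≤ d@(suc _) x m _ h = begin
   d · m ≡⟨ ℕ.*-comm d m ⟩
   m · d ≤⟨ ℕ.*-monoˡ-≤ d h ⟩
   (x ℕ./ d) · d ≤⟨ ℕ.m/n*n≤m x d ⟩
   x ∎
   where open ℕ.≤-Reasoning

 ≤-÷ : ∀ d x m → 1 ≼ d → d · m ≼ x → m ≼ x ÷ d
 ≤-÷ d@(suc _) x m _ h = begin
   m ≡⟨ sym (ℕ.m*n/n≡m m d) ⟩
   m · d ℕ./ d ≤⟨ ℕ./-monoˡ-≤ d (≼-trans (≼-reflexive (ℕ.*-comm m d)) h) ⟩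
   x ℕ./ d ∎
   where open ℕ.≤-Reasoning

 <-÷ : ∀ d x → 1 ≼ d → x ℕ.< d · suc (x ÷ d)
 <-÷ d x 1≤d = ℕ.≰⇒> λ h → ℕ.1+n≰n (≤-÷ d x (suc (x ÷ d)) 1≤d h)

 ÷-≤-self : ∀ d x → 1 ≼ d → x ÷ d ≼ x
 ÷-≤-self d x 1≤d = ≼-trans (ℕ.m≤n*m (x ÷ d) d {{ℕ.>-nonZero 1≤d}}) (÷-≤ d x (x ÷ d) 1≤d ≼-refl)

 ÷-≥1 : ∀ d x → 1 ≼ d → d ≼ x → 1 ≼ x ÷ d
 ÷-≥1 d x 1≤d d≤x = ≤-÷ d x 1 1≤d (≼-trans (≼-reflexive (ℕ.*-identityʳ d)) d≤x)

 ∑-cut : ∀ {B k} f → k ≼ B → ∑ B (λ m → ι (m ≼? k) * f m) ≡ ∑ k f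
 ∑-cut {B} {k} f k≤B = trans (∑-trunc (λ m → ι (m ≼? k) * f m) k≤B λ i k<i _ → ι-*-no (i ≼? k) (ℕ.<⇒≱ k<i))
   (∑-cong k λ i _ i≤k → ι-*-yes (i ≼? k) i≤k)

 ι-÷ : ∀ d x m → 1 ≼ d → ι (d · m ≼? x) ≡ ι (m ≼? x ÷ d)
 ι-÷ d x m 1≤d = ι-⇔ (d · m ≼? x) (m ≼? x ÷ d) (≤-÷ d x m 1≤d) (÷-≤ d x m 1≤d)

 ∑-cut-÷ : ∀ {B} d x f → 1 ≼ d → x ≼ B → ∑ B (λ m → ι (d · m ≼? x) * f m) ≡ ∑ (x ÷ d) f
 ∑-cut-÷ {B} d x f 1≤d x≤B = trans (∑-ext B λ m → cong (_* f m) (ι-÷ d x m 1≤d)) (∑-cut f (≼-trans (÷-≤-self d x 1≤d) x≤B))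

 ∑-count : ∀ {B} d x → 1 ≼ d → x ≼ B → ∑ B (λ m → ι (d · m ≼? x)) ≡ # (x ÷ d)
 ∑-count {B} d x 1≤d x≤B = trans (∑-ext B λ m → sym (*-identityʳ _))
   (trans (∑-cut-÷ d x (λ _ → 1ℚ) 1≤d x≤B) (trans (∑-const (x ÷ d) 1ℚ) (*-identityʳ _)))

 ∑-≤-trunc : ∀ {m n} f → m ≼ n → (∀ i → 1 ≼ i → i ≼ n → 0ℚ ≤ f i) → ∑ m f ≤ ∑ n f
 ∑-≤-trunc {m} {n} f m≤n h with ℕ.m≤n⇒∃[o]m+o≡n m≤n
 ... | o , refl = (≤-by ((0≤∑ o (λ i p q → h (m ∔ i) (≼-trans p (ℕ.m≤n+m i m)) (ℕ.+-monoʳ-≤ m q))) ⊕ (≡⇒≤ (sym (∑-++ m o f)))) (solve (∑ (m ∔ o) f ∷ ∑ m f ∷ ∑ o (λ i → f (m ∔ i)) ∷ []) (v0 :+ (c0 :+ (v1 :+ v2))) (v1 :+ (v2 :+ v0))))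

 ∑-bound : ∀ n {f c} → (∀ i → 1 ≼ i → i ≼ n → ∣ f i ∣≤ c i) → ∣ ∑ n f ∣≤ ∑ n c
 ∑-bound n {f} {c} h = subst (_≤ ∑ n f) (∑-neg n c) (∑-mono n λ i p q → proj₁ (h i p q)) , ∑-mono n λ i p q → proj₂ (h i p q)

 geometric : ∀ p K → 2 ≼ p → ∑ K (λ k → r (p ^ k)) ≤ # 2 * r p
 geometric p K 2≤p = (≤-by ((go K) ⊕ (0≤* (0≤* (0≤r (p ^ K) (p^≥1 K)) (0≤# 2)) (0≤r p 1≤p))) (solve (r p ∷ ∑ K (λ k → r (p ^ k)) ∷ r (p ^ K) ∷ []) (c2 :* v0 :+ (v1 :+ v2 :* c2 :* v0 :+ c0)) (v1 :+ (c2 :* v0 :+ v2 :* c2 :* v0))))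
   where
   1≤p = ≼-trans (s≤s z≤n) 2≤p
   p^≥1 : ∀ k → 1 ≼ p ^ k
   p^≥1 k = ℕ.m^n>0 p {{ℕ.>-nonZero 1≤p}} k
   2rp≤1 : # 2 * r p ≤ 1ℚ
   2rp≤1 = (≤-by (((0≤r p 1≤p) ⊗ (#-mono 2≤p)) ⊕ (≡⇒≤ (r-inv p 1≤p))) (solve (r p ∷ # p ∷ []) (c1 :+ (v0 :* c2 :+ v1 :* v0)) (c2 :* v0 :+ (v0 :* v1 :+ c1))))
   -- Strengthened by a remainder 2 / p^(K + 1), which pays for the next term and the next remainder
   -- because 2 / p ≤ 1.
   go : ∀ K → ∑ K (λ k → r (p ^ k)) + r (p ^ K) * # 2 * r p ≤ # 2 * r p
   go zero = (≤-by (((0≤r p 1≤p) ⊗ (≡⇒≤ r-1)) ⊕ ((0≤r p 1≤p) ⊗ (≡⇒≤ r-1))) (solve (r p ∷ r 1 ∷ []) (c2 :* v0 :+ (v0 :* v1 :+ v0 :* v1)) (c0 :+ v1 :* c2 :* v0 :+ (v0 :* c1 :+ v0 :* c1))))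
   go (suc K) = (≤-by ((go K) ⊕ ((0≤r (p ^ suc K) (p^≥1 (suc K))) ⊗ 2rp≤1) ⊕ ((0≤# 2) ⊗ (≡⇒≤ (r-* p (p ^ K) 1≤p (p^≥1 K))))) (solve (r p ∷ ∑ K (λ k → r (p ^ k)) ∷ r (p ^ K) ∷ r (p ^ suc K) ∷ []) (c2 :* v0 :+ (v1 :+ v2 :* c2 :* v0 :+ v3 :* (c2 :* v0) :+ c2 :* v3)) (v1 :+ v3 :+ v3 :* c2 :* v0 :+ (c2 :* v0 :+ v3 :* c1 :+ c2 :* (v0 :* v2)))))

 -- Partial summation bounds the interior part by `M` times the total decrease of `f`, and the
 -- boundary term adds `M * f y`; together they make up `M * f 1`.
 abel : ∀ (a f : ℕ → ℚ) M y → (∀ j → j ≼ y → ∣ ∑ j a ∣≤ M) →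
        (∀ m → 1 ≼ m → m ℕ.< y → f (suc m) ≤ f m) → (1 ≼ y → 0ℚ ≤ f y) → 0ℚ ≤ f 1 →
        ∣ ∑ y (λ m → a m * f m) ∣≤ M * f 1
 abel a f M zero ha hf 0≤fy 0≤f1 =
   (≤-by (0≤f1 ⊗ (proj₁ (ha 0 z≤n))) (solve (f 1 ∷ M ∷ []) (c0 :+ v0 :* (:- v1)) (:- (v1 :* v0) :+ v0 :* c0))) ,
   (≤-by (0≤f1 ⊗ (proj₂ (ha 0 z≤n))) (solve (M ∷ f 1 ∷ []) (v0 :* v1 :+ v1 :* c0) (c0 :+ v1 :* v0)))
 abel a f M y@(suc y-1) ha hf 0≤fy 0≤f1 =
   (≤-by ((proj₁ (go y-1 ≼-refl)) ⊕ ((0≤fy (s≤s z≤n)) ⊗ (proj₁ (ha y ≼-refl)))) (solve (∑ y (λ m → a m * f m) ∷ M ∷ f 1 ∷ f y ∷ ∑ y a ∷ []) (v0 :+ (:- (v1 :* (v2 :- v3)) :+ v3 :* (:- v1))) (:- (v1 :* v2) :+ (v0 :- v4 :* v3 :+ v3 :* v4)))) ,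
   (≤-by ((proj₂ (go y-1 ≼-refl)) ⊕ ((0≤fy (s≤s z≤n)) ⊗ (proj₂ (ha y ≼-refl)))) (solve (M ∷ f 1 ∷ ∑ y (λ m → a m * f m) ∷ ∑ y a ∷ f y ∷ []) (v0 :* v1 :+ (v2 :- v3 :* v4 :+ v4 :* v3)) (v2 :+ (v0 :* (v1 :- v4) :+ v4 :* v0))))
   where
   X : ℕ → ℚ
   X j = ∑ j (λ m → a m * f m)
   go : ∀ j → suc j ≼ y → ∣ X (suc j) - ∑ (suc j) a * f (suc j) ∣≤ M * (f 1 - f (suc j))
   go zero _ = ≤-reflexive (solve (M ∷ f 1 ∷ a 1 ∷ []) (:- (v0 :* (v1 :- v1))) (c0 :+ v2 :* v1 :- (c0 :+ v2) :* v1)) ,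
               ≤-reflexive (solve (a 1 ∷ f 1 ∷ M ∷ []) (c0 :+ v0 :* v1 :- (c0 :+ v0) :* v1) (v2 :* (v1 :- v1)))
   go (suc i) i<y with go i (ℕ.<⇒≤ i<y) | hf (suc i) (s≤s z≤n) i<y | ha (suc i) (ℕ.<⇒≤ i<y)
   ... | lo , hi | dec | (alo , ahi) =
     (≤-by (lo ⊕ (0≤δ ⊗ alo)) (solve (X (suc i) ∷ a (suc (suc i)) ∷ f (suc (suc i)) ∷ ∑ (suc i) a ∷ M ∷ f 1 ∷ f (suc i) ∷ []) (v0 :+ v1 :* v2 :- (v3 :+ v1) :* v2 :+ (:- (v4 :* (v5 :- v6)) :+ (v6 :- v2) :* (:- v4))) (:- (v4 :* (v5 :- v2)) :+ (v0 :- v3 :* v6 :+ (v6 :- v2) :* v3)))) ,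
     (≤-by (hi ⊕ (0≤δ ⊗ ahi)) (solve (M ∷ f 1 ∷ f (suc (suc i)) ∷ X (suc i) ∷ ∑ (suc i) a ∷ f (suc i) ∷ a (suc (suc i)) ∷ []) (v0 :* (v1 :- v2) :+ (v3 :- v4 :* v5 :+ (v5 :- v2) :* v4)) (v3 :+ v6 :* v2 :- (v4 :+ v6) :* v2 :+ (v0 :* (v1 :- v5) :+ (v5 :- v2) :* v0))))
     where
     0≤δ : 0ℚ ≤ f (suc i) - f (suc (suc i))
     0≤δ = (≤-by dec (solve (f (suc i) ∷ f (suc (suc i)) ∷ []) (v0 :- v1 :+ v1) (c0 :+ v0)))

 -- The interface between the approximate logarithm and the analytic part. Additivity comes from the
 -- construction of `lg` for arbitrary prime weights; the fields add the order-theoretic facts.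
 record LogData : Set where
   field
     B : ℕ
     2≤B : 2 ≼ B
     ℓ : ℕ → ℚ
     0≤ℓ : ∀ n → 0ℚ ≤ ℓ n
   open Log B ℓ
   field
     lg-mono : ∀ n → 1 ≼ n → suc n ≼ B → lg n ≤ lg (suc n)
     lg-incr : ∀ n → 1 ≼ n → suc n ≼ B → # n * (lg (suc n) - lg n) ≤ # 4
     lg-2 : lg 2 ≡ 1ℚ

 -- Estimates of Chebyshev and Mertens.

 module Mertens (𝓛 : LogData) where

   open LogData 𝓛 public
   open Log B ℓ public

   1≤B : 1 ≼ B
   1≤B = ≼-trans (s≤s z≤n) 2≤B

   Λ≥0 : ∀ n → 0ℚ ≤ Λ n
   Λ≥0 = 0≤Λ 0≤ℓ

   lg-≤ : ∀ {m n} → 1 ≼ m → m ≼ n → n ≼ B → lg m ≤ lg n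
   lg-≤ {m} {n} 1≤m m≤n n≤B with ℕ.m≤n⇒∃[o]m+o≡n m≤n
   ... | o , refl = go o n≤B
     where
     go : ∀ o → m ∔ o ≼ B → lg m ≤ lg (m ∔ o)
     go zero _ = ≤-reflexive (cong lg (sym (ℕ.+-identityʳ m)))
     go (suc o) h = subst (λ z → lg m ≤ lg z) (sym (ℕ.+-suc m o))
       (≤-trans (go o (≼-trans (ℕ.+-monoʳ-≤ m (ℕ.n≤1+n o)) h)) (lg-mono (m ∔ o) (≼-trans 1≤m (ℕ.m≤m+n m o)) (subst (ℕ._≤ B) (ℕ.+-suc m o) h)))

   0≤lg : ∀ {n} → 1 ≼ n → n ≼ B → 0ℚ ≤ lg n
   0≤lg {n} 1≤n n≤B = subst (_≤ lg n) lg-1 (lg-≤ ≼-refl 1≤n n≤B)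

   lg-double : ∀ n → 1 ≼ n → 2 · n ≼ B → lg (2 · n) ≡ 1ℚ + lg n
   lg-double n 1≤n h = trans (lg-* 2 n (s≤s z≤n) 1≤n h) (cong (_+ lg n) lg-2)

   T ψ P h : ℕ → ℚ
   T x = ∑ x lg
   ψ x = ∑ x Λ
   P x = ∑ x (λ d → Λ d * r d)
   h x = ∑ x r

   -- A weak form of Stirling's formula: the left side grows from x to x + 1 by x (lg (x + 1) - lg
   -- x) ≤ 4.
   T-lower : ∀ x → 1 ≼ x → x ≼ B → # x * lg x - T x ≤ # 4 * # x
   T-lower (suc zero) _ _ = (≤-by (0≤# 4) (solve (lg 1 ∷ []) (c4 :* c1 :+ c0) (c1 :* v0 :- (c0 :+ v0) :+ c4)))
   T-lower (suc x@(suc _)) _ x<B = (≤-by ((T-lower x (s≤s z≤n) (ℕ.<⇒≤ x<B)) ⊕ (lg-incr x (s≤s z≤n) x<B) ⊕ ((0≤lg (s≤s z≤n) x<B) ⊗ (≡⇒≤ (#-suc x))) ⊕ ((0≤# 4) ⊗ (≡⇒≤ (sym (#-suc x))))) (solve (# (suc x) ∷ # x ∷ lg x ∷ T x ∷ lg (suc x) ∷ []) (c4 :* v0 :+ (v1 :* v2 :- v3 :+ v1 :* (v4 :- v2) :+ v4 :* v0 :+ c4 :* (c1 :+ v1))) (v0 :* v4 :- (v3 :+ v4) :+ (c4 :* v1 :+ c4 :+ v4 :* (c1 :+ v1) :+ c4 :* v0))))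

   T-upper : ∀ x → 1 ≼ x → x ≼ B → T x ≤ # x * lg x
   T-upper x 1≤x x≤B = ≤-trans (∑-mono x λ i 1≤i i≤x → lg-≤ 1≤i i≤x x≤B) (≤-reflexive (∑-const x (lg x)))

   T-floor : ∀ x → x ≼ B → T x ≡ ∑ B (λ d → Λ d * # (x ÷ d))
   T-floor x x≤B = begin
     T x ≡⟨ sym (∑-cut lg x≤B) ⟩
     ∑ B (λ n → ι (n ≼? x) * lg n) ≡⟨ ∑-ext B (λ n → *-comm _ _) ⟩
     ∑ B (λ n → lg n * ι (n ≼? x)) ≡⟨ ∑-lg (λ n → ι (n ≼? x)) (λ n B<n → ι-no (n ≼? x) λ n≤x → ℕ.<⇒≱ B<n (≼-trans n≤x x≤B)) ⟩
     ∑ B (λ d → Λ d * ∑ B (λ m → ι (d · m ≼? x))) ≡⟨ ∑-cong B (λ d 1≤d _ → cong (Λ d *_) (∑-count d x 1≤d x≤B)) ⟩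
     ∑ B (λ d → Λ d * # (x ÷ d)) ∎
     where open ≡-Reasoning

   T-floor′ : ∀ x → x ≼ B → T x ≡ ∑ x (λ d → Λ d * # (x ÷ d))
   T-floor′ x x≤B = trans (T-floor x x≤B) (∑-trunc _ x≤B λ d x<d _ → trans (cong (λ z → Λ d * # z) (zero-÷ d x<d)) (zeroʳ (Λ d)))
     where
     zero-÷ : ∀ d → x ℕ.< d → x ÷ d ≡ 0
     zero-÷ (suc d) x<d = ℕ.m<n⇒m/n≡0 x<d

   ψ≤T : ∀ x → x ≼ B → ψ x ≤ T x
   ψ≤T x x≤B = subst (ψ x ≤_) (sym (T-floor′ x x≤B)) (∑-mono x λ d 1≤d d≤x →
     (≤-by ((Λ≥0 d) ⊗ (#-mono (÷-≥1 d x 1≤d d≤x))) (solve (Λ d ∷ # (x ÷ d) ∷ []) (v0 :* v1 :+ v0 :* c1) (v0 :+ v0 :* v1))))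

   -- The left side is the logarithm of the central binomial coefficient. One step adds lg (2x + 1)
   -- + lg (2x + 2) - 2 lg (x + 1), which is at most 2 because lg (2x + 2) = 1 + lg (x + 1).
   T-double : ∀ x → 2 · x ≼ B → T (2 · x) - # 2 * T x ≤ # 2 * # x
   T-double zero _ = ≤-reflexive (solve [] (c0 :- c2 :* c0) (c2 :* c0))
   T-double (suc x) h = subst (λ z → T z - # 2 * T (suc x) ≤ # 2 * # (suc x)) (sym e)
     (≤-by ((T-double x 2x≤B) ⊕ (lg-mono (suc (2 · x)) (s≤s z≤n) h′) ⊕ ((0≤# 2) ⊗ (≡⇒≤ e₂)) ⊕ ((0≤# 2) ⊗ (≡⇒≤ (sym (#-suc x))))) (solve (# (suc x) ∷ T (2 · x) ∷ T x ∷ lg (suc (2 · x)) ∷ lg (suc (suc (2 · x))) ∷ # x ∷ lg (suc x) ∷ []) (c2 :* v0 :+ (v1 :- c2 :* v2 :+ v3 :+ c2 :* v4 :+ c2 :* (c1 :+ v5))) (v1 :+ v3 :+ v4 :- c2 :* (v2 :+ v6) :+ (c2 :* v5 :+ v4 :+ c2 :* (c1 :+ v6) :+ c2 :* v0))))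
     where
     e : 2 · suc x ≡ suc (suc (2 · x))
     e = lem x
       where
       lem : ∀ x → 2 · suc x ≡ suc (suc (2 · x))
       lem = solve-∀
     h′ : suc (suc (2 · x)) ≼ B
     h′ = subst (ℕ._≤ B) e h
     2x≤B : 2 · x ≼ B
     2x≤B = ≼-trans (ℕ.*-monoʳ-≤ 2 (ℕ.n≤1+n x)) h
     e₂ : lg (suc (suc (2 · x))) ≡ 1ℚ + lg (suc x)
     e₂ = trans (cong lg (sym e)) (lg-double (suc x) (s≤s z≤n) h)

   -- In T (2x) - 2 T x = Σ Λ(d) (⌊2x/d⌋ - 2 ⌊x/d⌋) all coefficients are nonnegative, and those with
   -- x < d ≤ 2x are at least 1.
   ψ-double : ∀ x → 2 · x ≼ B → ψ (2 · x) ≤ ψ x + # 2 * # x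
   ψ-double x h = (≤-by ((T-double x h) ⊕ key) (solve (ψ x ∷ # x ∷ T (2 · x) ∷ T x ∷ ψ (2 · x) ∷ []) (v0 :+ c2 :* v1 :+ (v2 :- c2 :* v3 :+ (v4 :- v0))) (v4 :+ (c2 :* v1 :+ (v2 :- c2 :* v3)))))
     where
     x≤2x = ℕ.m≤m+n x (x ∔ 0)
     x≤B = ≼-trans x≤2x h
     term : ∀ d → 1 ≼ d → ι (d ≼? 2 · x) - ι (d ≼? x) ≤ # (2 · x ÷ d) - # 2 * # (x ÷ d)
     term d 1≤d with d ≼? x
     ... | yes d≤x = (≤-by ((ι≤1 (d ≼? 2 · x)) ⊕ (#-mono (≤-÷ d (2 · x) (2 · (x ÷ d)) 1≤d dbl)) ⊕ (≡⇒≤ (sym (#-* 2 (x ÷ d))))) (solve (# (2 · x ÷ d) ∷ # (x ÷ d) ∷ ι (d ≼? 2 · x) ∷ # (2 · (x ÷ d)) ∷ []) (v0 :- c2 :* v1 :+ (v2 :+ v3 :+ c2 :* v1)) (v2 :- c1 :+ (c1 :+ v0 :+ v3))))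
       where
       dbl : d · (2 · (x ÷ d)) ≼ 2 · x
       dbl = ≼-trans (≼-reflexive (lem d (x ÷ d))) (ℕ.*-monoʳ-≤ 2 (÷-≤ d x (x ÷ d) 1≤d ≼-refl))
         where
         lem : ∀ d y → d · (2 · y) ≡ 2 · (d · y)
         lem = solve-∀
     ... | no d≰x = subst (λ z → ι (d ≼? 2 · x) - 0ℚ ≤ # (2 · x ÷ d) - # 2 * # z) (sym z0) (≤-trans (≤-reflexive (solve (ι (d ≼? 2 · x) ∷ []) (v0 :- c0) v0)) (≤-trans (go (d ≼? 2 · x)) (≤-reflexive (solve (# (2 · x ÷ d) ∷ []) v0 (v0 :- c2 :* c0)))))
       where
       z0 : x ÷ d ≡ 0
       z0 = ℕ.n<1⇒n≡0 (ℕ.≰⇒> λ p → d≰x (≼-trans (≼-reflexive (sym (ℕ.*-identityʳ d))) (÷-≤ d x 1 1≤d p)))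
       go : (e : Dec (d ≼ 2 · x)) → ι e ≤ # (2 · x ÷ d)
       go (yes q) = #-mono (÷-≥1 d (2 · x) 1≤d q)
       go (no _) = 0≤# (2 · x ÷ d)
     key : ψ (2 · x) - ψ x ≤ T (2 · x) - # 2 * T x
     key = subst₂ _≤_ lhs rhs (∑-mono B λ d 1≤d _ → Λ≥0 d ⊗ term d 1≤d)
       where
       cutΛ : ∀ y → y ≼ B → ∑ B (λ d → Λ d * ι (d ≼? y)) ≡ ψ y
       cutΛ y y≤B = trans (∑-ext B λ d → *-comm _ _) (∑-cut Λ y≤B)
       lhs : ∑ B (λ d → Λ d * (ι (d ≼? 2 · x) - ι (d ≼? x))) ≡ ψ (2 · x) - ψ x
       lhs = trans (∑-ext B λ d → (solve (Λ d ∷ ι (d ≼? 2 · x) ∷ ι (d ≼? x) ∷ []) (v0 :* (v1 :- v2)) (v0 :* v1 :- v0 :* v2)))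
         (trans (∑-sub B _ _) (cong₂ _-_ (cutΛ (2 · x) h) (cutΛ x x≤B)))
       rhs : ∑ B (λ d → Λ d * (# (2 · x ÷ d) - # 2 * # (x ÷ d))) ≡ T (2 · x) - # 2 * T x
       rhs = trans (∑-ext B λ d → (solve (Λ d ∷ # (2 · x ÷ d) ∷ # (x ÷ d) ∷ []) (v0 :* (v1 :- c2 :* v2)) (v0 :* v1 :- c2 :* (v0 :* v2))))
         (trans (∑-sub B _ _) (cong₂ _-_ (sym (T-floor (2 · x) h)) (trans (sym (∑-*ˡ B (# 2) _)) (cong (# 2 *_) (sym (T-floor x x≤B))))))

   -- Repeated halving. The constant 6 leaves room for rounding up: an odd x = 2j + 3 is replaced by
   -- 2 (j + 2), and 8 (j + 2) ≤ 6 x.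
   chebyshev : ∀ x → suc x ≼ B → ψ x ≤ # 6 * # x
   chebyshev = <-rec (λ x → suc x ≼ B → ψ x ≤ # 6 * # x) step
     where
     step : ∀ x → (∀ {y} → y ℕ.< x → suc y ≼ B → ψ y ≤ # 6 * # y) → suc x ≼ B → ψ x ≤ # 6 * # x
     step zero _ _ = ≤-reflexive (solve [] c0 (c6 :* c0))
     step (suc zero) _ h = ≤-trans (ψ≤T 1 1≤B) (≤-by ((≡⇒≤ lg-1) ⊕ (0≤# 6)) (solve (lg 1 ∷ []) (c6 :* c1 :+ (v0 :+ c0)) (c0 :+ v0 :+ (c0 :+ c6))))
     step x@(suc (suc x₂)) rec x<B with half x₂
     ... | j , inj₁ refl = subst (λ z → ψ z ≤ # 6 * # z) e
             (≤-by ((ψ-double (suc j) (≼-trans (≼-reflexive e) (ℕ.<⇒≤ x<B))) ⊕ (rec lt (≼-trans (s≤s (ℕ.<⇒≤ lt)) x<B)) ⊕ ((0≤# 6) ⊗ (≡⇒≤ (sym (#-* 2 (suc j))))) ⊕ ((0≤# 4) ⊗ (0≤# (suc j)))) (solve (# (2 · suc j) ∷ ψ (2 · suc j) ∷ ψ (suc j) ∷ # (suc j) ∷ []) (c6 :* v0 :+ (v1 :+ v2 :+ c6 :* (c2 :* v3) :+ c4 :* c0)) (v1 :+ (v2 :+ c2 :* v3 :+ c6 :* v3 :+ c6 :* v0 :+ c4 :* v3))))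
       where
       e : 2 · suc j ≡ suc (suc (2 · j))
       e = lem j
         where
         lem : ∀ j → 2 · suc j ≡ suc (suc (2 · j))
         lem = solve-∀
       lt : suc j ℕ.< x
       lt = s≤s (s≤s (ℕ.m≤m+n j (j ∔ 0)))
     ... | j , inj₂ refl = ≤-trans (∑-≤-trunc Λ (≼-trans (ℕ.n≤1+n x) (≼-reflexive (sym e))) (λ i _ _ → Λ≥0 i))
             (≤-by ((ψ-double (suc (suc j)) (≼-trans (≼-reflexive e) x<B)) ⊕ (rec lt (≼-trans (s≤s (ℕ.<⇒≤ lt)) x<B)) ⊕ ((0≤# 8) ⊗ (≡⇒≤ ej)) ⊕ ((0≤# 6) ⊗ (≡⇒≤ (sym ex))) ⊕ ((0≤# 4) ⊗ (0≤# j)) ⊕ (0≤# 2)) (solve (# x ∷ ψ (2 · suc (suc j)) ∷ ψ (suc (suc j)) ∷ # (suc (suc j)) ∷ # j ∷ []) (c6 :* v0 :+ (v1 :+ v2 :+ c8 :* v3 :+ c6 :* (cn 3 :+ c2 :* v4) :+ c4 :* c0 :+ c0)) (v1 :+ (v2 :+ c2 :* v3 :+ c6 :* v3 :+ c8 :* (c2 :+ v4) :+ c6 :* v0 :+ c4 :* v4 :+ c2))))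
       where
       e : 2 · suc (suc j) ≡ suc x
       e = lem j
         where
         lem : ∀ j → 2 · suc (suc j) ≡ suc (suc (suc (suc (2 · j))))
         lem = solve-∀
       lt : suc (suc j) ℕ.< x
       lt = s≤s (s≤s (s≤s (ℕ.m≤m+n j (j ∔ 0))))
       ej : # (suc (suc j)) ≡ # 2 + # j
       ej = #-+ 2 j
       ex : # x ≡ # 3 + # 2 * # j
       ex = trans (#-+ 3 (2 · j)) (cong (# 3 +_) (#-* 2 j))

   -- In T x = Σ Λ(d) ⌊x/d⌋ the floors may be dropped for this bound. Each floor loses at most 1, in
   -- total at most ψ x ≤ 6 x, which gives the upper bound after it.
   mertens-lower : ∀ x → 1 ≼ x → x ≼ B → lg x - # 4 ≤ P x
   mertens-lower x 1≤x x≤B = cancel-≤ (#≰0 1≤x) (0≤# x)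
     (≤-by ((T-lower x 1≤x x≤B) ⊕ key) (solve (# x ∷ P x ∷ lg x ∷ T x ∷ []) (v0 :* v1 :+ (v0 :* v2 :- v3 :+ v3)) (v0 :* (v2 :- c4) :+ (c4 :* v0 :+ v0 :* v1))))
     where
     key : T x ≤ # x * P x
     key = subst₂ _≤_ (sym (T-floor′ x x≤B)) (sym (∑-*ˡ x (# x) _)) (∑-mono x λ d 1≤d d≤x → le d 1≤d)
       where
       le : ∀ d → 1 ≼ d → Λ d * # (x ÷ d) ≤ # x * (Λ d * r d)
       le d 1≤d = (≤-by (((0≤* (Λ≥0 d) (0≤r d 1≤d)) ⊗ (#-mono (÷-≤ d x (x ÷ d) 1≤d ≼-refl))) ⊕ ((0≤* (Λ≥0 d) (0≤r d 1≤d)) ⊗ (≡⇒≤ (sym (#-* d (x ÷ d))))) ⊕ ((0≤* (Λ≥0 d) (0≤# (x ÷ d))) ⊗ (≡⇒≤ (sym (r-inv d 1≤d))))) (solve (# x ∷ Λ d ∷ r d ∷ # (d · (x ÷ d)) ∷ # d ∷ # (x ÷ d) ∷ []) (v0 :* (v1 :* v2) :+ (v1 :* v2 :* v3 :+ v1 :* v2 :* (v4 :* v5) :+ v1 :* v5 :* c1)) (v1 :* v5 :+ (v1 :* v2 :* v0 :+ v1 :* v2 :* v3 :+ v1 :* v5 :* (v4 :* v2)))))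

   mertens-upper : ∀ x → 1 ≼ x → suc x ≼ B → P x ≤ lg x + # 6
   mertens-upper x 1≤x x<B = cancel-≤ (#≰0 1≤x) (0≤# x)
     (≤-by (key ⊕ (T-upper x 1≤x x≤B) ⊕ (chebyshev x x<B)) (solve (# x ∷ lg x ∷ P x ∷ T x ∷ ψ x ∷ []) (v0 :* (v1 :+ c6) :+ (v0 :* v2 :+ v3 :+ v4)) (v0 :* v2 :+ (v3 :+ v4 :+ v0 :* v1 :+ c6 :* v0))))
     where
     x≤B = ℕ.<⇒≤ x<B
     key : # x * P x ≤ T x + ψ x
     key = subst₂ _≤_ (sym (∑-*ˡ x (# x) _)) (trans (∑-+ x _ _) (cong (_+ ψ x) (sym (T-floor′ x x≤B)))) (∑-mono x λ d 1≤d d≤x → le d 1≤d)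
       where
       le : ∀ d → 1 ≼ d → # x * (Λ d * r d) ≤ Λ d * # (x ÷ d) + Λ d
       le d 1≤d = (≤-by (((0≤* (Λ≥0 d) (0≤r d 1≤d)) ⊗ (#-mono (ℕ.<⇒≤ (<-÷ d x 1≤d)))) ⊕ ((0≤* (Λ≥0 d) (0≤r d 1≤d)) ⊗ (≡⇒≤ e)) ⊕ ((0≤* (Λ≥0 d) (0≤+ 0≤1 (0≤# (x ÷ d)))) ⊗ (≡⇒≤ (r-inv d 1≤d)))) (solve (Λ d ∷ # (x ÷ d) ∷ r d ∷ # x ∷ # (d · suc (x ÷ d)) ∷ # d ∷ []) (v0 :* v1 :+ v0 :+ (v0 :* v2 :* v3 :+ v0 :* v2 :* v4 :+ v0 :* (c1 :+ v1) :* (v5 :* v2))) (v3 :* (v0 :* v2) :+ (v0 :* v2 :* v4 :+ v0 :* v2 :* (v5 :* (c1 :+ v1)) :+ v0 :* (c1 :+ v1) :* c1))))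
         where
         e : # (d · suc (x ÷ d)) ≡ # d * (1ℚ + # (x ÷ d))
         e = trans (#-* d (suc (x ÷ d))) (cong (# d *_) (#-suc (x ÷ d)))

   -- The terms beyond y = ⌊x/2⌋ number at most y + 1, each at most 1 / (y + 1), and doubling the
   -- argument raises `lg` by 1.
   harmonic : ∀ x → 1 ≼ x → x ≼ B → h x ≤ lg x + 1ℚ
   harmonic = <-rec (λ x → 1 ≼ x → x ≼ B → h x ≤ lg x + 1ℚ) step
     where
     block : ∀ y k → 1 ≼ y → k ≼ suc y → ∑ k (λ i → r (y ∔ i)) ≤ 1ℚ
     block y k 1≤y k≤1+y = ≤-trans (∑-mono k λ i 1≤i _ → r-anti (s≤s z≤n) (≼-trans (≼-reflexive (ℕ.+-comm 1 y)) (ℕ.+-monoʳ-≤ y 1≤i)))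
       (≤-by ((≡⇒≤ (∑-const k (r (suc y)))) ⊕ ((0≤r (suc y) (s≤s z≤n)) ⊗ (#-mono k≤1+y)) ⊕ (≡⇒≤ (r-inv (suc y) (s≤s z≤n)))) (solve (∑ k (λ _ → r (suc y)) ∷ r (suc y) ∷ # k ∷ # (suc y) ∷ []) (c1 :+ (v0 :+ v1 :* v2 :+ v3 :* v1)) (v0 :+ (v2 :* v1 :+ v1 :* v3 :+ c1))))
     step : ∀ x → (∀ {y} → y ℕ.< x → 1 ≼ y → y ≼ B → h y ≤ lg y + 1ℚ) → 1 ≼ x → x ≼ B → h x ≤ lg x + 1ℚ
     step (suc zero) _ _ _ = (≤-by ((≡⇒≤ r-1) ⊕ (≡⇒≤ (sym lg-1))) (solve (lg 1 ∷ r 1 ∷ []) (v0 :+ c1 :+ (v1 :+ c0)) (c0 :+ v1 :+ (c1 :+ v0))))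
     step x@(suc (suc x₂)) rec _ x≤B with half x₂
     ... | j , e = go y (x ℕ.∸ y) refl k≤ 2y≤x (ℕ.m+[n∸m]≡n y≤x)
       where
       y = suc j
       2y≡ : ∀ j → 2 · suc j ≡ suc (suc (2 · j))
       2y≡ = solve-∀
       2j≤ : 2 · j ≼ x₂
       2j≤ = [ (λ { refl → ≼-refl }) , (λ { refl → ℕ.n≤1+n _ }) ]′ e
       2y≤x : 2 · y ≼ x
       2y≤x = ≼-trans (≼-reflexive (2y≡ j)) (s≤s (s≤s 2j≤))
       y≤x : y ≼ x
       y≤x = ≼-trans (ℕ.m≤m+n y (y ∔ 0)) 2y≤x
       x₂≤ : x₂ ≼ suc (2 · j)
       x₂≤ = [ (λ { refl → ℕ.n≤1+n _ }) , (λ { refl → ≼-refl }) ]′ e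
       k≤ : x ℕ.∸ y ≼ suc y
       k≤ = ≼-trans (ℕ.∸-monoˡ-≤ y (s≤s (s≤s x₂≤))) (≼-reflexive (trans (cong (ℕ._∸ y) (lem j)) (ℕ.m+n∸n≡m (suc y) y)))
         where
         lem : ∀ j → suc (suc (suc (2 · j))) ≡ suc (suc j) ∔ suc j
         lem = solve-∀
       go : ∀ y k → y ≡ suc j → k ≼ suc y → 2 · y ≼ x → y ∔ k ≡ x → h x ≤ lg x + 1ℚ
       go y k refl k≤ 2y≤x e = (≤-by ((≡⇒≤ (trans (cong h (sym e)) (∑-++ y k r))) ⊕ (block y k (s≤s z≤n) k≤) ⊕ (rec y<x (s≤s z≤n) (≼-trans y≤x x≤B)) ⊕ (lg-≤ (s≤s z≤n) 2y≤x x≤B) ⊕ (≡⇒≤ (sym (lg-double y (s≤s z≤n) (≼-trans 2y≤x x≤B))))) (solve (lg x ∷ h x ∷ ∑ k (λ i → r (y ∔ i)) ∷ h y ∷ lg (2 · y) ∷ lg y ∷ []) (v0 :+ c1 :+ (v1 :+ v2 :+ v3 :+ v4 :+ (c1 :+ v5))) (v1 :+ (v3 :+ v2 :+ c1 :+ (v5 :+ c1) :+ v0 :+ v4))))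
         where
         y<x : y ℕ.< x
         y<x = ℕ.<-≤-trans (ℕ.m<m+n (suc j) (s≤s z≤n)) 2y≤x

 -- Residue classes modulo N.

 module Residues (N : ℕ) (1≤N : 1 ≼ N) where

   open Representatives N 1≤N public

   κ : ℕ → ℕ → ℚ
   κ g n = ι (n ≅? g [ N ])

   υ : ℕ → ℚ
   υ n = ι (coprime? n N)

   Φ : ℚ
   Φ = ∑ N υ

   υ-* : ∀ m n → υ (m · n) ≡ υ m * υ n
   υ-* m n with coprime? m N | coprime? n N
   ... | yes p | yes q = trans (ι-yes (coprime? (m · n) N) (coprime-*ˡ p q)) (sym (*-identityˡ 1ℚ))
   ... | yes p | no ¬q = trans (ι-no (coprime? (m · n) N) λ c → ¬q (coprime-∣ˡ (ℕ.n∣m*n m) c)) (sym (zeroʳ 1ℚ))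
   ... | no ¬p | _ = trans (ι-no (coprime? (m · n) N) λ c → ¬p (coprime-∣ˡ (ℕ.m∣m*n n) c)) (sym (zeroˡ _))

   κ-cong : ∀ {g g′} n → g ≅ g′ [ N ] → κ g n ≡ κ g′ n
   κ-cong n e = ι-⇔ (n ≅? _ [ N ]) (n ≅? _ [ N ]) (λ p → ≋-trans p e) (λ p → ≋-trans p (≋-sym e))

   κ-periodic : ∀ g n → κ g (N ∔ n) ≡ κ g n
   κ-periodic g n = ι-⇔ ((N ∔ n) ≅? g [ N ]) (n ≅? g [ N ]) (λ p → ≋-trans (≋-sym ≅-+N) p) (λ p → ≋-trans ≅-+N p)

   ∑-κ : ∀ g (f : ℕ → ℚ) → ∑ N (λ m → κ g m * f m) ≡ f (proj₁ (rep g))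
   ∑-κ g f with rep g
   ... | k , 1≤k , k≤N , k≅g = trans (∑-cong N λ m 1≤m m≤N → cong (_* f m) (ι-⇔ (m ≅? g [ N ]) (m ℕ.≟ k)
           (λ p → rep-unique 1≤m m≤N 1≤k k≤N (≋-trans p (≋-sym k≅g))) (λ { refl → k≅g })))
           (∑-δ N k f 1≤k k≤N)

   ∑-υκ : ∀ n → ∑ N (λ g → υ g * κ g n) ≡ υ n
   ∑-υκ n = trans (∑-ext N λ g → trans (*-comm _ _) (cong (_* υ g) (ι-⇔ (n ≅? g [ N ]) (g ≅? n [ N ]) ≋-sym ≋-sym)))
     (trans (∑-κ n υ) (ι-⇔ (coprime? k N) (coprime? n N) (≅-coprime (≋-sym k≅n)) (≅-coprime k≅n)))
     where
     k = proj₁ (rep n)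
     k≅n = proj₂ (proj₂ (proj₂ (rep n)))

   -- Full periods drop out, and at most `N` terms of size at most 1 remain.
   periodic-bound : ∀ (a : ℕ → ℚ) → (∀ i → a (N ∔ i) ≡ a i) → ∑ N a ≡ 0ℚ → (∀ i → ∣ a i ∣≤ 1ℚ) → ∀ j → ∣ ∑ j a ∣≤ # N
   periodic-bound a per tot bd = <-rec (λ j → ∣ ∑ j a ∣≤ # N) step
     where
     step : ∀ j → (∀ {i} → i ℕ.< j → ∣ ∑ i a ∣≤ # N) → ∣ ∑ j a ∣≤ # N
     step j rec with j ≼? N
     ... | yes j≤N with ∑-bound j {c = λ _ → 1ℚ} (λ i _ _ → bd i)
     ... | lo , hi = (≤-by (lo ⊕ (≡⇒≤ (∑-const j 1ℚ)) ⊕ (#-mono j≤N)) (solve (∑ j a ∷ ∑ j (λ _ → 1ℚ) ∷ # j ∷ # N ∷ []) (v0 :+ (:- v1 :+ v1 :+ v2)) (:- v3 :+ (v0 :+ v2 :* c1 :+ v3)))) ,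
                       (≤-by (hi ⊕ (≡⇒≤ (∑-const j 1ℚ)) ⊕ (#-mono j≤N)) (solve (# N ∷ ∑ j a ∷ ∑ j (λ _ → 1ℚ) ∷ # j ∷ []) (v0 :+ (v1 :+ v2 :+ v3)) (v1 :+ (v2 :+ v3 :* c1 :+ v0))))
     step j rec | no j≰N with ℕ.m≤n⇒∃[o]m+o≡n (ℕ.<⇒≤ (ℕ.≰⇒> j≰N))
     ... | o , refl = subst (∣_∣≤ # N) (sym (trans (∑-++ N o a) (trans (cong₂ _+_ tot (∑-ext o per)) (+-identityˡ _))))
                          (rec (ℕ.m<n+m o 1≤N))

   -- Equidistribution of all integers over the classes. Selberg's identity transfers it to the
   -- weights Λ log + Λ * Λ.
   κ-diff-bound : ∀ g g′ j → ∣ ∑ j (λ m → κ g m - κ g′ m) ∣≤ # N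
   κ-diff-bound g g′ = periodic-bound (λ m → κ g m - κ g′ m) (λ i → cong₂ _-_ (κ-periodic g i) (κ-periodic g′ i))
     (trans (∑-sub N (κ g) (κ g′)) (trans (cong₂ _-_ (one g) (one g′)) (solve [] (c1 :- c1) c0)))
     (λ i → (≤-by ((0≤ι (i ≅? g [ N ])) ⊕ (ι≤1 (i ≅? g′ [ N ]))) (solve (κ g i ∷ κ g′ i ∷ []) (v0 :- v1 :+ (c0 :+ v1)) (:- c1 :+ (v0 :+ c1)))) ,
            (≤-by ((0≤ι (i ≅? g′ [ N ])) ⊕ (ι≤1 (i ≅? g [ N ]))) (solve (κ g i ∷ κ g′ i ∷ []) (c1 :+ (c0 :+ v0)) (v0 :- v1 :+ (v1 :+ c1)))))
     where
     one : ∀ g → ∑ N (κ g) ≡ 1ℚ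
     one g = trans (∑-ext N λ m → sym (*-identityʳ _)) (∑-κ g (λ _ → 1ℚ))

   κ-quot : ∀ {d i} g m → d · i ≅ 1 [ N ] → κ g (d · m) ≡ κ (i · g) m
   κ-quot {d} {i} g m di≅1 = ι-⇔ ((d · m) ≅? g [ N ]) (m ≅? (i · g) [ N ])
     (λ p → ≋-trans (≅-≡ (sym (ℕ.*-identityˡ m))) (≋-trans (≅-* (≋-sym di≅1) ≋-refl) (≋-trans (≅-≡ (e₁ d i m)) (≅-* (≋-refl {a = ℤ.+ i}) p))))
     (λ p → ≋-trans (≅-* (≋-refl {a = ℤ.+ d}) p) (≋-trans (≅-≡ (sym (ℕ.*-assoc d i g))) (≋-trans (≅-* di≅1 ≋-refl) (≅-≡ (ℕ.*-identityˡ g)))))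
     where
     e₁ : ∀ d i m → d · i · m ≡ i · (d · m)
     e₁ = solve-∀

 -- Selberg's formula in residue classes.

 module SelbergFormula (𝓛 : LogData) (N : ℕ) (1≤N : 1 ≼ N) (N≤B : N ≼ LogData.B 𝓛) where

   open Mertens 𝓛 public
   open Residues N 1≤N public
   open Möbius B
   open Selberg B 1≤B ℓ

   lg-step : ∀ n → 1 ≼ n → suc n ≼ B → lg (suc n) - lg n ≤ # 4
   lg-step n@(suc k) _ n<B = (≤-by ((lg-incr n (s≤s z≤n) n<B) ⊕ ((0≤# k) ⊗ (lg-mono n (s≤s z≤n) n<B)) ⊕ (0≤δ ⊗ (≡⇒≤ (sym (#-suc k))))) (solve (# n ∷ lg (suc n) ∷ lg n ∷ # k ∷ []) (c4 :+ (v0 :* (v1 :- v2) :+ v3 :* v2 :+ (v1 :- v2) :* (c1 :+ v3))) (v1 :- v2 :+ (c4 :+ v3 :* v1 :+ (v1 :- v2) :* v0))))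
     where
     0≤δ : 0ℚ ≤ lg (suc n) - lg n
     0≤δ = (≤-by (lg-mono n (s≤s z≤n) n<B) (solve (lg (suc n) ∷ lg n ∷ []) (v0 :- v1 :+ v1) (c0 :+ v0)))

   lg-linear : ∀ n → 1 ≼ n → n ≼ B → lg n ≤ # 4 * # n
   lg-linear (suc zero) _ _ = (≤-by ((≡⇒≤ lg-1) ⊕ (0≤# 4)) (solve (lg 1 ∷ []) (c4 :* c1 :+ (v0 :+ c0)) (v0 :+ (c0 :+ c4))))
   lg-linear (suc n@(suc _)) _ n<B = (≤-by ((lg-linear n (s≤s z≤n) (ℕ.<⇒≤ n<B)) ⊕ (lg-step n (s≤s z≤n) n<B) ⊕ ((0≤# 4) ⊗ (≡⇒≤ (sym (#-suc n))))) (solve (# (suc n) ∷ lg n ∷ lg (suc n) ∷ # n ∷ []) (c4 :* v0 :+ (v1 :+ (v2 :- v1) :+ c4 :* (c1 :+ v3))) (v2 :+ (c4 :* v3 :+ c4 :+ c4 :* v0))))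

   module Step (m : ℕ) (1≤m : 1 ≼ m) (m<B : suc m ≼ B) where
     l δ u v : ℚ
     l = lg m
     δ = lg (suc m) - lg m
     u = r m
     v = r (suc m)
     0≤u = 0≤r m 1≤m
     0≤v = 0≤r (suc m) (s≤s z≤n)
     0≤l : 0ℚ ≤ l
     0≤l = 0≤lg 1≤m (ℕ.<⇒≤ m<B)
     0≤δ : 0ℚ ≤ δ
     0≤δ = (≤-by (lg-mono m 1≤m m<B) (solve (lg (suc m) ∷ lg m ∷ []) (v0 :- v1 :+ v1) (c0 :+ v0)))
     uv : u - v ≡ u * v
     uv = r-diff m 1≤m
     δ≤4 : δ ≤ # 4
     δ≤4 = lg-step m 1≤m m<B
     δ≤4u : δ ≤ # 4 * u
     δ≤4u = (≤-by ((0≤u ⊗ (lg-incr m 1≤m m<B)) ⊕ (0≤δ ⊗ (≡⇒≤ (sym (r-inv m 1≤m))))) (solve (u ∷ # m ∷ δ ∷ []) (c4 :* v0 :+ (v0 :* (v1 :* v2) :+ v2 :* c1)) (v2 :+ (v0 :* c4 :+ v2 :* (v1 :* v0)))))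
     lg≡ : lg (suc m) ≡ l + δ
     lg≡ = (solve (lg (suc m) ∷ lg m ∷ []) v0 (v1 :+ (v0 :- v1)))

   -- λ² / m is a combination of the decreasing functions f₁, f₂ and 1/m.
   f₁ f₂ : ℕ → ℚ
   f₁ m = (lg m * lg m + # 8 * lg m + # 48) * r m
   f₂ m = (lg m + # 4) * r m

   f₂-dec : ∀ m → 1 ≼ m → suc m ≼ B → f₂ (suc m) ≤ f₂ m
   f₂-dec m 1≤m m<B = subst (λ z → (z + # 4) * v ≤ f₂ m) (sym lg≡)
     (≤-by ((0≤v ⊗ δ≤4u) ⊕ ((0≤+ 0≤l (0≤# 4)) ⊗ (≡⇒≤ (sym uv))) ⊕ (0≤* (0≤* 0≤l 0≤u) 0≤v)) (solve (l ∷ u ∷ v ∷ δ ∷ []) ((v0 :+ c4) :* v1 :+ (v2 :* v3 :+ (v0 :+ c4) :* (v1 :* v2) :+ c0)) ((v0 :+ v3 :+ c4) :* v2 :+ (v2 :* (c4 :* v1) :+ (v0 :+ c4) :* (v1 :- v2) :+ v0 :* v1 :* v2))))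
     where open Step m 1≤m m<B

   f₁-dec : ∀ m → 1 ≼ m → suc m ≼ B → f₁ (suc m) ≤ f₁ m
   f₁-dec m 1≤m m<B = subst (λ z → (z * z + # 8 * z + # 48) * v ≤ f₁ m) (sym lg≡)
     (≤-by (((0≤* 0≤v (0≤+ (0≤+ (0≤* (0≤# 2) 0≤l) 0≤δ) (0≤# 8))) ⊗ δ≤4u) ⊕ ((0≤* (0≤* (0≤# 4) 0≤u) 0≤v) ⊗ δ≤4) ⊕ ((0≤+ (0≤+ (0≤* 0≤l 0≤l) (0≤* (0≤# 8) 0≤l)) (0≤# 48)) ⊗ (≡⇒≤ (sym uv))) ⊕ (0≤* (0≤* (0≤* 0≤l 0≤l) 0≤u) 0≤v)) (solve (l ∷ u ∷ v ∷ δ ∷ []) ((v0 :* v0 :+ c8 :* v0 :+ cn 48) :* v1 :+ (v2 :* (c2 :* v0 :+ v3 :+ c8) :* v3 :+ c4 :* v1 :* v2 :* v3 :+ (v0 :* v0 :+ c8 :* v0 :+ cn 48) :* (v1 :* v2) :+ c0)) (((v0 :+ v3) :* (v0 :+ v3) :+ c8 :* (v0 :+ v3) :+ cn 48) :* v2 :+ (v2 :* (c2 :* v0 :+ v3 :+ c8) :* (c4 :* v1) :+ c4 :* v1 :* v2 :* c4 :+ (v0 :* v0 :+ c8 :* v0 :+ cn 48) :* (v1 :- v2) :+ v0 :* v0 :* v1 :* v2))))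
     where open Step m 1≤m m<B

   -- Since lg² / m = f₁ - 8 f₂ - 16 / m, partial summation bounds the sum by `N` times the values
   -- at 1, where 48 + 8 · 4 + 16 = 96.
   class-sum-bound : ∀ g g′ y → y ≼ B → ∣ ∑ y (λ m → (κ g m - κ g′ m) * ((lg m * lg m) * r m)) ∣≤ # 96 * # N
   class-sum-bound g g′ y y≤B = subst (∣_∣≤ # 96 * # N) (sym split)
     ( (≤-by ((proj₁ b₁) ⊕ ((0≤# 8) ⊗ (proj₂ b₂)) ⊕ ((0≤# 16) ⊗ (proj₂ b₃)) ⊕ ((0≤# N) ⊗ (≡⇒≤ f₁1)) ⊕ ((0≤* (0≤# 8) (0≤# N)) ⊗ (≡⇒≤ f₂1)) ⊕ ((0≤* (0≤# 16) (0≤# N)) ⊗ (≡⇒≤ r-1))) (solve (S₁ ∷ S₂ ∷ S₃ ∷ # N ∷ f₁ 1 ∷ f₂ 1 ∷ r 1 ∷ []) (v0 :- c8 :* v1 :- cn 16 :* v2 :+ (:- (v3 :* v4) :+ c8 :* v1 :+ cn 16 :* v2 :+ v3 :* v4 :+ c8 :* v3 :* v5 :+ cn 16 :* v3 :* v6)) (:- (cn 96 :* v3) :+ (v0 :+ c8 :* (v3 :* v5) :+ cn 16 :* (v3 :* v6) :+ v3 :* cn 48 :+ c8 :* v3 :* c4 :+ cn 16 :* v3 :* c1))))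
     , (≤-by ((proj₂ b₁) ⊕ ((0≤# 8) ⊗ (proj₁ b₂)) ⊕ ((0≤# 16) ⊗ (proj₁ b₃)) ⊕ ((0≤# N) ⊗ (≡⇒≤ f₁1)) ⊕ ((0≤* (0≤# 8) (0≤# N)) ⊗ (≡⇒≤ f₂1)) ⊕ ((0≤* (0≤# 16) (0≤# N)) ⊗ (≡⇒≤ r-1))) (solve (# N ∷ S₁ ∷ f₂ 1 ∷ r 1 ∷ f₁ 1 ∷ S₂ ∷ S₃ ∷ []) (cn 96 :* v0 :+ (v1 :+ c8 :* (:- (v0 :* v2)) :+ cn 16 :* (:- (v0 :* v3)) :+ v0 :* v4 :+ c8 :* v0 :* v2 :+ cn 16 :* v0 :* v3)) (v1 :- c8 :* v5 :- cn 16 :* v6 :+ (v0 :* v4 :+ c8 :* v5 :+ cn 16 :* v6 :+ v0 :* cn 48 :+ c8 :* v0 :* c4 :+ cn 16 :* v0 :* c1)))))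
     where
     a : ℕ → ℚ
     a m = κ g m - κ g′ m
     S₁ S₂ S₃ : ℚ
     S₁ = ∑ y (λ m → a m * f₁ m)
     S₂ = ∑ y (λ m → a m * f₂ m)
     S₃ = ∑ y (λ m → a m * r m)
     split : ∑ y (λ m → a m * ((lg m * lg m) * r m)) ≡ S₁ - # 8 * S₂ - # 16 * S₃
     split = trans (∑-ext y λ m → (solve (a m ∷ lg m ∷ r m ∷ []) (v0 :* (v1 :* v1 :* v2)) (v0 :* ((v1 :* v1 :+ c8 :* v1 :+ cn 48) :* v2) :- c8 :* (v0 :* ((v1 :+ c4) :* v2)) :- cn 16 :* (v0 :* v2))))
       (trans (∑-sub y _ _) (cong₂ _-_ (trans (∑-sub y _ _) (cong (_-_ S₁) (sym (∑-*ˡ y (# 8) _)))) (sym (∑-*ˡ y (# 16) _))))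
     f₁1 : f₁ 1 ≡ # 48
     f₁1 = trans (cong₂ (λ z w → (z * z + # 8 * z + # 48) * w) lg-1 r-1) (solve [] ((c0 :* c0 :+ c8 :* c0 :+ cn 48) :* c1) (cn 48))
     f₂1 : f₂ 1 ≡ # 4
     f₂1 = trans (cong₂ (λ z w → (z + # 4) * w) lg-1 r-1) (solve [] ((c0 :+ c4) :* c1) c4)
     0≤f₁ : ∀ m → 1 ≼ m → m ≼ B → 0ℚ ≤ f₁ m
     0≤f₁ m p q = 0≤* (0≤+ (0≤+ (0≤* (0≤lg p q) (0≤lg p q)) (0≤* (0≤# 8) (0≤lg p q))) (0≤# 48)) (0≤r m p)
     0≤f₂ : ∀ m → 1 ≼ m → m ≼ B → 0ℚ ≤ f₂ m
     0≤f₂ m p q = 0≤* (0≤+ (0≤lg p q) (0≤# 4)) (0≤r m p)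
     ha : ∀ j → j ≼ y → ∣ ∑ j a ∣≤ # N
     ha j _ = κ-diff-bound g g′ j
     b₁ = abel a f₁ (# N) y ha (λ m p q → f₁-dec m p (≼-trans q y≤B)) (λ p → 0≤f₁ y p y≤B) (0≤f₁ 1 ≼-refl 1≤B)
     b₂ = abel a f₂ (# N) y ha (λ m p q → f₂-dec m p (≼-trans q y≤B)) (λ p → 0≤f₂ y p y≤B) (0≤f₂ 1 ≼-refl 1≤B)
     b₃ = abel a r (# N) y ha (λ m p q → r-anti p (ℕ.n≤1+n m)) (λ p → 0≤r y p) (0≤r 1 ≼-refl)

   -- The test function 1 / n on the class of `g`, cut off at `x`. With this weight the main term is
   -- lg² x and the error is O(lg x).
   H : ℕ → ℕ → ℕ → ℚ
   H g x n = κ g n * (r n * ι (n ≼? x))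

   H-supp : ∀ g {x} → x ≼ B → ∀ n → B ℕ.< n → H g x n ≡ 0ℚ
   H-supp g {x} x≤B n B<n = trans (cong (λ z → κ g n * (r n * z)) (ι-no (n ≼? x) λ n≤x → ℕ.<⇒≱ B<n (≼-trans n≤x x≤B)))
     (solve (κ g n ∷ r n ∷ []) (v0 :* (v1 :* c0)) c0)

   -- The three terms of Selberg's identity: Λ log, Λ * Λ and μ * log².
   A₁ B₂ D : (ℕ → ℚ) → ℚ
   A₁ F = ∑ B (λ e → Λ e * (lg e * F e))
   B₂ F = ∑ B (λ e → Λ e * ∑ B (λ b → Λ b * F (e · b)))
   D F = ∑ B (λ d → μ d * ∑ B (λ m → (lg m * lg m) * F (d · m)))

   -- For d prime to N, division by d carries both classes to classes, whose inner sums differ by at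
   -- most 96 N; the factor 1 / d then sums to at most lg x + 1. For other d both inner sums are
   -- empty, as `g` and `g′` are units.
   D-diff : ∀ g g′ x → Coprime g N → Coprime g′ N → 1 ≼ x → x ≼ B →
            ∣ D (H g x) - D (H g′ x) ∣≤ # 96 * # N * (lg x + 1ℚ)
   D-diff g g′ x g⊥N g′⊥N 1≤x x≤B = subst (∣_∣≤ C * (lg x + 1ℚ)) eq
     ( (≤-by ((proj₁ bd) ⊕ (≡⇒≤ tot) ⊕ (0≤C ⊗ (harmonic x 1≤x x≤B))) (solve (∑ B E ∷ ∑ B (λ d → ι (d ≼? x) * (r d * C)) ∷ C ∷ h x ∷ lg x ∷ []) (v0 :+ (:- v1 :+ v1 :+ v2 :* v3)) (:- (v2 :* (v4 :+ c1)) :+ (v0 :+ v3 :* v2 :+ v2 :* (v4 :+ c1)))))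
     , (≤-by ((proj₂ bd) ⊕ (≡⇒≤ tot) ⊕ (0≤C ⊗ (harmonic x 1≤x x≤B))) (solve (C ∷ lg x ∷ ∑ B E ∷ ∑ B (λ d → ι (d ≼? x) * (r d * C)) ∷ h x ∷ []) (v0 :* (v1 :+ c1) :+ (v2 :+ v3 :+ v0 :* v4)) (v2 :+ (v3 :+ v4 :* v0 :+ v0 :* (v1 :+ c1))))))
     where
     C : ℚ
     C = # 96 * # N
     0≤C : 0ℚ ≤ C
     0≤C = 0≤* (0≤# 96) (0≤# N)
     I : ℕ → ℕ → ℚ
     I g d = ∑ B (λ m → (lg m * lg m) * H g x (d · m))
     E : ℕ → ℚ
     E d = μ d * (I g d - I g′ d)
     eq : ∑ B E ≡ D (H g x) - D (H g′ x)
     eq = trans (∑-ext B λ d → (solve (μ d ∷ I g d ∷ I g′ d ∷ []) (v0 :* (v1 :- v2)) (v0 :* v1 :- v0 :* v2))) (∑-sub B _ _)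
     tot : ∑ B (λ d → ι (d ≼? x) * (r d * C)) ≡ h x * C
     tot = trans (∑-cut (λ d → r d * C) x≤B) (sym (∑-*ʳ x C r))
     bd : ∣ ∑ B E ∣≤ ∑ B (λ d → ι (d ≼? x) * (r d * C))
     bd = ∑-bound B λ d 1≤d _ → Sign-bound (μ-sign d) (inner d 1≤d (coprime? d N))
       where
       inner : ∀ d → 1 ≼ d → Dec (Coprime d N) → ∣ I g d - I g′ d ∣≤ ι (d ≼? x) * (r d * C)
       inner d 1≤d (no ¬c) = subst (∣_∣≤ ι (d ≼? x) * (r d * C)) (sym (trans (cong₂ _-_ (vanish g g⊥N) (vanish g′ g′⊥N)) (solve [] (c0 :- c0) c0)))
         ((≤-by pos (solve (ι (d ≼? x) ∷ r d ∷ C ∷ []) (c0 :+ c0) (:- (v0 :* (v1 :* v2)) :+ v0 :* (v1 :* v2)))) , pos)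
         where
         pos : 0ℚ ≤ ι (d ≼? x) * (r d * C)
         pos = 0≤* (0≤ι (d ≼? x)) (0≤* (0≤r d 1≤d) 0≤C)
         vanish : ∀ g → Coprime g N → I g d ≡ 0ℚ
         vanish g g⊥N = ∑-0 B λ m _ _ → trans (cong (λ z → (lg m * lg m) * (z * (r (d · m) * ι (d · m ≼? x))))
             (ι-no ((d · m) ≅? g [ N ]) λ p → ¬c (coprime-∣ˡ (ℕ.m∣m*n m) (≅-coprime p g⊥N))))
           (solve (lg m ∷ r (d · m) ∷ ι (d · m ≼? x) ∷ []) (v0 :* v0 :* (c0 :* (v1 :* v2))) c0)
       inner d 1≤d (yes d⊥N) = subst (∣_∣≤ ι (d ≼? x) * (r d * C)) (sym main) (bound (d ≼? x))
         where
         i = proj₁ (inverse d⊥N)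
         di≅1 = proj₂ (inverse d⊥N)
         y = x ÷ d
         Q : ℕ → ℚ
         Q g = ∑ y (λ m → κ (i · g) m * ((lg m * lg m) * r m))
         I≡ : ∀ g → I g d ≡ r d * Q g
         I≡ g = trans (∑-cong B λ m 1≤m _ → trans (cong₂ (λ z w → (lg m * lg m) * (z * (w * ι (d · m ≼? x)))) (κ-quot {d} {i} g m di≅1) (r-* d m 1≤d 1≤m))
                         (solve (lg m ∷ κ (i · g) m ∷ r d ∷ r m ∷ ι (d · m ≼? x) ∷ []) (v0 :* v0 :* (v1 :* (v2 :* v3 :* v4))) (v4 :* (v2 :* (v1 :* (v0 :* v0 :* v3))))))
                  (trans (∑-cut-÷ d x _ 1≤d x≤B) (sym (∑-*ˡ y (r d) _)))
         R : ℚ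
         R = ∑ y (λ m → (κ (i · g) m - κ (i · g′) m) * ((lg m * lg m) * r m))
         R≡ : R ≡ Q g - Q g′
         R≡ = trans (∑-ext y λ m → (solve (κ (i · g) m ∷ κ (i · g′) m ∷ lg m ∷ r m ∷ []) ((v0 :- v1) :* (v2 :* v2 :* v3)) (v0 :* (v2 :* v2 :* v3) :- v1 :* (v2 :* v2 :* v3)))) (∑-sub y _ _)
         main : I g d - I g′ d ≡ r d * R
         main = trans (cong₂ _-_ (I≡ g) (I≡ g′)) (trans (solve (r d ∷ Q g ∷ Q g′ ∷ []) (v0 :* v1 :- v0 :* v2) (v0 :* (v1 :- v2))) (cong (r d *_) (sym R≡)))
         bound : (e : Dec (d ≼ x)) → ∣ r d * R ∣≤ ι e * (r d * C)
         bound (yes _) = (≤-by ((0≤r d 1≤d) ⊗ (proj₁ cs)) (solve (r d ∷ R ∷ C ∷ []) (v0 :* v1 :+ v0 :* (:- v2)) (:- (c1 :* (v0 :* v2)) :+ v0 :* v1))) , (≤-by ((0≤r d 1≤d) ⊗ (proj₂ cs)) (solve (r d ∷ C ∷ R ∷ []) (c1 :* (v0 :* v1) :+ v0 :* v2) (v0 :* v2 :+ v0 :* v1)))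
           where
           cs : ∣ R ∣≤ C
           cs = class-sum-bound (i · g) (i · g′) y (≼-trans (÷-≤-self d x 1≤d) x≤B)
         bound (no d≰x) = subst (∣_∣≤ 0ℚ * (r d * C)) (sym (trans (cong (r d *_) R≡0) (zeroʳ (r d))))
                            (≤-reflexive (solve (r d ∷ C ∷ []) (:- (c0 :* (v0 :* v1))) c0) , ≤-reflexive (solve (r d ∷ C ∷ []) c0 (c0 :* (v0 :* v1))))
           where
           y≡0 : y ≡ 0
           y≡0 = ℕ.n<1⇒n≡0 (ℕ.≰⇒> λ p → d≰x (≼-trans (≼-reflexive (sym (ℕ.*-identityʳ d))) (÷-≤ d x 1 1≤d p)))
           R≡0 : R ≡ 0ℚ
           R≡0 = cong (λ z → ∑ z (λ m → (κ (i · g) m - κ (i · g′) m) * ((lg m * lg m) * r m))) y≡0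

   W : ℕ → ℚ
   W e = Λ e * (υ e * r e)

   P° : ℕ → ℚ
   P° y = ∑ y W

   0≤υ : ∀ n → 0ℚ ≤ υ n
   0≤υ n = 0≤ι (coprime? n N)

   υ≤1 : ∀ n → υ n ≤ 1ℚ
   υ≤1 n = ι≤1 (coprime? n N)

   0≤W : ∀ e → 1 ≼ e → 0ℚ ≤ W e
   0≤W e 1≤e = 0≤* (Λ≥0 e) (0≤* (0≤υ e) (0≤r e 1≤e))

   P°-upper : ∀ y → 1 ≼ y → suc y ≼ B → P° y ≤ lg y + # 6
   P°-upper y 1≤y y<B = ≤-trans (∑-mono y λ e 1≤e _ → (≤-by (((0≤* (Λ≥0 e) (0≤r e 1≤e)) ⊗ (υ≤1 e)) ⊕ (≤-reflexive (solve (Λ e ∷ υ e ∷ r e ∷ []) (v0 :* (v1 :* v2)) (v0 :* v2 :* v1)))) (solve (Λ e ∷ r e ∷ υ e ∷ W e ∷ []) (v0 :* v1 :+ (v0 :* v1 :* v2 :+ v3)) (v3 :+ (v0 :* v1 :* c1 :+ v0 :* v1 :* v2))))) (mertens-upper y 1≤y y<B)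

   -- Compared with `P`, only powers of primes p ∣ N are missing. Such a prime contributes at most 2
   -- ℓ(p) / p ≤ 8, because ℓ(p) ≤ 4 p, and at most N primes divide N.
   P°-lower : ∀ y → 1 ≼ y → y ≼ B → lg y - (# 4 + # 8 * # N) ≤ P° y
   P°-lower y 1≤y y≤B = (≤-by ((mertens-lower y 1≤y y≤B) ⊕ (≡⇒≤ diff) ⊕ (≡⇒≤ (∑-Λ F)) ⊕ (∑-mono B (λ p 1≤p _ → G≤ p (prime? p) (p ∣? N))) ⊕ cnt) (solve (P° y ∷ lg y ∷ P y ∷ ∑ B (λ d → Λ d * F d) ∷ ∑ B G ∷ ∑ B (λ p → ι (p ∣? N) * # 8) ∷ # N ∷ []) (v0 :+ (v1 :- c4 :+ (v2 :- v0) :+ v3 :+ v4 :+ v5)) (v1 :- (c4 :+ c8 :* v6) :+ (v2 :+ v3 :+ v4 :+ v5 :+ v6 :* c8))))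
     where
     F : ℕ → ℚ
     F d = ι (d ≼? y) * ((1ℚ - υ d) * r d)
     G : ℕ → ℚ
     G p = ι (prime? p) * ∑ B (λ k → ι (p ^ k ≼? B) * (ℓ p * F (p ^ k)))
     diff : P y - P° y ≡ ∑ B (λ d → Λ d * F d)
     diff = sym (trans (∑-ext B λ d → (solve (Λ d ∷ ι (d ≼? y) ∷ υ d ∷ r d ∷ []) (v0 :* (v1 :* ((c1 :- v2) :* v3))) (v1 :* (v0 :* v3 :- v0 :* (v2 :* v3)))))
       (trans (∑-cut _ y≤B) (∑-sub y _ _)))
     cnt : ∑ B (λ p → ι (p ∣? N) * # 8) ≤ # N * # 8
     cnt = ≤-trans (≤-reflexive (∑-trunc (λ p → ι (p ∣? N) * # 8) N≤B λ p N<p _ → ι-*-no (p ∣? N) λ d → ℕ.<⇒≱ N<p (ℕ.∣⇒≤ {{ℕ.>-nonZero 1≤N}} d)))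
       (≤-trans (∑-mono N λ p _ _ → (≤-by ((0≤# 8) ⊗ (ι≤1 (p ∣? N))) (solve (ι (p ∣? N) ∷ []) (c8 :+ c8 :* v0) (v0 :* c8 :+ c8 :* c1)))) (≤-reflexive (∑-const N (# 8))))
     G≤ : ∀ p (dp : Dec (Prime p)) (dN : Dec (p ∣ N)) → ι dp * ∑ B (λ k → ι (p ^ k ≼? B) * (ℓ p * F (p ^ k))) ≤ ι dN * # 8
     G≤ p (no _) dN = subst (_≤ ι dN * # 8) (sym (zeroˡ _)) (0≤* (0≤ι dN) (0≤# 8))
     G≤ p (yes pp) (no p∤N) = ≤-reflexive (trans (*-identityˡ _) (trans (∑-0 B λ k _ _ → trans
         (cong (λ z → ι (p ^ k ≼? B) * (ℓ p * (ι (p ^ k ≼? y) * ((1ℚ - z) * r (p ^ k))))) (ι-yes (coprime? (p ^ k) N) (coprime-^ˡ k (prime∤⇒coprime pp p∤N))))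
         (solve (ι (p ^ k ≼? B) ∷ ℓ p ∷ ι (p ^ k ≼? y) ∷ r (p ^ k) ∷ []) (v0 :* (v1 :* (v2 :* ((c1 :- c1) :* v3)))) c0)) (sym (zeroˡ (# 8)))))
     G≤ p (yes pp) (yes p∣N) = (≤-by ((∑-mono B (λ k _ _ → term k)) ⊕ (≡⇒≤ (sym (∑-*ˡ B (ℓ p) _))) ⊕ ((0≤ℓ p) ⊗ (geometric p B (prime≥2 pp))) ⊕ ((0≤* (0≤# 2) (0≤r p 1≤p)) ⊗ ℓ≤) ⊕ ((0≤# 8) ⊗ (≡⇒≤ (r-inv p 1≤p)))) (solve (∑ B (λ k → ι (p ^ k ≼? B) * (ℓ p * F (p ^ k))) ∷ ∑ B (λ k → ℓ p * r (p ^ k)) ∷ ℓ p ∷ ∑ B (λ k → r (p ^ k)) ∷ r p ∷ # p ∷ []) (c1 :* c8 :+ (v0 :+ v1 :+ v2 :* v3 :+ c2 :* v4 :* v2 :+ c8 :* (v5 :* v4))) (c1 :* v0 :+ (v1 :+ v2 :* v3 :+ v2 :* (c2 :* v4) :+ c2 :* v4 :* (c4 :* v5) :+ c8 :* c1))))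
       where
       1≤p = prime-≥1 pp
       p≤B = ≼-trans (ℕ.∣⇒≤ {{ℕ.>-nonZero 1≤N}} p∣N) N≤B
       ℓ≤ : ℓ p ≤ # 4 * # p
       ℓ≤ = subst (_≤ # 4 * # p) (lg-prime p pp p≤B) (lg-linear p 1≤p p≤B)
       term : ∀ k → ι (p ^ k ≼? B) * (ℓ p * F (p ^ k)) ≤ ℓ p * r (p ^ k)
       term k = (≤-by (((0≤* (0≤ℓ p) (0≤* (0≤ι (p ^ k ≼? y)) (0≤* 0≤1-υ 0≤rk))) ⊗ (ι≤1 (p ^ k ≼? B))) ⊕ ((0≤* (0≤ℓ p) (0≤* 0≤1-υ 0≤rk)) ⊗ (ι≤1 (p ^ k ≼? y))) ⊕ ((0≤* (0≤ℓ p) 0≤rk) ⊗ (0≤υ (p ^ k)))) (solve (ℓ p ∷ r (p ^ k) ∷ ι (p ^ k ≼? y) ∷ υ (p ^ k) ∷ ι (p ^ k ≼? B) ∷ []) (v0 :* v1 :+ (v0 :* (v2 :* ((c1 :- v3) :* v1)) :* v4 :+ v0 :* ((c1 :- v3) :* v1) :* v2 :+ v0 :* v1 :* c0)) (v4 :* (v0 :* (v2 :* ((c1 :- v3) :* v1))) :+ (v0 :* (v2 :* ((c1 :- v3) :* v1)) :* c1 :+ v0 :* ((c1 :- v3) :* v1) :* c1 :+ v0 :* v1 :* v3))))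
         where
         0≤rk = 0≤r (p ^ k) (ℕ.m^n>0 p {{ℕ.>-nonZero 1≤p}} k)
         0≤1-υ : 0ℚ ≤ 1ℚ - υ (p ^ k)
         0≤1-υ = (≤-by (υ≤1 (p ^ k)) (solve (υ (p ^ k) ∷ []) (c1 :- v0 :+ v0) (c0 :+ c1)))

   lg-÷-upper : ∀ e x → 1 ≼ e → e ≼ x → x ≼ B → lg e + lg (x ÷ e) ≤ lg x
   lg-÷-upper e x 1≤e e≤x x≤B = subst (_≤ lg x) (lg-* e (x ÷ e) 1≤e 1≤y (≼-trans ey≤x x≤B)) (lg-≤ (ℕ.*-mono-≤ 1≤e 1≤y) ey≤x x≤B)
     where
     1≤y = ÷-≥1 e x 1≤e e≤x
     ey≤x = ÷-≤ e x (x ÷ e) 1≤e ≼-refl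

   lg-÷-lower : ∀ e x → 1 ≼ e → e ≼ x → 2 · x ≼ B → lg x ≤ 1ℚ + (lg e + lg (x ÷ e))
   lg-÷-lower e x 1≤e e≤x 2x≤B = ≤-trans (lg-≤ (≼-trans 1≤e e≤x) x≤ 2ey≤B)
     (≤-reflexive (trans (lg-double (e · y) (ℕ.*-mono-≤ 1≤e 1≤y) 2ey≤B) (cong (1ℚ +_) (lg-* e y 1≤e 1≤y (≼-trans (ℕ.m≤m+n (e · y) _) 2ey≤B)))))
     where
     y = x ÷ e
     1≤y = ÷-≥1 e x 1≤e e≤x
     2ey≤B : 2 · (e · y) ≼ B
     2ey≤B = ≼-trans (ℕ.*-monoʳ-≤ 2 (÷-≤ e x y 1≤e ≼-refl)) 2x≤B
     x≤ : x ≼ 2 · (e · y)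
     x≤ = begin
       x ≤⟨ ℕ.<⇒≤ (<-÷ e x 1≤e) ⟩
       e · suc y ≤⟨ ℕ.*-monoʳ-≤ e (ℕ.+-monoˡ-≤ y 1≤y) ⟩
       e · (y ∔ y) ≡⟨ lem e y ⟩
       2 · (e · y) ∎
       where
       open ℕ.≤-Reasoning
       lem : ∀ e y → e · (y ∔ y) ≡ 2 · (e · y)
       lem = solve-∀

   H° : ℕ → ℕ → ℚ
   H° x n = υ n * (r n * ι (n ≼? x))

   A₁° : ∀ x → x ≼ B → A₁ (H° x) ≡ ∑ x (λ e → W e * lg e)
   A₁° x x≤B = trans (∑-ext B λ e → (solve (Λ e ∷ lg e ∷ υ e ∷ r e ∷ ι (e ≼? x) ∷ []) (v0 :* (v1 :* (v2 :* (v3 :* v4)))) (v4 :* (v0 :* (v2 :* v3) :* v1)))) (∑-cut _ x≤B)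

   B₂° : ∀ x → x ≼ B → B₂ (H° x) ≡ ∑ x (λ e → W e * P° (x ÷ e))
   B₂° x x≤B = trans (∑-cong B λ e 1≤e _ → trans (cong (Λ e *_) (inner e 1≤e)) (solve (Λ e ∷ υ e ∷ r e ∷ P° (x ÷ e) ∷ []) (v0 :* (v1 :* v2 :* v3)) (v0 :* (v1 :* v2) :* v3)))
     (∑-trunc (λ e → W e * P° (x ÷ e)) x≤B λ { e@(suc _) x<e _ → trans (cong (λ z → W e * P° z) (ℕ.m<n⇒m/n≡0 x<e)) (zeroʳ (W e)) })
     where
     inner : ∀ e → 1 ≼ e → ∑ B (λ b → Λ b * H° x (e · b)) ≡ (υ e * r e) * P° (x ÷ e)
     inner e 1≤e = trans (∑-cong B λ b 1≤b _ → trans (cong₂ (λ z w → Λ b * (z * (w * ι (e · b ≼? x)))) (υ-* e b) (r-* e b 1≤e 1≤b))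
         (solve (Λ b ∷ υ e ∷ υ b ∷ r e ∷ r b ∷ ι (e · b ≼? x) ∷ []) (v0 :* (v1 :* v2 :* (v3 :* v4 :* v5))) (v5 :* (v1 :* v3 :* (v0 :* (v2 :* v4))))))
       (trans (∑-cut-÷ e x _ 1≤e x≤B) (sym (∑-*ˡ (x ÷ e) (υ e * r e) W)))

   c₃ : ℕ
   c₃ = 36 ∔ 48 · N

   private
     #c₃ : # c₃ ≡ # 36 + # 48 * # N
     #c₃ = trans (#-+ 36 (48 · N)) (cong (# 36 +_) (#-* 48 N))

   -- Over all unit classes together the two terms combine to Σ W(e) (lg e + P° (x / e)). The
   -- bracket is lg x up to a constant by Mertens, and so is the sum of the weights.
   total : ∀ x → 1 ≼ x → 2 · x ≼ B → ∣ (A₁ (H° x) + B₂ (H° x)) - lg x * lg x ∣≤ # c₃ * (lg x + 1ℚ)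
   total x 1≤x 2x≤B =
       (≤-by ((≡⇒≤ (sym eq)) ⊕ lo ⊕ (0≤lgx ⊗ (P°-lower x 1≤x x≤B)) ⊕ ((0≤+ (0≤# 5) (0≤* (0≤# 8) (0≤# N))) ⊗ (P°-upper x 1≤x x<B)) ⊕ ((0≤+ 0≤lgx 0≤1) ⊗ (≡⇒≤ (sym #c₃))) ⊕ ((0≤* 0≤lgx (0≤# N)) ⊗ (0≤# 32)) ⊕ (0≤lgx ⊗ (0≤# 27)) ⊕ (0≤# 6)) (solve (A₁ (H° x) ∷ B₂ (H° x) ∷ lg x ∷ ∑ x (λ e → W e * (lg e + P° (x ÷ e))) ∷ P° x ∷ # N ∷ # c₃ ∷ []) (v0 :+ v1 :- v2 :* v2 :+ (v3 :+ v4 :* (v2 :- (cn 5 :+ c8 :* v5)) :+ v2 :* (v2 :- (c4 :+ c8 :* v5)) :+ (cn 5 :+ c8 :* v5) :* v4 :+ (v2 :+ c1) :* (cn 36 :+ cn 48 :* v5) :+ v2 :* v5 :* c0 :+ v2 :* c0 :+ c0)) (:- (v6 :* (v2 :+ c1)) :+ (v0 :+ v1 :+ v3 :+ v2 :* v4 :+ (cn 5 :+ c8 :* v5) :* (v2 :+ c6) :+ (v2 :+ c1) :* v6 :+ v2 :* v5 :* cn 32 :+ v2 :* cn 27 :+ c6))))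
     , (≤-by ((≡⇒≤ eq) ⊕ hi ⊕ ((0≤+ 0≤lgx (0≤# 6)) ⊗ (P°-upper x 1≤x x<B)) ⊕ ((0≤+ 0≤lgx 0≤1) ⊗ (≡⇒≤ (sym #c₃))) ⊕ (0≤lgx ⊗ (0≤# 24)) ⊕ ((0≤* (0≤+ 0≤lgx 0≤1) (0≤# 48)) ⊗ (0≤# N))) (solve (# c₃ ∷ lg x ∷ A₁ (H° x) ∷ B₂ (H° x) ∷ ∑ x (λ e → W e * (lg e + P° (x ÷ e))) ∷ P° x ∷ # N ∷ []) (v0 :* (v1 :+ c1) :+ (v2 :+ v3 :+ v4 :+ (v1 :+ c6) :* v5 :+ (v1 :+ c1) :* (cn 36 :+ cn 48 :* v6) :+ v1 :* c0 :+ (v1 :+ c1) :* cn 48 :* c0)) (v2 :+ v3 :- v1 :* v1 :+ (v4 :+ v5 :* (v1 :+ c6) :+ (v1 :+ c6) :* (v1 :+ c6) :+ (v1 :+ c1) :* v0 :+ v1 :* cn 24 :+ (v1 :+ c1) :* cn 48 :* v6))))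
     where
     x≤B : x ≼ B
     x≤B = ≼-trans (ℕ.m≤m+n x _) 2x≤B
     x<B : suc x ≼ B
     x<B = ≼-trans (ℕ.+-monoˡ-≤ x 1≤x) (≼-trans (≼-reflexive (cong (x ℕ.+_) (sym (ℕ.+-identityʳ x)))) 2x≤B)
     0≤lgx = 0≤lg 1≤x x≤B
     eq : A₁ (H° x) + B₂ (H° x) ≡ ∑ x (λ e → W e * (lg e + P° (x ÷ e)))
     eq = trans (cong₂ _+_ (A₁° x x≤B) (B₂° x x≤B)) (trans (sym (∑-+ x _ _)) (∑-ext x λ e → sym (distribˡ (W e) _ _)))
     hi : ∑ x (λ e → W e * (lg e + P° (x ÷ e))) ≤ P° x * (lg x + # 6)
     hi = ≤-trans (∑-mono x λ e 1≤e e≤x → 0≤W e 1≤e ⊗ (≤-by ((P°-upper (x ÷ e) (÷-≥1 e x 1≤e e≤x) (≼-trans (s≤s (÷-≤-self e x 1≤e)) x<B)) ⊕ (lg-÷-upper e x 1≤e e≤x x≤B)) (solve (lg x ∷ P° (x ÷ e) ∷ lg e ∷ lg (x ÷ e) ∷ []) (v0 :+ c6 :+ (v1 :+ (v2 :+ v3))) (v2 :+ v1 :+ (v3 :+ c6 :+ v0)))))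
       (≤-reflexive (sym (∑-*ʳ x (lg x + # 6) W)))
     lo : P° x * (lg x - (# 5 + # 8 * # N)) ≤ ∑ x (λ e → W e * (lg e + P° (x ÷ e)))
     lo = ≤-trans (≤-reflexive (∑-*ʳ x (lg x - (# 5 + # 8 * # N)) W)) (∑-mono x λ e 1≤e e≤x → 0≤W e 1≤e ⊗
       (≤-by ((P°-lower (x ÷ e) (÷-≥1 e x 1≤e e≤x) (≼-trans (÷-≤-self e x 1≤e) x≤B)) ⊕ (lg-÷-lower e x 1≤e e≤x 2x≤B)) (solve (lg e ∷ P° (x ÷ e) ∷ lg (x ÷ e) ∷ # N ∷ lg x ∷ []) (v0 :+ v1 :+ (v2 :- (c4 :+ c8 :* v3) :+ v4)) (v4 :- (cn 5 :+ c8 :* v3) :+ (v1 :+ (c1 :+ (v0 :+ v2)))))))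

   c₄ : ℕ
   c₄ = c₃ ∔ N · (96 · N)

   #c₄ : # c₄ ≡ # c₃ + # N * (# 96 * # N)
   #c₄ = trans (#-+ c₃ _) (cong (# c₃ +_) (trans (#-* N (96 · N)) (cong (# N *_) (#-* 96 N))))

   -- By `D-diff` all unit classes have nearly equal values of `D`, so `Φ` times one of them is
   -- nearly their sum, which `total` evaluates. Comparing with up to `N` classes at 96 N each is
   -- the part N · 96 N of `c₄`.
   selberg : ∀ g x → Coprime g N → 1 ≼ x → 2 · x ≼ B →
             ∣ Φ * (A₁ (H g x) + B₂ (H g x)) - lg x * lg x ∣≤ # c₄ * (lg x + 1ℚ)
   selberg g x g⊥N 1≤x 2x≤B =
       (≤-by ((proj₁ bd) ⊕ (0≤Φ ⊗ (≡⇒≤ (SI (H g x) (H-supp g x≤B)))) ⊕ (≡⇒≤ (sym (SI (H° x) H°-supp))) ⊕ (proj₁ (total x 1≤x 2x≤B)) ⊕ (≡⇒≤ (∑-const N C)) ⊕ (0≤lgx+1 ⊗ (≡⇒≤ (sym #c₄))) ⊕ (≤-reflexive (solve (# N ∷ lg x ∷ []) (v0 :* (cn 96 :* v0 :* (v1 :+ c1))) ((v1 :+ c1) :* (v0 :* (cn 96 :* v0)))))) (solve (Φ ∷ A₁ (H g x) ∷ B₂ (H g x) ∷ lg x ∷ ∑ N (λ _ → C) ∷ D (H g x) ∷ A₁ (H° x) ∷ B₂ (H° x) ∷ # c₃ ∷ # N ∷ C ∷ # c₄ ∷ D (H° x) ∷ []) (v0 :* (v1 :+ v2) :- v3 :*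 v3 :+ (:- v4 :+ v0 :* v5 :+ (v6 :+ v7) :+ (:- (v8 :* (v3 :+ c1))) :+ v4 :+ (v3 :+ c1) :* (v8 :+ v9 :* (cn 96 :* v9)) :+ v9 :* v10)) (:- (v11 :* (v3 :+ c1)) :+ (v0 :* v5 :- v12 :+ v0 :* (v1 :+ v2) :+ v12 :+ (v6 :+ v7 :- v3 :* v3) :+ v9 :* v10 :+ (v3 :+ c1) :* v11 :+ (v3 :+ c1) :* (v9 :* (cn 96 :* v9))))))
     , (≤-by ((proj₂ bd) ⊕ (0≤Φ ⊗ (≡⇒≤ (sym (SI (H g x) (H-supp g x≤B))))) ⊕ (≡⇒≤ (SI (H° x) H°-supp)) ⊕ (proj₂ (total x 1≤x 2x≤B)) ⊕ (≡⇒≤ (∑-const N C)) ⊕ (0≤lgx+1 ⊗ (≡⇒≤ (sym #c₄))) ⊕ (≤-reflexive (solve (# N ∷ lg x ∷ []) (v0 :* (cn 96 :* v0 :* (v1 :+ c1))) ((v1 :+ c1) :* (v0 :* (cn 96 :* v0)))))) (solve (# c₄ ∷ lg x ∷ Φ ∷ D (H g x) ∷ D (H° x) ∷ A₁ (H g x) ∷ B₂ (H g x) ∷ A₁ (H° x) ∷ B₂ (H° x) ∷ ∑ N (λ _ → C) ∷ # c₃ ∷ # N ∷ C ∷ []) (v0 :* (v1 :+ c1) :+ (v2 :* v3 :- v4 :+ v2 :* (v5 :+ v6) :+ v4 :+ (v7 :+ v8 :- v1 :* v1) :+ v9 :+ (v1 :+ c1) :* (v10 :+ v11 :* (cn 96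 :* v11)) :+ v11 :* v12)) (v2 :* (v5 :+ v6) :- v1 :* v1 :+ (v9 :+ v2 :* v3 :+ (v7 :+ v8) :+ v10 :* (v1 :+ c1) :+ v11 :* v12 :+ (v1 :+ c1) :* v0 :+ (v1 :+ c1) :* (v11 :* (cn 96 :* v11))))))
     where
     x≤B = ≼-trans (ℕ.m≤m+n x _) 2x≤B
     C : ℚ
     C = # 96 * # N * (lg x + 1ℚ)
     0≤Φ : 0ℚ ≤ Φ
     0≤Φ = 0≤∑ N λ g _ _ → 0≤υ g
     0≤lgx+1 : 0ℚ ≤ lg x + 1ℚ
     0≤lgx+1 = 0≤+ (0≤lg 1≤x x≤B) 0≤1
     0≤C : 0ℚ ≤ C
     0≤C = 0≤* (0≤* (0≤# 96) (0≤# N)) 0≤lgx+1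
     SI : ∀ F → (∀ n → B ℕ.< n → F n ≡ 0ℚ) → D F ≡ A₁ F + B₂ F
     SI = selberg-identity
     H°-supp : ∀ n → B ℕ.< n → H° x n ≡ 0ℚ
     H°-supp n B<n = trans (cong (λ z → υ n * (r n * z)) (ι-no (n ≼? x) λ n≤x → ℕ.<⇒≱ B<n (≼-trans n≤x x≤B)))
       (solve (υ n ∷ r n ∷ []) (v0 :* (v1 :* c0)) c0)
     H°≡ : ∀ n → H° x n ≡ ∑ N (λ g → υ g * H g x n)
     H°≡ n = trans (cong (_* (r n * ι (n ≼? x))) (sym (∑-υκ n))) (trans (∑-*ʳ N _ _) (∑-ext N λ g → *-assoc (υ g) (κ g n) _))
     D-lin : D (H° x) ≡ ∑ N (λ g → υ g * D (H g x))
     D-lin = begin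
       ∑ B (λ d → μ d * ∑ B (λ m → (lg m * lg m) * H° x (d · m)))
         ≡⟨ ∑-ext B (λ d → cong (μ d *_) (trans (∑-ext B λ m → trans (cong ((lg m * lg m) *_) (H°≡ (d · m))) (pull1 (lg m * lg m) d m)) (trans (∑-swap B N _) (∑-ext N λ g → sym (∑-*ˡ B (υ g) _))))) ⟩
       ∑ B (λ d → μ d * ∑ N (λ g → υ g * ∑ B (λ m → (lg m * lg m) * H g x (d · m))))
         ≡⟨ ∑-ext B (λ d → trans (∑-*ˡ N (μ d) _) (∑-ext N λ g → (solve (μ d ∷ υ g ∷ ∑ B (λ m → (lg m * lg m) * H g x (d · m)) ∷ []) (v0 :* (v1 :* v2)) (v1 :* (v0 :* v2))))) ⟩
       ∑ B (λ d → ∑ N (λ g → υ g * (μ d * ∑ B (λ m → (lg m * lg m) * H g x (d · m)))))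
         ≡⟨ trans (∑-swap B N _) (∑-ext N λ g → sym (∑-*ˡ B (υ g) _)) ⟩
       ∑ N (λ g → υ g * D (H g x)) ∎
       where
       open ≡-Reasoning
       pull1 : ∀ c d m → c * ∑ N (λ g → υ g * H g x (d · m)) ≡ ∑ N (λ g → υ g * (c * H g x (d · m)))
       pull1 c d m = trans (∑-*ˡ N c _) (∑-ext N λ g → (solve (c ∷ υ g ∷ H g x (d · m) ∷ []) (v0 :* (v1 :* v2)) (v1 :* (v0 :* v2))))
     bd : ∣ Φ * D (H g x) - D (H° x) ∣≤ ∑ N (λ _ → C)
     bd = subst (∣_∣≤ ∑ N (λ _ → C)) (trans (∑-ext N λ g′ → (solve (υ g′ ∷ D (H g x) ∷ D (H g′ x) ∷ []) (v0 :* (v1 :- v2)) (v0 :* v1 :- v0 :* v2)))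
            (trans (∑-sub N _ _) (cong₂ _-_ (sym (∑-*ʳ N (D (H g x)) υ)) (sym D-lin))))
          (∑-bound N λ g′ _ _ → term g′ (coprime? g′ N))
       where
       term : ∀ g′ (d : Dec (Coprime g′ N)) → ∣ ι d * (D (H g x) - D (H g′ x)) ∣≤ C
       term g′ (yes g′⊥N) = subst (∣_∣≤ C) (sym (*-identityˡ _)) (D-diff g g′ x g⊥N g′⊥N 1≤x x≤B)
       term g′ (no _) = subst (∣_∣≤ C) (sym (zeroˡ _)) ((≤-by 0≤C (solve (C ∷ []) (c0 :+ c0) (:- v0 :+ v0))) , 0≤C)

 -- Upper bounds for the primes in a class.

 module ClassDensity (𝓛 : LogData) (N : ℕ) (1≤N : 1 ≼ N) (N≤B : N ≼ LogData.B 𝓛) where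

   open SelbergFormula 𝓛 N 1≤N N≤B public

   V : ℕ → ℕ → ℚ
   V g e = Λ e * (κ g e * r e)

   -- The factor `Φ`, the number of unit classes, normalises `p` so that equidistribution would mean
   -- p g x ≈ lg x.
   Pₐ p A : ℕ → ℕ → ℚ
   Pₐ g x = ∑ x (V g)
   p g x = Φ * Pₐ g x
   A g x = A₁ (H g x)

   0≤Φ : 0ℚ ≤ Φ
   0≤Φ = 0≤∑ N λ g _ _ → 0≤υ g

   Φ≤N : Φ ≤ # N
   Φ≤N = ≤-trans (∑-mono N λ g _ _ → υ≤1 g) (≤-reflexive (trans (∑-const N 1ℚ) (*-identityʳ _)))

   1≤Φ : 1ℚ ≤ Φ
   1≤Φ = ≤-trans (≤-reflexive (sym (trans (+-identityˡ _) (ι-yes (coprime? 1 N) 1-coprime)))) (∑-≤-trunc υ 1≤N λ g _ _ → 0≤υ g)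

   0≤κ : ∀ g n → 0ℚ ≤ κ g n
   0≤κ g n = 0≤ι (n ≅? g [ N ])

   0≤V : ∀ g e → 1 ≼ e → 0ℚ ≤ V g e
   0≤V g e 1≤e = 0≤* (Λ≥0 e) (0≤* (0≤κ g e) (0≤r e 1≤e))

   0≤Pₐ : ∀ g x → 0ℚ ≤ Pₐ g x
   0≤Pₐ g x = 0≤∑ x λ e 1≤e _ → 0≤V g e 1≤e

   0≤p : ∀ g x → 0ℚ ≤ p g x
   0≤p g x = 0≤* 0≤Φ (0≤Pₐ g x)

   Pₐ-mono : ∀ g {x y} → x ≼ y → Pₐ g x ≤ Pₐ g y
   Pₐ-mono g x≤y = ∑-≤-trunc (V g) x≤y λ e 1≤e _ → 0≤V g e 1≤e

   p-mono : ∀ g {x y} → x ≼ y → p g x ≤ p g y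
   p-mono g x≤y = 0≤Φ ⊗ Pₐ-mono g x≤y

   p-cong : ∀ {g g′} x → g ≅ g′ [ N ] → p g x ≡ p g′ x
   p-cong x e = cong (Φ *_) (∑-ext x λ n → cong (λ z → Λ n * (z * r n)) (κ-cong n e))

   p-crude : ∀ g x → 1 ≼ x → suc x ≼ B → p g x ≤ # N * (lg x + # 6)
   p-crude g x 1≤x x<B = (≤-by ((0≤Φ ⊗ le) ⊕ (0≤Φ ⊗ (mertens-upper x 1≤x x<B)) ⊕ ((0≤+ (0≤lg 1≤x (ℕ.<⇒≤ x<B)) (0≤# 6)) ⊗ Φ≤N) ⊕ (≤-reflexive refl)) (solve (# N ∷ lg x ∷ Φ ∷ Pₐ g x ∷ P x ∷ p g x ∷ []) (v0 :* (v1 :+ c6) :+ (v2 :* v3 :+ v2 :* v4 :+ (v1 :+ c6) :* v2 :+ v5)) (v5 :+ (v2 :* v4 :+ v2 :* (v1 :+ c6) :+ (v1 :+ c6) :* v0 :+ v2 :* v3))))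
     where
     le : Pₐ g x ≤ P x
     le = ∑-mono x λ e 1≤e _ → (≤-by ((0≤* (Λ≥0 e) (0≤r e 1≤e)) ⊗ (ι≤1 (e ≅? g [ N ]))) (solve (Λ e ∷ r e ∷ κ g e ∷ []) (v0 :* v1 :+ v0 :* v1 :* v2) (v0 :* (v2 :* v1) :+ v0 :* v1 :* c1)))

   A≡ : ∀ g x → x ≼ B → A g x ≡ ∑ x (λ e → V g e * lg e)
   A≡ g x x≤B = trans (∑-ext B λ e → (solve (Λ e ∷ lg e ∷ κ g e ∷ r e ∷ ι (e ≼? x) ∷ []) (v0 :* (v1 :* (v2 :* (v3 :* v4)))) (v4 :* (v0 :* (v2 :* v3) :* v1)))) (∑-cut _ x≤B)

   A≤ : ∀ g x → 1 ≼ x → x ≼ B → A g x ≤ lg x * Pₐ g x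
   A≤ g x 1≤x x≤B = subst₂ _≤_ (sym (A≡ g x x≤B)) (trans (sym (∑-*ʳ x (lg x) (V g))) (*-comm _ _))
     (∑-mono x λ e 1≤e e≤x → 0≤V g e 1≤e ⊗ lg-≤ 1≤e e≤x x≤B)

   B₂-mono : ∀ g {x y} → x ≼ y → B₂ (H g x) ≤ B₂ (H g y)
   B₂-mono g {x} {y} x≤y = ∑-mono B λ e 1≤e _ → Λ≥0 e ⊗ ∑-mono B λ b 1≤b _ → Λ≥0 b ⊗ (0≤κ g (e · b) ⊗ (0≤r (e · b) (ℕ.*-mono-≤ 1≤e 1≤b) ⊗ lem (e · b ≼? x) (e · b ≼? y)))
     where
     lem : ∀ {n} (d : Dec (n ≼ x)) (d′ : Dec (n ≼ y)) → ι d ≤ ι d′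
     lem (yes q) d′ = ≤-reflexive (sym (ι-yes d′ (≼-trans q x≤y)))
     lem (no _) d′ = 0≤ι d′

   -- Partial summation for sums weighted by the logarithm, multiplied by 2 to avoid a fraction.
   abel-log : ∀ (f : ℕ → ℚ) α β x → 0ℚ ≤ α → 1 ≼ x → x ≼ B →
              (∀ n → 1 ≼ n → n ℕ.< x → ∑ n f ≤ α * lg n + β) →
              # 2 * lg x * ∑ x f - α * (lg x * lg x) - # 2 * β * lg x ≤ # 2 * ∑ x (λ e → f e * lg e)
   abel-log f α β (suc zero) 0≤α _ _ _ = ≤-reflexive (trans (cong (λ z → # 2 * z * (0ℚ + f 1) - α * (z * z) - # 2 * β * z) lg-1)
     (trans (solve (f 1 ∷ α ∷ β ∷ []) (c2 :* c0 :* (c0 :+ v0) :- v1 :* (c0 :* c0) :- c2 :* v2 :* c0) (c2 :* (c0 :+ v0 :* c0))) (cong (λ z → # 2 * (0ℚ + f 1 * z)) (sym lg-1))))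
   abel-log f α β (suc x@(suc _)) 0≤α _ x<B bd =
     (≤-by ((abel-log f α β x 0≤α (s≤s z≤n) (ℕ.<⇒≤ x<B) (λ n p q → bd n p (ℕ.m≤n⇒m≤1+n q))) ⊕ ((0≤* (0≤# 2) 0≤δ) ⊗ (bd x (s≤s z≤n) ≼-refl)) ⊕ (0≤* 0≤α (0≤* 0≤δ 0≤δ))) (solve (∑ x (λ e → f e * lg e) ∷ f (suc x) ∷ lg (suc x) ∷ lg x ∷ ∑ x f ∷ α ∷ β ∷ []) (c2 :* (v0 :+ v1 :* v2) :+ (c2 :* v3 :* v4 :- v5 :* (v3 :* v3) :- c2 :* v6 :* v3 :+ c2 :* (v2 :- v3) :* v4 :+ c0)) (c2 :* v2 :* (v4 :+ v1) :- v5 :* (v2 :* v2) :- c2 :* v6 :* v2 :+ (c2 :* v0 :+ c2 :* (v2 :- v3) :* (v5 :* v3 :+ v6) :+ v5 :* ((v2 :- v3) :* (v2 :- v3))))))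
     where
     0≤δ : 0ℚ ≤ lg (suc x) - lg x
     0≤δ = (≤-by (lg-mono x (s≤s z≤n) x<B) (solve (lg (suc x) ∷ lg x ∷ []) (v0 :- v1 :+ v1) (c0 :+ v0)))

   -- `B₂` increases with x, so Selberg's formula at y = z + o and at z gives Φ (A y - A z) ≤ lg² y
   -- - lg² z up to errors. By partial summation lg y times the increment `X` is this plus `S`, the
   -- discrete integral of `X` against `lg`. Inserting the bound inductively gives S ≤ (lg y - lg
   -- z)² up to E, and lg² y - lg² z + (lg y - lg z)² = 2 lg y (lg y - lg z). This is the origin of
   -- the factor 2.
   brun-titchmarsh : ∀ g z Y E → Coprime g N → 1 ≼ z → 2 · Y ≼ B → ¬ lg z ≤ 0ℚ → 0ℚ ≤ E →
                     # 2 * # c₄ * (lg Y + 1ℚ) ≤ E * lg z →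
                     ∀ o → z ∔ o ≼ Y → p g (z ∔ o) - p g z ≤ # 2 * (lg (z ∔ o) - lg z) + E
   brun-titchmarsh g z Y E g⊥N 1≤z 2Y≤B lgz≰0 0≤E hE o = λ zo≤Y → proj₂ (go o zo≤Y)
     where
     Y≤B : Y ≼ B
     Y≤B = ≼-trans (ℕ.m≤m+n Y _) 2Y≤B
     L X S : ℕ → ℚ
     L o = lg (z ∔ o)
     X o = p g (z ∔ o) - p g z
     S zero = 0ℚ
     S (suc o) = S o + X o * (L (suc o) - L o)
     X0 : X 0 ≡ 0ℚ
     X0 = trans (cong (λ w → p g w - p g z) (ℕ.+-identityʳ z)) (solve (p g z ∷ []) (v0 :- v0) c0)
     1≤zo : ∀ o → 1 ≼ z ∔ o
     1≤zo o = ≼-trans 1≤z (ℕ.m≤m+n z o)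
     pred≤ : ∀ {o} → z ∔ suc o ≼ Y → z ∔ o ≼ Y
     pred≤ {o} = ≼-trans (ℕ.+-monoʳ-≤ z (ℕ.n≤1+n o))
     0≤δ : ∀ o → z ∔ suc o ≼ Y → 0ℚ ≤ L (suc o) - L o
     0≤δ o h = (≤-by (lg-≤ (1≤zo o) (ℕ.+-monoʳ-≤ z (ℕ.n≤1+n o)) (≼-trans h Y≤B)) (solve (L (suc o) ∷ L o ∷ []) (v0 :- v1 :+ v1) (c0 :+ v0)))
     0≤Δ : ∀ o → z ∔ o ≼ Y → 0ℚ ≤ L o - lg z
     0≤Δ o h = (≤-by (lg-≤ 1≤z (ℕ.m≤m+n z o) (≼-trans h Y≤B)) (solve (L o ∷ lg z ∷ []) (v0 :- v1 :+ v1) (c0 :+ v0)))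
     stepP : ∀ o → Pₐ g (z ∔ suc o) ≡ Pₐ g (z ∔ o) + V g (z ∔ suc o)
     stepP o = subst (λ w → Pₐ g w ≡ Pₐ g (z ∔ o) + V g w) (sym (ℕ.+-suc z o)) refl
     stepA : ∀ o → ∑ (z ∔ suc o) (λ e → V g e * lg e) ≡ ∑ (z ∔ o) (λ e → V g e * lg e) + V g (z ∔ suc o) * L (suc o)
     stepA o = subst (λ w → ∑ w (λ e → V g e * lg e) ≡ ∑ (z ∔ o) (λ e → V g e * lg e) + V g w * lg w) (sym (ℕ.+-suc z o)) refl
     As : ℕ → ℚ
     As y = ∑ y (λ e → V g e * lg e)
     ident : ∀ o → L o * X o ≡ Φ * (As (z ∔ o) - As z) + S o
     ident zero = trans (cong (L 0 *_) X0) (trans (solve (L 0 ∷ Φ ∷ As z ∷ []) (v0 :* c0) (v1 :* (v2 :- v2) :+ c0)) (cong (λ w → Φ * (As w - As z) + 0ℚ) (sym (ℕ.+-identityʳ z))))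
     ident (suc o) = (≡-by ((ident o) ⊕≡ (cong ((L (suc o) * Φ) *_) (stepP o)) ⊕≡ (cong ((- Φ) *_) (stepA o))) (solve (Φ ∷ As (z ∔ suc o) ∷ As z ∷ S o ∷ Pₐ g (z ∔ o) ∷ p g z ∷ L (suc o) ∷ L o ∷ Pₐ g (z ∔ suc o) ∷ As (z ∔ o) ∷ V g (z ∔ suc o) ∷ []) (v0 :* (v1 :- v2) :+ (v3 :+ (v0 :* v4 :- v5) :* (v6 :- v7)) :+ (v7 :* (v0 :* v4 :- v5) :+ v6 :* v0 :* v8 :+ (:- v0) :* v1)) (v6 :* (v0 :* v8 :- v5) :+ (v0 :* (v9 :- v2) :+ v3 :+ v6 :* v0 :* (v4 :+ v10) :+ (:- v0) :* (v9 :+ v10 :* v6)))))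
     claim : ∀ o → z ∔ o ≼ Y → S o ≤ (L o - lg z) * (L o - lg z) + E * (L o - lg z) → X o ≤ # 2 * (L o - lg z) + E
     claim o h sb = cancel-≤ (λ q → lgz≰0 (≤-trans (lg-≤ 1≤z (ℕ.m≤m+n z o) y≤B) q)) (0≤lg (1≤zo o) y≤B)
       (≤-by ((≡⇒≤ (ident o)) ⊕ sb ⊕ (proj₂ (selberg g y g⊥N (1≤zo o) 2y≤B)) ⊕ (proj₁ (selberg g z g⊥N 1≤z 2z≤B)) ⊕ (0≤Φ ⊗ (B₂-mono g {z} {y} (ℕ.m≤m+n z o))) ⊕ (0≤Φ ⊗ (≡⇒≤ (sym (A≡ g y y≤B)))) ⊕ (0≤Φ ⊗ (≡⇒≤ (A≡ g z z≤B))) ⊕ ((0≤# c₄) ⊗ (lg-≤ (1≤zo o) h Y≤B)) ⊕ ((0≤# c₄) ⊗ (lg-≤ 1≤z z≤Y Y≤B)) ⊕ hE) (solve (L o ∷ lg z ∷ E ∷ X o ∷ S o ∷ Φ ∷ A g y ∷ B₂ (H g y) ∷ # c₄ ∷ B₂ (H g z) ∷ As y ∷ A g z ∷ lg Y ∷ As z ∷ []) (v0 :* (c2 :* (v0 :- v1) :+ v2) :+ (v0 :* v3 :+ v4 :+ (v5 :* (v6 :+ v7) :- v0 :* v0) :+ (:- (v8 :* (v1 :+ c1))) :+ v5 :* v9 :+ v5 :* v10 :+ v5 :* v11 :+ v8 :* v0 :+ v8 :* v1 :+ c2 :* v8 :* (v12 :+ c1))) (v0 :* v3 :+ (v5 :*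 (v10 :- v13) :+ v4 :+ ((v0 :- v1) :* (v0 :- v1) :+ v2 :* (v0 :- v1)) :+ v8 :* (v0 :+ c1) :+ (v5 :* (v11 :+ v9) :- v1 :* v1) :+ v5 :* v7 :+ v5 :* v6 :+ v5 :* v13 :+ v8 :* v12 :+ v8 :* v12 :+ v2 :* v1))))
       where
       y = z ∔ o
       z≤Y = ≼-trans (ℕ.m≤m+n z o) h
       y≤B = ≼-trans h Y≤B
       z≤B = ≼-trans z≤Y Y≤B
       2y≤B = ≼-trans (ℕ.*-monoʳ-≤ 2 h) 2Y≤B
       2z≤B = ≼-trans (ℕ.*-monoʳ-≤ 2 z≤Y) 2Y≤B
     go : ∀ o → z ∔ o ≼ Y → (S o ≤ (L o - lg z) * (L o - lg z) + E * (L o - lg z)) × (X o ≤ # 2 * (L o - lg z) + E)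
     go zero h = s0 , claim 0 h s0
       where
       s0 : S 0 ≤ (L 0 - lg z) * (L 0 - lg z) + E * (L 0 - lg z)
       s0 = 0≤+ (0≤* (0≤Δ 0 h) (0≤Δ 0 h)) (0≤* 0≤E (0≤Δ 0 h))
     go (suc o) h with go o (pred≤ h)
     ... | so , xo = s1 , claim (suc o) h s1
       where
       s1 : S (suc o) ≤ (L (suc o) - lg z) * (L (suc o) - lg z) + E * (L (suc o) - lg z)
       s1 = (≤-by (so ⊕ ((0≤δ o h) ⊗ xo) ⊕ (0≤* (0≤δ o h) (0≤δ o h))) (solve (L (suc o) ∷ lg z ∷ E ∷ S o ∷ L o ∷ X o ∷ []) ((v0 :- v1) :* (v0 :- v1) :+ v2 :* (v0 :- v1) :+ (v3 :+ (v0 :- v4) :* v5 :+ c0)) (v3 :+ v5 :* (v0 :- v4) :+ ((v4 :- v1) :* (v4 :- v1) :+ v2 :* (v4 :- v1) :+ (v0 :- v4) :* (c2 :* (v4 :- v1) :+ v2) :+ (v0 :- v4) :* (v0 :- v4)))))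

   -- The class g / b. The junk value 0 occurs only for b not prime to `N`, where the accompanying
   -- weight `W b` is 0.
   quo : ℕ → ℕ → ℕ
   quo g b with coprime? b N
   ... | yes b⊥N = proj₁ (inverse b⊥N) · g
   ... | no _ = 0

   quo-spec : ∀ g b → Coprime b N → b · quo g b ≅ g [ N ]
   quo-spec g b b⊥N with coprime? b N
   ... | no ¬c = ⊥-elim (¬c b⊥N)
   ... | yes c = ≋-trans (≅-≡ (sym (ℕ.*-assoc b i g))) (≋-trans (≅-* (proj₂ (inverse c)) ≋-refl) (≅-≡ (ℕ.*-identityˡ g)))
     where i = proj₁ (inverse c)

   quo-coprime : ∀ g b → Coprime g N → Coprime b N → Coprime (quo g b) N
   quo-coprime g b g⊥N b⊥N = coprime-∣ˡ (ℕ.n∣m*n b) (≅-coprime (quo-spec g b b⊥N) g⊥N)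

   B₂≡ : ∀ g x → Coprime g N → x ≼ B → B₂ (H g x) ≡ ∑ x (λ b → W b * Pₐ (quo g b) (x ÷ b))
   B₂≡ g x g⊥N x≤B = trans (∑-cong B λ e 1≤e _ → inner e 1≤e)
     (∑-trunc (λ e → W e * Pₐ (quo g e) (x ÷ e)) x≤B λ { e@(suc _) x<e _ → trans (cong (λ z → W e * Pₐ (quo g e) z) (ℕ.m<n⇒m/n≡0 x<e)) (zeroʳ (W e)) })
     where
     inner : ∀ e → 1 ≼ e → Λ e * ∑ B (λ b → Λ b * H g x (e · b)) ≡ W e * Pₐ (quo g e) (x ÷ e)
     inner e 1≤e with coprime? e N
     ... | no ¬c = trans (cong (Λ e *_) (∑-0 B λ b _ _ → trans (cong (λ z → Λ b * (z * (r (e · b) * ι (e · b ≼? x))))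
               (ι-no ((e · b) ≅? g [ N ]) λ q → ¬c (coprime-∣ˡ (ℕ.m∣m*n b) (≅-coprime q g⊥N)))) (solve (Λ b ∷ r (e · b) ∷ ι (e · b ≼? x) ∷ []) (v0 :* (c0 :* (v1 :* v2))) c0)))
             (solve (Λ e ∷ r e ∷ Pₐ 0 (x ÷ e) ∷ []) (v0 :* c0) (v0 :* (c0 :* v1) :* v2))
     ... | yes c = trans (cong (Λ e *_) (trans (∑-cong B λ b 1≤b _ → trans (cong₂ (λ z w → Λ b * (z * (w * ι (e · b ≼? x)))) (κ-quot {e} {proj₁ (inverse c)} g b (proj₂ (inverse c))) (r-* e b 1≤e 1≤b))
                 (solve (Λ b ∷ κ q b ∷ r e ∷ r b ∷ ι (e · b ≼? x) ∷ []) (v0 :* (v1 :* (v2 :* v3 :* v4))) (v4 :* (v2 :* (v0 :* (v1 :* v3))))))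
               (trans (∑-cut-÷ e x _ 1≤e x≤B) (sym (∑-*ˡ (x ÷ e) (r e) (V q))))))
             (solve (Λ e ∷ r e ∷ Pₐ q (x ÷ e) ∷ []) (v0 :* (v1 :* v2)) (v0 :* (c1 :* v1) :* v2))
       where q = proj₁ (inverse c) · g

   -- Above `z₀` the sieve bound holds with an error `E₀` of order lg Y / lg z₀; below `z₀` the
   -- trivial bound costs N (lg z₀ + 6). `E` covers both, and is smallest when lg z₀ has the order
   -- of the square root of lg Y.
   module Sieve (Y : ℕ) (2Y≤B : 2 · Y ≼ B) (z₀ : ℕ) (1≤z₀ : 1 ≼ z₀) (z₀≤Y : z₀ ≼ Y) (lgz₀≰0 : ¬ lg z₀ ≤ 0ℚ)
                (E₀ E : ℚ) (0≤E₀ : 0ℚ ≤ E₀) (hE₀ : # 2 * # c₄ * (lg Y + 1ℚ) ≤ E₀ * lg z₀)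
                (hE : E₀ + # N * (lg z₀ + # 6) ≤ E) where

     Y≤B : Y ≼ B
     Y≤B = ≼-trans (ℕ.m≤m+n Y _) 2Y≤B

     1≤Y : 1 ≼ Y
     1≤Y = ≼-trans 1≤z₀ z₀≤Y

     Y<B : suc Y ≼ B
     Y<B = ≼-trans (ℕ.+-monoˡ-≤ Y 1≤Y) (≼-trans (≼-reflexive (cong (Y ℕ.+_) (sym (ℕ.+-identityʳ Y)))) 2Y≤B)

     private
       0≤lgz₀ = 0≤lg 1≤z₀ (≼-trans z₀≤Y Y≤B)
       0≤N[] : 0ℚ ≤ # N * (lg z₀ + # 6)
       0≤N[] = 0≤* (0≤# N) (0≤+ 0≤lgz₀ (0≤# 6))

     0≤E : 0ℚ ≤ E
     0≤E = ≤-trans (0≤+ 0≤E₀ 0≤N[]) hE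

     private
       pz₀ : ∀ g {y} → 1 ≼ y → y ≼ z₀ → p g y ≤ # N * (lg z₀ + # 6)
       pz₀ g {y} 1≤y y≤z₀ = ≤-trans (p-mono g y≤z₀) (p-crude g z₀ 1≤z₀ (≼-trans (s≤s z₀≤Y) Y<B))

       bt₀ : ∀ g {z y} → Coprime g N → z₀ ≼ z → z ≼ y → y ≼ Y → p g y - p g z ≤ # 2 * (lg y - lg z) + E₀
       bt₀ g {z} {y} g⊥N z₀≤z z≤y y≤Y with ℕ.m≤n⇒∃[o]m+o≡n z≤y
       ... | o , refl = brun-titchmarsh g z Y E₀ g⊥N 1≤z 2Y≤B (λ q → lgz₀≰0 (≤-trans lgz₀≤ q)) 0≤E₀
                          (≤-trans hE₀ (0≤E₀ ⊗ lgz₀≤)) o y≤Y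
         where
         1≤z = ≼-trans 1≤z₀ z₀≤z
         lgz₀≤ = lg-≤ 1≤z₀ z₀≤z (≼-trans z≤y (≼-trans y≤Y Y≤B))

     bt : ∀ g {z y} → Coprime g N → 1 ≼ z → z ≼ y → y ≼ Y → p g y - p g z ≤ # 2 * (lg y - lg z) + E
     bt g {z} {y} g⊥N 1≤z z≤y y≤Y with ℕ.≤-total z₀ z | ℕ.≤-total z₀ y
     ... | inj₁ z₀≤z | _ = (≤-by ((bt₀ g g⊥N z₀≤z z≤y y≤Y) ⊕ hE ⊕ 0≤N[]) (solve (lg y ∷ lg z ∷ E ∷ p g y ∷ p g z ∷ E₀ ∷ # N ∷ lg z₀ ∷ []) (c2 :* (v0 :- v1) :+ v2 :+ (v3 :- v4 :+ (v5 :+ v6 :* (v7 :+ c6)) :+ c0)) (v3 :- v4 :+ (c2 :* (v0 :- v1) :+ v5 :+ v2 :+ v6 :* (v7 :+ c6)))))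
     ... | inj₂ z≤z₀ | inj₁ z₀≤y = (≤-by ((bt₀ g g⊥N ≼-refl z₀≤y y≤Y) ⊕ (pz₀ g 1≤z₀ ≼-refl) ⊕ (0≤p g z) ⊕ hE ⊕ ((0≤# 2) ⊗ (lg-≤ 1≤z z≤z₀ (≼-trans z₀≤Y Y≤B)))) (solve (lg y ∷ lg z ∷ E ∷ p g y ∷ p g z₀ ∷ E₀ ∷ # N ∷ lg z₀ ∷ p g z ∷ []) (c2 :* (v0 :- v1) :+ v2 :+ (v3 :- v4 :+ v4 :+ c0 :+ (v5 :+ v6 :* (v7 :+ c6)) :+ c2 :* v1)) (v3 :- v8 :+ (c2 :* (v0 :- v7) :+ v5 :+ v6 :* (v7 :+ c6) :+ v8 :+ v2 :+ c2 :* v7))))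
     ... | inj₂ z≤z₀ | inj₂ y≤z₀ = (≤-by ((pz₀ g (≼-trans 1≤z z≤y) y≤z₀) ⊕ (0≤p g z) ⊕ hE ⊕ 0≤E₀ ⊕ ((0≤# 2) ⊗ (lg-≤ 1≤z z≤y (≼-trans y≤Y Y≤B)))) (solve (lg y ∷ lg z ∷ E ∷ p g y ∷ E₀ ∷ # N ∷ lg z₀ ∷ p g z ∷ []) (c2 :* (v0 :- v1) :+ v2 :+ (v3 :+ c0 :+ (v4 :+ v5 :* (v6 :+ c6)) :+ c0 :+ c2 :* v1)) (v3 :- v7 :+ (v5 :* (v6 :+ c6) :+ v7 :+ v2 :+ v4 :+ c2 :* v0))))

     p≤ : ∀ g {y} → Coprime g N → 1 ≼ y → y ≼ Y → p g y ≤ # 2 * lg y + E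
     p≤ g {y} g⊥N 1≤y y≤Y with ℕ.≤-total z₀ y
     ... | inj₁ z₀≤y = (≤-by ((bt₀ g g⊥N ≼-refl z₀≤y y≤Y) ⊕ (pz₀ g 1≤z₀ ≼-refl) ⊕ hE ⊕ ((0≤# 2) ⊗ 0≤lgz₀)) (solve (lg y ∷ E ∷ p g y ∷ p g z₀ ∷ E₀ ∷ # N ∷ lg z₀ ∷ []) (c2 :* v0 :+ v1 :+ (v2 :- v3 :+ v3 :+ (v4 :+ v5 :* (v6 :+ c6)) :+ c2 :* c0)) (v2 :+ (c2 :* (v0 :- v6) :+ v4 :+ v5 :* (v6 :+ c6) :+ v1 :+ c2 :* v6))))
     ... | inj₂ y≤z₀ = (≤-by ((pz₀ g 1≤y y≤z₀) ⊕ hE ⊕ 0≤E₀ ⊕ ((0≤# 2) ⊗ (0≤lg 1≤y (≼-trans y≤Y Y≤B)))) (solve (lg y ∷ E ∷ p g y ∷ E₀ ∷ # N ∷ lg z₀ ∷ []) (c2 :* v0 :+ v1 :+ (v2 :+ (v3 :+ v4 :* (v5 :+ c6)) :+ c0 :+ c2 :* c0)) (v2 :+ (v4 :* (v5 :+ c6) :+ v1 :+ v3 :+ c2 :* v0))))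

     -- By partial summation Φ A is lg x · p minus the integral of p against `lg`, and p ≤ 2 lg + E
     -- bounds that integral by lg² x + E lg x.
     A-lower : ∀ g x → Coprime g N → 1 ≼ x → x ≼ Y → lg x * p g x - lg x * lg x - E * lg x ≤ Φ * A g x
     A-lower g x g⊥N 1≤x x≤Y = cancel-≤ {# 2} (λ q → 1≰0 (≤-trans (#-mono {1} {2} (s≤s z≤n)) q)) (0≤# 2)
       (≤-by ((abel-log (λ e → Φ * V g e) (# 2) E x (0≤# 2) 1≤x (≼-trans x≤Y Y≤B) (λ n 1≤n n<x → subst (_≤ # 2 * lg n + E) (∑-*ˡ n Φ (V g)) (p≤ g g⊥N 1≤n (≼-trans (ℕ.<⇒≤ n<x) x≤Y)))) ⊕ ((0≤* (0≤# 2) (0≤lg 1≤x (≼-trans x≤Y Y≤B))) ⊗ (≡⇒≤ (∑-*ˡ x Φ (V g)))) ⊕ ((0≤# 2) ⊗ (≡⇒≤ (trans (∑-ext x λ e → *-assoc Φ (V g e) (lg e)) (sym (∑-*ˡ x Φ _))))) ⊕ ((0≤* (0≤# 2) 0≤Φ) ⊗ (≡⇒≤ (sym (A≡ g x (≼-trans x≤Y Y≤B)))))) (solve (Φ ∷ A g x ∷ lg x ∷ ∑ x (λ e → Φ * V g e) ∷ E ∷ p g x ∷ ∑ x (λ e → (Φ * V g e) * lg e) ∷ ∑ x (λ e → V g e * lg e) ∷ []) (c2 :* (v0 :* v1) :+ (c2 :* v2 :* v3 :- c2 :* (v2 :* v2) :- c2 :* v4 :* v2 :+ c2 :* v2 :*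 v5 :+ c2 :* v6 :+ c2 :* v0 :* v7)) (c2 :* (v2 :* v5 :- v2 :* v2 :- v4 :* v2) :+ (c2 :* v6 :+ c2 :* v2 :* v3 :+ c2 :* (v0 :* v7) :+ c2 :* v0 :* v1))))

     A°-lower : ∀ x → 1 ≼ x → x ≼ Y → # 2 * lg x * P° x - lg x * lg x - # 12 * lg x ≤ # 2 * ∑ x (λ e → W e * lg e)
     A°-lower x 1≤x x≤Y = ≤-trans (≤-reflexive (solve (lg x ∷ P° x ∷ []) (c2 :* v0 :* v1 :- v0 :* v0 :- cn 12 :* v0) (c2 :* v0 :* v1 :- c1 :* (v0 :* v0) :- c2 :* c6 :* v0)))
       (abel-log W 1ℚ (# 6) x 0≤1 1≤x (≼-trans x≤Y Y≤B) λ n 1≤n n<x →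
         ≤-trans (P°-upper n 1≤n (≼-trans n<x (≼-trans x≤Y Y≤B))) (≤-reflexive (solve (lg n ∷ []) (v0 :+ c6) (c1 :* v0 :+ c6))))

     -- With x = z², the defects `Δ b` are nonnegative by `p≤`. Their sum with weights `W b` is
     -- about 2 Σ W(b) lg (x / b) - Φ B₂; the first term is about lg² x, and so is Φ B₂ when `A g x`
     -- is small. Thus all defects together are small. The part with b ≤ z in the class of `h` has x
     -- / b ≥ z, and it yields the product on the left.
     pair-bound : ∀ g h k z δ → Coprime g N → Coprime h N → h · k ≅ g [ N ] → 1 ≼ z → z · z ≼ Y →
                  Φ * A g (z · z) ≤ δ →
                  Pₐ h z * (# 2 * lg z - p k z) ≤ (# 12 + # c₄ + # 6 * E) * (lg (z · z) + 1ℚ) + δ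
     pair-bound g h k z δ g⊥N h⊥N hk≅g 1≤z x≤Y hδ = ≤-trans lower upper
       where
       x = z · z
       1≤x = ℕ.*-mono-≤ 1≤z 1≤z
       x≤B = ≼-trans x≤Y Y≤B
       z≤x = ℕ.m≤m*n z z {{ℕ.>-nonZero 1≤z}}
       Δ : ℕ → ℚ
       Δ b = # 2 * lg (x ÷ b) + E - p (quo g b) (x ÷ b)
       ÷≤Y : ∀ b → 1 ≼ b → x ÷ b ≼ Y
       ÷≤Y b 1≤b = ≼-trans (÷-≤-self b x 1≤b) x≤Y
       0≤WΔ : ∀ b → 1 ≼ b → b ≼ x → 0ℚ ≤ W b * Δ b
       0≤WΔ b 1≤b b≤x = go (coprime? b N)
         where
         go : Dec (Coprime b N) → 0ℚ ≤ W b * Δ b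
         go (no ¬c) = ≤-reflexive (sym (trans (cong (λ u → (Λ b * (u * r b)) * Δ b) (ι-no (coprime? b N) ¬c)) (solve (Λ b ∷ r b ∷ Δ b ∷ []) (v0 :* (c0 :* v1) :* v2) c0)))
         go (yes c) = 0≤* (0≤W b 1≤b) (≤-by (p≤ (quo g b) (quo-coprime g b g⊥N c) (÷-≥1 b x 1≤b b≤x) (÷≤Y b 1≤b)) (solve (lg (x ÷ b) ∷ E ∷ p (quo g b) (x ÷ b) ∷ []) (c2 :* v0 :+ v1 :- v2 :+ v2) (c0 :+ (c2 :* v0 :+ v1))))
       lower : Pₐ h z * (# 2 * lg z - p k z) ≤ ∑ x (λ b → W b * Δ b)
       lower = ≤-trans (≤-reflexive (∑-*ʳ z _ (V h))) (≤-trans (∑-mono z λ b 1≤b b≤z → term b 1≤b b≤z (b ≅? h [ N ])) (∑-≤-trunc _ z≤x 0≤WΔ))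
         where
         term : ∀ b → 1 ≼ b → b ≼ z → (d : Dec (b ≅ h [ N ])) → (Λ b * (ι d * r b)) * (# 2 * lg z - p k z) ≤ W b * Δ b
         term b 1≤b b≤z (no _) = ≤-trans (≤-reflexive (solve (Λ b ∷ r b ∷ lg z ∷ p k z ∷ []) (v0 :* (c0 :* v1) :* (c2 :* v2 :- v3)) c0)) (0≤WΔ b 1≤b (≼-trans b≤z z≤x))
         term b 1≤b b≤z (yes b≅h) = ≤-trans (0≤* (Λ≥0 b) (0≤* 0≤1 (0≤r b 1≤b)) ⊗ D≥) (≤-reflexive (cong (λ u → (Λ b * (u * r b)) * Δ b) (sym (ι-yes (coprime? b N) b⊥N))))
           where
           b⊥N = ≅-coprime b≅h h⊥N
           k⊥N : Coprime k N
           k⊥N = coprime-∣ˡ (ℕ.n∣m*n h) (≅-coprime hk≅g g⊥N)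
           y = x ÷ b
           z≤y : z ≼ y
           z≤y = ≤-÷ b x z 1≤b (ℕ.*-monoˡ-≤ z b≤z)
           q≅k : quo g b ≅ k [ N ]
           q≅k = ≅-cancelˡ b⊥N (≋-trans (quo-spec g b b⊥N) (≋-trans (≋-sym hk≅g) (≅-* (≋-sym b≅h) ≋-refl)))
           -- By `bt` the defect 2 lg y - p k y drops by at most `E` between z and y; the summand
           -- `E` in `Δ` pays for it.
           D≥ : # 2 * lg z - p k z ≤ Δ b
           D≥ = (≤-by ((≡⇒≤ (p-cong y q≅k)) ⊕ (bt k k⊥N 1≤z z≤y (÷≤Y b 1≤b))) (solve (lg y ∷ E ∷ p (quo g b) y ∷ p k y ∷ p k z ∷ lg z ∷ []) (c2 :* v0 :+ v1 :- v2 :+ (v2 :+ (v3 :- v4))) (c2 :* v5 :- v4 :+ (v3 :+ (c2 :* (v0 :- v5) :+ v1)))))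
       sumL : ℚ
       sumL = ∑ x (λ b → W b * lg (x ÷ b))
       split : ∑ x (λ b → W b * Δ b) ≡ # 2 * sumL + E * P° x - Φ * B₂ (H g x)
       split = trans (∑-ext x λ b → (solve (W b ∷ lg (x ÷ b) ∷ E ∷ Φ ∷ Pₐ (quo g b) (x ÷ b) ∷ []) (v0 :* (c2 :* v1 :+ v2 :- v3 :* v4)) (c2 :* (v0 :* v1) :+ v2 :* v0 :- v3 :* (v0 :* v4))))
         (trans (∑-sub x _ _) (cong₂ _-_ (trans (∑-+ x _ _) (cong₂ _+_ (sym (∑-*ˡ x (# 2) _)) (sym (∑-*ˡ x E W)))) (trans (sym (∑-*ˡ x Φ _)) (cong (Φ *_) (sym (B₂≡ g x g⊥N x≤B))))))
       sumL≤ : sumL ≤ lg x * P° x - ∑ x (λ e → W e * lg e)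
       sumL≤ = ≤-trans (∑-mono x λ b 1≤b b≤x → 0≤W b 1≤b ⊗ (≤-by (lg-÷-upper b x 1≤b b≤x x≤B) (solve (lg x ∷ lg b ∷ lg (x ÷ b) ∷ []) (v0 :- v1 :+ (v1 :+ v2)) (v2 :+ v0))))
         (≤-reflexive (trans (∑-ext x λ b → (solve (W b ∷ lg x ∷ lg b ∷ []) (v0 :* (v1 :- v2)) (v1 :* v0 :- v0 :* v2))) (trans (∑-sub x _ _) (cong (_- ∑ x (λ e → W e * lg e)) (sym (∑-*ˡ x (lg x) W))))))
       0≤lgx = 0≤lg 1≤x x≤B
       upper : ∑ x (λ b → W b * Δ b) ≤ (# 12 + # c₄ + # 6 * E) * (lg x + 1ℚ) + δ
       upper = (≤-by ((≡⇒≤ split) ⊕ ((0≤# 2) ⊗ sumL≤) ⊕ (A°-lower x 1≤x x≤Y) ⊕ (0≤E ⊗ (P°-upper x 1≤x (≼-trans (s≤s x≤Y) Y<B))) ⊕ (proj₁ (selberg g x g⊥N 1≤x (≼-trans (ℕ.*-monoʳ-≤ 2 x≤Y) 2Y≤B))) ⊕ hδ ⊕ ((0≤* (0≤# 5) 0≤E) ⊗ 0≤lgx) ⊕ (0≤# 12)) (solve (# c₄ ∷ E ∷ lg x ∷ δ ∷ ∑ x (λ b → W b * Δ b) ∷ sumL ∷ P° x ∷ Φ ∷ A g x ∷ B₂ (H g x) ∷ ∑ x (λ e → W e * lg e) ∷ []) ((cn 12 :+ v0 :+ c6 :* v1) :* (v2 :+ c1) :+ v3 :+ (v4 :+ c2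 :* v5 :+ (c2 :* v2 :* v6 :- v2 :* v2 :- cn 12 :* v2) :+ v1 :* v6 :+ (:- (v0 :* (v2 :+ c1))) :+ v7 :* v8 :+ cn 5 :* v1 :* c0 :+ c0)) (v4 :+ (c2 :* v5 :+ v1 :* v6 :- v7 :* v9 :+ c2 :* (v2 :* v6 :- v10) :+ c2 :* v10 :+ v1 :* (v2 :+ c6) :+ (v7 :* (v8 :+ v9) :- v2 :* v2) :+ v3 :+ cn 5 :* v1 :* v2 :+ cn 12))))

     -- A product of two numbers up to v from the classes of `h` and `k` lies in the class of `g`
     -- and is at most v², so `B₂` counts it.
     product-bound : ∀ g h k v → Coprime g N → h · k ≅ g [ N ] → 1 ≼ v → v · v ≼ B → Pₐ h v * Pₐ k v ≤ B₂ (H g (v · v))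
     product-bound g h k v g⊥N hk≅g 1≤v x≤B = ≤-trans (≤-reflexive (trans (∑-*ʳ v (Pₐ k v) (V h)) (∑-ext v λ e → *-assoc (Λ e) _ _)))
       (≤-trans (∑-mono v λ e 1≤e e≤v → Λ≥0 e ⊗ inner e 1≤e e≤v (e ≅? h [ N ]))
         (∑-≤-trunc _ v≤B λ e 1≤e _ → 0≤* (Λ≥0 e) (0≤∑ B λ b 1≤b _ → 0≤* (Λ≥0 b) (0≤H (e · b) (ℕ.*-mono-≤ 1≤e 1≤b)))))
       where
       v≤B = ≼-trans (ℕ.m≤m*n v v {{ℕ.>-nonZero 1≤v}}) x≤B
       0≤H : ∀ n → 1 ≼ n → 0ℚ ≤ H g (v · v) n
       0≤H n 1≤n = 0≤* (0≤κ g n) (0≤* (0≤r n 1≤n) (0≤ι (n ≼? v · v)))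
       inner : ∀ e → 1 ≼ e → e ≼ v → (d : Dec (e ≅ h [ N ])) → (ι d * r e) * Pₐ k v ≤ ∑ B (λ b → Λ b * H g (v · v) (e · b))
       inner e 1≤e e≤v (no _) = ≤-trans (≤-reflexive (solve (r e ∷ Pₐ k v ∷ []) (c0 :* v0 :* v1) c0)) (0≤∑ B λ b 1≤b _ → 0≤* (Λ≥0 b) (0≤H (e · b) (ℕ.*-mono-≤ 1≤e 1≤b)))
       inner e 1≤e e≤v (yes e≅h) = ≤-trans (≤-reflexive (∑-*ˡ v (1ℚ * r e) (V k)))
         (≤-trans (∑-mono v λ b 1≤b b≤v → term b 1≤b b≤v (b ≅? k [ N ])) (∑-≤-trunc _ v≤B λ b 1≤b _ → 0≤* (Λ≥0 b) (0≤H (e · b) (ℕ.*-mono-≤ 1≤e 1≤b))))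
         where
         term : ∀ b → 1 ≼ b → b ≼ v → (d : Dec (b ≅ k [ N ])) → (1ℚ * r e) * (Λ b * (ι d * r b)) ≤ Λ b * H g (v · v) (e · b)
         term b 1≤b b≤v (no _) = ≤-trans (≤-reflexive (solve (r e ∷ Λ b ∷ r b ∷ []) (c1 :* v0 :* (v1 :* (c0 :* v2))) c0)) (0≤* (Λ≥0 b) (0≤H (e · b) (ℕ.*-mono-≤ 1≤e 1≤b)))
         term b 1≤b b≤v (yes b≅k) = ≤-reflexive (trans (solve (r e ∷ Λ b ∷ r b ∷ []) (c1 :* v0 :* (v1 :* (c1 :* v2))) (v1 :* (c1 :* (v0 :* v2 :* c1))))
           (cong (Λ b *_) (cong₂ _*_ (sym (ι-yes ((e · b) ≅? g [ N ]) (≋-trans (≅-* e≅h b≅k) hk≅g)))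
             (cong₂ _*_ (sym (r-* e b 1≤e 1≤b)) (sym (ι-yes (e · b ≼? v · v) (ℕ.*-mono-≤ e≤v b≤v)))))))

 -- Quadratic characters and Monsky's bound for L(1, χ).

 module Quadratic (N : ℕ) (1≤N : 1 ≼ N) (χ : ℕ → ℚ) (χ-sign : ∀ n → Sign (χ n)) (χ-per : ∀ i → χ (N ∔ i) ≡ χ i)
                  (χ-* : ∀ m n → χ (m · n) ≡ χ m * χ n) (χ-1 : χ 1 ≡ 1ℚ) (χ-tot : ∑ N χ ≡ 0ℚ) where

   open Residues N 1≤N using (periodic-bound)

   χ-bound : ∀ {y c} n → ∣ y ∣≤ c → ∣ χ n * y ∣≤ c
   χ-bound n = Sign-bound (χ-sign n)

   private
     1≤1 : ∣ 1ℚ ∣≤ 1ℚ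
     1≤1 = (≤-by (0≤# 2) (solve [] (c1 :+ c0) (:- c1 :+ c2))) , ≤-refl

   χ-partial : ∀ j → ∣ ∑ j χ ∣≤ # N
   χ-partial = periodic-bound χ χ-per χ-tot λ i → subst (∣_∣≤ 1ℚ) (*-identityʳ (χ i)) (χ-bound i 1≤1)

   -- The convolution χ * 1. For a real character it is nonnegative, and at least 1 at squares; this
   -- keeps the L-value away from 0.
   σ : ℕ → ℚ
   σ n = ∑ n (λ d → ι (d ∣? n) * χ d)

   σ-extend : ∀ {M} n → 1 ≼ n → n ≼ M → ∑ M (λ d → ι (d ∣? n) * χ d) ≡ σ n
   σ-extend n 1≤n n≤M = ∑-trunc _ n≤M λ d n<d _ → ι-*-no (d ∣? n) λ q → ℕ.<⇒≱ n<d (ℕ.∣⇒≤ {{ℕ.>-nonZero 1≤n}} q)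

   σ-1 : σ 1 ≡ 1ℚ
   σ-1 = trans (+-identityˡ _) (trans (ι-*-yes (1 ∣? 1) ℕ.∣-refl) χ-1)

   -- The divisors of p^(v + 1) m that are multiples of p are p d with d ∣ p^v m, and the others are
   -- the divisors of m.
   σ-step : ∀ p v m → Prime p → ¬ p ∣ m → 1 ≼ m → σ (p · (p ^ v · m)) ≡ χ p * σ (p ^ v · m) + σ m
   σ-step p v m pp p∤m 1≤m = begin
     σ (p · n)
       ≡⟨ ∑-ext M (λ d → (solve (ι (d ∣? p · n) ∷ χ d ∷ ι (p ∣? d) ∷ []) (v0 :* v1) (v2 :* (v0 :* v1) :+ (c1 :- v2) :* v0 :* v1))) ⟩
     ∑ M (λ d → ι (p ∣? d) * F d + (1ℚ - ι (p ∣? d)) * ι (d ∣? p · n) * χ d)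
       ≡⟨ ∑-+ M _ _ ⟩
     ∑ M (λ d → ι (p ∣? d) * F d) + ∑ M (λ d → (1ℚ - ι (p ∣? d)) * ι (d ∣? p · n) * χ d)
       ≡⟨ cong₂ _+_ first second ⟩
     χ p * σ n + σ m ∎
     where
     open ≡-Reasoning
     n = p ^ v · m
     M = p · n
     1≤p^v = ℕ.m^n>0 p {{ℕ.>-nonZero (prime-≥1 pp)}} v
     1≤n = ℕ.*-mono-≤ 1≤p^v 1≤m
     1≤M = ℕ.*-mono-≤ (prime-≥1 pp) 1≤n
     n≤M = ℕ.m≤n*m n p {{ℕ.>-nonZero (prime-≥1 pp)}}
     m≤M = ≼-trans (ℕ.m≤n*m m (p ^ v) {{ℕ.>-nonZero 1≤p^v}}) n≤M
     F : ℕ → ℚ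
     F d = ι (d ∣? p · n) * χ d
     first : ∑ M (λ d → ι (p ∣? d) * F d) ≡ χ p * σ n
     first = begin
       ∑ M (λ d → ι (p ∣? d) * F d)
         ≡⟨ sym (∑-multiples M p F (prime-≥1 pp) λ d M<d → ι-*-no (d ∣? p · n) λ q → ℕ.<⇒≱ M<d (ℕ.∣⇒≤ {{ℕ.>-nonZero 1≤M}} q)) ⟩
       ∑ M (λ d → ι (p · d ∣? p · n) * χ (p · d))
         ≡⟨ ∑-ext M (λ d → trans (cong₂ _*_ (ι-⇔ (p · d ∣? p · n) (d ∣? n) (ℕ.*-cancelˡ-∣ p {{ℕ.>-nonZero (prime-≥1 pp)}}) (ℕ.*-monoʳ-∣ p)) (χ-* p d))
              (solve (ι (d ∣? n) ∷ χ p ∷ χ d ∷ []) (v0 :* (v1 :* v2)) (v1 :* (v0 :* v2)))) ⟩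
       ∑ M (λ d → χ p * (ι (d ∣? n) * χ d))
         ≡⟨ sym (∑-*ˡ M (χ p) _) ⟩
       χ p * ∑ M (λ d → ι (d ∣? n) * χ d)
         ≡⟨ cong (χ p *_) (σ-extend n 1≤n n≤M) ⟩
       χ p * σ n ∎
     second : ∑ M (λ d → (1ℚ - ι (p ∣? d)) * ι (d ∣? p · n) * χ d) ≡ σ m
     second = trans (∑-ext M λ d → cong (_* χ d) (lem d (p ∣? d))) (σ-extend m 1≤m m≤M)
       where
       pn≡ : p · n ≡ p ^ suc v · m
       pn≡ = sym (ℕ.*-assoc p (p ^ v) m)
       lem : ∀ d (e : Dec (p ∣ d)) → (1ℚ - ι e) * ι (d ∣? p · n) ≡ ι (d ∣? m)
       lem d (yes p∣d) = trans (solve (ι (d ∣? p · n) ∷ []) ((c1 :- c1) :* v0) c0) (sym (ι-no (d ∣? m) λ d∣m → p∤m (ℕ.∣-trans p∣d d∣m)))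
       lem d (no p∤d) = trans (solve (ι (d ∣? p · n) ∷ []) ((c1 :- c0) :* v0) v0) (ι-⇔ (d ∣? p · n) (d ∣? m)
         (λ q → coprime-divisor (coprime-sym (coprime-^ˡ (suc v) (prime∤⇒coprime pp p∤d))) (subst (d ∣_) pn≡ q))
         (λ q → ℕ.∣n⇒∣m*n p (ℕ.∣n⇒∣m*n (p ^ v) q)))

   private
     module Powers (p m : ℕ) (pp : Prime p) (p∤m : ¬ p ∣ m) (1≤m : 1 ≼ m) (0≤s : 0ℚ ≤ σ m) where
       s : ℕ → ℚ
       s v = σ (p ^ v · m)
       s0 : s 0 ≡ σ m
       s0 = cong σ (ℕ.*-identityˡ m)
       s-suc : ∀ v → s (suc v) ≡ χ p * s v + σ m
       s-suc v = trans (cong σ (ℕ.*-assoc p (p ^ v) m)) (σ-step p v m pp p∤m 1≤m)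
       -- Along v = 0, 1, 2, ... the values are σ m times 1, 2, 3, ... if χ p = 1, times 1, 1, 1,
       -- ... if χ p = 0, and times 1, 0, 1, 0, ... if χ p = -1.
       even : ∀ w → σ m ≤ s (2 · w)
       odd : ∀ w → 0ℚ ≤ s (suc (2 · w))
       up : χ p ≡ 1ℚ → ∀ v → σ m ≤ s v
       up e zero = ≤-reflexive (sym s0)
       up e (suc v) = (≤-by ((≡⇒≤ (sym (s-suc v))) ⊕ (≡⇒≤ (cong (_* s v) (sym e))) ⊕ (up e v) ⊕ 0≤s) (solve (s (suc v) ∷ χ p ∷ s v ∷ σ m ∷ []) (v0 :+ (v1 :* v2 :+ v3 :+ c1 :* v2 :+ v3 :+ c0)) (v3 :+ (v0 :+ v1 :* v2 :+ v2 :+ v3))))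
       flat : χ p ≡ 0ℚ → ∀ v → s v ≡ σ m
       flat e zero = s0
       flat e (suc v) = trans (s-suc v) (trans (cong (λ z → z * s v + σ m) e) (solve (s v ∷ σ m ∷ []) (c0 :* v0 :+ v1) v1))
       alt : χ p ≡ - 1ℚ → ∀ w → s (2 · w) ≡ σ m × s (suc (2 · w)) ≡ 0ℚ
       alt e w = ev w , od w
         where
         od : ∀ w → s (suc (2 · w)) ≡ 0ℚ
         ev : ∀ w → s (2 · w) ≡ σ m
         ev zero = s0
         ev (suc w) = trans (cong s (lem w)) (trans (s-suc (suc (2 · w))) (trans (cong₂ (λ z u → z * u + σ m) e (od w)) (solve (σ m ∷ []) ((:- c1) :* c0 :+ v0) v0)))
           where
           lem : ∀ w → 2 · suc w ≡ suc (suc (2 · w))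
           lem = solve-∀
         od w = trans (s-suc (2 · w)) (trans (cong₂ (λ z u → z * u + σ m) e (ev w)) (solve (σ m ∷ []) ((:- c1) :* v0 :+ v0) c0))
       even w with χ-sign p
       ... | inj₁ e = up e (2 · w)
       ... | inj₂ (inj₁ e) = ≤-reflexive (sym (flat e (2 · w)))
       ... | inj₂ (inj₂ e) = ≤-reflexive (sym (proj₁ (alt e w)))
       odd w with χ-sign p
       ... | inj₁ e = ≤-trans 0≤s (up e (suc (2 · w)))
       ... | inj₂ (inj₁ e) = ≤-trans 0≤s (≤-reflexive (sym (flat e (suc (2 · w)))))
       ... | inj₂ (inj₂ e) = ≤-reflexive (sym (proj₂ (alt e w)))
       nonneg : ∀ v → 0ℚ ≤ s v
       nonneg v with half v
       ... | w , inj₁ refl = ≤-trans 0≤s (even w)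
       ... | w , inj₂ refl = odd w

     stripped< : ∀ {p v m n} → Prime p → p ∣ n → n ≡ p ^ v · m → ¬ p ∣ m → 1 ≼ m → m ℕ.< n
     stripped< {p} {zero} {m} pp p∣n refl p∤m 1≤m = ⊥-elim (p∤m (subst (p ∣_) (ℕ.*-identityˡ m) p∣n))
     stripped< {p} {suc v} {m} pp p∣n refl p∤m 1≤m = ℕ.<-≤-trans (ℕ.m<m*n m p {{ℕ.>-nonZero 1≤m}} (prime≥2 pp))
       (≼-trans (≼-reflexive (ℕ.*-comm m p)) (ℕ.*-monoˡ-≤ m (ℕ.m≤m*n p (p ^ v) {{ℕ.m^n≢0 p v {{ℕ.>-nonZero (prime-≥1 pp)}}}})))

   0≤σ : ∀ n → 1 ≼ n → 0ℚ ≤ σ n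
   0≤σ = <-rec (λ n → 1 ≼ n → 0ℚ ≤ σ n) step
     where
     step : ∀ n → (∀ {k} → k ℕ.< n → 1 ≼ k → 0ℚ ≤ σ k) → 1 ≼ n → 0ℚ ≤ σ n
     step (suc zero) _ _ = subst (0ℚ ≤_) (sym σ-1) 0≤1
     step n@(suc (suc _)) rec 1≤n with ∃-prime-factor n (s≤s (s≤s z≤n))
     ... | p , pp , p∣n with strip p pp n 1≤n
     ... | v , m , e , p∤m , 1≤m = subst (λ z → 0ℚ ≤ σ z) (sym e)
               (Powers.nonneg p m pp p∤m 1≤m (rec (stripped< {v = v} pp p∣n e p∤m 1≤m) 1≤m) v)

   1≤σ² : ∀ k → 1 ≼ k → 1ℚ ≤ σ (k · k)
   1≤σ² = <-rec (λ k → 1 ≼ k → 1ℚ ≤ σ (k · k)) step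
     where
     step : ∀ k → (∀ {j} → j ℕ.< k → 1 ≼ j → 1ℚ ≤ σ (j · j)) → 1 ≼ k → 1ℚ ≤ σ (k · k)
     step (suc zero) _ _ = ≤-reflexive (sym σ-1)
     step k@(suc (suc _)) rec 1≤k with ∃-prime-factor k (s≤s (s≤s z≤n))
     ... | p , pp , p∣k with strip p pp k 1≤k
     ... | w , m , e , p∤m , 1≤m = subst (λ z → 1ℚ ≤ σ z) (sym sq)
               (≤-trans (rec (stripped< {v = w} pp p∣k e p∤m 1≤m) 1≤m) (Powers.even p (m · m) pp p∤m² (ℕ.*-mono-≤ 1≤m 1≤m) (0≤σ (m · m) (ℕ.*-mono-≤ 1≤m 1≤m)) w))
       where
       p∤m² : ¬ p ∣ m · m
       p∤m² q = [ p∤m , p∤m ]′ (euclidsLemma m m pp q)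
       lem : ∀ x m → x · m · (x · m) ≡ x · x · (m · m)
       lem = solve-∀
       sq : k · k ≡ p ^ (2 · w) · (m · m)
       sq = trans (cong₂ _·_ e e) (trans (lem (p ^ w) m) (cong (ℕ._* (m · m))
         (trans (sym (ℕ.^-distribˡ-+-* p w w)) (cong (p ^_) (cong (w ℕ.+_) (sym (ℕ.+-identityʳ w)))))))

   ℒ : ℕ → ℚ
   ℒ x = ∑ x (λ n → χ n * r n)

   -- With t = 1 - 1 / Z, `G n` is (1 - t^n) / (1 - t) and `e n` is the Lambert term (1 - t) t^n /
   -- (1 - t^n). As `β n` = 1 / n - e n decreases from τ and stays nonnegative, replacing 1 / n by
   -- `e n` changes the L-series by at most N τ; and the Lambert series has the nonnegative
   -- coefficients `σ`.
   module Monsky (Z : ℕ) (1≤Z : 1 ≼ Z) where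

     τ t : ℚ
     τ = r Z
     t = 1ℚ - τ

     0≤τ : 0ℚ ≤ τ
     0≤τ = 0≤r Z 1≤Z

     0≤t : 0ℚ ≤ t
     0≤t = (≤-by ((r-anti ≼-refl 1≤Z) ⊕ (≡⇒≤ r-1)) (solve (τ ∷ r 1 ∷ []) (c1 :- v0 :+ (v0 :+ v1)) (c0 :+ (v1 :+ c1))))

     pw G : ℕ → ℚ
     pw zero = 1ℚ
     pw (suc k) = t * pw k
     G zero = 0ℚ
     G (suc n) = G n + pw n

     0≤pw : ∀ k → 0ℚ ≤ pw k
     0≤pw zero = 0≤1
     0≤pw (suc k) = 0≤* 0≤t (0≤pw k)

     pw-dec : ∀ k → pw (suc k) ≤ pw k
     pw-dec k = (≤-by (0≤* 0≤τ (0≤pw k)) (solve (pw k ∷ τ ∷ []) (v0 :+ c0) ((c1 :- v1) :* v0 :+ v1 :* v0)))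

     pw-anti : ∀ m n → m ≼ n → pw n ≤ pw m
     pw-anti m n m≤n with ℕ.m≤n⇒∃[o]m+o≡n m≤n
     ... | o , refl = go o
       where
       go : ∀ o → pw (m ∔ o) ≤ pw m
       go zero = ≤-reflexive (cong pw (ℕ.+-identityʳ m))
       go (suc o) = subst (λ z → pw z ≤ pw m) (sym (ℕ.+-suc m o)) (≤-trans (pw-dec (m ∔ o)) (go o))

     pw-+ : ∀ m n → pw (m ∔ n) ≡ pw m * pw n
     pw-+ zero n = sym (*-identityˡ _)
     pw-+ (suc m) n = trans (cong (t *_) (pw-+ m n)) (sym (*-assoc t _ _))

     G-geom : ∀ n → 1ℚ - pw n ≡ τ * G n
     G-geom zero = (solve (τ ∷ []) (c1 :- c1) (v0 :* c0))
     G-geom (suc n) = (≡-by (G-geom n) (solve (τ ∷ G n ∷ pw n ∷ []) (v0 :* (v1 :+ v2) :+ (c1 :- v2)) (c1 :- (c1 :- v0) :* v2 :+ v0 :* v1)))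

     G-suc : ∀ n → 1ℚ + t * G n ≡ G n + pw n
     G-suc n = (≡-by (G-geom n) (solve (G n ∷ pw n ∷ τ ∷ []) (v0 :+ v1 :+ (c1 :- v1)) (c1 :+ (c1 :- v2) :* v0 :+ v2 :* v0)))

     0≤G : ∀ n → 0ℚ ≤ G n
     0≤G zero = ≤-refl
     0≤G (suc n) = 0≤+ (0≤G n) (0≤pw n)

     1≤G : ∀ n → 1 ≼ n → 1ℚ ≤ G n
     1≤G (suc n) _ = (≤-by ((≡⇒≤ (G-suc n)) ⊕ (0≤* 0≤t (0≤G n))) (solve (G n ∷ pw n ∷ t ∷ []) (v0 :+ v1 :+ (c1 :+ v2 :* v0 :+ c0)) (c1 :+ (v0 :+ v1 :+ v2 :* v0))))

     -- The right side is G at 2m, a sum of 2m powers of t. The claim is a slightly weakened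
     -- arithmetic-geometric mean inequality for these powers, proved by induction.
     double : ∀ m → # 2 * # m * pw m ≤ G m * (1ℚ + pw m)
     double zero = ≤-reflexive (solve [] (c2 :* c0 :* c1) (c0 :* (c1 :+ c1)))
     double (suc m) = (≤-by ((0≤t ⊗ (double m)) ⊕ ((0≤* (0≤# 2) (0≤pw (suc m))) ⊗ (≡⇒≤ (#-suc m))) ⊕ ((0≤+ 0≤1 (0≤pw (suc m))) ⊗ (≡⇒≤ (G-suc m))) ⊕ ((0≤pw (suc m)) ⊗ (≡⇒≤ (sym (G-suc m)))) ⊕ sq ⊕ ((0≤pw (suc m)) ⊗ (pw-dec m))) (solve (G m ∷ pw m ∷ t ∷ # m ∷ # (suc m) ∷ []) ((v0 :+ v1) :* (c1 :+ v2 :* v1) :+ (v2 :* (c2 :* v3 :* v1) :+ c2 :* (v2 :* v1) :* v4 :+ (c1 :+ v2 :* v1) :* (c1 :+ v2 :* v0) :+ v2 :* v1 :* (v0 :+ v1) :+ c0 :+ v2 :* v1 :* (v2 :* v1))) (c2 :* v4 :* (v2 :* v1) :+ (v2 :* (v0 :* (c1 :+ v1)) :+ c2 :* (v2 :* v1) :* (c1 :+ v3) :+ (c1 :+ v2 :* v1) :* (v0 :+ v1) :+ v2 :* v1 :* (c1 :+ v2 :* v0) :+ (c1 :- v2 :* v1) :* (c1 :- v2 :* v1) :+ v2 :* v1 :* v1))))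
       where
       h : 0ℚ ≤ 1ℚ - t * pw m
       h = (≤-by (pw-anti 0 (suc m) z≤n) (solve (t ∷ pw m ∷ []) (c1 :- v0 :* v1 :+ v0 :* v1) (c0 :+ c1)))
       sq = 0≤* h h

     -- This makes `β` decrease: from n to n + 1 the term 1 / n falls by 1 / (n (n + 1)), while
     -- `e n` falls by t^n / (G n · G (n + 1)).
     amgm : ∀ n → # n * # (suc n) * pw n ≤ G n * G (suc n)
     amgm zero = ≤-reflexive (solve [] (c0 :* c1 :* c1) (c0 :* (c0 :+ c1)))
     amgm (suc n) = (≤-by ((0≤t ⊗ (amgm n)) ⊕ (double (suc n)) ⊕ ((0≤* (0≤# (suc n)) (0≤pw (suc n))) ⊗ (≡⇒≤ e₂)) ⊕ ((0≤G (suc n)) ⊗ (≡⇒≤ (G-suc n)))) (solve (G n ∷ pw n ∷ t ∷ # n ∷ # (suc n) ∷ # (suc (suc n)) ∷ []) ((v0 :+ v1) :* (v0 :+ v1 :+ v2 :* v1) :+ (v2 :* (v3 :* v4 :* v1) :+ c2 :* v4 :* (v2 :* v1) :+ v4 :* (v2 :* v1) :* v5 :+ (v0 :+ v1) :* (c1 :+ v2 :* v0))) (v4 :* v5 :* (v2 :* v1) :+ (v2 :* (v0 :* (v0 :+ v1)) :+ (v0 :+ v1) :* (c1 :+ v2 :* v1) :+ v4 :* (v2 :* v1) :* (c2 :+ v3) :+ (v0 :+ v1) :* (v0 :+ v1)))))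
       where
       e₂ : # (suc (suc n)) ≡ # 2 + # n
       e₂ = #-+ 2 n

     iG e β : ℕ → ℚ
     iG n = inv (G n)
     e n = pw n * iG n
     β n = r n - e n

     G≰0 : ∀ n → 1 ≼ n → ¬ G n ≤ 0ℚ
     G≰0 n 1≤n q = 1≰0 (≤-trans (1≤G n 1≤n) q)

     G-inv : ∀ n → 1 ≼ n → G n * iG n ≡ 1ℚ
     G-inv n 1≤n = inv-r (G n) (G≰0 n 1≤n)

     0≤iG : ∀ n → 1 ≼ n → 0ℚ ≤ iG n
     0≤iG n 1≤n = 0≤inv (G n) (G≰0 n 1≤n) (0≤G n)

     iG≤1 : ∀ n → 1 ≼ n → iG n ≤ 1ℚ
     iG≤1 n 1≤n = (≤-by (((0≤iG n 1≤n) ⊗ (1≤G n 1≤n)) ⊕ (≡⇒≤ (G-inv n 1≤n))) (solve (iG n ∷ G n ∷ []) (c1 :+ (v0 :* c1 :+ v1 :* v0)) (v0 :+ (v0 :* v1 :+ c1))))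

     β-dec : ∀ n → 1 ≼ n → β (suc n) ≤ β n
     β-dec n 1≤n = (≤-by (key ⊕ (≡⇒≤ (sym (r-diff n 1≤n))) ⊕ (≡⇒≤ gi)) (solve (u ∷ pw n ∷ i ∷ j ∷ v ∷ t ∷ []) (v0 :- v1 :* v2 :+ (v1 :* v2 :* v3 :+ v0 :* v4 :+ (v1 :* v2 :- v5 :* v1 :* v3))) (v4 :- v5 :* v1 :* v3 :+ (v0 :* v4 :+ (v0 :- v4) :+ v1 :* v2 :* v3))))
       where
       u v i j : ℚ
       u = r n
       v = r (suc n)
       i = iG n
       j = iG (suc n)
       0≤u = 0≤r n 1≤n
       0≤v = 0≤r (suc n) (s≤s z≤n)
       0≤i = 0≤iG n 1≤n
       0≤j = 0≤iG (suc n) (s≤s z≤n)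
       Gi = G-inv n 1≤n
       Gj : (G n + pw n) * j ≡ 1ℚ
       Gj = G-inv (suc n) (s≤s z≤n)
       gi : pw n * i - (t * pw n) * j ≡ pw n * i * j
       gi = (≡-by ((cong ((- (pw n * i)) *_) Gj) ⊕≡ (cong ((t * pw n * j) *_) Gi) ⊕≡ (cong ((- (pw n * i * j)) *_) (G-suc n))) (solve (pw n ∷ i ∷ j ∷ G n ∷ t ∷ []) (v0 :* v1 :* v2 :+ ((:- (v0 :* v1)) :* ((v3 :+ v0) :* v2) :+ v4 :* v0 :* v2 :* (v3 :* v1) :+ (:- (v0 :* v1 :* v2)) :* (c1 :+ v4 :* v3))) (v0 :* v1 :- v4 :* v0 :* v2 :+ ((:- (v0 :* v1)) :* c1 :+ v4 :* v0 :* v2 :* c1 :+ (:- (v0 :* v1 :* v2)) :* (v3 :+ v0)))))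
       nu = r-inv n 1≤n
       nv = r-inv (suc n) (s≤s z≤n)
       key : pw n * i * j ≤ u * v
       key = (≤-by (((0≤* (0≤* 0≤i 0≤j) (0≤* 0≤u 0≤v)) ⊗ (amgm n)) ⊕ ((0≤* (0≤* (0≤pw n) 0≤i) 0≤j) ⊗ (≡⇒≤ (sym nu))) ⊕ ((0≤* (0≤* (0≤* (0≤pw n) 0≤i) 0≤j) (0≤* (0≤# n) 0≤u)) ⊗ (≡⇒≤ (sym nv))) ⊕ ((0≤* 0≤u 0≤v) ⊗ (≡⇒≤ Gi)) ⊕ ((0≤* (0≤* 0≤u 0≤v) (0≤* (0≤G n) 0≤i)) ⊗ (≡⇒≤ Gj))) (solve (u ∷ v ∷ i ∷ j ∷ # n ∷ # (suc n) ∷ pw n ∷ G n ∷ []) (v0 :* v1 :+ (v2 :* v3 :* (v0 :* v1) :* (v4 :* v5 :* v6) :+ v6 :* v2 :* v3 :* c1 :+ v6 :* v2 :* v3 :* (v4 :* v0) :* c1 :+ v0 :* v1 :* (v7 :* v2) :+ v0 :* v1 :* (v7 :* v2) :* ((v7 :+ v6) :* v3))) (v6 :* v2 :* v3 :+ (v2 :* v3 :* (v0 :* v1) :* (v7 :* (v7 :+ v6)) :+ v6 :* v2 :* v3 :* (v4 :* v0) :+ v6 :* v2 :* v3 :* (v4 :* v0) :* (v5 :* v1) :+ v0 :* v1 :* c1 :+ v0 :* v1 :* (v7 :* v2) :* c1))))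

     β-1 : β 1 ≡ τ
     β-1 = (≡-by (r-1 ⊕≡ (cong ((- t) *_) (G-inv 1 ≼-refl)) ⊕≡ (refl {x = t})) (solve (τ ∷ r 1 ∷ t ∷ iG 1 ∷ []) (v0 :+ (v1 :+ (:- v2) :* ((c0 :+ c1) :* v3) :+ (c1 :- v0))) (v1 :- v2 :* c1 :* v3 :+ (c1 :+ (:- v2) :* c1 :+ v2))))

     0≤β : ∀ n → 1 ≼ n → 0ℚ ≤ β n
     0≤β n 1≤n = (≤-by (((0≤* (0≤r n 1≤n) (0≤iG n 1≤n)) ⊗ (npw n)) ⊕ ((0≤* (0≤pw n) (0≤iG n 1≤n)) ⊗ (≡⇒≤ (sym (r-inv n 1≤n)))) ⊕ ((0≤r n 1≤n) ⊗ (≡⇒≤ (G-inv n 1≤n)))) (solve (r n ∷ pw n ∷ iG n ∷ # n ∷ G n ∷ []) (v0 :- v1 :* v2 :+ (v0 :* v2 :* (v3 :* v1) :+ v1 :* v2 :* c1 :+ v0 :* (v4 :* v2))) (c0 :+ (v0 :* v2 :* v4 :+ v1 :* v2 :* (v3 :* v0) :+ v0 :* c1))))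
       where
       npw : ∀ n → # n * pw n ≤ G n
       npw zero = ≤-reflexive (solve [] (c0 :* c1) c0)
       npw (suc n) = (≤-by (((0≤pw (suc n)) ⊗ (≡⇒≤ (#-suc n))) ⊕ ((0≤# n) ⊗ (pw-dec n)) ⊕ (pw-dec n) ⊕ (npw n)) (solve (G n ∷ pw n ∷ pw (suc n) ∷ # (suc n) ∷ # n ∷ []) (v0 :+ v1 :+ (v2 :* v3 :+ v4 :* v2 :+ v2 :+ v4 :* v1)) (v3 :* v2 :+ (v2 :* (c1 :+ v4) :+ v4 :* v1 :+ v1 :+ v0))))

     -- The geometric expansion of the Lambert term into τ (t^n + t^(2n) + ...), stopped after `J`
     -- terms with its exact remainder.
     e-unfold : ∀ n → 1 ≼ n → ∀ J → e n ≡ τ * ∑ J (λ m → pw (n · m)) + pw (n · J) * e n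
     e-unfold n 1≤n zero = trans (solve (e n ∷ τ ∷ []) v0 (v1 :* c0 :+ c1 :* v0)) (cong (λ z → τ * 0ℚ + pw z * e n) (sym (ℕ.*-zeroʳ n)))
     e-unfold n 1≤n (suc J) = (≡-by ((e-unfold n 1≤n J) ⊕≡ (cong ((pw (n · J)) *_) one) ⊕≡ (cong ((- (τ + e n)) *_) pwJ)) (solve (τ ∷ ∑ J (λ m → pw (n · m)) ∷ pw (n · suc J) ∷ e n ∷ pw (n · J) ∷ pw n ∷ []) (v0 :* (v1 :+ v2) :+ v2 :* v3 :+ (v3 :+ v4 :* v3 :+ (:- (v0 :+ v3)) :* v2)) (v3 :+ (v0 :* v1 :+ v4 :* v3 :+ v4 :* (v0 :* v5 :+ v5 :* v3) :+ (:- (v0 :+ v3)) :* (v5 :* v4)))))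
       where
       pwJ : pw (n · suc J) ≡ pw n * pw (n · J)
       pwJ = trans (cong pw (ℕ.*-suc n J)) (pw-+ n (n · J))
       one : e n ≡ τ * pw n + pw n * e n
       one = (≡-by ((cong ((pw n * iG n) *_) (G-geom n)) ⊕≡ (cong ((τ * pw n) *_) (G-inv n 1≤n))) (solve (τ ∷ pw n ∷ iG n ∷ G n ∷ []) (v0 :* v1 :+ v1 :* (v1 :* v2) :+ (v1 :* v2 :* (c1 :- v1) :+ v0 :* v1 :* (v3 :* v2))) (v1 :* v2 :+ (v1 :* v2 :* (v0 :* v3) :+ v0 :* v1 :* c1))))

     -- Split 1 / n into `β n` and `e n`. The first part is at least -N τ by partial summation. In
     -- the second, the powers with exponents up to X collect to Σ σ(k) t^k, and each of the X
     -- remainders is at most t^X.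
     L-lower : ∀ X → - (# N * τ) + τ * ∑ X (λ k → pw k * σ k) - # X * pw X ≤ ℒ X
     L-lower X = (≤-by ((≡⇒≤ (sym split)) ⊕ (proj₁ βb) ⊕ ((0≤# N) ⊗ (≡⇒≤ β-1)) ⊕ (≡⇒≤ (sym esum)) ⊕ (proj₁ rb) ⊕ (≡⇒≤ (∑-const X (pw X)))) (solve (ℒ X ∷ ∑ X (λ n → χ n * β n) ∷ ∑ X (λ n → χ n * e n) ∷ # N ∷ β 1 ∷ τ ∷ ∑ X (λ k → pw k * σ k) ∷ ∑ X (λ n → χ n * R n) ∷ ∑ X (λ _ → pw X) ∷ # X ∷ pw X ∷ []) (v0 :+ (v1 :+ v2 :+ (:- (v3 :* v4)) :+ v3 :* v4 :+ (v5 :* v6 :+ v7) :+ (:- v8) :+ v8)) (:- (v3 :* v5) :+ v5 :* v6 :- v9 :* v10 :+ (v0 :+ v1 :+ v3 :* v5 :+ v2 :+ v7 :+ v9 :* v10))))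
       where
       R : ℕ → ℚ
       R n = pw (n · (X ÷ n)) * e n
       split : ℒ X ≡ ∑ X (λ n → χ n * β n) + ∑ X (λ n → χ n * e n)
       split = trans (∑-ext X λ n → (solve (χ n ∷ r n ∷ e n ∷ []) (v0 :* v1) (v0 :* (v1 :- v2) :+ v0 :* v2))) (∑-+ X _ _)
       βb = abel χ β (# N) X (λ j _ → χ-partial j) (λ n 1≤n _ → β-dec n 1≤n) (0≤β X) (0≤β 1 ≼-refl)
       rb : ∣ ∑ X (λ n → χ n * R n) ∣≤ ∑ X (λ _ → pw X)
       rb = ∑-bound X λ n 1≤n _ → χ-bound n ((≤-by ((0≤R n 1≤n) ⊕ (0≤pw X)) (solve (R n ∷ pw X ∷ []) (v0 :+ (c0 :+ c0)) (:- v1 :+ (v0 :+ v1)))) , R≤ n 1≤n)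
         where
         0≤R : ∀ n → 1 ≼ n → 0ℚ ≤ R n
         0≤R n 1≤n = 0≤* (0≤pw (n · (X ÷ n))) (0≤* (0≤pw n) (0≤iG n 1≤n))
         R≤ : ∀ n → 1 ≼ n → R n ≤ pw X
         R≤ n 1≤n = (≤-by (((0≤* (0≤pw (n · (X ÷ n))) (0≤pw n)) ⊗ (iG≤1 n 1≤n)) ⊕ (≡⇒≤ (sym (pw-+ (n · (X ÷ n)) n))) ⊕ (pw-anti X (n · (X ÷ n) ∔ n) (ℕ.<⇒≤ (ℕ.<-≤-trans (<-÷ n X 1≤n) (≼-reflexive (trans (ℕ.*-suc n (X ÷ n)) (ℕ.+-comm n _))))))) (solve (pw X ∷ pw (n · (X ÷ n)) ∷ pw n ∷ iG n ∷ pw (n · (X ÷ n) ∔ n) ∷ []) (v0 :+ (v1 :* v2 :* v3 :+ v1 :* v2 :+ v4)) (v1 :* (v2 :* v3) :+ (v1 :* v2 :* c1 :+ v4 :+ v0))))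
       Hk : ℕ → ℚ
       Hk k = ι (k ≼? X) * pw k
       dbl : ∑ X (λ n → χ n * ∑ (X ÷ n) (λ m → pw (n · m))) ≡ ∑ X (λ k → pw k * σ k)
       dbl = begin
         ∑ X (λ n → χ n * ∑ (X ÷ n) (λ m → pw (n · m)))
           ≡⟨ ∑-cong X (λ n 1≤n _ → cong (χ n *_) (trans (sym (∑-cut-÷ n X (λ m → pw (n · m)) 1≤n ≼-refl)) (∑-multiples X n Hk 1≤n λ k X<k → ι-*-no (k ≼? X) (ℕ.<⇒≱ X<k)))) ⟩
         ∑ X (λ n → χ n * ∑ X (λ k → ι (n ∣? k) * Hk k))
           ≡⟨ ∑-ext X (λ n → ∑-*ˡ X (χ n) _) ⟩
         ∑ X (λ n → ∑ X (λ k → χ n * (ι (n ∣? k) * Hk k)))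
           ≡⟨ ∑-swap X X _ ⟩
         ∑ X (λ k → ∑ X (λ n → χ n * (ι (n ∣? k) * Hk k)))
           ≡⟨ ∑-cong X (λ k 1≤k k≤X → trans (∑-ext X λ n → trans (cong (λ z → χ n * (ι (n ∣? k) * z)) (ι-*-yes (k ≼? X) k≤X)) (solve (χ n ∷ ι (n ∣? k) ∷ pw k ∷ []) (v0 :* (v1 :* v2)) (v2 :* (v1 :* v0))))
                (trans (sym (∑-*ˡ X (pw k) _)) (cong (pw k *_) (σ-extend k 1≤k k≤X)))) ⟩
         ∑ X (λ k → pw k * σ k) ∎
         where open ≡-Reasoning
       esum : ∑ X (λ n → χ n * e n) ≡ τ * ∑ X (λ k → pw k * σ k) + ∑ X (λ n → χ n * R n)
       esum = trans (∑-cong X λ n 1≤n _ → trans (cong (χ n *_) (e-unfold n 1≤n (X ÷ n)))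
                      (solve (χ n ∷ τ ∷ ∑ (X ÷ n) (λ m → pw (n · m)) ∷ R n ∷ []) (v0 :* (v1 :* v2 :+ v3)) (v1 :* (v0 :* v2) :+ v0 :* v3)))
                (trans (∑-+ X _ _) (cong (_+ ∑ X (λ n → χ n * R n)) (trans (sym (∑-*ˡ X τ _)) (cong (τ *_) dbl))))

     -- Only the squares are kept; elsewhere `σ` is nonnegative.
     squares : ∀ X j → j · j ≼ X → ∑ j (λ i → pw (i · i)) ≤ ∑ X (λ k → pw k * σ k)
     squares X j j²≤X = ≤-trans (≤-reflexive (trans (∑-cong j λ i 1≤i i≤j → sym (∑-δ X (i · i) pw (ℕ.*-mono-≤ 1≤i 1≤i) (≼-trans (ℕ.*-mono-≤ i≤j i≤j) j²≤X))) (∑-swap j X _)))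
       (∑-mono X λ k 1≤k _ → ≤-trans (≤-reflexive (sym (∑-*ʳ j (pw k) _))) (≤-trans (≤-reflexive (*-comm _ _)) (0≤pw k ⊗ count k 1≤k)))
       where
       count : ∀ k → 1 ≼ k → ∑ j (λ i → ι (k ℕ.≟ i · i)) ≤ σ k
       count k 1≤k = go j
         where
         sq-inj : ∀ {a b} → a · a ≡ b · b → a ≡ b
         sq-inj {a} {b} h with ℕ.<-cmp a b
         ... | tri< a<b _ _ = ⊥-elim (ℕ.<⇒≢ (ℕ.*-mono-< a<b a<b) h)
         ... | tri≈ _ e _ = e
         ... | tri> _ _ b<a = ⊥-elim (ℕ.<⇒≢ (ℕ.*-mono-< b<a b<a) (sym h))
         go : ∀ j → ∑ j (λ i → ι (k ℕ.≟ i · i)) ≤ σ k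
         go zero = 0≤σ k 1≤k
         go (suc j) with k ℕ.≟ suc j · suc j
         ... | no _ = (≤-by (go j) (solve (σ k ∷ ∑ j (λ i → ι (k ℕ.≟ i · i)) ∷ []) (v0 :+ v1) (v1 :+ c0 :+ v0)))
         ... | yes refl = (≤-by ((≡⇒≤ (∑-0 j (λ i _ i≤j → ι-no (k ℕ.≟ i · i) λ q → ℕ.1+n≰n (≼-trans (≼-reflexive (sq-inj q)) i≤j)))) ⊕ (1≤σ² (suc j) (s≤s z≤n))) (solve (σ k ∷ ∑ j (λ i → ι (k ℕ.≟ i · i)) ∷ []) (v0 :+ (v1 :+ c1)) (v1 :+ c1 :+ (c0 :+ v0))))

     pw-bernoulli : ∀ k → 1ℚ - # k * τ ≤ pw k
     pw-bernoulli zero = ≤-reflexive (solve (τ ∷ []) (c1 :- c0 :* v0) c1)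
     pw-bernoulli (suc k) = (≤-by ((0≤t ⊗ (pw-bernoulli k)) ⊕ (0≤τ ⊗ (≡⇒≤ (sym (#-suc k)))) ⊕ (0≤* (0≤* (0≤# k) 0≤τ) 0≤τ)) (solve (τ ∷ pw k ∷ # k ∷ # (suc k) ∷ []) ((c1 :- v0) :* v1 :+ ((c1 :- v0) :* (c1 :- v2 :* v0) :+ v0 :* (c1 :+ v2) :+ c0)) (c1 :- v3 :* v0 :+ ((c1 :- v0) :* v1 :+ v0 :* v3 :+ v2 :* v0 :* v0))))

     pw-decay : ∀ k → # k * pw k ≤ # Z
     pw-decay k = (≤-by (((0≤# Z) ⊗ (go k)) ⊕ ((0≤* (0≤# k) (0≤pw k)) ⊗ (≡⇒≤ (sym (r-inv Z 1≤Z)))) ⊕ (0≤* (0≤# Z) (0≤pw k))) (solve (# Z ∷ pw k ∷ # k ∷ τ ∷ []) (v0 :+ (v0 :* (v1 :* (c1 :+ v2 :* v3)) :+ v2 :* v1 :* c1 :+ c0)) (v2 :* v1 :+ (v0 :* c1 :+ v2 :* v1 :* (v0 :* v3) :+ v0 :* v1))))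
       where
       go : ∀ k → pw k * (1ℚ + # k * τ) ≤ 1ℚ
       go zero = ≤-reflexive (solve (τ ∷ []) (c1 :* (c1 :+ c0 :* v0)) c1)
       go (suc k) = (≤-by ((go k) ⊕ ((0≤* (0≤pw (suc k)) 0≤τ) ⊗ (≡⇒≤ (#-suc k))) ⊕ (0≤* (0≤* (0≤* (0≤pw k) 0≤τ) 0≤τ) (0≤+ 0≤1 (0≤# k)))) (solve (pw k ∷ # k ∷ τ ∷ # (suc k) ∷ []) (c1 :+ (v0 :* (c1 :+ v1 :* v2) :+ (c1 :- v2) :* v0 :* v2 :* v3 :+ c0)) ((c1 :- v2) :* v0 :* (c1 :+ v3 :* v2) :+ (c1 :+ (c1 :- v2) :* v0 :* v2 :* (c1 :+ v1) :+ v0 :* v2 :* v2 :* (c1 :+ v1)))))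

     -- From m t^m ≤ Z one gets X t^X ≤ 4 m t^(3m) ≤ 4 Z³ / m², and 2 Z² ≤ m makes this at most 1 /
     -- Z.
     tail-small : ∀ X m → 1 ≼ m → 3 · m ≼ X → X ≼ 4 · m → 2 · (Z · Z) ≼ m → # X * pw X ≤ τ
     tail-small X m 1≤m 3m≤X X≤4m hm = (≤-by (((0≤pw X) ⊗ (#-mono X≤4m)) ⊕ ((0≤pw X) ⊗ (≡⇒≤ (#-* 4 m))) ⊕ (0≤τ ⊗ fin) ⊕ ((0≤* (0≤* (0≤# 4) (0≤# m)) (0≤pw X)) ⊗ (≡⇒≤ (sym (r-inv Z 1≤Z))))) (solve (τ ∷ pw X ∷ # X ∷ # (4 · m) ∷ # Z ∷ # m ∷ []) (v0 :+ (v1 :* v2 :+ v1 :* v3 :+ v0 :* (v4 :* (c4 :* v5 :* v1)) :+ c4 :* v5 :* v1 :* c1)) (v2 :* v1 :+ (v1 :* v3 :+ v1 :* (c4 :* v5) :+ v0 :* c1 :+ c4 :* v5 :* v1 :* (v4 :* v0)))))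
       where
       a : ℚ
       a = # m * pw m
       0≤a = 0≤* (0≤# m) (0≤pw m)
       0≤Z = 0≤# Z
       a³ : a * a * a ≤ # Z * # Z * # Z
       a³ = (≤-by (((0≤* 0≤a 0≤a) ⊗ (pw-decay m)) ⊕ ((0≤* 0≤a 0≤Z) ⊗ (pw-decay m)) ⊕ ((0≤* 0≤Z 0≤Z) ⊗ (pw-decay m))) (solve (# Z ∷ a ∷ []) (v0 :* v0 :* v0 :+ (v1 :* v1 :* v1 :+ v1 :* v0 :* v1 :+ v0 :* v0 :* v1)) (v1 :* v1 :* v1 :+ (v1 :* v1 :* v0 :+ v1 :* v0 :* v0 :+ v0 :* v0 :* v0))))
       pX : pw X ≤ pw m * (pw m * pw m)
       pX = ≤-trans (pw-anti (3 · m) X 3m≤X) (≤-reflexive (trans (pw-+ m (m ∔ (m ∔ 0))) (cong (pw m *_) (trans (pw-+ m (m ∔ 0)) (cong (λ z → pw m * pw z) (ℕ.+-identityʳ m))))))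
       hm′ : # 2 * (# Z * # Z) ≤ # m
       hm′ = ≤-trans (≤-reflexive (sym (trans (#-* 2 (Z · Z)) (cong (# 2 *_) (#-* Z Z))))) (#-mono hm)
       fin : # Z * (# 4 * # m * pw X) ≤ 1ℚ
       fin = cancel-≤ {# m * # m} (λ q → 1≰0 (≤-trans (≤-trans (≤-reflexive (sym (*-identityˡ 1ℚ))) (_⊛_ 0≤1 (0≤# m) (#-mono 1≤m) (#-mono 1≤m))) q)) (0≤* (0≤# m) (0≤# m))
         (≤-by (((0≤* (0≤* (0≤* (0≤* (0≤# m) (0≤# m)) 0≤Z) (0≤# 4)) (0≤# m)) ⊗ pX) ⊕ ((0≤* (0≤# 4) 0≤Z) ⊗ a³) ⊕ ((0≤* (0≤# 2) (0≤* 0≤Z 0≤Z)) ⊗ hm′) ⊕ ((0≤# m) ⊗ hm′)) (solve (# m ∷ # Z ∷ pw X ∷ pw m ∷ []) (v0 :* v0 :* c1 :+ (v0 :* v0 :* v1 :* c4 :* v0 :* v2 :+ c4 :* v1 :* (v0 :* v3 :* (v0 :* v3) :* (v0 :* v3)) :+ c2 :* (v1 :* v1) :* (c2 :* (v1 :* v1)) :+ v0 :* (c2 :* (v1 :* v1)))) (v0 :* v0 :* (v1 :* (c4 :* v0 :* v2)) :+ (v0 :* v0 :* v1 :* c4 :* v0 :* (v3 :* (v3 :* v3)) :+ c4 :* v1 :* (v1 :* v1 :* v1) :+ c2 :* (v1 :* v1) :* v0 :+ v0 :* v0))))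

   -- By Bernoulli's inequality Z₀ = 2 j₀² gives t^(i²) ≥ 1/2 for i ≤ j₀, so the squares contribute
   -- at least j₀ / 2 = N + 2: `N` against the loss from `β`, 1 against the tail, and 1 for the
   -- resulting bound.
   j₀ Z₀ : ℕ
   j₀ = 2 · (N ∔ 2)
   Z₀ = 2 · (j₀ · j₀)

   1≤j₀ : 1 ≼ j₀
   1≤j₀ = ≼-trans (s≤s z≤n) (≼-trans (ℕ.m≤n+m 2 N) (ℕ.m≤m+n (N ∔ 2) _))

   1≤Z₀ : 1 ≼ Z₀
   1≤Z₀ = ≼-trans (ℕ.*-mono-≤ 1≤j₀ 1≤j₀) (ℕ.m≤m+n (j₀ · j₀) _)

   L-bound : ∀ X m → 1 ≼ m → 3 · m ≼ X → X ≼ 4 · m → 2 · (Z₀ · Z₀) ≼ m → r Z₀ ≤ ℒ X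
   L-bound X m 1≤m 3m≤X X≤4m hm = (≤-by ((L-lower X) ⊕ (0≤τ ⊗ sumlow) ⊕ (tail-small X m 1≤m 3m≤X X≤4m hm)) (solve (ℒ X ∷ # N ∷ τ ∷ ∑ X (λ k → pw k * σ k) ∷ # X ∷ pw X ∷ []) (v0 :+ (:- (v1 :* v2) :+ v2 :* v3 :- v4 :* v5 :+ v2 :* (v1 :+ c2) :+ v4 :* v5)) (v2 :+ (v0 :+ v2 :* v3 :+ v2))))
     where
     open Monsky Z₀ 1≤Z₀
     j²≤X : j₀ · j₀ ≼ X
     j²≤X = begin
       j₀ · j₀ ≤⟨ ℕ.m≤m+n (j₀ · j₀) _ ⟩
       Z₀ ≤⟨ ℕ.m≤m*n Z₀ Z₀ {{ℕ.>-nonZero 1≤Z₀}} ⟩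
       Z₀ · Z₀ ≤⟨ ℕ.m≤m+n (Z₀ · Z₀) _ ⟩
       2 · (Z₀ · Z₀) ≤⟨ hm ⟩
       m ≤⟨ ℕ.m≤m+n m _ ⟩
       3 · m ≤⟨ 3m≤X ⟩
       X ∎
       where open ℕ.≤-Reasoning
     half-pw : ∀ i → i ≼ j₀ → 1ℚ ≤ # 2 * pw (i · i)
     half-pw i i≤j = (≤-by (((0≤# 2) ⊗ (pw-bernoulli (i · i))) ⊕ ((0≤* (0≤# 2) 0≤τ) ⊗ (#-mono (ℕ.*-mono-≤ i≤j i≤j))) ⊕ (0≤τ ⊗ (≡⇒≤ (sym (#-* 2 (j₀ · j₀))))) ⊕ (≡⇒≤ (r-inv Z₀ 1≤Z₀))) (solve (pw (i · i) ∷ # (i · i) ∷ τ ∷ # (j₀ · j₀) ∷ # Z₀ ∷ []) (c2 :* v0 :+ (c2 :* (c1 :- v1 :* v2) :+ c2 :* v2 :* v1 :+ v2 :* (c2 :* v3) :+ v4 :* v2)) (c1 :+ (c2 :* v0 :+ c2 :* v2 :* v3 :+ v2 :* v4 :+ c1))))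
     sumlow : # N + # 2 ≤ ∑ X (λ k → pw k * σ k)
     sumlow = cancel-≤ {# 2} (λ q → 1≰0 (≤-trans (#-mono {1} {2} (s≤s z≤n)) q)) (0≤# 2)
       (≤-by (((0≤# 2) ⊗ (squares X j₀ j²≤X)) ⊕ (≤-reflexive (sym (∑-*ˡ j₀ (# 2) _))) ⊕ (∑-mono j₀ (λ i _ i≤j → half-pw i i≤j)) ⊕ (≡⇒≤ (sym (∑-const j₀ 1ℚ))) ⊕ (≡⇒≤ (sym (trans (#-* 2 (N ∔ 2)) (cong (# 2 *_) (#-+ N 2)))))) (solve (∑ X (λ k → pw k * σ k) ∷ ∑ j₀ (λ i → pw (i · i)) ∷ ∑ j₀ (λ i → # 2 * pw (i · i)) ∷ ∑ j₀ (λ _ → 1ℚ) ∷ # j₀ ∷ # N ∷ []) (c2 :* v0 :+ (c2 :* v1 :+ v2 :+ v3 :+ v4 :* c1 :+ c2 :* (v5 :+ c2))) (c2 :* (v5 :+ c2) :+ (c2 :* v0 :+ c2 :* v1 :+ v2 :+ v3 :+ v4))))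

   module PrimeSum (𝓛 : LogData) (N≤B : N ≼ LogData.B 𝓛) where

     open SelbergFormula 𝓛 N 1≤N N≤B

     Pχ : ℕ → ℚ
     Pχ x = ∑ x (λ d → Λ d * (χ d * r d))

     -- Expand Σ χ(n) lg n / n, which is at most 8 N in size, as Σ Λ(d) χ(d) / d · ℒ (z / d).
     -- Replacing ℒ (z / d) by ℒ z costs at most 2 N / z for each d after the factor 1 / d, in total
     -- 2 N ψ z / z ≤ 12 N.
     LP-bound : ∀ z → 1 ≼ z → suc z ≼ B → - (# 20 * # N) ≤ ℒ z * Pχ z
     LP-bound z 1≤z z<B = (≤-by ((proj₁ lhs-bound) ⊕ (≡⇒≤ identity) ⊕ (proj₂ errb) ⊕ (≡⇒≤ (sym (∑-*ʳ z (# 2 * # N * r z) Λ))) ⊕ ((0≤* (0≤* (0≤# 2) (0≤# N)) (0≤r z 1≤z)) ⊗ (chebyshev z z<B)) ⊕ ((0≤* (0≤# 12) (0≤# N)) ⊗ (≡⇒≤ (r-inv z 1≤z)))) (solve (ℒ z ∷ Pχ z ∷ # N ∷ ∑ z (λ n → χ n * (lg n * r n)) ∷ ∑ z (λ d → Λ d * ((χ d * r d) * (ℒ (z ÷ d) - ℒ z))) ∷ ∑ z (λ d → Λ d * (# 2 * # N * r z)) ∷ r z ∷ ψ z ∷ # z ∷ []) (v0 :* v1 :+ (:- (c8 :* v2) :+ v3 :+ v4 :+ v5 :+ c2 :* v2 :* v6 :* v7 :+ cn 12 :* v2 :* (v8 :* v6))) (:- (cn 20 :* v2) :+ (v3 :+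 (v0 :* v1 :+ v4) :+ v5 :+ v7 :* (c2 :* v2 :* v6) :+ c2 :* v2 :* v6 :* (c6 :* v8) :+ cn 12 :* v2 :* c1))))
       where
       z≤B = ℕ.<⇒≤ z<B
       f₂-1 : f₂ 1 ≡ # 4
       f₂-1 = trans (cong₂ (λ a b → (a + # 4) * b) lg-1 r-1) (solve [] ((c0 :+ c4) :* c1) c4)
       0≤f₂ : ∀ m → 1 ≼ m → m ≼ B → 0ℚ ≤ f₂ m
       0≤f₂ m a b = 0≤* (0≤+ (0≤lg a b) (0≤# 4)) (0≤r m a)
       b₂ = abel χ f₂ (# N) z (λ j _ → χ-partial j) (λ m a b → f₂-dec m a (≼-trans b z≤B)) (λ a → 0≤f₂ z a z≤B) (0≤f₂ 1 ≼-refl 1≤B)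
       b₃ = abel χ r (# N) z (λ j _ → χ-partial j) (λ m a _ → r-anti a (ℕ.n≤1+n m)) (λ a → 0≤r z a) (0≤r 1 ≼-refl)
       S₂ S₃ : ℚ
       S₂ = ∑ z (λ m → χ m * f₂ m)
       S₃ = ∑ z (λ m → χ m * r m)
       lhs≡ : ∑ z (λ n → χ n * (lg n * r n)) ≡ S₂ - # 4 * S₃
       lhs≡ = trans (∑-ext z λ n → (solve (χ n ∷ lg n ∷ r n ∷ []) (v0 :* (v1 :* v2)) (v0 :* ((v1 :+ c4) :* v2) :- c4 :* (v0 :* v2)))) (trans (∑-sub z _ _) (cong (_-_ S₂) (sym (∑-*ˡ z (# 4) _))))
       lhs-bound : ∣ ∑ z (λ n → χ n * (lg n * r n)) ∣≤ # 8 * # N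
       lhs-bound = subst (∣_∣≤ # 8 * # N) (sym lhs≡)
         ( (≤-by ((proj₁ b₂) ⊕ ((0≤# 4) ⊗ (proj₂ b₃)) ⊕ ((0≤# N) ⊗ (≡⇒≤ f₂-1)) ⊕ ((0≤* (0≤# 4) (0≤# N)) ⊗ (≡⇒≤ r-1))) (solve (S₂ ∷ S₃ ∷ # N ∷ f₂ 1 ∷ r 1 ∷ []) (v0 :- c4 :* v1 :+ (:- (v2 :* v3) :+ c4 :* v1 :+ v2 :* v3 :+ c4 :* v2 :* v4)) (:- (c8 :* v2) :+ (v0 :+ c4 :* (v2 :* v4) :+ v2 :* c4 :+ c4 :* v2 :* c1))))
         , (≤-by ((proj₂ b₂) ⊕ ((0≤# 4) ⊗ (proj₁ b₃)) ⊕ ((0≤# N) ⊗ (≡⇒≤ f₂-1)) ⊕ ((0≤* (0≤# 4) (0≤# N)) ⊗ (≡⇒≤ r-1))) (solve (# N ∷ S₂ ∷ r 1 ∷ f₂ 1 ∷ S₃ ∷ []) (c8 :* v0 :+ (v1 :+ c4 :* (:- (v0 :* v2)) :+ v0 :* v3 :+ c4 :* v0 :* v2)) (v1 :- c4 :* v4 :+ (v0 :* v3 :+ c4 :* v4 :+ v0 :* c4 :+ c4 :* v0 :* c1)))))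
       Hχ : ℕ → ℚ
       Hχ n = ι (n ≼? z) * (χ n * r n)
       identity : ∑ z (λ n → χ n * (lg n * r n)) ≡ ℒ z * Pχ z + ∑ z (λ d → Λ d * ((χ d * r d) * (ℒ (z ÷ d) - ℒ z)))
       identity = begin
         ∑ z (λ n → χ n * (lg n * r n))
           ≡⟨ sym (∑-cut _ z≤B) ⟩
         ∑ B (λ n → ι (n ≼? z) * (χ n * (lg n * r n)))
           ≡⟨ ∑-ext B (λ n → (solve (ι (n ≼? z) ∷ χ n ∷ lg n ∷ r n ∷ []) (v0 :* (v1 :* (v2 :* v3))) (v2 :* (v0 :* (v1 :* v3))))) ⟩
         ∑ B (λ n → lg n * Hχ n)
           ≡⟨ ∑-lg Hχ (λ n B<n → ι-*-no (n ≼? z) λ q → ℕ.<⇒≱ B<n (≼-trans q z≤B)) ⟩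
         ∑ B (λ d → Λ d * ∑ B (λ m → Hχ (d · m)))
           ≡⟨ ∑-cong B (λ d 1≤d _ → cong (Λ d *_) (inner d 1≤d)) ⟩
         ∑ B (λ d → Λ d * ((χ d * r d) * ℒ (z ÷ d)))
           ≡⟨ ∑-trunc _ z≤B (λ { d@(suc _) z<d _ → trans (cong (λ w → Λ d * ((χ d * r d) * ℒ w)) (ℕ.m<n⇒m/n≡0 z<d)) (solve (Λ d ∷ χ d ∷ r d ∷ []) (v0 :* (v1 :* v2 :* c0)) c0) }) ⟩
         ∑ z (λ d → Λ d * ((χ d * r d) * ℒ (z ÷ d)))
           ≡⟨ ∑-ext z (λ d → (solve (Λ d ∷ χ d ∷ r d ∷ ℒ (z ÷ d) ∷ ℒ z ∷ []) (v0 :* (v1 :* v2 :* v3)) (v4 :* (v0 :* (v1 :* v2)) :+ v0 :* (v1 :* v2 :* (v3 :- v4))))) ⟩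
         ∑ z (λ d → ℒ z * (Λ d * (χ d * r d)) + Λ d * ((χ d * r d) * (ℒ (z ÷ d) - ℒ z)))
           ≡⟨ trans (∑-+ z _ _) (cong₂ _+_ (sym (∑-*ˡ z (ℒ z) _)) refl) ⟩
         ℒ z * Pχ z + ∑ z (λ d → Λ d * ((χ d * r d) * (ℒ (z ÷ d) - ℒ z))) ∎
         where
         open ≡-Reasoning
         inner : ∀ d → 1 ≼ d → ∑ B (λ m → Hχ (d · m)) ≡ (χ d * r d) * ℒ (z ÷ d)
         inner d 1≤d = trans (∑-cong B λ m 1≤m _ → cong (ι (d · m ≼? z) *_) (trans (cong₂ _*_ (χ-* d m) (r-* d m 1≤d 1≤m)) (solve (χ d ∷ χ m ∷ r d ∷ r m ∷ []) (v0 :* v1 :* (v2 :* v3)) (v0 :* v2 :* (v1 :* v3)))))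
           (trans (∑-cut-÷ d z _ 1≤d z≤B) (sym (∑-*ˡ (z ÷ d) (χ d * r d) _)))
       errb : ∣ ∑ z (λ d → Λ d * ((χ d * r d) * (ℒ (z ÷ d) - ℒ z))) ∣≤ ∑ z (λ d → Λ d * (# 2 * # N * r z))
       errb = ∑-bound z λ d 1≤d d≤z → scale d (subst (∣_∣≤ # 2 * # N * r z) (sym (*-assoc (χ d) (r d) _)) (χ-bound d (term d 1≤d d≤z)))
         where
         scale : ∀ d {y c} → ∣ y ∣≤ c → ∣ Λ d * y ∣≤ Λ d * c
         scale d {y} {c} (lo , hi) = (≤-by ((Λ≥0 d) ⊗ lo) (solve (Λ d ∷ y ∷ c ∷ []) (v0 :* v1 :+ v0 :* (:- v2)) (:- (v0 :* v2) :+ v0 :* v1))) , (Λ≥0 d ⊗ hi)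
         term : ∀ d → 1 ≼ d → d ≼ z → ∣ r d * (ℒ (z ÷ d) - ℒ z) ∣≤ # 2 * # N * r z
         term d 1≤d d≤z with ℕ.m≤n⇒∃[o]m+o≡n (÷-≤-self d z 1≤d)
         ... | o , eq = (≤-by ((0≤rd ⊗ (proj₂ tb)) ⊕ (0≤rd ⊗ (≡⇒≤ split)) ⊕ (0≤2N ⊗ rr)) (solve (r d ∷ ℒ y ∷ ℒ z ∷ Tl ∷ # N ∷ r (y ∔ 1) ∷ r z ∷ []) (v0 :* (v1 :- v2) :+ (v0 :* v3 :+ v0 :* v2 :+ c2 :* v4 :* (v0 :* v5))) (:- (c2 :* v4 :* v6) :+ (v0 :* (c2 :* v4 :* v5) :+ v0 :* (v1 :+ v3) :+ c2 :* v4 :* v6)))) ,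
                      (≤-by ((0≤rd ⊗ (proj₁ tb)) ⊕ (0≤rd ⊗ (≡⇒≤ (sym split))) ⊕ (0≤2N ⊗ rr)) (solve (# N ∷ r z ∷ r d ∷ r (y ∔ 1) ∷ ℒ y ∷ Tl ∷ ℒ z ∷ []) (c2 :* v0 :* v1 :+ (v2 :* (:- (c2 :* v0 :* v3)) :+ v2 :* (v4 :+ v5) :+ c2 :* v0 :* (v2 :* v3))) (v2 :* (v4 :- v6) :+ (v2 :* v5 :+ v2 :* v6 :+ c2 :* v0 :* v1))))
           where
           y = z ÷ d
           0≤rd = 0≤r d 1≤d
           0≤2N : 0ℚ ≤ # 2 * # N
           0≤2N = 0≤* (0≤# 2) (0≤# N)
           Tl : ℚ
           Tl = ∑ o (λ m → χ (y ∔ m) * r (y ∔ m))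
           split : ℒ z ≡ ℒ y + Tl
           split = trans (cong ℒ (sym eq)) (∑-++ y o _)
           1≤y+ : ∀ {m} → 1 ≼ m → 1 ≼ y ∔ m
           1≤y+ {m} a = ≼-trans a (ℕ.m≤n+m m y)
           part : ∀ j → ∣ ∑ j (λ m → χ (y ∔ m)) ∣≤ # 2 * # N
           part j = (≤-by ((proj₁ (χ-partial (y ∔ j))) ⊕ (proj₂ (χ-partial y)) ⊕ (≡⇒≤ (∑-++ y j χ))) (solve (∑ j (λ m → χ (y ∔ m)) ∷ # N ∷ ∑ y χ ∷ ∑ (y ∔ j) χ ∷ []) (v0 :+ (:- v1 :+ v2 :+ v3)) (:- (c2 :* v1) :+ (v3 :+ v1 :+ (v2 :+ v0))))) ,
                    (≤-by ((proj₂ (χ-partial (y ∔ j))) ⊕ (proj₁ (χ-partial y)) ⊕ (≡⇒≤ (sym (∑-++ y j χ)))) (solve (# N ∷ ∑ (y ∔ j) χ ∷ ∑ y χ ∷ ∑ j (λ m → χ (y ∔ m)) ∷ []) (c2 :* v0 :+ (v1 :+ (:- v0) :+ (v2 :+ v3))) (v3 :+ (v0 :+ v2 :+ v1))))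
           tb : ∣ Tl ∣≤ # 2 * # N * r (y ∔ 1)
           tb = abel (λ m → χ (y ∔ m)) (λ m → r (y ∔ m)) (# 2 * # N) o (λ j _ → part j)
                  (λ m a _ → r-anti (1≤y+ a) (ℕ.+-monoʳ-≤ y (ℕ.n≤1+n m))) (λ a → 0≤r _ (1≤y+ a)) (0≤r _ (1≤y+ ≼-refl))
           rr : r d * r (y ∔ 1) ≤ r z
           rr = ≤-trans (≤-reflexive (sym (r-* d (y ∔ 1) 1≤d (1≤y+ ≼-refl)))) (r-anti 1≤z (≼-trans (ℕ.<⇒≤ (<-÷ d z 1≤d)) (≼-reflexive (cong (d ·_) (ℕ.+-comm 1 y)))))

 -- Choice of the constants.

 module Params (N : ℕ) where

   -- Copies of the constant of Selberg's formula and of `Z₀`, available before any `LogData`,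
   -- because the range `B` is chosen from them.
   c₄ Z : ℕ
   c₄ = 36 ∔ 48 · N ∔ N · (96 · N)
   Z = 2 · (2 · (N ∔ 2) · (2 · (N ∔ 2)))

   opaque
     -- `c₅` and `c₇` are the coefficients of J in the errors `E` and `w`. `k₁`, `k₅` and `k₇`
     -- collect what the three lower bounds `T-large₁`, `T-large₅` and `T-large₇` demand of J. Being
     -- opaque, they enter only through the equations below.
     c₅ c₇ k₁ k₅ k₇ j : ℕ
     c₅ = 10 · c₄ ∔ 7 · N
     c₇ = N · (36 ∔ 3 · c₄ ∔ 18 · c₅ ∔ 32 · N)
     k₁ = 1 ∔ 4 · N · (c₇ ∔ c₅ ∔ 2 · c₄) ∔ 2 · (c₇ ∔ c₅)
     k₅ = 1 ∔ c₇ ∔ 2 · N · (24 ∔ 2 · c₄ ∔ 12 · c₅ ∔ c₇)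
     k₇ = 5 ∔ 8 · N ∔ 2 · c₇ ∔ 20 · N · Z
     j = Z ∔ (k₁ ∔ (k₅ ∔ k₇))

     Z≤j : Z ≼ j
     Z≤j = ℕ.m≤m+n Z _

     5≤j : 5 ≼ j
     5≤j = ≼-trans (≼-trans (ℕ.m≤m+n 5 _) (≼-trans (≼-reflexive (sym (ℕ.+-assoc 5 (8 · N) (2 · c₇)))) (ℕ.m≤m+n (5 ∔ 8 · N ∔ 2 · c₇) (20 · N · Z))))
       (≼-trans (ℕ.m≤n+m k₇ k₅) (≼-trans (ℕ.m≤n+m (k₅ ∔ k₇) k₁) (ℕ.m≤n+m (k₁ ∔ (k₅ ∔ k₇)) Z)))

     #c₅ : # c₅ ≡ # 10 * # c₄ + # 7 * # N
     #c₅ = trans (#-+ (10 · c₄) (7 · N)) (cong₂ _+_ (#-* 10 c₄) (#-* 7 N))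

     #c₇ : # c₇ ≡ # N * (# 36 + # 3 * # c₄ + # 18 * # c₅ + # 32 * # N)
     #c₇ = trans (#-* N (36 ∔ 3 · c₄ ∔ 18 · c₅ ∔ 32 · N)) (cong (# N *_) (trans (#-+ (36 ∔ 3 · c₄ ∔ 18 · c₅) (32 · N)) (cong₂ _+_ (trans (#-+ (36 ∔ 3 · c₄) (18 · c₅)) (cong₂ _+_ (trans (#-+ 36 (3 · c₄)) (cong (# 36 +_) (#-* 3 c₄))) (#-* 18 c₅))) (#-* 32 N))))

     #k₁ : # k₁ ≡ 1ℚ + # 4 * # N * (# c₇ + # c₅ + # 2 * # c₄) + # 2 * (# c₇ + # c₅)
     #k₁ = trans (#-+ (1 ∔ 4 · N · (c₇ ∔ c₅ ∔ 2 · c₄)) (2 · (c₇ ∔ c₅))) (cong₂ _+_ (trans (#-suc (4 · N · (c₇ ∔ c₅ ∔ 2 · c₄))) (cong (1ℚ +_) (trans (#-* (4 · N) (c₇ ∔ c₅ ∔ 2 · c₄)) (cong₂ _*_ (#-* 4 N) (trans (#-+ (c₇ ∔ c₅) (2 · c₄)) (cong₂ _+_ (#-+ c₇ c₅) (#-* 2 c₄))))))) (trans (#-* 2 (c₇ ∔ c₅)) (cong (# 2 *_) (#-+ c₇ c₅))))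

     #k₅ : # k₅ ≡ 1ℚ + # c₇ + # 2 * # N * (# 24 + # 2 * # c₄ + # 12 * # c₅ + # c₇)
     #k₅ = trans (#-+ (1 ∔ c₇) (2 · N · (24 ∔ 2 · c₄ ∔ 12 · c₅ ∔ c₇))) (cong₂ _+_ (#-suc c₇) (trans (#-* (2 · N) (24 ∔ 2 · c₄ ∔ 12 · c₅ ∔ c₇)) (cong₂ _*_ (#-* 2 N) (trans (#-+ (24 ∔ 2 · c₄ ∔ 12 · c₅) c₇) (cong (_+ # c₇) (trans (#-+ (24 ∔ 2 · c₄) (12 · c₅)) (cong₂ _+_ (trans (#-+ 24 (2 · c₄)) (cong (# 24 +_) (#-* 2 c₄))) (#-* 12 c₅))))))))

     #k₇ : # k₇ ≡ # 5 + # 8 * # N + # 2 * # c₇ + # 20 * # N * # Z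
     #k₇ = trans (#-+ (5 ∔ 8 · N ∔ 2 · c₇) (20 · N · Z)) (cong₂ _+_ (trans (#-+ (5 ∔ 8 · N) (2 · c₇)) (cong₂ _+_ (trans (#-+ 5 (8 · N)) (cong (# 5 +_) (#-* 8 N))) (#-* 2 c₇))) (trans (#-* (20 · N) Z) (cong (_* # Z) (#-* 20 N))))

     #k≤j : # k₁ + # k₅ + # k₇ ≤ # j
     #k≤j = ≤-trans (≤-reflexive (trans (+-assoc _ _ _) (sym (trans (#-+ k₁ (k₅ ∔ k₇)) (cong (# k₁ +_) (#-+ k₅ k₇)))))) (#-mono (ℕ.m≤n+m (k₁ ∔ (k₅ ∔ k₇)) Z))

   -- Agrees with `B₀` = 2 Y of the argument by contradiction, and so bounds the search for a prime
   -- in advance.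
   B : ℕ
   B = 2 · (2 ^ (j · j) · 2 ^ (j · j) · (2 ^ (j · j) · 2 ^ (j · j)))

 -- A class without primes up to B is impossible.

 module Contradiction (N : ℕ) (1≤N : 1 ≼ N) (a : ℕ) (a⊥N : Coprime a N)
                      (no-prime : ∀ q → Prime q → q ≼ Params.B N → ¬ q ≅ a [ N ]) where

   open Params N using (c₅; c₇; Z; k₁; k₅; k₇; j; Z≤j; 5≤j; #c₅; #c₇; #k₁; #k₅; #k₇) renaming (#k≤j to #k≤J)

   -- Their logarithms are J², 2 J², 4 J² and J. Three scales are needed because `pair-bound` and
   -- `product-bound` each compare a point with its square: v with z, and z with Y. The last one is
   -- the threshold of the sieve.
   v z Y z₀ : ℕ
   v = 2 ^ (j · j)
   z = v · v
   Y = z · z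
   z₀ = 2 ^ j

   1≤j : 1 ≼ j
   1≤j = ≼-trans (s≤s z≤n) 5≤j

   1≤v : 1 ≼ v
   1≤v = ℕ.m^n>0 2 (j · j)

   1≤z : 1 ≼ z
   1≤z = ℕ.*-mono-≤ 1≤v 1≤v

   1≤Y : 1 ≼ Y
   1≤Y = ℕ.*-mono-≤ 1≤z 1≤z

   z≤Y : z ≼ Y
   z≤Y = ℕ.m≤m*n z z {{ℕ.>-nonZero 1≤z}}

   v≤z : v ≼ z
   v≤z = ℕ.m≤m*n v v {{ℕ.>-nonZero 1≤v}}

   z₀≤v : z₀ ≼ v
   z₀≤v = ℕ.^-monoʳ-≤ 2 (ℕ.m≤m*n j j {{ℕ.>-nonZero 1≤j}})

   B₀ : ℕ
   B₀ = 2 · Y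

   2≤B₀ : 2 ≼ B₀
   2≤B₀ = ℕ.*-monoʳ-≤ 2 1≤Y

   Y≤B₀ : Y ≼ B₀
   Y≤B₀ = ℕ.m≤m+n Y _

   N≤B₀ : N ≼ B₀
   N≤B₀ = begin
     N ≤⟨ ℕ.m≤m+n N 2 ⟩
     N ∔ 2 ≤⟨ ℕ.m≤m+n (N ∔ 2) _ ⟩
     N2 ≤⟨ ℕ.m≤m*n N2 N2 {{ℕ.>-nonZero (≼-trans (s≤s z≤n) (ℕ.*-monoʳ-≤ 2 (ℕ.m≤n+m 2 N)))}} ⟩
     N2 · N2 ≤⟨ ℕ.m≤m+n (N2 · N2) _ ⟩
     Z ≤⟨ Z≤j ⟩
     j ≤⟨ ℕ.<⇒≤ (n<2^n j) ⟩
     z₀ ≤⟨ z₀≤v ⟩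
     v ≤⟨ v≤z ⟩
     z ≤⟨ z≤Y ⟩
     Y ≤⟨ Y≤B₀ ⟩
     B₀ ∎
     where
     open ℕ.≤-Reasoning
     N2 = 2 · (N ∔ 2)

   private
     module LB = Build B₀ 2≤B₀

   𝓛 : LogData
   𝓛 = record { B = B₀ ; 2≤B = 2≤B₀ ; ℓ = LB.ℓ ; 0≤ℓ = LB.0≤ℓ ; lg-mono = LB.lg-mono ; lg-incr = LB.lg-incr ; lg-2 = LB.lg-2 }

   open ClassDensity 𝓛 N 1≤N N≤B₀ hiding (T)

   J T C₄ w E : ℚ
   J = # j
   T = lg z
   C₄ = # c₄
   w = # c₇ * J
   E = # c₅ * J

   lg-2^ : ∀ k → 2 ^ k ≼ B₀ → lg (2 ^ k) ≡ # k
   lg-2^ zero _ = lg-1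
   lg-2^ (suc k) h = trans (lg-double (2 ^ k) (ℕ.m^n>0 2 k) h) (trans (cong (1ℚ +_) (lg-2^ k (≼-trans (ℕ.m≤m+n (2 ^ k) _) h))) (sym (#-suc k)))

   lgv : lg v ≡ J * J
   lgv = trans (lg-2^ (j · j) (≼-trans v≤z (≼-trans z≤Y Y≤B₀))) (#-* j j)

   T≡ : T ≡ lg v + lg v
   T≡ = lg-* v v 1≤v 1≤v (≼-trans z≤Y Y≤B₀)

   T≡J : T ≡ # 2 * (J * J)
   T≡J = (≡-by (T≡ ⊕≡ (cong ((# 2) *_) lgv)) (solve (J ∷ T ∷ lg v ∷ []) (c2 :* (v0 :* v0) :+ (v1 :+ c2 :* v2)) (v1 :+ (v2 :+ v2 :+ c2 :* (v0 :* v0)))))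

   lgY : lg Y ≡ T + T
   lgY = lg-* z z 1≤z 1≤z Y≤B₀

   lgz₀ : lg z₀ ≡ J
   lgz₀ = lg-2^ j (≼-trans z₀≤v (≼-trans v≤z (≼-trans z≤Y Y≤B₀)))

   1≤J : 1ℚ ≤ J
   1≤J = #-mono 1≤j

   0≤J : 0ℚ ≤ J
   0≤J = 0≤# j

   0≤N : 0ℚ ≤ # N
   0≤N = 0≤# N

   0≤C₄ : 0ℚ ≤ C₄
   0≤C₄ = 0≤# c₄

   0≤w : 0ℚ ≤ w
   0≤w = 0≤* (0≤# c₇) 0≤J

   kJ≤T : ∀ k → # k ≤ J → # k * J ≤ T
   kJ≤T k h = (≤-by ((0≤J ⊗ h) ⊕ (0≤* 0≤J 0≤J) ⊕ (≡⇒≤ (sym T≡J))) (solve (T ∷ J ∷ # k ∷ []) (v0 :+ (v1 :* v2 :+ c0 :+ c2 :* (v1 :* v1))) (v2 :* v1 :+ (v1 :* v1 :+ v1 :* v1 :+ v0))))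

   k₁≤J : # k₁ ≤ J
   k₁≤J = (≤-by (#k≤J ⊕ (0≤# k₅) ⊕ (0≤# k₇)) (solve (J ∷ # k₁ ∷ # k₅ ∷ # k₇ ∷ []) (v0 :+ (v1 :+ v2 :+ v3 :+ c0 :+ c0)) (v1 :+ (v0 :+ v2 :+ v3))))

   k₅≤J : # k₅ ≤ J
   k₅≤J = (≤-by (#k≤J ⊕ (0≤# k₁) ⊕ (0≤# k₇)) (solve (J ∷ # k₁ ∷ # k₅ ∷ # k₇ ∷ []) (v0 :+ (v1 :+ v2 :+ v3 :+ c0 :+ c0)) (v2 :+ (v0 :+ v1 :+ v3))))

   k₇≤J : # k₇ ≤ J
   k₇≤J = (≤-by (#k≤J ⊕ (0≤# k₁) ⊕ (0≤# k₅)) (solve (J ∷ # k₁ ∷ # k₅ ∷ # k₇ ∷ []) (v0 :+ (v1 :+ v2 :+ v3 :+ c0 :+ c0)) (v3 :+ (v0 :+ v1 :+ v2))))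

   -- T = 2 J² dominates every quantity of size O(J).
   T-large₁ : 1ℚ + # 4 * # N * (w + E + # 2 * C₄) + # 2 * (w + E) ≤ T
   T-large₁ = (≤-by ((kJ≤T k₁ k₁≤J) ⊕ (0≤J ⊗ (≡⇒≤ (sym #k₁))) ⊕ ((0≤+ 0≤1 (0≤* (0≤* (0≤# 8) 0≤N) 0≤C₄)) ⊗ 1≤J) ⊕ ((0≤+ (0≤* (0≤# 4) 0≤N) (0≤# 2)) ⊗ (≤-reflexive (refl {x = w}))) ⊕ ((0≤+ (0≤* (0≤# 4) 0≤N) (0≤# 2)) ⊗ (≤-reflexive (refl {x = E})))) (solve (T ∷ # k₁ ∷ J ∷ # N ∷ # c₇ ∷ # c₅ ∷ C₄ ∷ w ∷ E ∷ []) (v0 :+ (v1 :* v2 :+ v2 :* (c1 :+ c4 :* v3 :* (v4 :+ v5 :+ c2 :* v6) :+ c2 :* (v4 :+ v5)) :+ (c1 :+ c8 :* v3 :* v6) :* c1 :+ (c4 :* v3 :+ c2) :* v7 :+ (c4 :* v3 :+ c2) :* v8)) (c1 :+ c4 :* v3 :* (v7 :+ v8 :+ c2 :* v6) :+ c2 :* (v7 :+ v8) :+ (v0 :+ v2 :* v1 :+ (c1 :+ c8 :* v3 :* v6) :* v2 :+ (c4 :* v3 :+ c2) :* (v4 :* v2) :+ (c4 :* v3 :+ c2) :* (v5 :* v2)))))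

   T-large₅ : 1ℚ + w + # 2 * # N * (# 24 + # 2 * C₄ + # 12 * E + w) ≤ T
   T-large₅ = (≤-by ((kJ≤T k₅ k₅≤J) ⊕ (0≤J ⊗ (≡⇒≤ (sym #k₅))) ⊕ ((0≤+ 0≤1 (0≤* (0≤* (0≤# 2) 0≤N) (0≤+ (0≤# 24) (0≤* (0≤# 2) 0≤C₄)))) ⊗ 1≤J)) (solve (T ∷ # k₅ ∷ J ∷ # c₇ ∷ # N ∷ C₄ ∷ # c₅ ∷ []) (v0 :+ (v1 :* v2 :+ v2 :* (c1 :+ v3 :+ c2 :* v4 :* (cn 24 :+ c2 :* v5 :+ cn 12 :* v6 :+ v3)) :+ (c1 :+ c2 :* v4 :* (cn 24 :+ c2 :* v5)) :* c1)) (c1 :+ v3 :* v2 :+ c2 :* v4 :* (cn 24 :+ c2 :* v5 :+ cn 12 :* (v6 :* v2) :+ v3 :* v2) :+ (v0 :+ v2 :* v1 :+ (c1 :+ c2 :* v4 :* (cn 24 :+ c2 :* v5)) :* v2))))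

   T-large₇ : # 5 + # 8 * # N + # 2 * w + # 20 * # N * # Z ≤ T
   T-large₇ = (≤-by ((kJ≤T k₇ k₇≤J) ⊕ (0≤J ⊗ (≡⇒≤ (sym #k₇))) ⊕ ((0≤+ (0≤+ (0≤# 5) (0≤* (0≤# 8) 0≤N)) (0≤* (0≤* (0≤# 20) 0≤N) (0≤# Z))) ⊗ 1≤J)) (solve (T ∷ # k₇ ∷ J ∷ # N ∷ # c₇ ∷ # Z ∷ []) (v0 :+ (v1 :* v2 :+ v2 :* (cn 5 :+ c8 :* v3 :+ c2 :* v4 :+ cn 20 :* v3 :* v5) :+ (cn 5 :+ c8 :* v3 :+ cn 20 :* v3 :* v5) :* c1)) (cn 5 :+ c8 :* v3 :+ c2 :* (v4 :* v2) :+ cn 20 :* v3 :* v5 :+ (v0 :+ v2 :* v1 :+ (cn 5 :+ c8 :* v3 :+ cn 20 :* v3 :* v5) :* v2))))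

   1≤T : 1ℚ ≤ T
   1≤T = (≤-by (T-large₇ ⊕ ((0≤# 8) ⊗ 0≤N) ⊕ ((0≤# 2) ⊗ 0≤w) ⊕ ((0≤# 20) ⊗ (0≤* 0≤N (0≤# Z))) ⊕ (0≤# 4)) (solve (T ∷ # N ∷ w ∷ # Z ∷ []) (v0 :+ (cn 5 :+ c8 :* v1 :+ c2 :* v2 :+ cn 20 :* v1 :* v3 :+ c8 :* c0 :+ c2 :* c0 :+ cn 20 :* c0 :+ c0)) (c1 :+ (v0 :+ c8 :* v1 :+ c2 :* v2 :+ cn 20 :* (v1 :* v3) :+ c4))))

   0≤T : 0ℚ ≤ T
   0≤T = ≤-trans 0≤1 1≤T

   T≰0 : ¬ T ≤ 0ℚ
   T≰0 h = 1≰0 (≤-trans 1≤T h)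

   E₀ : ℚ
   E₀ = # 10 * C₄ * J

   private
     J≰0 : ¬ lg z₀ ≤ 0ℚ
     J≰0 h = 1≰0 (≤-trans 1≤J (subst (_≤ 0ℚ) lgz₀ h))

     0≤E₀ : 0ℚ ≤ E₀
     0≤E₀ = 0≤* (0≤* (0≤# 10) 0≤C₄) 0≤J

     JJ : 1ℚ ≤ J * J
     JJ = ≤-trans 1≤J (≤-trans (≤-reflexive (sym (*-identityʳ J))) (0≤J ⊗ 1≤J))

     hE₀ : # 2 * # c₄ * (lg Y + 1ℚ) ≤ E₀ * lg z₀
     hE₀ = (≤-by (((0≤* (0≤# 2) 0≤C₄) ⊗ (≡⇒≤ lgY)) ⊕ ((0≤* (0≤# 4) 0≤C₄) ⊗ (≡⇒≤ T≡J)) ⊕ (0≤E₀ ⊗ (≡⇒≤ (sym lgz₀))) ⊕ ((0≤* (0≤# 2) 0≤C₄) ⊗ JJ)) (solve (C₄ ∷ J ∷ lg z₀ ∷ lg Y ∷ T ∷ []) (cn 10 :* v0 :* v1 :* v2 :+ (c2 :* v0 :* v3 :+ c4 :* v0 :* v4 :+ cn 10 :* v0 :* v1 :* v1 :+ c2 :* v0 :* c1)) (c2 :* v0 :* (v3 :+ c1) :+ (c2 :* v0 :* (v4 :+ v4) :+ c4 :* v0 :* (c2 :* (v1 :* v1)) :+ cn 10 :* v0 :* v1 :* v2 :+ c2 :* v0 :* (v1 :* v1)))))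

     hE : E₀ + # N * (lg z₀ + # 6) ≤ E
     hE = (≤-by ((0≤J ⊗ (≡⇒≤ (sym #c₅))) ⊕ (0≤N ⊗ (≡⇒≤ lgz₀)) ⊕ ((0≤* (0≤# 6) 0≤N) ⊗ 1≤J)) (solve (# c₅ ∷ J ∷ C₄ ∷ # N ∷ lg z₀ ∷ []) (v0 :* v1 :+ (v1 :* (cn 10 :* v2 :+ cn 7 :* v3) :+ v3 :* v4 :+ c6 :* v3 :* c1)) (cn 10 :* v2 :* v1 :+ v3 :* (v4 :+ c6) :+ (v1 :* v0 :+ v3 :* v1 :+ c6 :* v3 :* v1))))

     z₀≤Y : z₀ ≼ Y
     z₀≤Y = ≼-trans z₀≤v (≼-trans v≤z z≤Y)

   open Sieve Y ≼-refl z₀ (ℕ.m^n>0 2 j) z₀≤Y J≰0 E₀ E 0≤E₀ hE₀ hE hiding (1≤Y)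

   Y<B₀ : suc Y ≼ B₀
   Y<B₀ = Y<B

   -- `f₂` falls from m to m + 1 by at least lg m / (m (m + 1)), so it acts as a primitive of the
   -- summand.
   telescope : ∀ y → suc y ≼ B₀ → ∑ y (λ m → lg m * (r m * r (suc m))) ≤ f₂ 1 - f₂ (suc y)
   telescope zero _ = ≤-reflexive (solve (f₂ 1 ∷ []) c0 (v0 :- v0))
   telescope (suc y) h = (≤-by ((telescope y (ℕ.<⇒≤ h)) ⊕ drop ⊕ (≤-reflexive (solve (lg (suc y) ∷ r (suc y) ∷ r (suc (suc y)) ∷ []) (v0 :* (v1 :* v2)) (v0 :* v1 :* v2)))) (solve (f₂ 1 ∷ f₂ (suc (suc y)) ∷ ∑ y (λ m → lg m * (r m * r (suc m))) ∷ l ∷ u ∷ v′ ∷ lg (suc y) ∷ r (suc y) ∷ r (suc (suc y)) ∷ f₂ (suc y) ∷ []) (v0 :- v1 :+ (v2 :+ (v1 :+ v3 :* v4 :* v5) :+ v6 :* (v7 :* v8))) (v2 :+ v6 :* (v7 :* v8) :+ (v0 :- v9 :+ v9 :+ v3 :* v4 :* v5))))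
     where
     open Step (suc y) (s≤s z≤n) h using (l; δ; u; uv; lg≡; δ≤4u; 0≤l; 0≤v) renaming (v to v′)
     drop : f₂ (suc (suc y)) + l * u * v′ ≤ f₂ (suc y)
     drop = subst (λ ζ → (ζ + # 4) * v′ + l * u * v′ ≤ f₂ (suc y)) (sym lg≡)
       (≤-by ((0≤v ⊗ δ≤4u) ⊕ ((0≤+ 0≤l (0≤# 4)) ⊗ (≡⇒≤ (sym uv)))) (solve (l ∷ u ∷ v′ ∷ δ ∷ []) ((v0 :+ c4) :* v1 :+ (v2 :* v3 :+ (v0 :+ c4) :* (v1 :* v2))) ((v0 :+ v3 :+ c4) :* v2 :+ v0 :* v1 :* v2 :+ (v2 :* (c4 :* v1) :+ (v0 :+ c4) :* (v1 :- v2)))))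

   -- Without primes in the class of a, only proper prime powers contribute to Pₐ a.
   Pₐ-small : ∀ x → x ≼ Y → Pₐ a x ≤ # 16
   Pₐ-small x x≤Y = ≤-trans (≤-reflexive (trans as-Λ (∑-Λ F))) (≤-trans (≤-reflexive (∑-trunc _ Y≤B₀ λ q Y<q _ → beyond q Y<q (prime? q)))
     (≤-trans (∑-mono Y λ q 1≤q q≤Y → G≤ q 1≤q q≤Y (prime? q)) (≤-trans (≤-reflexive (sym (∑-*ˡ Y (# 4) _)))
       (≤-by (((0≤# 4) ⊗ (telescope Y Y<B₀)) ⊕ ((0≤# 4) ⊗ (≡⇒≤ f₂-1)) ⊕ ((0≤# 4) ⊗ (0≤* (0≤+ (0≤lg (s≤s z≤n) Y<B₀) (0≤# 4)) (0≤r (suc Y) (s≤s z≤n))))) (solve (∑ Y (λ m → lg m * (r m * r (suc m))) ∷ f₂ 1 ∷ f₂ (suc Y) ∷ []) (cn 16 :+ (c4 :* v0 :+ c4 :* v1 :+ c4 :* c0)) (c4 :* v0 :+ (c4 :* (v1 :- v2) :+ c4 :* c4 :+ c4 :* v2)))))))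
     where
     F : ℕ → ℚ
     F e = ι (e ≼? x) * (κ a e * r e)
     f₂-1 : f₂ 1 ≡ # 4
     f₂-1 = trans (cong₂ (λ s t → (s + # 4) * t) lg-1 r-1) (solve [] ((c0 :+ c4) :* c1) c4)
     as-Λ : Pₐ a x ≡ ∑ B₀ (λ e → Λ e * F e)
     as-Λ = sym (trans (∑-ext B₀ λ e → (solve (Λ e ∷ ι (e ≼? x) ∷ κ a e ∷ r e ∷ []) (v0 :* (v1 :* (v2 :* v3))) (v1 :* (v0 :* (v2 :* v3))))) (∑-cut _ (≼-trans x≤Y Y≤B₀)))
     q^≥ : ∀ {q} k → Prime q → q ≼ q ^ suc k
     q^≥ {q} k pq = ℕ.m≤m*n q (q ^ k) {{ℕ.m^n≢0 q k {{ℕ.>-nonZero (prime-≥1 pq)}}}}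
     beyond : ∀ q → Y ℕ.< q → (d : Dec (Prime q)) → ι d * ∑ B₀ (λ k → ι (q ^ k ≼? B₀) * (ℓ q * F (q ^ k))) ≡ 0ℚ
     beyond q Y<q (no _) = zeroˡ _
     beyond q Y<q (yes pq) = trans (*-identityˡ _) (∑-0 B₀ λ { (suc k) _ _ → trans (cong (λ s → ι (q ^ suc k ≼? B₀) * (ℓ q * (s * (κ a (q ^ suc k) * r (q ^ suc k))))) (ι-no (q ^ suc k ≼? x) λ h → ℕ.<⇒≱ Y<q (≼-trans (q^≥ k pq) (≼-trans h x≤Y))))
       (solve (ι (q ^ suc k ≼? B₀) ∷ ℓ q ∷ κ a (q ^ suc k) ∷ r (q ^ suc k) ∷ []) (v0 :* (v1 :* (c0 :* (v2 :* v3)))) c0) })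
     G≤ : ∀ q → 1 ≼ q → q ≼ Y → (d : Dec (Prime q)) → ι d * ∑ B₀ (λ k → ι (q ^ k ≼? B₀) * (ℓ q * F (q ^ k))) ≤ # 4 * (lg q * (r q * r (suc q)))
     G≤ q 1≤q q≤Y (no _) = ≤-trans (≤-reflexive (zeroˡ _)) (0≤* (0≤# 4) (0≤* (0≤lg 1≤q q≤B₀) (0≤* (0≤r q 1≤q) (0≤r (suc q) (s≤s z≤n)))))
       where q≤B₀ = ≼-trans q≤Y Y≤B₀
     -- The exponent 1 contributes nothing. The powers from q² on give at most lg q · 2 / q², and 1
     -- / q ≤ 2 / (q + 1) brings this into the telescoping form.
     G≤ q 1≤q q≤Y (yes pq) = (≤-by ((split B₀ (≼-trans (s≤s z≤n) 2≤B₀)) ⊕ ((0≤* (0≤# 2) (0≤* 0≤lgq 0≤rq)) ⊗ rq≤)) (solve (lg q ∷ r q ∷ r (suc q) ∷ ∑ B₀ f ∷ []) (c4 :* (v0 :* (v1 :* v2)) :+ (v3 :+ c2 :* (v0 :* v1) :* v1)) (c1 :* v3 :+ (v0 :* v1 :* (c2 :* v1) :+ c2 :* (v0 :* v1) :* (c2 :* v2)))))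
       where
       f : ℕ → ℚ
       f k = ι (q ^ k ≼? B₀) * (ℓ q * F (q ^ k))
       q≤B₀ = ≼-trans q≤Y Y≤B₀
       0≤lgq = 0≤lg 1≤q q≤B₀
       0≤rq = 0≤r q 1≤q
       ℓ≡ : ℓ q ≡ lg q
       ℓ≡ = sym (lg-prime q pq q≤B₀)
       rq≤ : r q ≤ # 2 * r (suc q)
       rq≤ = (≤-by (((0≤* 0≤rq (0≤r (suc q) (s≤s z≤n))) ⊗ (#-mono {suc q} {2 · q} (≼-trans (ℕ.+-monoˡ-≤ q 1≤q) (≼-reflexive (cong (q ℕ.+_) (sym (ℕ.+-identityʳ q))))))) ⊕ ((0≤* 0≤rq (0≤r (suc q) (s≤s z≤n))) ⊗ (≡⇒≤ (#-* 2 q))) ⊕ ((0≤* (0≤# 2) (0≤r (suc q) (s≤s z≤n))) ⊗ (≡⇒≤ (r-inv q 1≤q))) ⊕ (0≤rq ⊗ (≡⇒≤ (sym (r-inv (suc q) (s≤s z≤n)))))) (solve (r (suc q) ∷ r q ∷ # (suc q) ∷ # (2 · q) ∷ # q ∷ []) (c2 :* v0 :+ (v1 :* v0 :* v2 :+ v1 :* v0 :* v3 :+ c2 :* v0 :* (v4 :* v1) :+ v1 :* c1)) (v1 :+ (v1 :* v0 :* v3 :+ v1 :* v0 :* (c2 :* v4) :+ c2 :* v0 :* c1 :+ v1 :* (v2 :* v0)))))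
       f1 : f 1 ≡ 0ℚ
       f1 = trans (cong (λ s → ι (q ^ 1 ≼? B₀) * (ℓ q * (ι (q ^ 1 ≼? x) * (s * r (q ^ 1))))) (ι-no ((q ^ 1) ≅? a [ N ]) λ h → no-prime q pq q≤B₀ (≋-trans (≅-≡ (sym (ℕ.*-identityʳ q))) h)))
         (solve (ι (q ^ 1 ≼? B₀) ∷ ℓ q ∷ ι (q ^ 1 ≼? x) ∷ r (q ^ 1) ∷ []) (v0 :* (v1 :* (v2 :* (c0 :* v3)))) c0)
       f≤ : ∀ k → f (suc k) ≤ lg q * r q * r (q ^ k)
       f≤ k = (≤-by (((0≤* (0≤ℓ q) (0≤* (0≤ι (q ^ suc k ≼? x)) (0≤* (0≤κ a (q ^ suc k)) 0≤rk))) ⊗ (ι≤1 (q ^ suc k ≼? B₀))) ⊕ ((0≤* (0≤ℓ q) (0≤* (0≤κ a (q ^ suc k)) 0≤rk)) ⊗ (ι≤1 (q ^ suc k ≼? x))) ⊕ ((0≤* (0≤ℓ q) 0≤rk) ⊗ (ι≤1 ((q ^ suc k) ≅? a [ N ]))) ⊕ ((0≤ℓ q) ⊗ (≡⇒≤ (r-* q (q ^ k) 1≤q (ℕ.m^n>0 q {{ℕ.>-nonZero 1≤q}} k)))) ⊕ ((0≤* 0≤rq (0≤r (q ^ k) (ℕ.m^n>0 q {{ℕ.>-nonZero 1≤q}} k))) ⊗ (≡⇒≤ ℓ≡))) (solve (lg q ∷ r q ∷ r (q ^ k) ∷ ℓ q ∷ ι₂ ∷ ι₃ ∷ r (q ^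 suc k) ∷ ι₁ ∷ []) (v0 :* v1 :* v2 :+ (v3 :* (v4 :* (v5 :* v6)) :* v7 :+ v3 :* (v5 :* v6) :* v4 :+ v3 :* v6 :* v5 :+ v3 :* v6 :+ v1 :* v2 :* v3)) (v7 :* (v3 :* (v4 :* (v5 :* v6))) :+ (v3 :* (v4 :* (v5 :* v6)) :* c1 :+ v3 :* (v5 :* v6) :* c1 :+ v3 :* v6 :* c1 :+ v3 :* (v1 :* v2) :+ v1 :* v2 :* v0))))
         where
         ι₁ ι₂ ι₃ : ℚ
         ι₁ = ι (q ^ suc k ≼? B₀)
         ι₂ = ι (q ^ suc k ≼? x)
         ι₃ = κ a (q ^ suc k)
         0≤rk = 0≤r (q ^ suc k) (ℕ.m^n>0 q {{ℕ.>-nonZero 1≤q}} (suc k))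
       split : ∀ b → 1 ≼ b → ∑ b f ≤ lg q * r q * (# 2 * r q)
       split (suc b) _ = (≤-by ((≡⇒≤ (∑-++ 1 b f)) ⊕ (≡⇒≤ f1) ⊕ (∑-mono b (λ k _ _ → f≤ k)) ⊕ (≡⇒≤ (sym (∑-*ˡ b (lg q * r q) _))) ⊕ ((0≤* 0≤lgq 0≤rq) ⊗ (geometric q b (prime≥2 pq)))) (solve (lg q ∷ r q ∷ ∑ (suc b) f ∷ f 1 ∷ ∑ b (λ k → f (suc k)) ∷ ∑ b (λ k → lg q * r q * r (q ^ k)) ∷ ∑ b (λ k → r (q ^ k)) ∷ []) (v0 :* v1 :* (c2 :* v1) :+ (v2 :+ v3 :+ v4 :+ v5 :+ v0 :* v1 :* v6)) (v2 :+ (c0 :+ v3 :+ v4 :+ c0 :+ v5 :+ v0 :* v1 :* v6 :+ v0 :* v1 :* (c2 :* v1)))))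

   -- Up to `w`, a class has twice the expected share T or more; together with `Small` this covers
   -- the two extremes that `star` permits.
   record Big (h : ℕ) : Set where
     constructor mkBig
     field lower : # 2 * T - w ≤ p h z

   record Small (h : ℕ) : Set where
     constructor mkSmall
     field upper : p h z ≤ w

   open Big
   open Small

   private
     K₀ : ℚ
     K₀ = # 12 + C₄ + # 6 * E
     0≤K₀ : 0ℚ ≤ K₀
     0≤K₀ = 0≤+ (0≤+ (0≤# 12) 0≤C₄) (0≤* (0≤# 6) 0≤E)

   -- `pair-bound` for the class of `a` itself: by `Pₐ-small` its term Φ A is only O(T), compared
   -- with the main term of order T². The constant `c₇` collects the errors, using lg Y + 1 ≤ 3 T.
   star : ∀ h k → Coprime h N → h · k ≅ a [ N ] → p h z * (# 2 * T - p k z) ≤ w * T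
   star h k h⊥N hk≅a = (≤-by ((0≤Φ ⊗ (pair-bound a h k z (# 32 * # N * T) a⊥N h⊥N hk≅a 1≤z ≼-refl hδ)) ⊕ ((0≤* 0≤Φ 0≤K₀) ⊗ (≡⇒≤ lgY)) ⊕ ((0≤* 0≤Φ 0≤K₀) ⊗ 1≤T) ⊕ ((0≤+ (0≤* 0≤K₀ (0≤* (0≤# 3) 0≤T)) (0≤* (0≤* (0≤# 32) 0≤N) 0≤T)) ⊗ Φ≤N) ⊕ ((0≤* (0≤* 0≤N 0≤T) (0≤+ (0≤+ (0≤# 36) (0≤* (0≤# 3) 0≤C₄)) (0≤* (0≤# 32) 0≤N))) ⊗ 1≤J) ⊕ ((0≤* 0≤J 0≤T) ⊗ (≡⇒≤ (sym #c₇)))) (solve (# c₇ ∷ J ∷ T ∷ Φ ∷ Pₐ h z ∷ p k z ∷ C₄ ∷ # c₅ ∷ lg Y ∷ # N ∷ []) (v0 :* v1 :* v2 :+ (v3 :* (v4 :* (c2 :* v2 :- v5)) :+ v3 :* (cn 12 :+ v6 :+ c6 :* (v7 :* v1)) :* v8 :+ v3 :* (cn 12 :+ v6 :+ c6 :* (v7 :* v1)) :* c1 :+ ((cn 12 :+ v6 :+ c6 :* (v7 :* v1)) :* (cn 3 :* v2) :+ cn 32 :* v9 :* v2) :* v3 :+ v9 :* v2 :* (cn 36 :+ cn 3 :* v6 :+ cn 32 :* v9) :* c1 :+ v1 :* v2 :* (v9 :* (cn 36 :+ cn 3 :* v6 :+ cn 18 :* v7 :+ cn 32 :* v9)))) (v3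 :* v4 :* (c2 :* v2 :- v5) :+ (v3 :* ((cn 12 :+ v6 :+ c6 :* (v7 :* v1)) :* (v8 :+ c1) :+ cn 32 :* v9 :* v2) :+ v3 :* (cn 12 :+ v6 :+ c6 :* (v7 :* v1)) :* (v2 :+ v2) :+ v3 :* (cn 12 :+ v6 :+ c6 :* (v7 :* v1)) :* v2 :+ ((cn 12 :+ v6 :+ c6 :* (v7 :* v1)) :* (cn 3 :* v2) :+ cn 32 :* v9 :* v2) :* v9 :+ v9 :* v2 :* (cn 36 :+ cn 3 :* v6 :+ cn 32 :* v9) :* v1 :+ v1 :* v2 :* v0))))
     where
     hδ : Φ * A a Y ≤ # 32 * # N * T
     hδ = (≤-by ((0≤Φ ⊗ (A≤ a Y 1≤Y Y≤B₀)) ⊕ ((0≤p a Y) ⊗ (≡⇒≤ lgY)) ⊕ ((0≤* 0≤Φ (0≤* (0≤# 2) 0≤T)) ⊗ (Pₐ-small Y ≼-refl)) ⊕ ((0≤* (0≤# 32) 0≤T) ⊗ Φ≤N)) (solve (# N ∷ T ∷ Φ ∷ A a Y ∷ Pₐ a Y ∷ lg Y ∷ []) (cn 32 :* v0 :* v1 :+ (v2 :* v3 :+ v2 :* v4 :* v5 :+ v2 :* (c2 :* v1) :* v4 :+ cn 32 :* v1 :* v2)) (v2 :* v3 :+ (v2 :* (v5 :* v4) :+ v2 :* v4 :* (v1 :+ v1) :+ v2 :* (c2 :* v1) :* cn 16 :+ cn 32 :* v1 :* v0))))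

   quo-coprimeˡ : ∀ g h → Coprime h N → quo g h · h ≅ g [ N ]
   quo-coprimeˡ g h h⊥N = ≋-trans (≅-≡ (ℕ.*-comm (quo g h) h)) (quo-spec g h h⊥N)

   opaque
     -- Let k = a / h. If p k z ≤ T, then 2 T - p k z ≥ T and `star` makes `h` Small. If p k z ≥ T,
     -- then `star` with the roles exchanged gives 2 T - p h z ≤ w, so `h` is Big.
     dichotomy : ∀ h → Coprime h N → Big h ⊎ Small h
     dichotomy h h⊥N = [ (λ T≤pk → inj₁ ([ above , below T≤pk ]′ (≤-total (# 2 * T) (p h z)))) , (λ pk≤T → inj₂ (thin pk≤T)) ]′ (≤-total T (p k z))
       where
       k : ℕ
       k = quo a h
       thin : p k z ≤ T → Small h
       thin pk≤T = mkSmall (cancel-≤ T≰0 0≤T (≤-by ((star h k h⊥N (quo-spec a h h⊥N)) ⊕ ((0≤p h z) ⊗ pk≤T)) (solve (T ∷ w ∷ p h z ∷ p k z ∷ []) (v0 :* v1 :+ (v2 :* (c2 :* v0 :- v3) :+ v2 :* v3)) (v0 :* v2 :+ (v1 :* v0 :+ v2 :* v0)))))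
       above : # 2 * T ≤ p h z → Big h
       above 2T≤ph = mkBig (≤-by (2T≤ph ⊕ 0≤w) (solve (p h z ∷ T ∷ w ∷ []) (v0 :+ (c2 :* v1 :+ c0)) (c2 :* v1 :- v2 :+ (v0 :+ v2))))
       below : T ≤ p k z → p h z ≤ # 2 * T → Big h
       below T≤pk ph≤2T = mkBig (≤-by diff (solve (p h z ∷ T ∷ w ∷ []) (v0 :+ (c2 :* v1 :- v0)) (c2 :* v1 :- v2 :+ v2)))
         where
         0≤d : 0ℚ ≤ # 2 * T - p h z
         0≤d = (≤-by ph≤2T (solve (T ∷ p h z ∷ []) (c2 :* v0 :- v1 :+ v1) (c0 :+ c2 :* v0)))
         diff : # 2 * T - p h z ≤ w
         diff = cancel-≤ T≰0 0≤T (≤-by ((star k h (quo-coprime a h a⊥N h⊥N) (quo-coprimeˡ a h h⊥N)) ⊕ (0≤d ⊗ T≤pk)) (solve (T ∷ w ∷ p k z ∷ p h z ∷ []) (v0 :* v1 :+ (v2 :* (c2 :* v0 :- v3) :+ (c2 :* v0 :- v3) :* v0)) (v0 :* (c2 :* v0 :- v3) :+ (v1 :* v0 :+ (c2 :* v0 :- v3) :* v2))))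

   exclusive : ∀ {h} → Big h → Small h → ⊥
   exclusive {h} big small = 1≰0 (≤-by ((lower big) ⊕ (upper small) ⊕ ((0≤# 2) ⊗ T-large₇) ⊕ ((0≤# 2) ⊗ 0≤w) ⊕ ((0≤# 16) ⊗ 0≤N) ⊕ ((0≤# 40) ⊗ (0≤* 0≤N (0≤# Z))) ⊕ (0≤# 9)) (solve (T ∷ w ∷ p h z ∷ # N ∷ # Z ∷ []) (c0 :+ (c2 :* v0 :- v1 :+ v2 :+ c2 :* (cn 5 :+ c8 :* v3 :+ c2 :* v1 :+ cn 20 :* v3 :* v4) :+ c2 :* c0 :+ cn 16 :* c0 :+ cn 40 :* c0 :+ c0)) (c1 :+ (v2 :+ v1 :+ c2 :* v0 :+ c2 :* v1 :+ cn 16 :* v3 :+ cn 40 :* (v3 :* v4) :+ cn 9))))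

   Big-cong : ∀ {g h} → g ≅ h [ N ] → Big g → Big h
   Big-cong e b = mkBig (subst (# 2 * T - w ≤_) (p-cong z e) (lower b))

   Small-cong : ∀ {g h} → g ≅ h [ N ] → Small g → Small h
   Small-cong e s = mkSmall (subst (_≤ w) (p-cong z e) (upper s))

   private
     U : ℚ
     U = T - w - E
     0≤U : 0ℚ ≤ U
     T≤2U : T ≤ # 2 * U
     T≤2U = (≤-by (T-large₁ ⊕ 0≤1 ⊕ (0≤* (0≤* (0≤# 4) 0≤N) (0≤+ (0≤+ 0≤w 0≤E) (0≤* (0≤# 2) 0≤C₄)))) (solve (T ∷ w ∷ E ∷ # N ∷ C₄ ∷ []) (c2 :* (v0 :- v1 :- v2) :+ (c1 :+ c4 :* v3 :* (v1 :+ v2 :+ c2 :* v4) :+ c2 :* (v1 :+ v2) :+ c0 :+ c0)) (v0 :+ (v0 :+ c1 :+ c4 :* v3 :* (v1 :+ v2 :+ c2 :* v4)))))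
     0≤U = cancel-≤ {# 2} (λ q → 1≰0 (≤-trans (#-mono {1} {2} (s≤s z≤n)) q)) (0≤# 2) (≤-trans (≤-reflexive (zeroʳ (# 2))) (≤-trans 0≤T T≤2U))

   -- Between v and z a class gains at most 2 (lg z - lg v) + E = T + E, so a Big class already has
   -- nearly T below v.
   Big-v : ∀ h → Coprime h N → Big h → U ≤ p h v
   Big-v h h⊥N big = (≤-by ((bt h h⊥N 1≤v v≤z z≤Y) ⊕ (lower big) ⊕ (≡⇒≤ T≡)) (solve (p h v ∷ p h z ∷ T ∷ w ∷ E ∷ lg v ∷ []) (v0 :+ (v1 :- v0 :+ (c2 :* v2 :- v3) :+ v2)) (v2 :- v3 :- v4 :+ (c2 :* (v2 :- v5) :+ v4 :+ v1 :+ (v5 :+ v5)))))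

   -- For a Big class `g` the term `A` alone exhausts the main term T² of Selberg's formula, whereas
   -- two Big classes with product `g` force `B₂` to have order T² as well.
   Big*Big : ∀ g h k → Coprime g N → Coprime h N → Coprime k N → h · k ≅ g [ N ] → Big h → Big k → ¬ Big g
   Big*Big g h k g⊥N h⊥N k⊥N hk≅g bh bk bg = <⇒≰ T-large (cancel-≤ T≰0 0≤T chain)
     where
     S₀ : ℚ
     S₀ = # 4 * # N * (w + E + # 2 * C₄)
     T-large : 1ℚ + S₀ ≤ T
     T-large = (≤-by (T-large₁ ⊕ ((0≤# 2) ⊗ (0≤+ 0≤w 0≤E))) (solve (T ∷ S₀ ∷ w ∷ E ∷ []) (v0 :+ (c1 :+ v1 :+ c2 :* (v2 :+ v3) :+ c2 :* c0)) (c1 :+ v1 :+ (v0 :+ c2 :* (v2 :+ v3)))))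
     β : ℚ
     β = B₂ (H g z)
     0≤β : 0ℚ ≤ β
     0≤β = ≤-trans (0≤* (0≤Pₐ h v) (0≤Pₐ k v)) (product-bound g h k v g⊥N hk≅g 1≤v (≼-trans z≤Y Y≤B₀))
     Φβ : Φ * β ≤ (w + E + # 2 * C₄) * T
     Φβ = (≤-by ((proj₂ (selberg g z g⊥N 1≤z (ℕ.*-monoʳ-≤ 2 z≤Y))) ⊕ (A-lower g z g⊥N 1≤z z≤Y) ⊕ (0≤T ⊗ (lower bg)) ⊕ (0≤C₄ ⊗ 1≤T)) (solve (w ∷ E ∷ C₄ ∷ T ∷ Φ ∷ A g z ∷ β ∷ p g z ∷ []) ((v0 :+ v1 :+ c2 :* v2) :* v3 :+ (v4 :* (v5 :+ v6) :- v3 :* v3 :+ (v3 :* v7 :- v3 :* v3 :- v1 :* v3) :+ v3 :* (c2 :* v3 :- v0) :+ v2 :* c1)) (v4 :* v6 :+ (v2 :* (v3 :+ c1) :+ v4 :* v5 :+ v3 :* v7 :+ v2 :* v3))))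
     UU : U * U ≤ Φ * Φ * β
     UU = (≤-by ((_⊛_ 0≤U (0≤p k v) (Big-v h h⊥N bh) (Big-v k k⊥N bk)) ⊕ ((0≤* 0≤Φ 0≤Φ) ⊗ (product-bound g h k v g⊥N hk≅g 1≤v (≼-trans z≤Y Y≤B₀)))) (solve (Φ ∷ β ∷ U ∷ Pₐ h v ∷ Pₐ k v ∷ []) (v0 :* v0 :* v1 :+ (v2 :* v2 :+ v0 :* v0 :* (v3 :* v4))) (v2 :* v2 :+ (v0 :* v3 :* (v0 :* v4) :+ v0 :* v0 :* v1))))
     chain : T * T ≤ T * S₀
     chain = (≤-by ((_⊛_ 0≤T (0≤* (0≤# 2) 0≤U) T≤2U T≤2U) ⊕ ((0≤# 4) ⊗ UU) ⊕ ((0≤* (0≤# 4) (0≤* 0≤Φ 0≤β)) ⊗ Φ≤N) ⊕ ((0≤* (0≤# 4) 0≤N) ⊗ Φβ)) (solve (T ∷ # N ∷ w ∷ E ∷ C₄ ∷ U ∷ Φ ∷ β ∷ []) (v0 :* (c4 :* v1 :* (v2 :+ v3 :+ c2 :* v4)) :+ (v0 :* v0 :+ c4 :* (v5 :* v5) :+ c4 :* (v6 :* v7) :* v6 :+ c4 :* v1 :* (v6 :* v7))) (v0 :* v0 :+ (c2 :* v5 :* (c2 :* v5) :+ c4 :* (v6 :* v6 :* v7) :+ c4 :* (v6 :* v7) :* v1 :+ c4 :* v1 :* ((v2 :+ v3 :+ c2 :* v4) :* v0)))))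

   -- For a Small class `g` the term `A` is negligible, so `pair-bound` applies to `g` as it did to
   -- `a`, now with v and z in place of z and Y. As `s` has a large share below v, the share of `k`
   -- must be near its maximum T there, and `k` cannot be Small.
   Small/Big : ∀ g s k → Coprime g N → Coprime s N → Coprime k N → s · k ≅ g [ N ] → Small g → Big s → Big k
   Small/Big g s k g⊥N s⊥N k⊥N sk≅g sg bs = [ (λ bk → bk) , (λ sk → ⊥-elim (not-small sk)) ]′ (dichotomy k k⊥N)
     where
     hδ : Φ * A g z ≤ T * w
     hδ = (≤-by ((0≤Φ ⊗ (A≤ g z 1≤z (≼-trans z≤Y Y≤B₀))) ⊕ (0≤T ⊗ (upper sg))) (solve (T ∷ w ∷ Φ ∷ A g z ∷ Pₐ g z ∷ []) (v0 :* v1 :+ (v2 :* v3 :+ v0 :* (v2 :* v4))) (v2 :* v3 :+ (v2 :* (v0 :* v4) :+ v0 :* v1))))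
     0≤T-w : 0ℚ ≤ T - w
     0≤T-w = (≤-by (0≤U ⊕ 0≤E) (solve (T ∷ w ∷ E ∷ []) (v0 :- v1 :+ (c0 :+ c0)) (c0 :+ (v0 :- v1 :- v2 :+ v2))))
     R : ℚ
     R = K₀ * (# 2 * T) + T * w
     0≤R : 0ℚ ≤ R
     0≤R = 0≤+ (0≤* 0≤K₀ (0≤* (0≤# 2) 0≤T)) (0≤* 0≤T 0≤w)
     pb : p s v * (T - p k v) ≤ # N * R
     pb = (≤-by ((0≤Φ ⊗ (pair-bound g s k v (T * w) g⊥N s⊥N sk≅g 1≤v z≤Y hδ)) ⊕ ((0≤p s v) ⊗ (≡⇒≤ T≡)) ⊕ ((0≤* 0≤Φ 0≤K₀) ⊗ 1≤T) ⊕ (0≤R ⊗ Φ≤N) ⊕ (0≤Φ ⊗ (≤-reflexive (sym (refl {x = R}))))) (solve (# N ∷ R ∷ Φ ∷ Pₐ s v ∷ lg v ∷ p k v ∷ T ∷ K₀ ∷ w ∷ []) (v0 :* v1 :+ (v2 :* (v3 :* (c2 :* v4 :- v5)) :+ v2 :* v3 :* v6 :+ v2 :* v7 :* c1 :+ v1 :* v2 :+ v2 :* (v7 :* (c2 :* v6) :+ v6 :* v8))) (v2 :* v3 :* (v6 :- v5) :+ (v2 :* (v7 :* (v6 :+ c1) :+ v6 :* v8) :+ v2 :* v3 :* (v4 :+ v4) :+ v2 :* v7 :* v6 :+ v1 :* v0 :+ v2 :* v1))))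
     not-small : ¬ Small k
     not-small sk = <⇒≰ T-large (cancel-≤ T≰0 0≤T chain)
       where
       T-large : 1ℚ + (w + # 2 * # N * (# 24 + # 2 * C₄ + # 12 * E + w)) ≤ T
       T-large = (≤-by T-large₅ (solve (T ∷ w ∷ # N ∷ C₄ ∷ E ∷ []) (v0 :+ (c1 :+ v1 :+ c2 :* v2 :* (cn 24 :+ c2 :* v3 :+ cn 12 :* v4 :+ v1))) (c1 :+ (v1 :+ c2 :* v2 :* (cn 24 :+ c2 :* v3 :+ cn 12 :* v4 :+ v1)) :+ v0)))
       pkv : p k v ≤ w
       pkv = ≤-trans (p-mono k v≤z) (upper sk)
       chain : T * T ≤ T * (w + # 2 * # N * (# 24 + # 2 * C₄ + # 12 * E + w))
       chain = (≤-by ((0≤T-w ⊗ T≤2U) ⊕ ((0≤* (0≤# 2) 0≤T-w) ⊗ (Big-v s s⊥N bs)) ⊕ ((0≤* (0≤# 2) (0≤p s v)) ⊗ pkv) ⊕ ((0≤# 2) ⊗ pb) ⊕ ((0≤* (0≤# 2) 0≤N) ⊗ (≤-reflexive (refl {x = R})))) (solve (T ∷ w ∷ # N ∷ C₄ ∷ E ∷ U ∷ p s v ∷ p k v ∷ R ∷ []) (v0 :* (v1 :+ c2 :* v2 :* (cn 24 :+ c2 :* v3 :+ cn 12 :* v4 :+ v1)) :+ ((v0 :- v1) :* v0 :+ c2 :* (v0 :- v1) :* v5 :+ c2 :* v6 :* v7 :+ c2 :* (v6 :* (v0 :- v7)) :+ c2 :* v2 :* v8)) (v0 :* v0 :+ ((v0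 :- v1) :* (c2 :* v5) :+ c2 :* (v0 :- v1) :* v6 :+ c2 :* v6 :* v1 :+ c2 :* (v2 :* v8) :+ c2 :* v2 :* ((cn 12 :+ v3 :+ c6 :* v4) :* (c2 :* v0) :+ v0 :* v1)))))

   search : ∀ n → (∃ λ h → Coprime h N × Big h) ⊎ (∀ h → 1 ≼ h → h ≼ n → Coprime h N → Small h)
   search zero = inj₂ λ { zero () _ ; (suc h) _ () }
   search (suc n) = [ inj₁ , (λ smalls → at smalls (coprime? (suc n) N)) ]′ (search n)
     where
     extend : (∀ h → 1 ≼ h → h ≼ n → Coprime h N → Small h) → (Coprime (suc n) N → Small (suc n)) →
              ∀ h → 1 ≼ h → h ≼ suc n → Coprime h N → Small h
     extend smalls new h 1≤h h≤ c = go (ℕ.m≤n⇒m<n∨m≡n h≤) c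
       where
       go : h ℕ.< suc n ⊎ h ≡ suc n → Coprime h N → Small h
       go (inj₁ h<) c = smalls h 1≤h (ℕ.≤-pred h<) c
       go (inj₂ refl) c = new c
     at : (∀ h → 1 ≼ h → h ≼ n → Coprime h N → Small h) → Dec (Coprime (suc n) N) →
          (∃ λ h → Coprime h N × Big h) ⊎ (∀ h → 1 ≼ h → h ≼ suc n → Coprime h N → Small h)
     at smalls (no ¬c) = inj₂ (extend smalls λ c → ⊥-elim (¬c c))
     at smalls (yes c₀) = [ (λ b → inj₁ (suc n , (λ {_} → c₀) , b)) , (λ s → inj₂ (extend smalls λ _ → s)) ]′ (dichotomy (suc n) c₀)

   P°≡ : ∀ x → P° x ≡ ∑ N (λ g → υ g * Pₐ g x)
   P°≡ x = sym (trans (∑-ext N λ g → ∑-*ˡ x (υ g) (V g)) (trans (∑-swap N x _) (∑-ext x λ e →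
     trans (∑-ext N λ g → (solve (υ g ∷ Λ e ∷ κ g e ∷ r e ∷ []) (v0 :* (v1 :* (v2 :* v3))) (v0 :* v2 :* (v1 :* v3))))
       (trans (sym (∑-*ʳ N (Λ e * r e) _)) (trans (cong (_* (Λ e * r e)) (∑-υκ e)) (solve (υ e ∷ Λ e ∷ r e ∷ []) (v0 :* (v1 :* v2)) (v1 :* (v0 :* v2))))))))

   Φ≰0 : ¬ Φ ≤ 0ℚ
   Φ≰0 h = 1≰0 (≤-trans 1≤Φ h)

   P°-large : T - (# 4 + # 8 * # N) ≤ P° z
   P°-large = P°-lower z 1≤z (≼-trans z≤Y Y≤B₀)

   -- If all unit classes were Small, their average `P° z` would be at most `w`, against the lower
   -- bound of Mertens type.
   ∃-Big : ∃ λ s → Coprime s N × Big s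
   ∃-Big = [ (λ e → e) , (λ smalls → ⊥-elim (absurd smalls)) ]′ (search N)
     where
     absurd : ¬ (∀ h → 1 ≼ h → h ≼ N → Coprime h N → Small h)
     absurd smalls = 1≰0 (≤-by (P°≤w ⊕ P°-large ⊕ T-large₇ ⊕ 0≤w ⊕ ((0≤# 20) ⊗ (0≤* 0≤N (0≤# Z)))) (solve (P° z ∷ T ∷ # N ∷ w ∷ # Z ∷ []) (c0 :+ (v0 :+ (v1 :- (c4 :+ c8 :* v2)) :+ (cn 5 :+ c8 :* v2 :+ c2 :* v3 :+ cn 20 :* v2 :* v4) :+ c0 :+ cn 20 :* c0)) (c1 :+ (v3 :+ v0 :+ v1 :+ v3 :+ cn 20 :* (v2 :* v4)))))
       where
       term : ∀ h → 1 ≼ h → h ≼ N → (d : Dec (Coprime h N)) → Φ * (ι d * Pₐ h z) ≤ ι d * w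
       term h 1≤h h≤N (no _) = ≤-reflexive (solve (Φ ∷ Pₐ h z ∷ w ∷ []) (v0 :* (c0 :* v1)) (c0 :* v2))
       term h 1≤h h≤N (yes c) = (≤-by (upper (smalls h 1≤h h≤N c)) (solve (w ∷ Φ ∷ Pₐ h z ∷ []) (c1 :* v0 :+ v1 :* v2) (v1 :* (c1 :* v2) :+ v0)))
       P°≤w : P° z ≤ w
       P°≤w = cancel-≤ Φ≰0 0≤Φ (≤-trans (≤-reflexive (trans (cong (Φ *_) (P°≡ z)) (∑-*ˡ N Φ _)))
         (≤-trans (∑-mono N λ h 1≤h h≤N → term h 1≤h h≤N (coprime? h N)) (≤-reflexive (sym (∑-*ʳ N w υ)))))

   sgn : ∀ {h} → Big h ⊎ Small h → ℚ
   sgn (inj₁ _) = - 1ℚ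
   sgn (inj₂ _) = 1ℚ

   χ′ : ∀ n → Dec (Coprime n N) → ℚ
   χ′ n (no _) = 0ℚ
   χ′ n (yes c) = sgn (dichotomy n c)

   χ : ℕ → ℚ
   χ n = χ′ n (coprime? n N)

   χ-out : ∀ n → ¬ Coprime n N → χ n ≡ 0ℚ
   χ-out n ¬c = go (coprime? n N)
     where
     go : (d : Dec (Coprime n N)) → χ′ n d ≡ 0ℚ
     go (no _) = refl
     go (yes c) = ⊥-elim (¬c c)

   χ-Big : ∀ n → Coprime n N → Big n → χ n ≡ - 1ℚ
   χ-Big n c₀ b = go (coprime? n N)
     where
     go′ : (e : Big n ⊎ Small n) → sgn e ≡ - 1ℚ
     go′ (inj₁ _) = refl
     go′ (inj₂ s) = ⊥-elim (exclusive {n} b s)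
     go : (d : Dec (Coprime n N)) → χ′ n d ≡ - 1ℚ
     go (no ¬c) = ⊥-elim (¬c c₀)
     go (yes c) = go′ (dichotomy n c)

   χ-Small : ∀ n → Coprime n N → Small n → χ n ≡ 1ℚ
   χ-Small n c₀ s = go (coprime? n N)
     where
     go′ : (e : Big n ⊎ Small n) → sgn e ≡ 1ℚ
     go′ (inj₁ b) = ⊥-elim (exclusive {n} b s)
     go′ (inj₂ _) = refl
     go : (d : Dec (Coprime n N)) → χ′ n d ≡ 1ℚ
     go (no ¬c) = ⊥-elim (¬c c₀)
     go (yes c) = go′ (dichotomy n c)

   data Class (n : ℕ) : Set where
     out : ¬ Coprime n N → Class n
     big : Coprime n N → Big n → Class n
     small : Coprime n N → Small n → Class n

   classify : ∀ n → Class n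
   classify n = go (coprime? n N)
     where
     go : Dec (Coprime n N) → Class n
     go (no ¬c) = out ¬c
     go (yes c) = [ big c , small c ]′ (dichotomy n c)

   χ-cong : ∀ {m n} → m ≅ n [ N ] → χ m ≡ χ n
   χ-cong {m} {n} e = go (classify n)
     where
     go : Class n → χ m ≡ χ n
     go (out ¬c) = trans (χ-out m λ c → ¬c (≅-coprime (≋-sym e) c)) (sym (χ-out n ¬c))
     go (big c b) = trans (χ-Big m (≅-coprime e c) (Big-cong (≋-sym e) b)) (sym (χ-Big n c b))
     go (small c s) = trans (χ-Small m (≅-coprime e c) (Small-cong (≋-sym e) s)) (sym (χ-Small n c s))

   χ-sign : ∀ n → Sign (χ n)
   χ-sign n = go (classify n)
     where
     go : Class n → Sign (χ n)
     go (out ¬c) = inj₂ (inj₁ (χ-out n ¬c))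
     go (big c b) = inj₂ (inj₂ (χ-Big n c b))
     go (small c s) = inj₁ (χ-Small n c s)

   private
     not-Big⇒Small : ∀ {n} → Coprime n N → ¬ Big n → Small n
     not-Big⇒Small c ¬b = [ (λ b → ⊥-elim (¬b b)) , (λ s → s) ]′ (dichotomy _ c)

     Small-1 : Small 1
     Small-1 = not-Big⇒Small 1-coprime λ b → Big*Big 1 1 1 1-coprime 1-coprime 1-coprime ≋-refl b b b

     Big-inv : ∀ {s i} → Coprime s N → Coprime i N → s · i ≅ 1 [ N ] → Big s → Big i
     Big-inv {s} {i} s⊥N i⊥N e b = Small/Big 1 s i 1-coprime s⊥N i⊥N e Small-1 b

     inv-* : ∀ {s i} g → s · i ≅ 1 [ N ] → i · (g · s) ≅ g [ N ]
     inv-* {s} {i} g e = ≋-trans (≅-≡ (lem s i g)) (≋-trans (≅-* (≋-refl {a = ℤ.+ g}) e) (≅-≡ (ℕ.*-identityʳ g)))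
       where
       lem : ∀ s i g → i · (g · s) ≡ g · (s · i)
       lem = solve-∀

     -- Write g = s⁻¹ · (g s). The inverse of a Big class is Big because 1 is Small, and then
     -- `Small/Big` applies to this product.
     Small*Big : ∀ g s → Coprime g N → Coprime s N → Small g → Big s → Big (g · s)
     Small*Big g s g⊥N s⊥N sg bs = Small/Big g i (g · s) g⊥N i⊥N (coprime-*ˡ g⊥N s⊥N) (inv-* {s} {i} g e) sg (Big-inv s⊥N i⊥N e bs)
       where
       i = proj₁ (inverse s⊥N)
       e = proj₂ (inverse s⊥N)
       i⊥N : Coprime i N
       i⊥N = inverse-coprime {s} {i} e

     Small*Small : ∀ g h → Coprime g N → Coprime h N → Small g → Small h → Small (g · h)
     Small*Small g h g⊥N h⊥N sg sh = not-Big⇒Small gh⊥N λ b → exclusive {g} (Big-cong (inv-* {h} {i} g e) (Small*Big i (g · h) i⊥N gh⊥N si b)) sg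
       where
       i = proj₁ (inverse h⊥N)
       e = proj₂ (inverse h⊥N)
       i⊥N : Coprime i N
       i⊥N = inverse-coprime {h} {i} e
       gh⊥N : Coprime (g · h) N
       gh⊥N = coprime-*ˡ g⊥N h⊥N
       si : Small i
       si = not-Big⇒Small i⊥N λ b → exclusive {h} (Big-inv i⊥N h⊥N (≋-trans (≅-≡ (ℕ.*-comm i h)) e) b) sh

   χ-* : ∀ m n → χ (m · n) ≡ χ m * χ n
   χ-* m n = go (classify m) (classify n)
     where
     go : Class m → Class n → χ (m · n) ≡ χ m * χ n
     go (out ¬c) _ = trans (χ-out (m · n) λ c → ¬c (coprime-∣ˡ (ℕ.m∣m*n n) c)) (sym (trans (cong (_* χ n) (χ-out m ¬c)) (zeroˡ _)))
     go _ (out ¬c) = trans (χ-out (m · n) λ c → ¬c (coprime-∣ˡ (ℕ.n∣m*n m) c)) (sym (trans (cong (χ m *_) (χ-out n ¬c)) (zeroʳ _)))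
     go (big c b) (big c′ b′) = trans (χ-Small (m · n) mn⊥N (not-Big⇒Small mn⊥N (Big*Big (m · n) m n mn⊥N c c′ ≋-refl b b′)))
         (sym (trans (cong₂ _*_ (χ-Big m c b) (χ-Big n c′ b′)) (solve [] ((:- c1) :* (:- c1)) c1)))
       where
       mn⊥N : Coprime (m · n) N
       mn⊥N = coprime-*ˡ c c′
     go (big c b) (small c′ s′) = trans (χ-Big (m · n) (coprime-*ˡ c c′) (Big-cong (≅-≡ (ℕ.*-comm n m)) (Small*Big n m c′ c s′ b)))
         (sym (trans (cong₂ _*_ (χ-Big m c b) (χ-Small n c′ s′)) (*-identityʳ _)))
     go (small c s) (big c′ b′) = trans (χ-Big (m · n) (coprime-*ˡ c c′) (Small*Big m n c c′ s b′))
         (sym (trans (cong₂ _*_ (χ-Small m c s) (χ-Big n c′ b′)) (*-identityˡ _)))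
     go (small c s) (small c′ s′) = trans (χ-Small (m · n) (coprime-*ˡ c c′) (Small*Small m n c c′ s s′))
         (sym (trans (cong₂ _*_ (χ-Small m c s) (χ-Small n c′ s′)) (*-identityˡ _)))

   χ-1 : χ 1 ≡ 1ℚ
   χ-1 = χ-Small 1 1-coprime Small-1

   χ-κ : ∀ e → χ e ≡ ∑ N (λ h → κ h e * χ h)
   χ-κ e = sym (trans (∑-ext N λ h → cong (_* χ h) (ι-⇔ (e ≅? h [ N ]) (h ≅? e [ N ]) ≋-sym ≋-sym))
     (trans (∑-κ e χ) (χ-cong (proj₂ (proj₂ (proj₂ (rep e)))))))

   -- Multiplication by a Big class permutes the residues and reverses the sign of every value.
   χ-tot : ∑ N χ ≡ 0ℚ
   χ-tot = ≡0 (≤-total 0ℚ (∑ N χ))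
     where
     s = proj₁ ∃-Big
     s⊥N : Coprime s N
     s⊥N = proj₁ (proj₂ ∃-Big)
     bs = proj₂ (proj₂ ∃-Big)
     i = proj₁ (inverse s⊥N)
     si≅1 = proj₂ (inverse s⊥N)
     shift : ∑ N (λ g → χ (s · g)) ≡ ∑ N χ
     shift = begin
       ∑ N (λ g → χ (s · g)) ≡⟨ ∑-ext N (λ g → χ-κ (s · g)) ⟩
       ∑ N (λ g → ∑ N (λ h → κ h (s · g) * χ h)) ≡⟨ ∑-swap N N _ ⟩
       ∑ N (λ h → ∑ N (λ g → κ h (s · g) * χ h)) ≡⟨ ∑-ext N (λ h → trans (∑-ext N λ g → cong (_* χ h) (κ-quot {s} {i} h g si≅1)) (∑-κ (i · h) (λ _ → χ h))) ⟩
       ∑ N χ ∎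
       where open ≡-Reasoning
     flip : ∑ N χ ≡ - 1ℚ * ∑ N χ
     flip = trans (sym shift) (trans (∑-ext N λ g → trans (χ-* s g) (cong (_* χ g) (χ-Big s s⊥N bs))) (sym (∑-*ˡ N (- 1ℚ) χ)))
     ≡0 : 0ℚ ≤ ∑ N χ ⊎ ∑ N χ ≤ 0ℚ → ∑ N χ ≡ 0ℚ
     ≡0 (inj₁ h) = ≤-antisym (≤-by (h ⊕ (≡⇒≤ flip)) (solve (∑ N χ ∷ []) (c0 :+ (c0 :+ v0)) (v0 :+ (v0 :+ (:- c1) :* v0)))) h
     ≡0 (inj₂ h) = ≤-antisym h (≤-by (h ⊕ (≡⇒≤ (sym flip))) (solve (∑ N χ ∷ []) (v0 :+ (v0 :+ (:- c1) :* v0)) (c0 :+ (c0 :+ v0))))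

   χ-per : ∀ i → χ (N ∔ i) ≡ χ i
   χ-per i = χ-cong ≅-+N

   open Quadratic N 1≤N χ χ-sign χ-per χ-* χ-1 χ-tot
   open PrimeSum 𝓛 N≤B₀

   -- For each unit class χ(h) p ≤ 2 w - p at z: trivially for Big ones, where χ = -1, and because p
   -- ≤ w for Small ones. Averaging shows that `Pχ z` is nearly -P° z.
   Pχ≤ : Pχ z ≤ # 2 * w - P° z
   Pχ≤ = cancel-≤ Φ≰0 0≤Φ (≤-trans (≤-reflexive (trans (cong (Φ *_) Pχ≡) (∑-*ˡ N Φ _)))
     (≤-trans (∑-mono N λ h _ _ → term h (classify h)) (≤-reflexive tot)))
     where
     Pχ≡ : Pχ z ≡ ∑ N (λ h → χ h * Pₐ h z)
     Pχ≡ = sym (trans (∑-ext N λ h → ∑-*ˡ z (χ h) (V h)) (trans (∑-swap N z _) (∑-ext z λ e →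
       trans (∑-ext N λ h → (solve (χ h ∷ Λ e ∷ κ h e ∷ r e ∷ []) (v0 :* (v1 :* (v2 :* v3))) (v2 :* v0 :* (v1 :* v3))))
         (trans (sym (∑-*ʳ N (Λ e * r e) _)) (trans (cong (_* (Λ e * r e)) (sym (χ-κ e))) (solve (χ e ∷ Λ e ∷ r e ∷ []) (v0 :* (v1 :* v2)) (v1 :* (v0 :* v2))))))))
     term : ∀ h → Class h → Φ * (χ h * Pₐ h z) ≤ υ h * (# 2 * w) - Φ * (υ h * Pₐ h z)
     term h (out ¬c) = ≤-reflexive (trans (cong (λ s → Φ * (s * Pₐ h z)) (χ-out h ¬c)) (trans (solve (Φ ∷ Pₐ h z ∷ w ∷ []) (v0 :* (c0 :* v1)) (c0 :* (c2 :* v2) :- v0 :* (c0 :* v1)))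
       (cong (λ s → s * (# 2 * w) - Φ * (s * Pₐ h z)) (sym (ι-no (coprime? h N) ¬c)))))
     term h (big c b) = subst₂ (λ s t → Φ * (s * Pₐ h z) ≤ t * (# 2 * w) - Φ * (t * Pₐ h z)) (sym (χ-Big h c b)) (sym (ι-yes (coprime? h N) c))
       (≤-by ((0≤# 2) ⊗ 0≤w) (solve (w ∷ Φ ∷ Pₐ h z ∷ []) (c1 :* (c2 :* v0) :- v1 :* (c1 :* v2) :+ c2 :* c0) (v1 :* ((:- c1) :* v2) :+ c2 :* v0)))
     term h (small c s) = subst₂ (λ s t → Φ * (s * Pₐ h z) ≤ t * (# 2 * w) - Φ * (t * Pₐ h z)) (sym (χ-Small h c s)) (sym (ι-yes (coprime? h N) c))
       (≤-by ((0≤# 2) ⊗ (upper s)) (solve (w ∷ Φ ∷ Pₐ h z ∷ []) (c1 :* (c2 :* v0) :- v1 :* (c1 :* v2) :+ c2 :* (v1 :* v2)) (v1 :* (c1 :* v2) :+ c2 :* v0)))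
     tot : ∑ N (λ h → υ h * (# 2 * w) - Φ * (υ h * Pₐ h z)) ≡ Φ * (# 2 * w - P° z)
     tot = trans (∑-sub N _ _) (trans (cong₂ _-_ (sym (∑-*ʳ N (# 2 * w) υ)) (trans (sym (∑-*ˡ N Φ _)) (cong (Φ *_) (sym (P°≡ z))))) (solve (Φ ∷ w ∷ P° z ∷ []) (v0 :* (c2 :* v1) :- v0 :* v2) (v0 :* (c2 :* v1 :- v2))))

   private
     -- A quarter of z, which puts z at the upper end of the window from 3m to 4m in `L-bound`.
     m : ℕ
     m = 2 ^ (j · j ∔ j · j ℕ.∸ 2)

     2≤j²+j² : 2 ≼ j · j ∔ j · j
     2≤j²+j² = ℕ.+-mono-≤ (ℕ.*-mono-≤ 1≤j 1≤j) (ℕ.*-mono-≤ 1≤j 1≤j)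

     z≡4m : z ≡ 4 · m
     z≡4m = trans (sym (ℕ.^-distribˡ-+-* 2 (j · j) (j · j))) (trans (cong (2 ^_) (sym (ℕ.m+[n∸m]≡n 2≤j²+j²))) (ℕ.^-distribˡ-+-* 2 2 (j · j ∔ j · j ℕ.∸ 2)))

     2Z²≤m : 2 · (Z · Z) ≼ m
     2Z²≤m = begin
       2 · (Z · Z) ≤⟨ ℕ.*-monoʳ-≤ 2 (ℕ.*-mono-≤ Z≤2^j Z≤2^j) ⟩
       2 · (2 ^ j · 2 ^ j) ≡⟨ cong (2 ·_) (sym (ℕ.^-distribˡ-+-* 2 j j)) ⟩
       2 ^ suc (j ∔ j) ≤⟨ ℕ.^-monoʳ-≤ 2 expo ⟩
       m ∎
       where
       open ℕ.≤-Reasoning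
       Z≤2^j = ≼-trans Z≤j (ℕ.<⇒≤ (n<2^n j))
       expo : suc (j ∔ j) ≼ j · j ∔ j · j ℕ.∸ 2
       expo = ℕ.m+n≤o⇒m≤o∸n (suc (j ∔ j)) (begin
         suc (j ∔ j) ∔ 2 ≡⟨ lem j ⟩
         j ∔ j ∔ 3 ≤⟨ ℕ.+-monoʳ-≤ (j ∔ j) (≼-trans (≼-trans (s≤s (s≤s (s≤s z≤n))) 5≤j) (ℕ.m≤m+n j j)) ⟩
         j ∔ j ∔ (j ∔ j) ≡⟨ lem₂ j ⟩
         2 · j ∔ 2 · j ≤⟨ ℕ.+-mono-≤ 2j≤ 2j≤ ⟩
         j · j ∔ j · j ∎)
         where
         lem : ∀ j → suc (j ∔ j) ∔ 2 ≡ j ∔ j ∔ 3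
         lem = solve-∀
         lem₂ : ∀ j → j ∔ j ∔ (j ∔ j) ≡ 2 · j ∔ 2 · j
         lem₂ = solve-∀
         2j≤ : 2 · j ≼ j · j
         2j≤ = ℕ.*-monoˡ-≤ j (≼-trans (s≤s (s≤s z≤n)) 5≤j)

     ℒz : r Z ≤ ℒ z
     ℒz = L-bound z m (ℕ.m^n>0 2 (j · j ∔ j · j ℕ.∸ 2)) (≼-trans (ℕ.*-monoˡ-≤ m {3} {4} (ℕ.n≤1+n 3)) (≼-reflexive (sym z≡4m))) (≼-reflexive z≡4m) 2Z²≤m

   -- ℒ z ≥ 1 / Z turns ℒ z · Pχ z ≥ -20 N into the bound 20 N Z for P° z - 2 w, which is exceeded
   -- because P° z grows like T and `w` only like J.
   contradiction : ⊥
   contradiction = <⇒≰ {# 20 * # N * # Z} {M} big-M ((≤-by (((0≤# Z) ⊗ step) ⊕ (0≤M ⊗ (≡⇒≤ (sym (r-inv Z 1≤Z₀))))) (solve (# N ∷ # Z ∷ r Z ∷ M ∷ []) (cn 20 :* v0 :* v1 :+ (v1 :* (v2 :* v3) :+ v3 :* c1)) (v3 :+ (v1 :* (cn 20 :* v0) :+ v3 :* (v1 :* v2))))))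
     where
     M : ℚ
     M = P° z - # 2 * w
     big-M : 1ℚ + # 20 * # N * # Z ≤ M
     big-M = (≤-by (P°-large ⊕ T-large₇) (solve (P° z ∷ w ∷ T ∷ # N ∷ # Z ∷ []) (v0 :- c2 :* v1 :+ (v2 :- (c4 :+ c8 :* v3) :+ (cn 5 :+ c8 :* v3 :+ c2 :* v1 :+ cn 20 :* v3 :* v4))) (c1 :+ cn 20 :* v3 :* v4 :+ (v0 :+ v2))))
     0≤M : 0ℚ ≤ M
     0≤M = ≤-trans (0≤+ 0≤1 (0≤* (0≤* (0≤# 20) 0≤N) (0≤# Z))) big-M
     0≤ℒ : 0ℚ ≤ ℒ z
     0≤ℒ = ≤-trans (0≤r Z 1≤Z₀) ℒz
     step : r Z * M ≤ # 20 * # N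
     step = (≤-by ((0≤M ⊗ ℒz) ⊕ (0≤ℒ ⊗ Pχ≤) ⊕ (LP-bound z 1≤z (≼-trans (s≤s z≤Y) Y<B₀)) ⊕ (0≤ℒ ⊗ (≤-reflexive (refl {x = M})))) (solve (# N ∷ M ∷ r Z ∷ ℒ z ∷ Pχ z ∷ w ∷ P° z ∷ []) (cn 20 :* v0 :+ (v1 :* v2 :+ v3 :* v4 :+ (:- (cn 20 :* v0)) :+ v3 :* v1)) (v2 :* v1 :+ (v1 :* v3 :+ v3 :* (c2 :* v5 :- v6) :+ v3 :* v4 :+ v3 :* (v6 :- c2 :* v5)))))

 -- Primality and congruence are decidable, so a search up to the explicit bound converts the
 -- refutation of its failure into a prime.
 dirichlet : ∀ N a → 1 ≼ N → Coprime a N → ∃ λ q → Prime q × q ≅ a [ N ]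
 dirichlet N a 1≤N a⊥N = [ (λ e → e) , (λ none → ⊥-elim (Contradiction.contradiction N 1≤N a a⊥N none)) ]′ (search (Params.B N))
   where
   search : ∀ b → (∃ λ q → Prime q × q ≅ a [ N ]) ⊎ (∀ q → Prime q → q ≼ b → ¬ q ≅ a [ N ])
   search zero = inj₂ λ q pq q≤0 _ → ℕ.<⇒≱ (prime-≥1 pq) q≤0
   search (suc b) = [ inj₁ , at (prime? (suc b)) (suc b ≅? a [ N ]) ]′ (search b)
     where
     at : Dec (Prime (suc b)) → Dec (suc b ≅ a [ N ]) → (∀ q → Prime q → q ≼ b → ¬ q ≅ a [ N ]) →
          (∃ λ q → Prime q × q ≅ a [ N ]) ⊎ (∀ q → Prime q → q ≼ suc b → ¬ q ≅ a [ N ])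
     at (yes pq) (yes e) _ = inj₁ (suc b , pq , e)
     at (no ¬pq) _ none = inj₂ λ q pq q≤ e → [ (λ q< → none q pq (ℕ.≤-pred q<) e) , (λ { refl → ¬pq pq }) ]′ (ℕ.m≤n⇒m<n∨m≡n q≤)
     at (yes _) (no ¬e) none = inj₂ λ q pq q≤ e → [ (λ q< → none q pq (ℕ.≤-pred q<) e) , (λ { refl → ¬e e }) ]′ (ℕ.m≤n⇒m<n∨m≡n q≤)

-- Divisibility, roots and Frobenius in commutative rings.

module Ring (R : CommutativeRing 0ℓ 0ℓ) where

 open CommutativeRing R public renaming (refl to ≈-refl; reflexive to ≈-reflexive; sym to ≈-sym; trans to ≈-trans)

 open IntSolver R public
 open import Data.Nat.Combinatorics using (_C_; nCn≡1; nC1≡n; nCk+nC[k+1]≡[n+1]C[k+1])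
 open import Data.Nat.Combinatorics.Specification using (k>n⇒nCk≡0)
 open import Data.Fin as Fin using (Fin; toℕ; fromℕ)
 open import Data.Fin.Properties using (toℕ<n; toℕ-fromℕ; toℕ-inject₁)
 open import Algebra.Properties.CommutativeSemiring.Exp commutativeSemiring public
 open import Algebra.Properties.Semiring.Mult semiring using (×-congˡ; ×-homo-1; ×-assocˡ) renaming (_×_ to _·_)
 import Algebra.Properties.CommutativeSemiring.Binomial commutativeSemiring as Binomial
 open import Algebra.Properties.Monoid.Sum +-monoid using (sum; sum-init-last; sum-cong-≋; sum-replicate-zero)

 infixl 5 _⊕≈_

 _⊕≈_ : ∀ {a b c d} → a ≈ b → c ≈ d → a + c ≈ b + d
 _⊕≈_ = +-cong

 ≈-by : ∀ {a b x y} → x ≈ y → b + x ≈ a + y → a ≈ b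
 ≈-by {a} {b} {x} {y} x≈y e = ≈-trans (solve (a ∷ y ∷ []) v0 (v0 :+ v1 :- v1)) (≈-trans (+-cong (≈-sym e) (-‿cong (≈-sym x≈y))) (solve (b ∷ x ∷ []) (v0 :+ v1 :- v1) v0))

 ≈-diff : ∀ {a b} → a - b ≈ 0# → a ≈ b
 ≈-diff {a} {b} e = (≈-by e (solve (b ∷ a ∷ []) (v0 :+ (v1 :- v0)) (v1 :+ c0)))

 infix 4 _∣_

 _∣_ : Carrier → Carrier → Set
 a ∣ b = ∃ λ q → b ≈ a * q

 ∣-refl : ∀ {a} → a ∣ a
 ∣-refl {a} = 1# , ≈-sym (*-identityʳ a)

 ∣-trans : ∀ {a b c} → a ∣ b → b ∣ c → a ∣ c
 ∣-trans {a} (q , e) (r , e′) = q * r , ≈-trans e′ (≈-trans (*-congʳ e) (*-assoc a q r))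

 ∣-resp : ∀ {a b c} → b ≈ c → a ∣ b → a ∣ c
 ∣-resp e (q , e′) = q , ≈-trans (≈-sym e) e′

 ∣-0 : ∀ {a} → a ∣ 0#
 ∣-0 {a} = 0# , ≈-sym (zeroʳ a)

 ∣-+ : ∀ {a b c} → a ∣ b → a ∣ c → a ∣ b + c
 ∣-+ {a} {b} {c} (q , e) (r , e′) = q + r , (≈-by (e ⊕≈ e′) (solve (a ∷ q ∷ r ∷ b ∷ c ∷ []) (v0 :* (v1 :+ v2) :+ (v3 :+ v4)) (v3 :+ v4 :+ (v0 :* v1 :+ v0 :* v2))))

 ∣-* : ∀ {a b} c → a ∣ b → a ∣ c * b
 ∣-* {a} {b} c (q , e) = c * q , (≈-by (*-congˡ { c } e) (solve (a ∷ c ∷ q ∷ b ∷ []) (v0 :* (v1 :* v2) :+ v1 :* v3) (v1 :* v3 :+ v1 :* (v0 :* v2))))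

 ∣-neg : ∀ {a b} → a ∣ b → a ∣ - b
 ∣-neg {a} {b} (q , e) = - q , (≈-by (*-congˡ { - 1# } e) (solve (a ∷ q ∷ b ∷ []) (v0 :* (:- v1) :+ (:- c1) :* v2) (:- v2 :+ (:- c1) :* (v0 :* v1))))

 -- evM evaluates the monic polynomial of degree length cs whose lower coefficients are cs.
 ev evM : List Carrier → Carrier → Carrier
 ev [] a = 0#
 ev (c ∷ cs) a = c + a * ev cs a
 evM [] a = 1#
 evM (c ∷ cs) a = c + a * evM cs a

 -- Residues modulo `f` are represented by ring elements, and congruence is divisibility of the
 -- difference; the hypotheses say that the quotient by `f` is a domain.
 module Roots (f : Carrier) (f∤1 : ¬ f ∣ 1#) (prime : ∀ {a b} → f ∣ a * b → f ∣ a ⊎ f ∣ b) where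

   private
     -- Horner's scheme: the lower coefficients of the quotient of the monic polynomial `c ∷ cs` by
     -- X - r.
     quot : Carrier → Carrier → List Carrier → List Carrier
     quot r c [] = []
     quot r c (c′ ∷ cs) = evM (c′ ∷ cs) r ∷ quot r c′ cs

     length-quot : ∀ r c cs → length (quot r c cs) ≡ length cs
     length-quot r c [] = refl
     length-quot r c (c′ ∷ cs) = ≡.cong suc (length-quot r c′ cs)

     evM-quot : ∀ r c cs a → evM (c ∷ cs) a - evM (c ∷ cs) r ≈ (a - r) * evM (quot r c cs) a
     evM-quot r c [] a = (solve (c ∷ a ∷ r ∷ []) (v0 :+ v1 :* c1 :- (v0 :+ v2 :* c1)) ((v1 :- v2) :* c1))
     evM-quot r c (c′ ∷ cs) a = (≈-by (*-congˡ { a } (evM-quot r c′ cs a)) (solve (a ∷ r ∷ evM (c′ ∷ cs) r ∷ evM (quot r c′ cs) a ∷ evM (c′ ∷ cs) a ∷ c ∷ []) ((v0 :- v1) :* (v2 :+ v0 :* v3) :+ v0 :* (v4 :- v2)) (v5 :+ v0 :* v4 :- (v5 :+ v1 :* v2) :+ v0 :* ((v0 :- v1) :* v3))))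

   -- Counting the roots of a monic polynomial over the domain R / (f).
   root-bound : ∀ n cs → length cs ≡ n → ∀ m (r : ℕ → Carrier) → (∀ i → i ℕ.< m → f ∣ evM cs (r i)) →
                (∀ i j → i ℕ.< j → j ℕ.< m → ¬ f ∣ r i - r j) → m ℕ.≤ n
   root-bound n cs len zero r roots distinct = z≤n
   root-bound zero [] len (suc m) r roots distinct = ⊥-elim (f∤1 (roots 0 (s≤s z≤n)))
   root-bound (suc n) (c ∷ cs) len (suc m) r roots distinct =
     s≤s (root-bound n (quot (r m) c cs) (≡.trans (length-quot (r m) c cs) (ℕ.suc-injective len)) m r
       (λ i i<m → [ (λ d → ⊥-elim (distinct i m i<m ℕ.≤-refl d)) , (λ d → d) ]′
         (prime (∣-resp (evM-quot (r m) c cs (r i)) (∣-+ (roots i (ℕ.m≤n⇒m≤1+n i<m)) (∣-neg (roots m ℕ.≤-refl))))))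
       (λ i j i<j j<m → distinct i j i<j (ℕ.m≤n⇒m≤1+n j<m)))

 absorb : ∀ n k → suc k ℕ.* (suc n C suc k) ≡ suc n ℕ.* (n C k)
 absorb zero zero = refl
 absorb zero (suc k) = ≡.trans (≡.cong (suc (suc k) ℕ.*_) (k>n⇒nCk≡0 {1} {suc (suc k)} (s≤s (s≤s z≤n)))) (≡.trans (ℕ.*-zeroʳ (suc (suc k))) (≡.sym (≡.cong (1 ℕ.*_) (k>n⇒nCk≡0 {0} {suc k} (s≤s z≤n)))))
 absorb (suc n) zero = ≡.trans (ℕ.*-identityˡ (suc (suc n) C 1)) (≡.trans (nC1≡n (suc (suc n))) (≡.sym (ℕ.*-identityʳ (suc (suc n)))))
 absorb (suc n) (suc k) = begin
   suc (suc k) ℕ.* (suc (suc n) C suc (suc k)) ≡⟨ ≡.cong (suc (suc k) ℕ.*_) (≡.sym (nCk+nC[k+1]≡[n+1]C[k+1] (suc n) (suc k))) ⟩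
   suc (suc k) ℕ.* (x ℕ.+ y) ≡⟨ lem₁ (suc k) x y ⟩
   x ℕ.+ (suc k ℕ.* x ℕ.+ suc (suc k) ℕ.* y) ≡⟨ ≡.cong (ℕ._+_ x) (≡.cong₂ ℕ._+_ (absorb n k) (absorb n (suc k))) ⟩
   x ℕ.+ (suc n ℕ.* (n C k) ℕ.+ suc n ℕ.* (n C suc k)) ≡⟨ ≡.cong (ℕ._+_ x) (≡.sym (ℕ.*-distribˡ-+ (suc n) (n C k) (n C suc k))) ⟩
   x ℕ.+ suc n ℕ.* (n C k ℕ.+ n C suc k) ≡⟨ ≡.cong (λ z → x ℕ.+ suc n ℕ.* z) (nCk+nC[k+1]≡[n+1]C[k+1] n k) ⟩
   suc (suc n) ℕ.* x ∎
   where
   open ≡.≡-Reasoning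
   x = suc n C suc k
   y = suc n C suc (suc k)
   lem₁ : ∀ k x y → suc k ℕ.* (x ℕ.+ y) ≡ x ℕ.+ (k ℕ.* x ℕ.+ suc k ℕ.* y)
   lem₁ = solve-∀

 -- By absorption p divides k times the binomial coefficient, and it does not divide k.
 p∣pCk : ∀ {p} → Prime p → ∀ k → 1 ℕ.≤ k → k ℕ.< p → p ℕ.∣ p C k
 p∣pCk {suc p} pp (suc k) _ k<p = [ (λ p∣k → ⊥-elim (ℕ.<⇒≱ k<p (ℕ.∣⇒≤ p∣k))) , (λ d → d) ]′
   (euclidsLemma (suc k) (suc p C suc k) pp (≡.subst (suc p ℕ.∣_) (≡.sym (absorb p k)) (ℕ.m∣m*n (p C k))))

 module Characteristic (p : ℕ) (pp : Prime p) (char : # p ≈ 0#) where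

   private
     #≈×1 : ∀ n → # n ≈ n · 1#
     #≈×1 zero = ≈-refl
     #≈×1 (suc n) = ≈-trans (#-suc n) (+-congˡ (#≈×1 n))

     ×≈0 : ∀ n z → p ℕ.∣ n → n · z ≈ 0#
     ×≈0 n z (divides q refl) = ≈-trans (≈-sym (×-assocˡ z q p)) (≈-trans (kill q (p · z) (p×z≈0)) ≈-refl)
       where
       ×-* : ∀ n z → n · z ≈ (n · 1#) * z
       ×-* zero z = ≈-sym (zeroˡ z)
       ×-* (suc n) z = ≈-trans (+-congˡ (×-* n z)) (≈-trans (+-congʳ (≈-sym (*-identityˡ z))) (≈-sym (distribʳ z 1# (n · 1#))))
       p×z≈0 : p · z ≈ 0#
       p×z≈0 = ≈-trans (×-* p z) (≈-trans (*-congʳ (≈-trans (≈-sym (#≈×1 p)) char)) (zeroˡ z))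
       kill : ∀ q w → w ≈ 0# → q · w ≈ 0#
       kill zero w e = ≈-refl
       kill (suc q) w e = ≈-trans (+-cong e (kill q w e)) (+-identityˡ 0#)

   frobenius-+ : ∀ x y → (x + y) ^ p ≈ x ^ p + y ^ p
   frobenius-+ x y = go p (≡.refl)
     where
     go : ∀ n → n ≡ p → (x + y) ^ n ≈ x ^ n + y ^ n
     go zero p≡ = ⊥-elim (ℕ.<⇒≱ (prime≥2 pp) (≡.subst (ℕ._≤ 1) p≡ z≤n))
     go (suc n) p≡ = ≈-trans (Binomial.theorem (suc n) x y) (≈-trans (+-cong first (≈-trans (sum-init-last {n} (λ k → t (Fin.suc k))) (+-cong (middle n (λ k → t (Fin.suc (Fin.inject₁ k))) vanish) final))) (solve (y ^ (suc n) ∷ x ^ (suc n) ∷ []) (v0 :+ (c0 :+ v1)) (v1 :+ v0)))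
       where
       t : Fin (suc (suc n)) → Carrier
       t = Binomial.binomialTerm x y (suc n)
       first : t Fin.zero ≈ y ^ suc n
       first = ≈-trans (×-homo-1 _) (*-identityˡ _)
       final : t (Fin.suc (fromℕ n)) ≈ x ^ suc n
       final = ≈-trans (≈-reflexive (≡.cong (λ k → (suc n C suc k) · (x ^ suc k * y ^ (n ℕ.∸ k))) (toℕ-fromℕ n)))
         (≈-trans (×-congˡ (nCn≡1 (suc n))) (≈-trans (×-homo-1 _) (≈-trans (*-congˡ (≈-reflexive (≡.cong (y ^_) (ℕ.n∸n≡0 n)))) (*-identityʳ _))))
       vanish : ∀ k → t (Fin.suc (Fin.inject₁ k)) ≈ 0#
       vanish k = ×≈0 _ _ (≡.subst (ℕ._∣ suc n C suc (toℕ (Fin.inject₁ k))) p≡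
         (≡.subst (λ q → q ℕ.∣ q C suc (toℕ (Fin.inject₁ k))) (≡.sym p≡) (p∣pCk pp (suc (toℕ (Fin.inject₁ k))) (s≤s z≤n)
           (≡.subst (suc (toℕ (Fin.inject₁ k)) ℕ.<_) p≡ (s≤s (≡.subst (ℕ._< n) (≡.sym (toℕ-inject₁ k)) (toℕ<n k)))))))
       middle : ∀ m (f : Fin m → Carrier) → (∀ k → f k ≈ 0#) → sum f ≈ 0#
       middle m f h = ≈-trans (sum-cong-≋ h) (sum-replicate-zero m)

-- The polynomial ring over 𝔽ₚ.

module Polynomial (p : ℕ) where

 open import Data.Integer using (ℤ; +_)

 infix 4 _≈ₚ_

 -- A record, so that the two polynomials can be inferred from the type of an equation.
 record _≈ₚ_ (f g : Poly) : Set where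
   constructor coeffwise
   field at : ∀ i → coeff f i ≋ coeff g i [ p ]

 open _≈ₚ_ public

 negate : Poly → Poly
 negate = map (λ a → ℤ.- a)

 infixl 6 _⊞_
 infixl 7 _⊠_

 opaque
   _⊞_ _⊠_ : Poly → Poly → Poly
   _⊞_ = _+P_
   _⊠_ = _*P_

   ⊟_ : Poly → Poly
   ⊟_ = negate

   C : ℤ → Poly
   C a = a ∷ []

   X : Poly
   X = + 0 ∷ + 1 ∷ []

 private
   scale : ℤ → Poly → Poly
   scale a = map (a ℤ.*_)

   shift : Poly → Poly
   shift f = + 0 ∷ f

   coeff-+P : ∀ f g i → coeff (f +P g) i ≡ coeff f i ℤ.+ coeff g i
   coeff-+P [] g i = sym (ℤ.+-identityˡ _)
   coeff-+P (a ∷ f) [] i = sym (ℤ.+-identityʳ _)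
   coeff-+P (a ∷ f) (b ∷ g) zero = refl
   coeff-+P (a ∷ f) (b ∷ g) (suc i) = coeff-+P f g i

   coeff-scale : ∀ a f i → coeff (scale a f) i ≡ a ℤ.* coeff f i
   coeff-scale a [] i = sym (ℤ.*-zeroʳ a)
   coeff-scale a (b ∷ f) zero = refl
   coeff-scale a (b ∷ f) (suc i) = coeff-scale a f i

   coeff-neg : ∀ f i → coeff (negate f) i ≡ ℤ.- coeff f i
   coeff-neg [] i = refl
   coeff-neg (b ∷ f) zero = refl
   coeff-neg (b ∷ f) (suc i) = coeff-neg f i

   ≈-refl : ∀ {f} → f ≈ₚ f
   ≈-refl = coeffwise λ i → ≋-refl

   ≈-sym : ∀ {f g} → f ≈ₚ g → g ≈ₚ f
   ≈-sym e = coeffwise λ i → ≋-sym (at e i)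

   ≈-trans : ∀ {f g h} → f ≈ₚ g → g ≈ₚ h → f ≈ₚ h
   ≈-trans e e′ = coeffwise λ i → ≋-trans (at e i) (at e′ i)

   exactly : ∀ {f g} → (∀ i → coeff f i ≡ coeff g i) → f ≈ₚ g
   exactly e = coeffwise λ i → ≋-reflexive (e i)

   +-cong : ∀ {f f′ g g′} → f ≈ₚ f′ → g ≈ₚ g′ → f +P g ≈ₚ f′ +P g′
   +-cong {f} {f′} {g} {g′} e e′ = coeffwise λ i → subst₂ (_≋_[ p ]) (sym (coeff-+P f g i)) (sym (coeff-+P f′ g′ i)) (≋-+ (at e i) (at e′ i))

   scale-cong : ∀ {a b f g} → a ≋ b [ p ] → f ≈ₚ g → scale a f ≈ₚ scale b g
   scale-cong {a} {b} {f} {g} e e′ = coeffwise λ i → subst₂ (_≋_[ p ]) (sym (coeff-scale a f i)) (sym (coeff-scale b g i)) (≋-* e (at e′ i))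

   shift-cong : ∀ {f g} → f ≈ₚ g → shift f ≈ₚ shift g
   shift-cong e = coeffwise λ { zero → ≋-refl ; (suc i) → at e i }

   +-assoc : ∀ f g h → (f +P g) +P h ≈ₚ f +P (g +P h)
   +-assoc f g h = exactly λ i → trans (trans (coeff-+P (f +P g) h i) (cong (ℤ._+ coeff h i) (coeff-+P f g i)))
     (trans (ℤ.+-assoc (coeff f i) (coeff g i) (coeff h i)) (sym (trans (coeff-+P f (g +P h) i) (cong (ℤ._+_ (coeff f i)) (coeff-+P g h i)))))

   +-comm : ∀ f g → f +P g ≈ₚ g +P f
   +-comm f g = exactly λ i → trans (coeff-+P f g i) (trans (ℤ.+-comm (coeff f i) (coeff g i)) (sym (coeff-+P g f i)))

   +-identityʳ : ∀ f → f +P [] ≈ₚ f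
   +-identityʳ f = +-comm f []

   +-inverseʳ : ∀ f → f +P negate f ≈ₚ []
   +-inverseʳ f = exactly λ i → trans (coeff-+P f _ i) (trans (cong (ℤ._+_ (coeff f i)) (coeff-neg f i)) (ℤ.+-inverseʳ (coeff f i)))

   interchange : ∀ a b c d → (a +P b) +P (c +P d) ≈ₚ (a +P c) +P (b +P d)
   interchange a b c d = ≈-trans (+-assoc a b (c +P d)) (≈-trans (+-cong (≈-refl {a}) (≈-trans (≈-sym (+-assoc b c d)) (≈-trans (+-cong (+-comm b c) ≈-refl) (+-assoc c b d)))) (≈-sym (+-assoc a c (b +P d))))

   scale-+ : ∀ a f g → scale a (f +P g) ≈ₚ scale a f +P scale a g
   scale-+ a f g = exactly λ i → trans (coeff-scale a (f +P g) i) (trans (cong (a ℤ.*_) (coeff-+P f g i)) (trans (ℤ.*-distribˡ-+ a (coeff f i) (coeff g i))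
     (sym (trans (coeff-+P (scale a f) (scale a g) i) (cong₂ ℤ._+_ (coeff-scale a f i) (coeff-scale a g i))))))

   scale-scale : ∀ a b f → scale a (scale b f) ≈ₚ scale (a ℤ.* b) f
   scale-scale a b f = exactly λ i → trans (coeff-scale a (scale b f) i) (trans (cong (a ℤ.*_) (coeff-scale b f i)) (trans (sym (ℤ.*-assoc a b (coeff f i))) (sym (coeff-scale (a ℤ.* b) f i))))

   scale-shift : ∀ a f → scale a (shift f) ≈ₚ shift (scale a f)
   scale-shift a f = coeffwise λ { zero → ≋-reflexive (ℤ.*-zeroʳ a) ; (suc i) → ≋-refl }

   *-congˡ : ∀ f {g g′} → g ≈ₚ g′ → f *P g ≈ₚ f *P g′
   *-congˡ [] e = ≈-refl
   *-congˡ (a ∷ f) e = +-cong (scale-cong (≋-refl {a = a}) e) (shift-cong (*-congˡ f e))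

   *-zeroʳ : ∀ f → f *P [] ≈ₚ []
   *-zeroʳ [] = ≈-refl
   *-zeroʳ (a ∷ f) = ≈-trans (shift-cong (*-zeroʳ f)) (coeffwise λ { zero → ≋-refl ; (suc i) → ≋-refl })

   -- The mirror image of the defining recursion of the product, from which commutativity follows by
   -- induction.
   *-∷ʳ : ∀ f b g → f *P (b ∷ g) ≈ₚ scale b f +P shift (f *P g)
   *-∷ʳ [] b g = coeffwise λ { zero → ≋-refl ; (suc i) → ≋-refl }
   *-∷ʳ (a ∷ f) b g = coeffwise λ where
     zero → ≋-reflexive (cong (ℤ._+ + 0) (ℤ.*-comm a b))
     (suc i) → at (≈-trans (+-cong (≈-refl {scale a g}) (*-∷ʳ f b g)) (≈-trans (≈-sym (+-assoc (scale a g) (scale b f) (shift (f *P g))))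
                 (≈-trans (+-cong (+-comm (scale a g) (scale b f)) ≈-refl) (+-assoc (scale b f) (scale a g) (shift (f *P g)))))) i

   *-comm : ∀ f g → f *P g ≈ₚ g *P f
   *-comm [] g = ≈-sym (*-zeroʳ g)
   *-comm (a ∷ f) g = ≈-trans (+-cong (≈-refl {scale a g}) (shift-cong (*-comm f g))) (≈-sym (*-∷ʳ g a f))

   *-cong : ∀ {f f′ g g′} → f ≈ₚ f′ → g ≈ₚ g′ → f *P g ≈ₚ f′ *P g′
   *-cong {f} {f′} {g} {g′} e e′ = ≈-trans (*-congˡ f e′) (≈-trans (*-comm f g′) (≈-trans (*-congˡ g′ e) (*-comm g′ f′)))

   *-distribˡ : ∀ f g h → f *P (g +P h) ≈ₚ (f *P g) +P (f *P h)
   *-distribˡ [] g h = ≈-refl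
   *-distribˡ (a ∷ f) g h = ≈-trans (+-cong (scale-+ a g h) (shift-cong (*-distribˡ f g h))) (interchange (scale a g) (scale a h) (shift (f *P g)) (shift (f *P h)))

   *-distribʳ : ∀ f g h → (g +P h) *P f ≈ₚ (g *P f) +P (h *P f)
   *-distribʳ f g h = ≈-trans (*-comm (g +P h) f) (≈-trans (*-distribˡ f g h) (+-cong (*-comm f g) (*-comm f h)))

   scale-* : ∀ a g h → scale a g *P h ≈ₚ scale a (g *P h)
   scale-* a [] h = ≈-refl
   scale-* a (b ∷ g) h = ≈-trans (+-cong (≈-sym (scale-scale a b h)) (≈-trans (shift-cong (scale-* a g h)) (≈-sym (scale-shift a (g *P h))))) (≈-sym (scale-+ a (scale b h) (shift (g *P h))))

   scale-0 : ∀ f → scale (+ 0) f ≈ₚ []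
   scale-0 f = exactly λ i → coeff-scale (+ 0) f i

   shift-* : ∀ g h → shift g *P h ≈ₚ shift (g *P h)
   shift-* g h = +-cong (scale-0 h) ≈-refl

   *-assoc : ∀ f g h → (f *P g) *P h ≈ₚ f *P (g *P h)
   *-assoc [] g h = ≈-refl
   *-assoc (a ∷ f) g h = ≈-trans (*-distribʳ h (scale a g) (shift (f *P g))) (+-cong (scale-* a g h) (≈-trans (shift-* (f *P g) h) (shift-cong (*-assoc f g h))))

   scale-1 : ∀ f → scale (+ 1) f ≈ₚ f
   scale-1 f = exactly λ i → trans (coeff-scale (+ 1) f i) (ℤ.*-identityˡ _)

   C* : ∀ a f → (a ∷ []) *P f ≈ₚ scale a f
   C* a f = ≈-trans (+-cong (≈-refl {scale a f}) (coeffwise λ { zero → ≋-refl ; (suc i) → ≋-refl })) (+-identityʳ (scale a f))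

   X* : ∀ f → (+ 0 ∷ + 1 ∷ []) *P f ≈ₚ shift f
   X* f = ≈-trans (shift-* (+ 1 ∷ []) f) (shift-cong (≈-trans (C* (+ 1) f) (scale-1 f)))

 opaque
   unfolding _⊞_

   isPolyRing : IsCommutativeRing _≈ₚ_ _⊞_ _⊠_ ⊟_ [] (C (+ 1))
   isPolyRing = record
     { isRing = record
       { +-isAbelianGroup = record
         { isGroup = record
           { isMonoid = record
             { isSemigroup = record
               { isMagma = record
                 { isEquivalence = record { refl = ≈-refl ; sym = ≈-sym ; trans = ≈-trans }
                 ; ∙-cong = +-cong }
               ; assoc = +-assoc }
             ; identity = (λ f → ≈-refl) , +-identityʳ }
           ; inverse = (λ f → ≈-trans (+-comm (negate f) f) (+-inverseʳ f)) , +-inverseʳ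
           ; ⁻¹-cong = λ {f} {g} e → coeffwise λ i → subst₂ (_≋_[ p ]) (sym (coeff-neg f i)) (sym (coeff-neg g i)) (≋-neg (at e i)) }
         ; comm = +-comm }
       ; *-cong = *-cong
       ; *-assoc = *-assoc
       ; *-identity = (λ f → ≈-trans (C* (+ 1) f) (scale-1 f)) , (λ f → ≈-trans (*-comm f (+ 1 ∷ [])) (≈-trans (C* (+ 1) f) (scale-1 f)))
       ; distrib = *-distribˡ , *-distribʳ }
     ; *-comm = *-comm }

   coeff-+ : ∀ f g i → coeff (f ⊞ g) i ≡ coeff f i ℤ.+ coeff g i
   coeff-+ = coeff-+P

   coeff-C* : ∀ a f i → coeff (C a ⊠ f) i ≋ a ℤ.* coeff f i [ p ]
   coeff-C* a f i = ≋-trans (at (C* a f) i) (≋-reflexive (coeff-scale a f i))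

   coeff-X*-suc : ∀ f i → coeff (X ⊠ f) (suc i) ≋ coeff f i [ p ]
   coeff-X*-suc f i = at (X* f) (suc i)

   coeff-C-0 : ∀ a → coeff (C a) 0 ≡ a
   coeff-C-0 a = refl

   coeff-C-suc : ∀ a i → coeff (C a) (suc i) ≡ + 0
   coeff-C-suc a i = refl

   ∷-≈ : ∀ a f → a ∷ f ≈ₚ C a ⊞ X ⊠ f
   ∷-≈ a f = coeffwise λ where
     zero → ≋-trans (≋-reflexive (sym (ℤ.+-identityʳ a))) (≋-trans (≋-+ (≋-refl {a = a}) (≋-sym (at (X* f) 0))) (≋-reflexive (sym (coeff-+P (a ∷ []) (X ⊠ f) 0))))
     (suc i) → ≋-trans (≋-sym (at (X* f) (suc i))) (≋-trans (≋-reflexive (sym (ℤ.+-identityˡ _))) (≋-reflexive (sym (coeff-+P (a ∷ []) (X ⊠ f) (suc i)))))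

   ⊠-*P : ∀ f g → f ⊠ g ≡ f *P g
   ⊠-*P f g = refl

   coeff-⊟ : ∀ f i → coeff (⊟ f) i ≡ ℤ.- coeff f i
   coeff-⊟ = coeff-neg

   ⊞-+P : ∀ f g → f ⊞ g ≡ f +P g
   ⊞-+P f g = refl

 polyRing : CommutativeRing 0ℓ 0ℓ
 polyRing = record { isCommutativeRing = isPolyRing }

-- Sublists of labelled degrees.

module Selection where

 open import Data.Nat using (_+_; _*_; _^_)
 open import Data.Nat.Properties using (+-*-isCommutativeSemiring)
 open import Data.Nat.Divisibility using (_∣_)
 open import Data.List using (_++_)
 open import Data.List.Properties using (map-++)
 open import Data.List.Relation.Unary.All using (All)
 open import Data.List.Relation.Ternary.Interleaving.Propositional using (Interleaving; []; consˡ; consʳ)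
 open BigSum _+_ _*_ 0 1 +-*-isCommutativeSemiring public

 repeat : ∀ {A : Set} → ℕ → List A → List A
 repeat zero xs = []
 repeat (suc n) xs = xs ++ repeat n xs

 map-repeat : ∀ {A B : Set} (f : A → B) n xs → map f (repeat n xs) ≡ repeat n (map f xs)
 map-repeat f zero xs = refl
 map-repeat f (suc n) xs = trans (map-++ f xs (repeat n xs)) (cong (map f xs ++_) (map-repeat f n xs))

 interleaving-map : ∀ {A B : Set} (f : A → B) {as bs cs} → Interleaving as bs cs → Interleaving (map f as) (map f bs) (map f cs)
 interleaving-map f [] = []
 interleaving-map f (consˡ il) = consˡ (interleaving-map f il)
 interleaving-map f (consʳ il) = consʳ (interleaving-map f il)

 interleaving-unmap : ∀ {A B : Set} (f : A → B) cs {as bs} → Interleaving as bs (map f cs) →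
                      ∃ λ as′ → ∃ λ bs′ → Interleaving as′ bs′ cs × as ≡ map f as′
 interleaving-unmap f [] [] = [] , [] , [] , refl
 interleaving-unmap f (c ∷ cs) (consˡ il) =
   let as′ , bs′ , il′ , e = interleaving-unmap f cs il in c ∷ as′ , bs′ , consˡ il′ , cong (f c ∷_) e
 interleaving-unmap f (c ∷ cs) (consʳ il) =
   let as′ , bs′ , il′ , e = interleaving-unmap f cs il in as′ , c ∷ bs′ , consʳ il′ , e

 -- With constant `u` = 1 this is the total degree, with an indicator the total degree of the
 -- factors whose label satisfies a condition.
 weight : (ℕ → ℕ) → List (ℕ × ℕ) → ℕ
 weight u [] = 0
 weight u ((d , o) ∷ ls) = u d * o + weight u ls

 -- The irreducible factors of x ^ n - 1 over 𝔽ₚ, each recorded as the order d of x modulo it and its degree.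
 record Pattern (p n : ℕ) : Set where
   field
     list : List (ℕ × ℕ)
     orders : All (λ (d , o) → d ∣ n × Order d p o) list
     divisor-sum : ∀ e → e ∣ n → weight (λ d → ι (d ∣? e)) list ≡ e
     divisor⇒selection : ∀ k → HasDivisorOfDegree p n k → ∃ λ as → ∃ λ bs → Interleaving as bs list × weight (λ _ → 1) as ≡ k
     selection⇒divisor : ∀ v as bs → Interleaving as bs (repeat (p ^ v) list) → HasDivisorOfDegree p (p ^ v * n) (weight (λ _ → 1) as)

-- Division and factorisation of polynomials over 𝔽ₚ.

module FiniteField (p : ℕ) (pp : Prime p) where

 open Selection
 open import Data.Nat.DivMod using (_%_; _/_; m≡m%n+[m/n]*n; m%n<n; m<n⇒m%n≡m; [m+kn]%n≡m%n; m<n*o⇒m/o<n; +-distrib-/-∣ʳ; m*n/n≡m; m<n⇒m/n≡0)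
 open import Data.Nat.ListAction using (sum)
 open import Data.Integer using (ℤ; +_; -[1+_])
 open import Data.Integer.DivMod using (_%ℕ_; _/ℕ_; a≡a%ℕn+[a/ℕn]*n; n%ℕd<d)
 open import Data.List using ([_]; _++_; replicate; applyUpTo)
 open import Data.List.Properties using (length-applyUpTo; length-map; length-replicate)
 open import Data.List.Relation.Unary.All as All using (All; []; _∷_)
 open import Data.List.Relation.Unary.All.Properties using (map⁺)
 open import Data.List.Relation.Ternary.Interleaving.Propositional using (Interleaving; []; consˡ; consʳ)
 open Polynomial p
 open Ring polyRing

 private
   instance
     p≢0 : ℕ.NonZero p
     p≢0 = ℕ.>-nonZero (prime-≥1 pp)

 ≋0⇒∣ : ∀ {a} → a ≋ + 0 [ p ] → p ℕ.∣ ℤ.∣ a ∣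
 ≋0⇒∣ {a} e = subst (λ z → p ℕ.∣ ℤ.∣ z ∣) (ℤ.+-identityʳ a) (≋⇒∣ e)

 ∣⇒≋0 : ∀ {a} → p ℕ.∣ ℤ.∣ a ∣ → a ≋ + 0 [ p ]
 ∣⇒≋0 {a} d = ∣⇒≋ (subst (λ z → p ℕ.∣ ℤ.∣ z ∣) (sym (ℤ.+-identityʳ a)) d)

 ≋-*-nonzero : ∀ {a b} → ¬ a ≋ + 0 [ p ] → ¬ b ≋ + 0 [ p ] → ¬ a ℤ.* b ≋ + 0 [ p ]
 ≋-*-nonzero {a} {b} a≢0 b≢0 e = [ (λ d → a≢0 (∣⇒≋0 d)) , (λ d → b≢0 (∣⇒≋0 d)) ]′
   (euclidsLemma ℤ.∣ a ∣ ℤ.∣ b ∣ pp (subst (p ℕ.∣_) (ℤ.abs-* a b) (≋0⇒∣ {a ℤ.* b} e)))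

 ≋-%ℕ : ∀ z → z ≋ + (z %ℕ p) [ p ]
 ≋-%ℕ z = by (z /ℕ p) (a≡a%ℕn+[a/ℕn]*n z p)

 opaque
   ≋-inverse : ∀ {z} → ¬ z ≋ + 0 [ p ] → ∃ λ u → u ℤ.* z ≋ + 1 [ p ]
   ≋-inverse {z} z≢0 = from-inverse (inverse r⊥p)
     where
     r : ℕ
     r = z %ℕ p
     r⊥p : Coprime r p
     r⊥p = coprime-sym (prime∤⇒coprime pp λ p∣r → z≢0 (≋-trans (≋-%ℕ z) (≅-0 p∣r)))
     from-inverse : (∃ λ i → r ℕ.* i ≅ 1 [ p ]) → ∃ λ u → u ℤ.* z ≋ + 1 [ p ]
     from-inverse (i , e) = + i , ≋-trans (≋-* (≋-refl {a = + i}) (≋-%ℕ z)) (≋-trans (≋-reflexive (trans (sym (ℤ.pos-* i r)) (cong +_ (ℕ.*-comm i r)))) e)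

 1≢0 : ¬ + 1 ≋ + 0 [ p ]
 1≢0 e = coprime⇒∤ (prime≥2 pp) (coprime-sym 1-coprime) (≅-0⁻¹ {1} {p} e)

 C-cong : ∀ {a b} → a ≋ b [ p ] → C a ≈ C b
 C-cong {a} {b} e = coeffwise λ where
   zero → subst₂ (_≋_[ p ]) (sym (coeff-C-0 a)) (sym (coeff-C-0 b)) e
   (suc i) → ≋-reflexive (trans (coeff-C-suc a i) (sym (coeff-C-suc b i)))

 C-+ : ∀ a b → C (a ℤ.+ b) ≈ C a + C b
 C-+ a b = coeffwise λ where
   zero → ≋-reflexive (trans (coeff-C-0 (a ℤ.+ b)) (sym (trans (coeff-+ (C a) (C b) 0) (cong₂ ℤ._+_ (coeff-C-0 a) (coeff-C-0 b)))))
   (suc i) → ≋-reflexive (trans (coeff-C-suc (a ℤ.+ b) i) (sym (trans (coeff-+ (C a) (C b) (suc i)) (cong₂ ℤ._+_ (coeff-C-suc a i) (coeff-C-suc b i)))))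

 C-* : ∀ a b → C (a ℤ.* b) ≈ C a * C b
 C-* a b = coeffwise λ where
   zero → ≋-trans (≋-reflexive (trans (coeff-C-0 (a ℤ.* b)) (cong (a ℤ.*_) (sym (coeff-C-0 b))))) (≋-sym (coeff-C* a (C b) 0))
   (suc i) → ≋-trans (≋-reflexive (trans (coeff-C-suc (a ℤ.* b) i) (sym (trans (cong (a ℤ.*_) (coeff-C-suc b i)) (ℤ.*-zeroʳ a))))) (≋-sym (coeff-C* a (C b) (suc i)))

 C-0 : C (+ 0) ≈ 0#
 C-0 = coeffwise λ { zero → ≋-reflexive (coeff-C-0 (+ 0)) ; (suc i) → ≋-reflexive (coeff-C-suc (+ 0) i) }

 #≈C : ∀ n → # n ≈ C (+ n)
 #≈C zero = ≈-sym C-0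
 #≈C (suc n) = ≈-trans (#-suc n) (≈-trans (+-congˡ (#≈C n)) (≈-sym (C-+ (+ 1) (+ n))))

 char : # p ≈ 0#
 char = ≈-trans (#≈C p) (≈-trans (C-cong (≅-0 ℕ.∣-refl)) C-0)

 -- A list may end in coefficients divisible by p, so its length only bounds the degree; degrees are
 -- therefore expressed by conditions on coefficients.
 record Below (k : ℕ) (f : Poly) : Set where
   constructor mkBelow
   field vanish : ∀ i → k ℕ.≤ i → coeff f i ≋ + 0 [ p ]
 open Below public

 record Degree (k : ℕ) (f : Poly) : Set where
   constructor mkDegree
   field
     below : Below (suc k) f
     top : ¬ coeff f k ≋ + 0 [ p ]
 open Degree public

 record Monic (k : ℕ) (f : Poly) : Set where
   constructor mkMonic
   field
     belowᴹ : Below (suc k) f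
     topᴹ : coeff f k ≋ + 1 [ p ]
 open Monic public

 monic⇒degree : ∀ {k f} → Monic k f → Degree k f
 monic⇒degree m = mkDegree (belowᴹ m) λ e → 1≢0 (≋-trans (≋-sym (topᴹ m)) e)

 below-≈ : ∀ {k f g} → f ≈ g → Below k f → Below k g
 below-≈ e b = mkBelow λ i k≤i → ≋-trans (≋-sym (at e i)) (vanish b i k≤i)

 degree-≈ : ∀ {k f g} → f ≈ g → Degree k f → Degree k g
 degree-≈ {k} e d = mkDegree (below-≈ e (below d)) λ z → top d (≋-trans (at e k) z)

 monic-≈ : ∀ {k f g} → f ≈ g → Monic k f → Monic k g
 monic-≈ {k} e d = mkMonic (below-≈ e (belowᴹ d)) (≋-trans (≋-sym (at e k)) (topᴹ d))

 below-mono : ∀ {k l f} → k ℕ.≤ l → Below k f → Below l f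
 below-mono k≤l b = mkBelow λ i l≤i → vanish b i (ℕ.≤-trans k≤l l≤i)

 below-0 : ∀ {f} → Below 0 f → f ≈ 0#
 below-0 b = coeffwise λ i → vanish b i z≤n

 0-below : ∀ {k} → Below k 0#
 0-below = mkBelow λ i _ → ≋-refl

 below-+ : ∀ {k f g} → Below k f → Below k g → Below k (f + g)
 below-+ {k} {f} {g} b c = mkBelow λ i k≤i → ≋-trans (≋-reflexive (coeff-+ f g i)) (≋-+ (vanish b i k≤i) (vanish c i k≤i))

 below-neg : ∀ {k f} → Below k f → Below k (- f)
 below-neg {k} {f} b = mkBelow λ i k≤i → ≋-trans (≋-reflexive (coeff-⊟ f i)) (≋-neg (vanish b i k≤i))

 below-C* : ∀ {k f} a → Below k f → Below k (C a * f)
 below-C* {k} {f} a b = mkBelow λ i k≤i → ≋-trans (coeff-C* a f i) (≋-trans (≋-* (≋-refl {a = a}) (vanish b i k≤i)) (≋-reflexive (ℤ.*-zeroʳ a)))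

 below-X* : ∀ {k f} → Below k f → Below (suc k) (X * f)
 below-X* {k} {f} b = mkBelow λ { (suc i) (s≤s k≤i) → ≋-trans (coeff-X*-suc f i) (vanish b i k≤i) }

 below-C : ∀ a → Below 1 (C a)
 below-C a = mkBelow λ { (suc i) _ → ≋-reflexive (coeff-C-suc a i) }

 below-tail : ∀ {k c f} → Below (suc k) (c ∷ f) → Below k f
 below-tail b = mkBelow λ i k≤i → vanish b (suc i) (s≤s k≤i)

 ∷-* : ∀ c f g → (c ∷ f) * g ≈ C c * g + X * (f * g)
 ∷-* c f g = ≈-trans (*-congʳ (∷-≈ c f)) (solve (C c ∷ X ∷ f ∷ g ∷ []) ((v0 :+ v1 :* v2) :* v3) (v0 :* v3 :+ v1 :* (v2 :* v3)))

 product-top : ∀ f g k l → Below (suc k) f → Below (suc l) g →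
               Below (suc (k ℕ.+ l)) (f * g) × coeff (f * g) (k ℕ.+ l) ≋ coeff f k ℤ.* coeff g l [ p ]
 product-top [] g k l bf bg = below-≈ (≈-sym (zeroˡ g)) 0-below , ≋-trans (at (zeroˡ g) (k ℕ.+ l)) (≋-reflexive (sym (ℤ.*-zeroˡ (coeff g l))))
 product-top (c ∷ f) g zero l bf bg = below-≈ (≈-sym e) (below-C* c bg) , ≋-trans (at e l) (coeff-C* c g l)
   where
   f≈0 : f ≈ 0#
   f≈0 = below-0 (below-tail bf)
   e : (c ∷ f) * g ≈ C c * g
   e = ≈-trans (∷-* c f g) (≈-by (*-congˡ { X * g } f≈0) (solve (C c ∷ g ∷ X ∷ f ∷ []) (v0 :* v1 :+ v2 :* v1 :* v3) (v0 :* v1 :+ v2 :* (v3 :* v1) :+ v2 :* v1 :* c0)))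
 product-top (c ∷ f) g (suc k) l bf bg =
   below-≈ (≈-sym (∷-* c f g)) (below-+ (below-C* c (below-mono (s≤s (ℕ.m≤n+m l (suc k))) bg)) (below-X* (proj₁ ih))) ,
   ≋-trans (at (∷-* c f g) (suc (k ℕ.+ l))) (≋-trans (≋-reflexive (coeff-+ (C c * g) (X * (f * g)) (suc (k ℕ.+ l))))
     (≋-trans (≋-+ (vanish (below-C* c bg) (suc (k ℕ.+ l)) (s≤s (ℕ.m≤n+m l k))) (≋-trans (coeff-X*-suc (f * g) (k ℕ.+ l)) (proj₂ ih)))
       (≋-reflexive (ℤ.+-identityˡ _))))
   where
   ih : Below (suc (k ℕ.+ l)) (f * g) × coeff (f * g) (k ℕ.+ l) ≋ coeff f k ℤ.* coeff g l [ p ]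
   ih = product-top f g k l (below-tail bf) bg

 degree-* : ∀ {k l f g} → Degree k f → Degree l g → Degree (k ℕ.+ l) (f * g)
 degree-* {k} {l} {f} {g} df dg = mkDegree (proj₁ t) λ e → ≋-*-nonzero (top df) (top dg) (≋-trans (≋-sym (proj₂ t)) e)
   where t = product-top f g k l (below df) (below dg)

 monic-* : ∀ {k l f g} → Monic k f → Monic l g → Monic (k ℕ.+ l) (f * g)
 monic-* {k} {l} {f} {g} df dg = mkMonic (proj₁ t) (≋-trans (proj₂ t) (≋-* (topᴹ df) (topᴹ dg)))
   where t = product-top f g k l (belowᴹ df) (belowᴹ dg)

 degree-below : ∀ {k l f} → Degree k f → Below l f → k ℕ.< l
 degree-below {k} d b = ℕ.≰⇒> λ l≤k → top d (vanish b k l≤k)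

 degree-unique : ∀ {k l f} → Degree k f → Degree l f → k ≡ l
 degree-unique d e = ℕ.≤-antisym (ℕ.≤-pred (degree-below d (below e))) (ℕ.≤-pred (degree-below e (below d)))

 degree-≉0 : ∀ {k f} → Degree k f → ¬ f ≈ 0#
 degree-≉0 {k} d e = top d (at e k)

 opaque
   zero-or-degree : ∀ f → f ≈ 0# ⊎ (∃ λ k → Degree k f)
   zero-or-degree [] = inj₁ ≈-refl
   zero-or-degree (c ∷ f) = extend (zero-or-degree f) (c ≋? + 0 [ p ])
     where
     extend : f ≈ 0# ⊎ (∃ λ k → Degree k f) → Dec (c ≋ + 0 [ p ]) → c ∷ f ≈ 0# ⊎ (∃ λ k → Degree k (c ∷ f))
     extend (inj₂ (k , d)) _ = inj₂ (suc k , mkDegree (mkBelow λ { (suc i) (s≤s q) → vanish (below d) i q }) (top d))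
     extend (inj₁ f≈0) (yes c≋0) = inj₁ (coeffwise λ { zero → c≋0 ; (suc i) → at f≈0 i })
     extend (inj₁ f≈0) (no c≢0) = inj₂ (0 , mkDegree (mkBelow λ { (suc i) _ → at f≈0 i }) c≢0)

 _≈0? : ∀ f → Dec (f ≈ 0#)
 f ≈0? with zero-or-degree f
 ... | inj₁ e = yes e
 ... | inj₂ (k , d) = no (degree-≉0 d)

 ≈-domain : ∀ {f g} → f * g ≈ 0# → f ≈ 0# ⊎ g ≈ 0#
 ≈-domain {f} {g} e with zero-or-degree f | zero-or-degree g
 ... | inj₁ z | _ = inj₁ z
 ... | inj₂ _ | inj₁ z = inj₂ z
 ... | inj₂ (k , d) | inj₂ (l , d′) = ⊥-elim (degree-≉0 (degree-* d d′) e)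

 ≈-cancelˡ : ∀ {k f g h} → Degree k f → f * g ≈ f * h → g ≈ h
 ≈-cancelˡ {k} {f} {g} {h} d e = [ (λ z → ⊥-elim (degree-≉0 d z)) , ≈-diff ]′ (≈-domain (≈-by e (solve (f ∷ g ∷ h ∷ []) (c0 :+ v0 :* v1) (v0 :* (v1 :- v2) :+ v0 :* v2))))

 monic-cofactor : ∀ {k l f g} → Monic k f → Monic l (f * g) → ∃ λ m → Monic m g × k ℕ.+ m ≡ l
 monic-cofactor {k} {l} {f} {g} mf mfg with zero-or-degree g
 ... | inj₁ z = ⊥-elim (degree-≉0 (monic⇒degree mfg) (≈-trans (*-congˡ z) (zeroʳ f)))
 ... | inj₂ (m , dg) = m , mkMonic (below dg) (≋-trans (≋-trans (≋-reflexive (sym (ℤ.*-identityˡ (coeff g m)))) (≋-sym (≋-* (topᴹ mf) (≋-refl {a = coeff g m}))))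
       (≋-trans (≋-sym (proj₂ (product-top f g k m (belowᴹ mf) (below dg)))) (subst (λ i → coeff (f * g) i ≋ + 1 [ p ]) (sym k+m≡l) (topᴹ mfg)))) , k+m≡l
   where
   k+m≡l : k ℕ.+ m ≡ l
   k+m≡l = degree-unique (degree-* (monic⇒degree mf) dg) (monic⇒degree mfg)

 opaque
   divide : ∀ {m g} → Monic m g → ∀ f → ∃ λ q → ∃ λ r → f ≈ q * g + r × Below m r
   divide {m} {g} mg [] = 0# , 0# , (solve (g ∷ []) c0 (c0 :* v0 :+ c0)) , 0-below
   divide {m} {g} mg (c ∷ f) = extend (divide mg f)
     where
     extend : (∃ λ q → ∃ λ r → f ≈ q * g + r × Below m r) → ∃ λ q → ∃ λ r → c ∷ f ≈ q * g + r × Below m r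
     extend (q , r , e , b) = X * q + C t , s - C t * g ,
         ≈-trans (∷-≈ c f) (≈-by (*-congˡ { X } e) (solve (X ∷ q ∷ C t ∷ g ∷ C c ∷ r ∷ f ∷ []) ((v0 :* v1 :+ v2) :* v3 :+ (v4 :+ v0 :* v5 :- v2 :* v3) :+ v0 :* v6) (v4 :+ v0 :* v6 :+ v0 :* (v1 :* v3 :+ v5)))) , lower
       where
       s : Poly
       s = C c + X * r
       t : ℤ
       t = coeff s m
       bs : Below (suc m) s
       bs = below-+ (below-mono (s≤s z≤n) (below-C c)) (below-X* b)
       bd : Below (suc m) (s - C t * g)
       bd = below-+ bs (below-neg (below-C* t (belowᴹ mg)))
       at-m : coeff (s - C t * g) m ≋ + 0 [ p ]
       at-m = ≋-trans (≋-reflexive (trans (coeff-+ s (- (C t * g)) m) (cong (ℤ._+_ t) (coeff-⊟ (C t * g) m))))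
         (≋-trans (≋-+ (≋-refl {a = t}) (≋-neg (≋-trans (coeff-C* t g m) (≋-trans (≋-* (≋-refl {a = t}) (topᴹ mg)) (≋-reflexive (ℤ.*-identityʳ t)))))) (≋-reflexive (ℤ.+-inverseʳ t)))
       lower : Below m (s - C t * g)
       lower = mkBelow λ i m≤i → [ (λ m<i → vanish bd i m<i) , (λ { refl → at-m }) ]′ (ℕ.m≤n⇒m<n∨m≡n m≤i)

 ∣-below : ∀ {m g r} → Monic m g → Below m r → g ∣ r → r ≈ 0#
 ∣-below {m} {g} {r} mg b (h , e) with zero-or-degree h
 ... | inj₁ z = ≈-trans e (≈-trans (*-congˡ z) (zeroʳ g))
 ... | inj₂ (k , d) = ⊥-elim (ℕ.<⇒≱ (degree-below (degree-≈ (≈-sym e) (degree-* (monic⇒degree mg) d)) b) (ℕ.m≤m+n m k))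

 opaque
   monic-∣? : ∀ {m g} → Monic m g → ∀ f → Dec (g ∣ f)
   monic-∣? {m} {g} mg f = decide (divide mg f)
     where
     decide : (∃ λ q → ∃ λ r → f ≈ q * g + r × Below m r) → Dec (g ∣ f)
     decide (q , r , e , b) = map′ (λ z → q , (≈-by (e ⊕≈ z) (solve (g ∷ q ∷ f ∷ r ∷ []) (v0 :* v1 :+ (v2 :+ v3)) (v2 :+ (v1 :* v0 :+ v3 :+ c0)))))
       (λ (h , e′) → ∣-below mg b (h - q , (≈-by ((*-congˡ { - 1# } e) ⊕≈ e′) (solve (g ∷ h ∷ q ∷ f ∷ r ∷ []) (v0 :* (v1 :- v2) :+ ((:- c1) :* v3 :+ v3)) (v4 :+ ((:- c1) :* (v2 :* v0 :+ v4) :+ v0 :* v1)))))) (r ≈0?)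

 X^-monic : ∀ k → Monic k (X ^ k)
 X^-monic zero = mkMonic (below-C (+ 1)) (≋-reflexive (coeff-C-0 (+ 1)))
 X^-monic (suc k) = mkMonic (below-X* (belowᴹ (X^-monic k))) (≋-trans (coeff-X*-suc (X ^ k) k) (topᴹ (X^-monic k)))

 below-suc-monic : ∀ {m r} → Below m r → Monic m (r + X ^ m)
 below-suc-monic {m} {r} b = mkMonic (below-+ (below-mono (ℕ.n≤1+n m) b) (belowᴹ (X^-monic m)))
   (≋-trans (≋-reflexive (coeff-+ r (X ^ m) m)) (≋-+ (vanish b m ℕ.≤-refl) (topᴹ (X^-monic m))))

 monic-low : ∀ {m g} → Monic m g → Below m (g - X ^ m)
 monic-low {m} {g} mg = mkBelow λ i m≤i → [ (λ m<i → vanish (below-+ (belowᴹ mg) (below-neg (belowᴹ (X^-monic m)))) i m<i)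
   , (λ { refl → ≋-trans (≋-reflexive (trans (coeff-+ g (- (X ^ m)) m) (cong (ℤ._+_ (coeff g m)) (coeff-⊟ (X ^ m) m)))) (≋-+ (topᴹ mg) (≋-neg (topᴹ (X^-monic m)))) }) ]′ (ℕ.m≤n⇒m<n∨m≡n m≤i)

 make-monic : ∀ {k g} → Degree k g → ∃ λ u → ∃ λ w → Monic k (C u * g) × C w * (C u * g) ≈ g
 make-monic {k} {g} d = from-inverse (≋-inverse (top d))
   where
   from-inverse : (∃ λ u → u ℤ.* coeff g k ≋ + 1 [ p ]) → ∃ λ u → ∃ λ w → Monic k (C u * g) × C w * (C u * g) ≈ g
   from-inverse (u , e) = u , coeff g k , mkMonic (below-C* u (below d)) (≋-trans (coeff-C* u g k) e) ,
     ≈-trans (≈-sym (*-assoc _ _ _)) (≈-trans (*-congʳ (≈-trans (≈-sym (C-* (coeff g k) u)) (C-cong (≋-trans (≋-reflexive (ℤ.*-comm (coeff g k) u)) e)))) (*-identityˡ g))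

 -- Base p digits enumerate the polynomials of degree below m by the numbers below p^m. This
 -- provides both a bounded search for divisors and the count of residues.
 digits : ℕ → ℕ → Poly
 digits zero i = []
 digits (suc m) i = + (i % p) ∷ digits m (i / p)

 digits-below : ∀ m i → Below m (digits m i)
 digits-below zero i = 0-below
 digits-below (suc m) i = mkBelow λ { (suc j) (s≤s q) → vanish (digits-below m (i / p)) j q }

 digits-injective : ∀ m i j → i ℕ.< p ℕ.^ m → j ℕ.< p ℕ.^ m → digits m i ≈ digits m j → i ≡ j
 digits-injective zero i j (s≤s z≤n) (s≤s z≤n) e = refl
 digits-injective (suc m) i j i< j< e = trans (m≡m%n+[m/n]*n i p) (trans (cong₂ (λ a b → a ℕ.+ b ℕ.* p) same-% same-/) (sym (m≡m%n+[m/n]*n j p)))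
   where
   same-% : i % p ≡ j % p
   same-% = trans (sym (m<n⇒m%n≡m (m%n<n i p))) (trans (≅⇒% (at e 0)) (m<n⇒m%n≡m (m%n<n j p)))
   same-/ : i / p ≡ j / p
   same-/ = digits-injective m (i / p) (j / p) (m<n*o⇒m/o<n (subst (i ℕ.<_) (ℕ.*-comm p (p ℕ.^ m)) i<)) (m<n*o⇒m/o<n (subst (j ℕ.<_) (ℕ.*-comm p (p ℕ.^ m)) j<)) (coeffwise λ k → at e (suc k))

 digits-complete : ∀ m f → Below m f → ∃ λ i → i ℕ.< p ℕ.^ m × digits m i ≈ f
 digits-complete zero f b = 0 , s≤s z≤n , ≈-sym (below-0 b)
 digits-complete (suc m) f b = extend (digits-complete m (tail f) (mkBelow λ i m≤i → ≋-trans (≋-reflexive (coeff-tail f i)) (vanish b (suc i) (s≤s m≤i))))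
   where
   tail : Poly → Poly
   tail [] = []
   tail (_ ∷ f) = f
   coeff-tail : ∀ f i → coeff (tail f) i ≡ coeff f (suc i)
   coeff-tail [] i = refl
   coeff-tail (_ ∷ f) i = refl
   c : ℤ
   c = coeff f 0
   r : ℕ
   r = c %ℕ p
   r<p : r ℕ.< p
   r<p = n%ℕd<d c p
   extend : (∃ λ i → i ℕ.< p ℕ.^ m × digits m i ≈ tail f) → ∃ λ i → i ℕ.< p ℕ.^ suc m × digits (suc m) i ≈ f
   extend (i , i< , e) = r ℕ.+ i ℕ.* p , bound , coeffwise λ where
       zero → ≋-trans (≋-reflexive (cong +_ (trans ([m+kn]%n≡m%n r i p) (m<n⇒m%n≡m r<p)))) (≋-sym (≋-%ℕ c))
       (suc j) → subst (λ k → coeff (digits m k) j ≋ coeff f (suc j) [ p ]) (sym /≡) (≋-trans (at e j) (≋-reflexive (coeff-tail f j)))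
     where
     /≡ : (r ℕ.+ i ℕ.* p) / p ≡ i
     /≡ = trans (+-distrib-/-∣ʳ r (divides i refl)) (cong₂ ℕ._+_ (m<n⇒m/n≡0 r<p) (m*n/n≡m i p))
     bound : r ℕ.+ i ℕ.* p ℕ.< p ℕ.^ suc m
     bound = ℕ.<-≤-trans (ℕ.+-monoˡ-< (i ℕ.* p) r<p) (subst (suc i ℕ.* p ℕ.≤_) (ℕ.*-comm (p ℕ.^ m) p) (ℕ.*-monoˡ-≤ p i<))

 record Irreducible (D : ℕ) (f : Poly) : Set where
   field
     monic : Monic D f
     positive : 1 ℕ.≤ D
     minimal : ∀ m g → Monic m g → 1 ℕ.≤ m → m ℕ.< D → ¬ g ∣ f

 candidate : ℕ → ℕ → Poly
 candidate m i = digits m i + X ^ m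

 candidate-monic : ∀ m i → Monic m (candidate m i)
 candidate-monic m i = below-suc-monic (digits-below m i)

 candidate-complete : ∀ {m g} → Monic m g → ∃ λ i → i ℕ.< p ℕ.^ m × candidate m i ≈ g
 candidate-complete {m} {g} mg = extend (digits-complete m (g - X ^ m) (monic-low mg))
   where
   extend : (∃ λ i → i ℕ.< p ℕ.^ m × digits m i ≈ g - X ^ m) → ∃ λ i → i ℕ.< p ℕ.^ m × candidate m i ≈ g
   extend (i , i< , e) = i , i< , (≈-by e (solve (g ∷ digits m i ∷ X ^ m ∷ []) (v0 :+ v1) (v1 :+ v2 :+ (v0 :- v2))))

 ∣-≈ˡ : ∀ {a b c} → a ≈ b → b ∣ c → a ∣ c
 ∣-≈ˡ e (q , e′) = q , ≈-trans e′ (*-congʳ (≈-sym e))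

 opaque
   -- Finitely many monic candidates of smaller positive degree are tested for divisibility. One
   -- that divides `f` continues the descent; if none does, `f` itself is irreducible.
   irreducible-factor : ∀ D f → Monic D f → 1 ℕ.≤ D → ∃ λ m → ∃ λ g → Irreducible m g × g ∣ f
   irreducible-factor = <-rec (λ D → ∀ f → Monic D f → 1 ℕ.≤ D → ∃ λ m → ∃ λ g → Irreducible m g × g ∣ f) step
     where
     step : ∀ D → (∀ {k} → k ℕ.< D → ∀ f → Monic k f → 1 ℕ.≤ k → ∃ λ m → ∃ λ g → Irreducible m g × g ∣ f) →
            ∀ f → Monic D f → 1 ℕ.≤ D → ∃ λ m → ∃ λ g → Irreducible m g × g ∣ f
     step D rec f mf 1≤D = cases (ℕ.anyUpTo? (λ m → (1 ℕ.≤? m) ×-dec ℕ.anyUpTo? (λ i → monic-∣? (candidate-monic m i) f) (p ℕ.^ m)) D)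
       where
       cases : Dec (∃ λ m → m ℕ.< D × 1 ℕ.≤ m × ∃ λ i → i ℕ.< p ℕ.^ m × candidate m i ∣ f) → ∃ λ m → ∃ λ g → Irreducible m g × g ∣ f
       cases (yes (m , m<D , 1≤m , i , _ , c∣f)) = deeper (rec m<D (candidate m i) (candidate-monic m i) 1≤m)
         where
         deeper : (∃ λ m′ → ∃ λ g → Irreducible m′ g × g ∣ candidate m i) → ∃ λ m → ∃ λ g → Irreducible m g × g ∣ f
         deeper (m′ , g , ig , g∣c) = m′ , g , ig , ∣-trans g∣c c∣f
       cases (no none) = D , f , record { monic = mf ; positive = 1≤D ; minimal = λ m g mg 1≤m m<D g∣f →
           let i , i< , e = candidate-complete mg in none (m , m<D , 1≤m , i , i< , ∣-≈ˡ e g∣f) } , ∣-refl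

 record Factor : Set where
   field
     degree : ℕ
     poly : Poly
     irreducible : Irreducible degree poly
   open Irreducible irreducible public
 open Factor

 ∏ : List Factor → Poly
 ∏ [] = 1#
 ∏ (f ∷ fs) = poly f * ∏ fs

 1-monic : Monic 0 1#
 1-monic = X^-monic 0

 ∏-monic : ∀ fs → Monic (sum (map degree fs)) (∏ fs)
 ∏-monic [] = 1-monic
 ∏-monic (f ∷ fs) = monic-* (monic f) (∏-monic fs)

 monic-0 : ∀ {f} → Monic 0 f → f ≈ 1#
 monic-0 {f} mf = coeffwise λ where
   zero → ≋-trans (topᴹ mf) (≋-reflexive (sym (coeff-C-0 (+ 1))))
   (suc i) → ≋-trans (vanish (belowᴹ mf) (suc i) (s≤s z≤n)) (≋-reflexive (sym (coeff-C-suc (+ 1) i)))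

 opaque
   factorise : ∀ D f → Monic D f → ∃ λ fs → f ≈ ∏ fs
   factorise = <-rec (λ D → ∀ f → Monic D f → ∃ λ fs → f ≈ ∏ fs) step
     where
     step : ∀ D → (∀ {k} → k ℕ.< D → ∀ f → Monic k f → ∃ λ fs → f ≈ ∏ fs) → ∀ f → Monic D f → ∃ λ fs → f ≈ ∏ fs
     step zero rec f mf = [] , monic-0 mf
     step (suc D) rec f mf = split (irreducible-factor (suc D) f mf (s≤s z≤n))
       where
       split : (∃ λ m → ∃ λ g → Irreducible m g × g ∣ f) → ∃ λ fs → f ≈ ∏ fs
       split (m , g , ig , h , e) = remaining (monic-cofactor (Irreducible.monic ig) (monic-≈ e mf))
         where
         remaining : (∃ λ k → Monic k h × m ℕ.+ k ≡ suc D) → ∃ λ fs → f ≈ ∏ fs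
         remaining (k , mh , m+k≡) = conclude (rec (subst (k ℕ.<_) m+k≡ (ℕ.+-monoˡ-≤ k (Irreducible.positive ig))) h mh)
           where
           conclude : (∃ λ fs → h ≈ ∏ fs) → ∃ λ fs → f ≈ ∏ fs
           conclude (fs , e′) = record { degree = m ; poly = g ; irreducible = ig } ∷ fs , ≈-trans e (*-congˡ e′)

 module Modulo (F : Factor) where

   private
     D = degree F
     f = poly F

   opaque
     -- Euclidean descent after making `g` monic: if f = q g + r and h inverts r modulo f, then -q h
     -- inverts g. Irreducibility excludes r = 0 as long as g is not constant.
     inverse-mod : ∀ k g → Degree k g → k ℕ.< D → ∃ λ h → f ∣ g * h - 1#
     inverse-mod = <-rec (λ k → ∀ g → Degree k g → k ℕ.< D → ∃ λ h → f ∣ g * h - 1#) step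
       where
       unscale : ∀ g u w → C w * (C u * g) ≈ g → (∃ λ h → f ∣ (C u * g) * h - 1#) → ∃ λ h → f ∣ g * h - 1#
       unscale g u w _ (h , d) = C u * h , ∣-resp (solve (C u ∷ g ∷ h ∷ []) (v0 :* v1 :* v2 :- c1) (v1 :* (v0 :* v2) :- c1)) d
       step : ∀ k → (∀ {l} → l ℕ.< k → ∀ g → Degree l g → l ℕ.< D → ∃ λ h → f ∣ g * h - 1#) →
              ∀ g → Degree k g → k ℕ.< D → ∃ λ h → f ∣ g * h - 1#
       step k rec g dg k<D = scaled (make-monic dg)
         where
         scaled : (∃ λ u → ∃ λ w → Monic k (C u * g) × C w * (C u * g) ≈ g) → ∃ λ h → f ∣ g * h - 1#
         scaled (u , w , mg , e) = unscale g u w e (cases k refl (divide mg f))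
           where
           g′ : Poly
           g′ = C u * g
           cases : ∀ j → j ≡ k → (∃ λ q → ∃ λ r → f ≈ q * g′ + r × Below k r) → ∃ λ h → f ∣ g′ * h - 1#
           cases zero refl _ = 1# , ∣-resp (≈-by (*-congˡ { - 1# } (monic-0 mg)) (solve (g′ ∷ []) (v0 :* c1 :- c1 :+ (:- c1) :* v0) (c0 :+ (:- c1) :* c1))) ∣-0
           cases (suc j) refl (q , r , e , b) = remainder (zero-or-degree r)
             where
             remainder : r ≈ 0# ⊎ (∃ λ l → Degree l r) → ∃ λ h → f ∣ g′ * h - 1#
             remainder (inj₁ z) = ⊥-elim (minimal F (suc j) g′ mg (s≤s z≤n) k<D (q , (≈-by (e ⊕≈ z) (solve (g′ ∷ q ∷ f ∷ r ∷ []) (v0 :* v1 :+ (v2 :+ v3)) (v2 :+ (v1 :* v0 :+ v3 :+ c0))))))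
             remainder (inj₂ (l , dr)) = conclude (rec l<k r dr (ℕ.<-trans l<k k<D))
               where
               l<k : l ℕ.< suc j
               l<k = degree-below dr b
               conclude : (∃ λ h → f ∣ r * h - 1#) → ∃ λ h → f ∣ g′ * h - 1#
               conclude (h , s , e′) = - (q * h) , s - h , (≈-by (e′ ⊕≈ (*-congˡ { h } e)) (solve (f ∷ s ∷ h ∷ r ∷ g′ ∷ q ∷ []) (v0 :* (v1 :- v2) :+ (v3 :* v2 :- c1 :+ v2 :* v0)) (v4 :* (:- (v5 :* v2)) :- c1 :+ (v0 :* v1 :+ v2 :* (v5 :* v4 :+ v3)))))

     prime-property : ∀ {a b} → f ∣ a * b → f ∣ a ⊎ f ∣ b
     prime-property {a} {b} (t , ab≈) = reduce (divide (monic F) a)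
       where
       reduce : (∃ λ q → ∃ λ r → a ≈ q * f + r × Below D r) → f ∣ a ⊎ f ∣ b
       reduce (q , r , e , below-r) = cases (zero-or-degree r)
         where
         cases : r ≈ 0# ⊎ (∃ λ l → Degree l r) → f ∣ a ⊎ f ∣ b
         cases (inj₁ z) = inj₁ (q , (≈-by (e ⊕≈ z) (solve (f ∷ q ∷ a ∷ r ∷ []) (v0 :* v1 :+ (v2 :+ v3)) (v2 :+ (v1 :* v0 :+ v3 :+ c0)))))
         cases (inj₂ (l , dr)) = inj₂ (invert (inverse-mod l r dr (degree-below dr below-r)))
           where
           invert : (∃ λ h → f ∣ r * h - 1#) → f ∣ b
           invert (h , s , e′) = h * t - h * q * b - b * s , (≈-by ((*-congˡ { - b } e′) ⊕≈ (*-congˡ { - (h * b) } e) ⊕≈ (*-congˡ { h } ab≈)) (solve (f ∷ h ∷ t ∷ q ∷ b ∷ s ∷ r ∷ a ∷ []) (v0 :* (v1 :* v2 :- v1 :* v3 :* v4 :- v4 :* v5) :+ ((:- v4) :* (v6 :* v1 :- c1) :+ (:- (v1 :* v4)) :* v7 :+ v1 :* (v7 :* v4))) (v4 :+ ((:- v4) :* (v0 :* v5) :+ (:- (v1 :* v4)) :* (v3 :* v0 :+ v6) :+ v1 :* (v0 :* v2)))))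

   ∤1 : ¬ f ∣ 1#
   ∤1 d = degree-≉0 (monic⇒degree 1-monic) (∣-below (monic F) (below-mono (positive F) (belowᴹ 1-monic)) d)

   open Roots f ∤1 (λ {a} {b} → prime-property {a} {b}) public

 -- Unique factorisation in the form needed for counting: each irreducible factor is prime, hence
 -- can be cancelled from `g` or from `h`, and only units are left.
 split-factors : ∀ fs g h → g * h ≈ ∏ fs →
   ∃ λ as → ∃ λ bs → Interleaving as bs fs × (∃ λ u → ∃ λ w → u * w ≈ 1# × g ≈ u * ∏ as × h ≈ w * ∏ bs)
 split-factors [] g h e = [] , [] , [] , g , h , e , ≈-sym (*-identityʳ g) , ≈-sym (*-identityʳ h)
 split-factors (F ∷ fs) g h e = cases (Modulo.prime-property F {g} {h} (∏ fs , e))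
   where
   f = poly F
   dF = monic⇒degree (monic F)
   Result = ∃ λ as → ∃ λ bs → Interleaving as bs (F ∷ fs) × (∃ λ u → ∃ λ w → u * w ≈ 1# × g ≈ u * ∏ as × h ≈ w * ∏ bs)
   cases : f ∣ g ⊎ f ∣ h → Result
   cases (inj₁ (g′ , eg)) = extend (split-factors fs g′ h (≈-cancelˡ dF (≈-by ((*-congˡ { - h } eg) ⊕≈ e) (solve (f ∷ ∏ fs ∷ h ∷ g ∷ g′ ∷ []) (v0 :* v1 :+ ((:- v2) :* v3 :+ v3 :* v2)) (v0 :* (v4 :* v2) :+ ((:- v2) :* (v0 :* v4) :+ v0 :* v1))))))
     where
     extend : (∃ λ as → ∃ λ bs → Interleaving as bs fs × (∃ λ u → ∃ λ w → u * w ≈ 1# × g′ ≈ u * ∏ as × h ≈ w * ∏ bs)) → Result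
     extend (as , bs , il , u , w , uw , e₁ , e₂) = F ∷ as , bs , consˡ il , u , w , uw ,
       (≈-by (eg ⊕≈ (*-congˡ { f } e₁)) (solve (u ∷ f ∷ ∏ as ∷ g ∷ g′ ∷ []) (v0 :* (v1 :* v2) :+ (v3 :+ v1 :* v4)) (v3 :+ (v1 :* v4 :+ v1 :* (v0 :* v2))))) , e₂
   cases (inj₂ (h′ , eh)) = extend (split-factors fs g h′ (≈-cancelˡ dF (≈-by ((*-congˡ { - g } eh) ⊕≈ e) (solve (f ∷ ∏ fs ∷ g ∷ h ∷ h′ ∷ []) (v0 :* v1 :+ ((:- v2) :* v3 :+ v2 :* v3)) (v0 :* (v2 :* v4) :+ ((:- v2) :* (v0 :* v4) :+ v0 :* v1))))))
     where
     extend : (∃ λ as → ∃ λ bs → Interleaving as bs fs × (∃ λ u → ∃ λ w → u * w ≈ 1# × g ≈ u * ∏ as × h′ ≈ w * ∏ bs)) → Result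
     extend (as , bs , il , u , w , uw , e₁ , e₂) = as , F ∷ bs , consʳ il , u , w , uw , e₁ ,
       (≈-by (eh ⊕≈ (*-congˡ { f } e₂)) (solve (w ∷ f ∷ ∏ bs ∷ h ∷ h′ ∷ []) (v0 :* (v1 :* v2) :+ (v3 :+ v1 :* v4)) (v3 :+ (v1 :* v4 :+ v1 :* (v0 :* v2)))))

 unit-degree : ∀ {u w} → u * w ≈ 1# → Degree 0 u
 unit-degree {u} {w} e with zero-or-degree u | zero-or-degree w
 ... | inj₁ z | _ = ⊥-elim (degree-≉0 (monic⇒degree 1-monic) (≈-by ((*-congˡ { - 1# } e) ⊕≈ (*-congˡ { w } z)) (solve (u ∷ w ∷ []) (c0 :+ ((:- c1) :* (v0 :* v1) :+ v1 :* v0)) (c1 :+ ((:- c1) :* c1 :+ v1 :* c0)))))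
 ... | inj₂ _ | inj₁ z = ⊥-elim (degree-≉0 (monic⇒degree 1-monic) (≈-by ((*-congˡ { - 1# } e) ⊕≈ (*-congˡ { u } z)) (solve (u ∷ w ∷ []) (c0 :+ ((:- c1) :* (v0 :* v1) :+ v0 :* v1)) (c1 :+ ((:- c1) :* c1 :+ v0 :* c0)))))
 ... | inj₂ (k , du) | inj₂ (l , dw) = subst (λ k → Degree k u) (ℕ.m+n≡0⇒m≡0 k (degree-unique (degree-≈ e (degree-* du dw)) (monic⇒degree 1-monic))) du

 degree-split : ∀ {k g u w as} → Degree k g → u * w ≈ 1# → g ≈ u * ∏ as → k ≡ sum (map degree as)
 degree-split {as = as} dg uw e = degree-unique dg (degree-≈ (≈-sym e) (degree-* (unit-degree uw) (monic⇒degree (∏-monic as))))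

 -- Frobenius and the degrees of irreducible factors.

 open Characteristic p pp char

 1^ : ∀ n → 1# ^ n ≈ 1#
 1^ zero = ≈-refl
 1^ (suc n) = ≈-trans (*-identityˡ _) (1^ n)

 #^p : ∀ n → # n ^ p ≈ # n
 #^p zero = go p (prime-≥1 pp)
   where
   go : ∀ k → 1 ℕ.≤ k → 0# ^ k ≈ 0#
   go (suc k) _ = zeroˡ _
 #^p (suc n) = ≈-trans (^-congˡ p (#-suc n)) (≈-trans (frobenius-+ 1# (# n)) (≈-trans (+-cong (1^ p) (#^p n)) (≈-sym (#-suc n))))

 C^p : ∀ a → C a ^ p ≈ C a
 C^p a = ≈-trans (^-congˡ p e) (≈-trans (#^p r) (≈-sym e))
   where
   r = ℤ._%ℕ_ a p {{ℕ.>-nonZero (prime-≥1 pp)}}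
   e : C a ≈ # r
   e = ≈-trans (C-cong (≋-%ℕ a)) (≈-sym (#≈C r))

 ev-congʳ : ∀ cs {a b} → a ≈ b → ev cs a ≈ ev cs b
 ev-congʳ [] e = ≈-refl
 ev-congʳ (c ∷ cs) e = +-congˡ (*-cong e (ev-congʳ cs e))

 ev-X : ∀ h → ev (map C h) X ≈ h
 ev-X [] = ≈-refl
 ev-X (c ∷ h) = ≈-trans (+-congˡ (*-congˡ (ev-X h))) (≈-sym (∷-≈ c h))

 evM≈ : ∀ cs a → evM cs a ≈ ev cs a + a ^ length cs
 evM≈ [] a = (solve [] c1 (c0 :+ c1))
 evM≈ (c ∷ cs) a = (≈-by (*-congˡ { a } (evM≈ cs a)) (solve (c ∷ a ∷ ev cs a ∷ a ^ (length cs) ∷ evM cs a ∷ []) (v0 :+ v1 :* v2 :+ v1 :* v3 :+ v1 :* v4) (v0 :+ v1 :* v4 :+ v1 :* (v2 :+ v3))))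

 ev-frobenius : ∀ h a → ev (map C h) a ^ p ≈ ev (map C h) (a ^ p)
 ev-frobenius [] a = #^p 0
 ev-frobenius (c ∷ h) a = ≈-trans (frobenius-+ (C c) (a * ev (map C h) a)) (+-cong (C^p c) (≈-trans (^-distrib-* a (ev (map C h) a) p) (*-congˡ (ev-frobenius h a))))

 ^-swap : ∀ a m n → (a ^ m) ^ n ≈ (a ^ n) ^ m
 ^-swap a m n = ≈-trans (^-assocʳ a m n) (≈-trans (≈-reflexive (cong (a ^_) (ℕ.*-comm m n))) (≈-sym (^-assocʳ a n m)))

 evM-frobenius : ∀ h a → evM (map C h) a ^ p ≈ evM (map C h) (a ^ p)
 evM-frobenius h a = ≈-trans (^-congˡ p (evM≈ (map C h) a)) (≈-trans (frobenius-+ _ _)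
   (≈-trans (+-cong (ev-frobenius h a) (^-swap a (length (map C h)) p)) (≈-sym (evM≈ (map C h) (a ^ p)))))

 -- Stated for every map that commutes with p-th powers, as it is applied both to evaluation of
 -- polynomials over 𝔽ₚ and to a ↦ a - 1.
 iterate : (φ : Poly → Poly) → (∀ {a b} → a ≈ b → φ a ≈ φ b) → (∀ a → φ a ^ p ≈ φ (a ^ p)) → ∀ i a → φ a ^ (p ℕ.^ i) ≈ φ (a ^ (p ℕ.^ i))
 iterate φ φ-cong φ-p zero a = ≈-trans (*-identityʳ (φ a)) (φ-cong (≈-sym (*-identityʳ a)))
 iterate φ φ-cong φ-p (suc i) a = ≈-trans (≈-sym (^-assocʳ (φ a) p (p ℕ.^ i))) (≈-trans (^-congˡ (p ℕ.^ i) (φ-p a))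
   (≈-trans (iterate φ φ-cong φ-p i (a ^ p)) (φ-cong (^-assocʳ a p (p ℕ.^ i)))))

 evM-congʳ : ∀ cs {a b} → a ≈ b → evM cs a ≈ evM cs b
 evM-congʳ [] e = ≈-refl
 evM-congʳ (c ∷ cs) e = +-congˡ (*-cong e (evM-congʳ cs e))

 ev-∣ : ∀ {f a b} cs → f ∣ a - b → f ∣ ev cs a - ev cs b
 ev-∣ {f} {a} {b} [] d = ∣-resp (solve [] c0 (c0 :- c0)) ∣-0
 ev-∣ {f} {a} {b} (c ∷ cs) d = ∣-resp (solve (a ∷ ev cs a ∷ ev cs b ∷ b ∷ c ∷ []) (v0 :* (v1 :- v2) :+ v2 :* (v0 :- v3)) (v4 :+ v0 :* v1 :- (v4 :+ v3 :* v2))) (∣-+ (∣-* a (ev-∣ cs d)) (∣-* (ev cs b) d))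

 ∣-^ : ∀ {f a} n → 1 ℕ.≤ n → f ∣ a → f ∣ a ^ n
 ∣-^ {f} {a} (suc n) _ d = ∣-resp (*-comm (a ^ n) a) (∣-* (a ^ n) d)

 p^≥1 : ∀ i → 1 ℕ.≤ p ℕ.^ i
 p^≥1 i = ℕ.m^n>0 p {{ℕ.>-nonZero (prime-≥1 pp)}} i

 X^∣ : ∀ {f} m n → f ∣ X ^ m - 1# → f ∣ X ^ n - 1# → f ∣ X ^ (m ℕ.+ n) - 1#
 X^∣ m n d e = ∣-resp (≈-trans (solve (X ^ n ∷ X ^ m ∷ []) (v0 :* (v1 :- c1) :+ (v0 :- c1)) (v1 :* v0 :- c1)) (+-congʳ (≈-sym (^-homo-* X m n)))) (∣-+ (∣-* (X ^ n) d) e)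

 X^∣⁻ : ∀ {f} m n → f ∣ X ^ m - 1# → f ∣ X ^ (m ℕ.+ n) - 1# → f ∣ X ^ n - 1#
 X^∣⁻ m n d e = ∣-resp (≈-trans (+-congʳ (+-congʳ (^-homo-* X m n))) (solve (X ^ m ∷ X ^ n ∷ []) (v0 :* v1 :- c1 :+ (:- (v1 :* (v0 :- c1)))) (v1 :- c1))) (∣-+ e (∣-neg (∣-* (X ^ n) d)))

 -- d is the order of X modulo f.
 record Label (f : Poly) (d : ℕ) : Set where
   field
     to : ∀ m → f ∣ X ^ m - 1# → d ℕ.∣ m
     from : ∀ m → d ℕ.∣ m → f ∣ X ^ m - 1#

 opaque
   label : ∀ F n → 1 ℕ.≤ n → poly F ∣ X ^ n - 1# → ∃ λ d → 1 ℕ.≤ d × d ℕ.∣ n × Label (poly F) d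
   label F n 1≤n f∣ = conclude (period (λ m → monic-∣? (monic F) (X ^ m - 1#)) (∣-resp (solve [] c0 (c1 :- c1)) ∣-0) (λ {a} {b} → X^∣ a b) (λ {a} {b} → X^∣⁻ a b) n 1≤n f∣)
     where
     conclude : (∃ λ d → 1 ℕ.≤ d × d ℕ.≤ n × (∀ m → poly F ∣ X ^ m - 1# → d ℕ.∣ m) × (∀ m → d ℕ.∣ m → poly F ∣ X ^ m - 1#)) →
                ∃ λ d → 1 ℕ.≤ d × d ℕ.∣ n × Label (poly F) d
     conclude (d , 1≤d , _ , to , from) = d , 1≤d , to n f∣ , record { to = to ; from = from }

 module DegreeOrder (F : Factor) (d j : ℕ) (1≤d : 1 ℕ.≤ d) (lab : Label (poly F) d) (p⊥d : Coprime p d) (ord : Order d p j) where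

   private
     f = poly F
     D = degree F

   open Modulo F

   private
     -- X is a unit modulo `f`, since X^(m d) ≡ 1 and m d ≥ m.
     f∤X^ : ∀ m → ¬ f ∣ X ^ m
     f∤X^ m f∣ = ∤1 (∣-resp e (∣-+ (∣-* (X ^ r) f∣) (∣-neg (Label.from lab (m ℕ.* d) (divides m refl)))))
       where
       r = m ℕ.* d ℕ.∸ m
       m+r≡ : r ℕ.+ m ≡ m ℕ.* d
       m+r≡ = ℕ.m∸n+n≡m (ℕ.m≤m*n m d {{ℕ.>-nonZero 1≤d}})
       e : X ^ r * X ^ m + (- (X ^ (m ℕ.* d) - 1#)) ≈ 1#
       e = ≈-trans (+-congʳ (≈-trans (≈-sym (^-homo-* X r m)) (≈-reflexive (cong (X ^_) m+r≡)))) (solve (X ^ (m ℕ.* d) ∷ []) (v0 :+ (:- (v0 :- c1))) c1)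

     -- A coincidence would, after cancelling X^(p^i), make d divide p^i (p^t - 1) with t = i′ - i.
     -- As p is prime to d this gives p^t ≡ 1 modulo d with 0 < t < j, against the order of p.
     X^-distinct : ∀ i i′ → i ℕ.< i′ → i′ ℕ.< j → ¬ f ∣ X ^ (p ℕ.^ i) - X ^ (p ℕ.^ i′)
     X^-distinct i i′ i<i′ i′<j f∣ = ℕ.<⇒≱ (ℕ.≤-<-trans (ℕ.m∸n≤m i′ i) i′<j) (ℕ.∣⇒≤ {{ℕ.>-nonZero (ℕ.m<n⇒0<n∸m i<i′)}} (Order.to ord t p^t≅1))
       where
       t = i′ ℕ.∸ i
       m = p ℕ.^ i
       M = p ℕ.^ t
       M≡ : m ℕ.+ m ℕ.* (M ℕ.∸ 1) ≡ p ℕ.^ i′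
       M≡ = trans (sym (ℕ.*-suc m (M ℕ.∸ 1))) (trans (cong (m ℕ.*_) (ℕ.m+[n∸m]≡n (p^≥1 t))) (trans (sym (ℕ.^-distribˡ-+-* p i t)) (cong (p ℕ.^_) (ℕ.m+[n∸m]≡n (ℕ.<⇒≤ i<i′)))))
       e : X ^ m - X ^ (p ℕ.^ i′) ≈ X ^ m * (- (X ^ (m ℕ.* (M ℕ.∸ 1)) - 1#))
       e = ≈-trans (+-congˡ (-‿cong (≈-trans (≈-reflexive (cong (X ^_) (sym M≡))) (^-homo-* X m (m ℕ.* (M ℕ.∸ 1)))))) (solve (X ^ m ∷ X ^ (m ℕ.* (M ℕ.∸ 1)) ∷ []) (v0 :- v0 :* v1) (v0 :* (:- (v1 :- c1))))
       d∣ : d ℕ.∣ m ℕ.* (M ℕ.∸ 1)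
       d∣ = Label.to lab _ ([ (λ z → ⊥-elim (f∤X^ m z)) , (λ z → ∣-resp (solve (X ^ (m ℕ.* (M ℕ.∸ 1)) ∷ []) (:- (:- (v0 :- c1))) (v0 :- c1)) (∣-neg z)) ]′ (prime-property {X ^ m} (∣-resp e f∣)))
       p^t≅1 : M ≅ 1 [ d ]
       p^t≅1 = ∸-≅ (p^≥1 t) (coprime-divisor (coprime-sym (coprime-^ˡ i p⊥d)) d∣)

     -- As f(X)^(p^i) = f(X^(p^i)), the conjugates X^(p^i) with i < j are roots of `f` modulo `f`,
     -- and they are distinct.
     order≤degree : j ℕ.≤ D
     order≤degree = with-digits (candidate-complete (monic F))
       where
       with-digits : (∃ λ i → i ℕ.< p ℕ.^ D × candidate D i ≈ f) → j ℕ.≤ D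
       with-digits (c , _ , e) = root-bound D cs len j (λ i → X ^ (p ℕ.^ i)) roots X^-distinct
         where
         h = digits D c
         cs = map C h
         length-digits : ∀ m i → length (digits m i) ≡ m
         length-digits zero i = refl
         length-digits (suc m) i = cong suc (length-digits m _)
         len : length cs ≡ D
         len = trans (length-map C h) (length-digits D c)
         evM-X : evM cs X ≈ f
         evM-X = ≈-trans (evM≈ cs X) (≈-trans (+-cong (ev-X h) (≈-reflexive (cong (X ^_) len))) e)
         roots : ∀ i → i ℕ.< j → f ∣ evM cs (X ^ (p ℕ.^ i))
         roots i _ = ∣-resp (≈-trans (≈-sym (^-congˡ (p ℕ.^ i) evM-X)) (iterate (evM cs) (evM-congʳ cs) (evM-frobenius h) i X)) (∣-^ (p ℕ.^ i) (p^≥1 i) ∣-refl)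

     X^p^j : f ∣ X ^ (p ℕ.^ j) - X
     X^p^j = ∣-resp (≈-trans (solve (X ∷ X ^ (p ℕ.^ j ℕ.∸ 1) ∷ []) (v0 :* (v1 :- c1)) (v0 :* v1 :- v0)) (+-congʳ (≈-reflexive (cong (X ^_) (ℕ.m+[n∸m]≡n (p^≥1 j))))))
       (∣-* X (Label.from lab (p ℕ.^ j ℕ.∸ 1) (≅-∸ (p^≥1 j) (Order.self ord))))

     fixed : ∀ h → f ∣ h ^ (p ℕ.^ j) - h
     fixed h = ∣-resp (+-cong (≈-trans (≈-sym (iterate (ev (map C h)) (ev-congʳ (map C h)) (ev-frobenius h) j X)) (^-congˡ (p ℕ.^ j) (ev-X h))) (-‿cong (ev-X h))) (ev-∣ (map C h) X^p^j)

     2≤p^j : 2 ℕ.≤ p ℕ.^ j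
     2≤p^j = ℕ.≤-trans (prime≥2 pp) (subst (ℕ._≤ p ℕ.^ j) (ℕ.^-identityʳ p) (ℕ.^-monoʳ-≤ p {{ℕ.>-nonZero (prime-≥1 pp)}} (Order.pos ord)))

     -- From X^(p^j) ≡ X every residue h satisfies h^(p^j) ≡ h, so all p^D residues are roots of a
     -- polynomial of degree p^j.
     degree≤order : D ℕ.≤ j
     degree≤order = ℕ.≮⇒≥ λ j<D → ℕ.<⇒≱ (ℕ.^-monoʳ-< p (prime≥2 pp) j<D)
         (root-bound (p ℕ.^ j) cs len (p ℕ.^ D) (digits D) (λ i _ → ∣-resp (≈-sym (ev-cs (digits D i))) (fixed (digits D i))) distinct)
       where
       N = p ℕ.^ j ℕ.∸ 2
       N≡ : 2 ℕ.+ N ≡ p ℕ.^ j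
       N≡ = ℕ.m+[n∸m]≡n 2≤p^j
       -- Lower coefficients of the monic polynomial y^(p^j) - y.
       cs : List Poly
       cs = 0# ∷ - 1# ∷ replicate N 0#
       len : length cs ≡ p ℕ.^ j
       len = trans (cong (λ k → suc (suc k)) (length-replicate N)) N≡
       evM-replicate : ∀ n a → evM (replicate n 0#) a ≈ a ^ n
       evM-replicate zero a = ≈-refl
       evM-replicate (suc n) a = ≈-trans (+-identityˡ _) (*-congˡ (evM-replicate n a))
       ev-cs : ∀ a → evM cs a ≈ a ^ (p ℕ.^ j) - a
       ev-cs a = ≈-trans (+-congˡ (*-congˡ (+-congˡ (*-congˡ (evM-replicate N a))))) (≈-trans (solve (a ∷ a ^ N ∷ []) (c0 :+ v0 :* (:- c1 :+ v0 :* v1)) (v0 :* (v0 :* v1) :- v0)) (+-congʳ (≈-reflexive (cong (a ^_) N≡))))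
       distinct : ∀ i i′ → i ℕ.< i′ → i′ ℕ.< p ℕ.^ D → ¬ f ∣ digits D i - digits D i′
       distinct i i′ i<i′ i′< f∣ = ℕ.<⇒≢ i<i′ (digits-injective D i i′ (ℕ.<-trans i<i′ i′<) i′<
         (≈-diff (∣-below (monic F) (below-+ (digits-below D i) (below-neg (digits-below D i′))) f∣)))

   degree≡order : D ≡ j
   degree≡order = ℕ.≤-antisym degree≤order order≤degree

 -- The factors of x^n - 1.

 -1≈ : C -[1+ 0 ] ≈ - 1#
 -1≈ = coeffwise λ where
   zero → ≋-reflexive (trans (coeff-C-0 -[1+ 0 ]) (sym (trans (coeff-⊟ 1# 0) (cong (λ z → ℤ.- z) (coeff-C-0 (+ 1))))))
   (suc i) → ≋-reflexive (trans (coeff-C-suc -[1+ 0 ] i) (sym (trans (coeff-⊟ 1# (suc i)) (cong (λ z → ℤ.- z) (coeff-C-suc (+ 1) i)))))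

 xⁿ-1≈ : ∀ n → xⁿ-1 n ≈ X ^ n - 1#
 xⁿ-1≈ n = ≈-trans (≈-reflexive (sym (⊞-+P (replicate n (+ 0) ++ [ + 1 ]) [ -[1+ 0 ] ])))
   (+-cong (power n) (≈-trans (∷-≈ -[1+ 0 ] []) (≈-by -1≈ (solve (C -[1+ 0 ] ∷ X ∷ []) (:- c1 :+ v0) (v0 :+ v1 :* c0 :+ (:- c1))))))
   where
   power : ∀ n → replicate n (+ 0) ++ [ + 1 ] ≈ X ^ n
   power zero = ≈-trans (∷-≈ (+ 1) []) (solve (X ∷ []) (c1 :+ v0 :* c0) c1)
   power (suc n) = ≈-trans (∷-≈ (+ 0) _) (≈-trans (+-cong C-0 (*-congˡ (power n))) (+-identityˡ _))

 X^-1-monic : ∀ n → 1 ℕ.≤ n → Monic n (X ^ n - 1#)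
 X^-1-monic n 1≤n = monic-≈ (+-comm (- 1#) (X ^ n)) (below-suc-monic (below-mono 1≤n (below-neg (below-C (+ 1)))))

 geometric : ℕ → Poly → Poly
 geometric zero y = 0#
 geometric (suc t) y = 1# + y * geometric t y

 geometric-sum : ∀ t y → (y - 1#) * geometric t y ≈ y ^ t - 1#
 geometric-sum zero y = (solve (y ∷ []) ((v0 :- c1) :* c0) (c1 :- c1))
 geometric-sum (suc t) y = (≈-by (*-congˡ { y } (geometric-sum t y)) (solve (y ∷ y ^ t ∷ geometric t y ∷ []) (v0 :* v1 :- c1 :+ v0 :* ((v0 :- c1) :* v2)) ((v0 :- c1) :* (c1 :+ v0 :* v2) :+ v0 :* (v1 :- c1))))

 -- For y = X^e and n = t e this separates the factors of X^e - 1 from those of the cofactor: modulo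
 -- a common factor the cofactor would be the constant t, which is invertible modulo p.
 geometric-mod : ∀ t y → y - 1# ∣ geometric t y - # t
 geometric-mod zero y = ∣-resp (solve [] c0 (c0 :- c0)) ∣-0
 geometric-mod (suc t) y = ∣-resp ((≈-by (#-suc t) (solve (y ∷ geometric t y ∷ # (suc t) ∷ # t ∷ []) (c1 :+ v0 :* v1 :- v2 :+ v2) (v0 :* (v1 :- v3) :+ v3 :* (v0 :- c1) :+ (c1 :+ v3)))))
   (∣-+ (∣-* y (geometric-mod t y)) (∣-* (# t) ∣-refl))

 factor-∣-∏ : ∀ fs → All (λ F → poly F ∣ ∏ fs) fs
 factor-∣-∏ [] = []
 factor-∣-∏ (F ∷ fs) = (∏ fs , ≈-refl) ∷ All.map (∣-* (poly F)) (factor-∣-∏ fs)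

 ∏-++ : ∀ fs gs → ∏ (fs ++ gs) ≈ ∏ fs * ∏ gs
 ∏-++ [] gs = ≈-sym (*-identityˡ _)
 ∏-++ (F ∷ fs) gs = ≈-trans (*-congˡ (∏-++ fs gs)) (≈-sym (*-assoc (poly F) (∏ fs) (∏ gs)))

 ∏-repeat : ∀ N fs → ∏ (repeat N fs) ≈ ∏ fs ^ N
 ∏-repeat zero fs = ≈-refl
 ∏-repeat (suc N) fs = ≈-trans (∏-++ fs (repeat N fs)) (*-congˡ (∏-repeat N fs))

 ∏-interleaving : ∀ {as bs fs} → Interleaving as bs fs → ∏ as * ∏ bs ≈ ∏ fs
 ∏-interleaving [] = *-identityˡ _
 ∏-interleaving {F ∷ as} {bs} (consˡ il) = ≈-trans (*-assoc (poly F) (∏ as) (∏ bs)) (*-congˡ (∏-interleaving il))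
 ∏-interleaving {as} {F ∷ bs} {_ ∷ fs} (consʳ il) = (≈-by (*-congˡ { poly F } (∏-interleaving il)) (solve (poly F ∷ ∏ fs ∷ ∏ as ∷ ∏ bs ∷ []) (v0 :* v1 :+ v0 :* (v2 :* v3)) (v2 :* (v0 :* v3) :+ v0 :* v1)))

 X^-1^ : ∀ n v → (X ^ n - 1#) ^ (p ℕ.^ v) ≈ X ^ (p ℕ.^ v ℕ.* n) - 1#
 X^-1^ n v = ≈-trans (iterate (λ a → a - 1#) +-congʳ (λ a → ≈-trans (frobenius-+ a (- 1#)) (+-congˡ -1^p)) v (X ^ n))
   (+-congʳ (≈-trans (^-assocʳ X n (p ℕ.^ v)) (≈-reflexive (cong (X ^_) (ℕ.*-comm n (p ℕ.^ v))))))
   where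
   -1^p : (- 1#) ^ p ≈ - 1#
   -1^p = ≈-trans (^-congˡ p (≈-sym -1≈)) (≈-trans (C^p -[1+ 0 ]) -1≈)

 -- `HasDivisorOfDegree` prescribes the length of the coefficient list, so a product is rewritten
 -- with exactly k + 1 entries.
 truncate : ℕ → Poly → Poly
 truncate k f = applyUpTo (coeff f) (suc k)

 truncate-≈ : ∀ {k f} → Below (suc k) f → truncate k f ≈ f
 truncate-≈ {k} {f} b = coeffwise λ i → coeffs (suc k) (coeff f) i (λ k<i → ≋-sym (vanish b i k<i))
   where
   coeffs : ∀ n c i → (n ℕ.≤ i → + 0 ≋ c i [ p ]) → coeff (applyUpTo c n) i ≋ c i [ p ]
   coeffs zero c i h = h z≤n
   coeffs (suc n) c zero h = ≋-refl
   coeffs (suc n) c (suc i) h = coeffs n (λ j → c (suc j)) i (λ q → h (s≤s q))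

 length-below : ∀ k f → length f ≡ k → Below k f
 length-below k f e = mkBelow λ i k≤i → ≋-reflexive (go f i (subst (ℕ._≤ i) (sym e) k≤i))
   where
   go : ∀ f i → length f ℕ.≤ i → coeff f i ≡ + 0
   go [] i _ = refl
   go (c ∷ f) (suc i) (s≤s q) = go f i q

 module _ (n : ℕ) (1≤n : 1 ℕ.≤ n) (p∤n : ¬ p ℕ.∣ n) where

   private
     p⊥ : ∀ {d} → d ℕ.∣ n → Coprime p d
     p⊥ d∣n = coprime-∣ʳ d∣n (prime∤⇒coprime pp p∤n)

     Factors = ∃ λ fs → X ^ n - 1# ≈ ∏ fs

     factors : Factors
     factors = factorise n (X ^ n - 1#) (X^-1-monic n 1≤n)

     fs : List Factor
     fs = proj₁ factors

     fs≈ : X ^ n - 1# ≈ ∏ fs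
     fs≈ = proj₂ factors

     opaque
       -- The junk value 0 is never taken on factors of X ^ n - 1.
       labelOf : Factor → ℕ
       labelOf F = go (monic-∣? (monic F) (X ^ n - 1#))
         where
         go : Dec (poly F ∣ X ^ n - 1#) → ℕ
         go (yes d) = proj₁ (label F n 1≤n d)
         go (no _) = 0

       labelOf-spec : ∀ F → poly F ∣ X ^ n - 1# → 1 ℕ.≤ labelOf F × labelOf F ℕ.∣ n × Label (poly F) (labelOf F)
       labelOf-spec F f∣ with monic-∣? (monic F) (X ^ n - 1#)
       ... | yes d = proj₂ (label F n 1≤n d)
       ... | no ¬d = ⊥-elim (¬d f∣)

     pair : Factor → ℕ × ℕ
     pair F = labelOf F , degree F

     order-of-factor : ∀ F → poly F ∣ X ^ n - 1# → labelOf F ℕ.∣ n × Order (labelOf F) p (degree F)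
     order-of-factor F f∣ = go (labelOf-spec F f∣)
       where
       go : 1 ℕ.≤ labelOf F × labelOf F ℕ.∣ n × Label (poly F) (labelOf F) → labelOf F ℕ.∣ n × Order (labelOf F) p (degree F)
       go (1≤d , d∣n , lab) = d∣n , with-order (order (labelOf F) p 1≤d (p⊥ d∣n))
         where
         with-order : (∃ λ o → Order (labelOf F) p o × o ℕ.≤ labelOf F × (2 ℕ.≤ labelOf F → o ℕ.< labelOf F)) → Order (labelOf F) p (degree F)
         with-order (o , ord , _) = subst (Order (labelOf F) p) (sym (DegreeOrder.degree≡order F (labelOf F) o 1≤d lab (p⊥ d∣n) ord)) ord

     ∣-all : All (λ F → poly F ∣ X ^ n - 1#) fs
     ∣-all = All.map (∣-resp (≈-sym fs≈)) (factor-∣-∏ fs)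

     -- The irreducible factors split between X^e - 1 and its cofactor `G`. Those of X^e - 1 are
     -- exactly the ones with label dividing e, because none of these can divide `G`; their total
     -- degree is e.
     weight-∣ : ∀ e → e ℕ.∣ n → weight (λ d → ι (d ∣? e)) (map pair fs) ≡ e
     weight-∣ e (divides t n≡) = go (split-factors fs (X ^ e - 1#) G (≈-trans (geometric-sum t (X ^ e)) (≈-trans (+-congʳ (≈-trans (^-assocʳ X e t) (≈-reflexive (cong (X ^_) (trans (ℕ.*-comm e t) (sym n≡)))))) fs≈)))
       where
       G = geometric t (X ^ e)
       1≤e : 1 ℕ.≤ e
       1≤e = ℕ.n≢0⇒n>0 λ { refl → ℕ.<⇒≱ 1≤n (ℕ.≤-reflexive (trans n≡ (ℕ.*-zeroʳ t))) }
       p∤t : ¬ p ℕ.∣ t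
       p∤t p∣t = p∤n (subst (p ℕ.∣_) (sym n≡) (ℕ.∣m⇒∣m*n e p∣t))
       sums : ∀ {as bs gs} → Interleaving as bs gs → All (λ F → labelOf F ℕ.∣ e) as → All (λ F → ¬ labelOf F ℕ.∣ e) bs →
              weight (λ d → ι (d ∣? e)) (map pair gs) ≡ sum (map degree as)
       sums [] [] [] = refl
       sums {F ∷ _} (consˡ il) (q ∷ qs) rs = cong₂ ℕ._+_ (ι-*-yes (labelOf F ∣? e) q) (sums il qs rs)
       sums {bs = F ∷ _} (consʳ il) qs (r ∷ rs) = trans (cong₂ ℕ._+_ (ι-*-no (labelOf F ∣? e) r) (sums il qs rs)) refl
       go : (∃ λ as → ∃ λ bs → Interleaving as bs fs × (∃ λ u → ∃ λ w → u * w ≈ 1# × X ^ e - 1# ≈ u * ∏ as × G ≈ w * ∏ bs)) →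
            weight (λ d → ι (d ∣? e)) (map pair fs) ≡ e
       go (as , bs , il , u , w , uw , e₁ , e₂) = trans (sums il in-as in-bs) (sym (degree-split {as = as} (monic⇒degree (X^-1-monic e 1≤e)) uw e₁))
         where
         parts : ∀ {as bs gs} → Interleaving as bs gs → All (λ F → poly F ∣ X ^ n - 1#) gs → All (λ F → poly F ∣ X ^ n - 1#) as × All (λ F → poly F ∣ X ^ n - 1#) bs
         parts [] [] = [] , []
         parts (consˡ il) (q ∷ qs) = let a , b = parts il qs in q ∷ a , b
         parts (consʳ il) (q ∷ qs) = let a , b = parts il qs in a , q ∷ b
         as-∣ : All (λ F → poly F ∣ X ^ e - 1#) as
         as-∣ = All.map (λ d → ∣-resp (≈-sym e₁) (∣-* u d)) (factor-∣-∏ as)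
         in-as : All (λ F → labelOf F ℕ.∣ e) as
         in-as = All.zipWith (λ {F} (d , d′) → Label.to (proj₂ (proj₂ (labelOf-spec F d))) e d′) (proj₁ (parts il ∣-all) , as-∣)
         ¬both : ∀ F → poly F ∣ X ^ e - 1# → poly F ∣ G → ⊥
         ¬both F d₁ d₂ = unit (≋-inverse {+ t} λ z → p∤t (≅-0⁻¹ z))
           where
           f∣t : poly F ∣ # t
           f∣t = ∣-resp (solve (G ∷ # t ∷ []) (v0 :- (v0 :- v1)) v1) (∣-+ d₂ (∣-neg (∣-trans d₁ (geometric-mod t (X ^ e)))))
           unit : (∃ λ a → a ℤ.* + t ≋ + 1 [ p ]) → ⊥
           unit (a , at≋1) = Modulo.∤1 F (∣-resp (≈-trans (*-congˡ (#≈C t)) (≈-trans (≈-sym (C-* a (+ t))) (C-cong at≋1))) (∣-* (C a) f∣t))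
         in-bs : All (λ F → ¬ labelOf F ℕ.∣ e) bs
         in-bs = All.zipWith (λ {F} (d , d′) l∣e → ¬both F (Label.from (proj₂ (proj₂ (labelOf-spec F d))) e l∣e) d′)
           (proj₂ (parts il ∣-all) , All.map (λ d → ∣-resp (≈-sym e₂) (∣-* w d)) (factor-∣-∏ bs))

     weight-degree : ∀ gs → weight (λ _ → 1) (map pair gs) ≡ sum (map degree gs)
     weight-degree [] = refl
     weight-degree (F ∷ gs) = cong₂ ℕ._+_ (ℕ.+-identityʳ (degree F)) (weight-degree gs)

     divisor⇒selection : ∀ k → HasDivisorOfDegree p n k → ∃ λ as → ∃ λ bs → Interleaving as bs (map pair fs) × weight (λ _ → 1) as ≡ k
     divisor⇒selection k (g , h , len , g-top , gh≈) = go (split-factors fs g h (≈-trans (≈-reflexive (⊠-*P g h)) (≈-trans (coeffwise λ i → ∣⇒≋ (gh≈ i)) (≈-trans (xⁿ-1≈ n) fs≈))))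
       where
       dg : Degree k g
       dg = mkDegree (length-below (suc k) g len) (λ z → g-top (≋0⇒∣ z))
       go : (∃ λ as → ∃ λ bs → Interleaving as bs fs × (∃ λ u → ∃ λ w → u * w ≈ 1# × g ≈ u * ∏ as × h ≈ w * ∏ bs)) →
            ∃ λ as → ∃ λ bs → Interleaving as bs (map pair fs) × weight (λ _ → 1) as ≡ k
       go (as , bs , il , u , w , uw , e₁ , _) = map pair as , map pair bs , interleaving-map pair il , trans (weight-degree as) (sym (degree-split {as = as} dg uw e₁))

     selection⇒divisor : ∀ v as bs → Interleaving as bs (repeat (p ℕ.^ v) (map pair fs)) → HasDivisorOfDegree p (p ℕ.^ v ℕ.* n) (weight (λ _ → 1) as)
     selection⇒divisor v as bs il = go (interleaving-unmap pair (repeat (p ℕ.^ v) fs) (subst (Interleaving as bs) (sym (map-repeat pair (p ℕ.^ v) fs)) il))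
       where
       go : (∃ λ as′ → ∃ λ bs′ → Interleaving as′ bs′ (repeat (p ℕ.^ v) fs) × as ≡ map pair as′) → HasDivisorOfDegree p (p ℕ.^ v ℕ.* n) (weight (λ _ → 1) as)
       go (as′ , bs′ , il′ , refl) = subst (HasDivisorOfDegree p (p ℕ.^ v ℕ.* n)) (sym (weight-degree as′))
           (truncate k (∏ as′) , ∏ bs′ , length-applyUpTo (coeff (∏ as′)) (suc k) , (λ p∣ → top (monic⇒degree m) (∣⇒≋0 {coeff (truncate k (∏ as′)) k} p∣)) , λ i → ≋⇒∣ (at product≈ i))
         where
         k = sum (map degree as′)
         m′ = ∏-monic as′
         t≈ : truncate k (∏ as′) ≈ ∏ as′
         t≈ = truncate-≈ (belowᴹ m′)
         m : Monic k (truncate k (∏ as′))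
         m = monic-≈ (≈-sym t≈) m′
         product≈ : truncate k (∏ as′) *P ∏ bs′ ≈ xⁿ-1 (p ℕ.^ v ℕ.* n)
         product≈ = ≈-trans (≈-reflexive (sym (⊠-*P (truncate k (∏ as′)) (∏ bs′)))) (≈-trans (*-congʳ t≈) (≈-trans (∏-interleaving il′) (≈-trans (∏-repeat (p ℕ.^ v) fs)
           (≈-trans (^-congˡ (p ℕ.^ v) (≈-sym fs≈)) (≈-trans (X^-1^ n v) (≈-sym (xⁿ-1≈ (p ℕ.^ v ℕ.* n))))))))

   pattern-of : Pattern p n
   pattern-of = record
     { list = map pair fs
     ; orders = map⁺ (All.map (λ {F} → order-of-factor F) ∣-all)
     ; divisor-sum = weight-∣
     ; divisor⇒selection = divisor⇒selection
     ; selection⇒divisor = selection⇒divisor }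

open Selection
open FiniteField using (pattern-of)
open PrimesInProgressions using (dirichlet)
open import Data.Nat using (_+_; _*_; _^_; _∸_; _≤_; _<_; >-nonZero; _≟_; _≤?_)
open import Data.Nat.Properties
open import Data.Nat.Divisibility as Divisibility hiding (_∣?_)
open import Data.Nat.GCD using (gcd; gcd[m,n]∣m; gcd[m,n]∣n; c*gcd[m,n]≡gcd[cm,cn])
open import Data.Nat.ListAction using (sum)
open import Data.Nat.ListAction.Properties using (sum-++)
open import Data.List using (_++_; _∷ʳ_; filter)
open import Data.List.Properties using (map-upTo; applyUpTo-∷ʳ; filter-++; length-++; map-++)
open import Data.List.Relation.Unary.All as All using (All; []; _∷_)
open import Data.List.Relation.Ternary.Interleaving.Propositional using (Interleaving; []; consˡ; consʳ)
open import Function.Bundles using (_⇔_; mk⇔)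

-- Counting by divisor sums.

∑-mono : ∀ n {f g : ℕ → ℕ} → (∀ i → 1 ≤ i → i ≤ n → f i ≤ g i) → ∑ n f ≤ ∑ n g
∑-mono zero h = z≤n
∑-mono (suc n) h = +-mono-≤ (∑-mono n λ i p q → h i p (m≤n⇒m≤1+n q)) (h (suc n) (s≤s z≤n) ≤-refl)

∑-1 : ∀ n → ∑ n (λ _ → 1) ≡ n
∑-1 zero = refl
∑-1 (suc n) = trans (cong (_+ 1) (∑-1 n)) (+-comm n 1)

∑-divisors : ∀ {m n} (f : ℕ → ℕ) → 1 ≤ m → m ≤ n → ∑ n (λ d → ι (d ∣? m) * f d) ≡ ∑ m (λ d → ι (d ∣? m) * f d)
∑-divisors {m} {n} f 1≤m m≤n = ∑-trunc (λ d → ι (d ∣? m) * f d) m≤n λ i m<i _ → ι-*-no (i ∣? m) λ i∣m → <⇒≱ m<i (∣⇒≤ {{>-nonZero 1≤m}} i∣m)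

module _ {P : ℕ → Set} (P? : ∀ n → Dec (P n)) where

  private
    snoc : ∀ n → oneTo (suc n) ≡ oneTo n ∷ʳ suc n
    snoc n = trans (map-upTo suc (suc n)) (trans (sym (applyUpTo-∷ʳ suc n)) (cong (_∷ʳ suc n) (sym (map-upTo suc n))))

    length₁ : ∀ x → length (filter P? (x ∷ [])) ≡ ι (P? x)
    length₁ x with P? x
    ... | yes _ = refl
    ... | no _ = refl

    sum₁ : ∀ (f : ℕ → ℕ) x → sum (map f (filter P? (x ∷ []))) ≡ ι (P? x) * f x
    sum₁ f x with P? x
    ... | yes _ = refl
    ... | no _ = refl

  length-filter : ∀ n → length (filter P? (oneTo n)) ≡ ∑ n (λ i → ι (P? i))
  length-filter zero = refl
  length-filter (suc n) = trans (cong (λ xs → length (filter P? xs)) (snoc n)) (trans (cong length (filter-++ P? (oneTo n) (suc n ∷ [])))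
    (trans (length-++ (filter P? (oneTo n))) (cong₂ _+_ (length-filter n) (length₁ (suc n)))))

  sum-filter : ∀ (f : ℕ → ℕ) n → sum (map f (filter P? (oneTo n))) ≡ ∑ n (λ i → ι (P? i) * f i)
  sum-filter f zero = refl
  sum-filter f (suc n) = trans (cong (λ xs → sum (map f (filter P? xs))) (snoc n)) (trans (cong (λ xs → sum (map f xs)) (filter-++ P? (oneTo n) (suc n ∷ [])))
    (trans (cong sum (map-++ f (filter P? (oneTo n)) (filter P? (suc n ∷ [])))) (trans (sum-++ (map f (filter P? (oneTo n))) (map f (filter P? (suc n ∷ [])))) (cong₂ _+_ (sum-filter f n) (sum₁ f (suc n))))))

φ≡∑ : ∀ d → φ d ≡ ∑ d (λ a → ι (gcd a d ≟ 1))
φ≡∑ d = length-filter (λ a → gcd a d ≟ 1) d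

sum-divisors : ∀ (f : ℕ → ℕ) n → sum (map f (divisors n)) ≡ ∑ n (λ d → ι (d ∣? n) * f d)
sum-divisors f n = trans (sum-filter (Divisibility._∣? n) f n) (∑-ext n λ d → cong (_* f d) (ι-⇔ (d Divisibility.∣? n) (d ∣? n) (λ x → x) (λ x → x)))

∑-multiples : ∀ t n (h : ℕ → ℕ) → 1 ≤ t → (∀ a → ¬ t ∣ a → h a ≡ 0) → ∑ (n * t) h ≡ ∑ n (λ b → h (b * t))
∑-multiples t zero h 1≤t h0 = refl
∑-multiples (suc t) (suc n) h 1≤t h0 = trans (cong (λ k → ∑ k h) (+-comm (suc t) (n * suc t))) (trans (∑-++ (n * suc t) (suc t) h)
  (cong₂ _+_ (∑-multiples (suc t) n h 1≤t h0) (cong₂ _+_ (∑-0 t λ i 1≤i i≤t → h0 _ λ d → <⇒≱ (s≤s i≤t) (∣⇒≤ {{>-nonZero 1≤i}} (∣m+n∣m⇒∣n d (n∣m*n n))))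
    (cong h (+-comm (n * suc t) (suc t))))))

module _ (e : ℕ) (1≤e : 1 ≤ e) where

  private
    -- Marks the `a` with gcd a e = e / d. For d ∣ e there are φ(d) of them up to e, and every `a`
    -- is marked for exactly one d; counting the pairs in both orders gives Gauss's formula.
    δ : ℕ → ℕ → ℕ
    δ d a = ι (d * gcd a e ≟ e)

    inner : ∀ d → d ∣ e → ∑ e (δ d) ≡ φ d
    inner d (divides t e≡) = trans (trans (cong (λ k → ∑ k (δ d)) (trans e≡ (*-comm t d))) (∑-multiples t d (δ d) 1≤t λ a t∤a → ι-no _ λ q → t∤a (subst (_∣ a) (gcd≡t a q) (gcd[m,n]∣m a e))))
        (trans (∑-ext d λ b → ι-⇔ (d * gcd (b * t) e ≟ e) (gcd b d ≟ 1) (λ q → scaled⁻ b (gcd≡t (b * t) q)) (λ q → trans (cong (d *_) (scaled b q)) (trans (*-comm d t) (sym e≡)))) (sym (φ≡∑ d)))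
      where
      1≤t : 1 ≤ t
      1≤t = n≢0⇒n>0 λ { refl → <⇒≱ 1≤e (≤-reflexive e≡) }
      1≤d : 1 ≤ d
      1≤d = n≢0⇒n>0 λ { refl → <⇒≱ 1≤e (≤-reflexive (trans e≡ (*-zeroʳ t))) }
      gcd≡t : ∀ a → d * gcd a e ≡ e → gcd a e ≡ t
      gcd≡t a q = *-cancelˡ-≡ (gcd a e) t d {{>-nonZero 1≤d}} (trans q (trans e≡ (*-comm t d)))
      gcd-scale : ∀ b → gcd (b * t) e ≡ t * gcd b d
      gcd-scale b = trans (cong₂ gcd (*-comm b t) e≡) (sym (c*gcd[m,n]≡gcd[cm,cn] t b d))
      scaled : ∀ b → gcd b d ≡ 1 → gcd (b * t) e ≡ t
      scaled b q = trans (gcd-scale b) (trans (cong (t *_) q) (*-identityʳ t))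
      scaled⁻ : ∀ b → gcd (b * t) e ≡ t → gcd b d ≡ 1
      scaled⁻ b q = *-cancelˡ-≡ (gcd b d) 1 t {{>-nonZero 1≤t}} (trans (sym (gcd-scale b)) (trans q (sym (*-identityʳ t))))

    outer : ∀ a → 1 ≤ a → ∑ e (λ d → ι (d ∣? e) * δ d a) ≡ 1
    outer a 1≤a = go (gcd[m,n]∣n a e)
      where
      go : gcd a e ∣ e → ∑ e (λ d → ι (d ∣? e) * δ d a) ≡ 1
      go (divides q e≡) = trans (∑-cong e λ d 1≤d d≤e → trans (ι-*-⇔ d) (sym (*-identityʳ _))) (∑-δ e q (λ _ → 1) 1≤q q≤e)
        where
        1≤g : 1 ≤ gcd a e
        1≤g = n≢0⇒n>0 λ z → <⇒≱ 1≤e (≤-reflexive (trans e≡ (trans (cong (q *_) z) (*-zeroʳ q))))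
        1≤q : 1 ≤ q
        1≤q = n≢0⇒n>0 λ { refl → <⇒≱ 1≤e (≤-reflexive e≡) }
        q≤e : q ≤ e
        q≤e = ≤-trans (m≤m*n q (gcd a e) {{>-nonZero 1≤g}}) (≤-reflexive (sym e≡))
        ι-*-⇔ : ∀ d → ι (d ∣? e) * δ d a ≡ ι (d ≟ q)
        ι-*-⇔ d = trans (ι-*-absorb (d * gcd a e ≟ e)) (ι-⇔ (d * gcd a e ≟ e) (d ≟ q) (λ x → *-cancelʳ-≡ d q (gcd a e) {{>-nonZero 1≤g}} (trans x e≡)) (λ { refl → sym e≡ }))
          where
          ι-*-absorb : (x : Dec (d * gcd a e ≡ e)) → ι (d ∣? e) * ι x ≡ ι x
          ι-*-absorb (yes x) = ι-*-yes (d ∣? e) (divides (gcd a e) (trans (sym x) (*-comm d (gcd a e))))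
          ι-*-absorb (no _) = *-zeroʳ (ι (d ∣? e))

  φ-divisor-sum : ∑ e (λ d → ι (d ∣? e) * φ d) ≡ e
  φ-divisor-sum = begin
    ∑ e (λ d → ι (d ∣? e) * φ d) ≡⟨ ∑-ext e (λ d → ι-*-cong (d ∣? e) λ d∣e → sym (inner d d∣e)) ⟩
    ∑ e (λ d → ι (d ∣? e) * ∑ e (δ d)) ≡⟨ ∑-ext e (λ d → ∑-*ˡ e (ι (d ∣? e)) (δ d)) ⟩
    ∑ e (λ d → ∑ e (λ a → ι (d ∣? e) * δ d a)) ≡⟨ ∑-swap e e (λ d a → ι (d ∣? e) * δ d a) ⟩
    ∑ e (λ a → ∑ e (λ d → ι (d ∣? e) * δ d a)) ≡⟨ ∑-cong e (λ a 1≤a _ → outer a 1≤a) ⟩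
    ∑ e (λ _ → 1) ≡⟨ ∑-1 e ⟩
    e ∎
    where open ≡-Reasoning

-- Induction in place of Möbius inversion: in the sum over the divisors of d all terms except the
-- one at d itself agree already.
divisor-sums-determine : ∀ n (f g : ℕ → ℕ) → 1 ≤ n →
  (∀ e → 1 ≤ e → e ∣ n → ∑ e (λ d → ι (d ∣? e) * f d) ≡ ∑ e (λ d → ι (d ∣? e) * g d)) → ∀ d → d ∣ n → f d ≡ g d
divisor-sums-determine n f g 1≤n sums = <-rec (λ d → d ∣ n → f d ≡ g d) step
  where
  step : ∀ d → (∀ {k} → k < d → k ∣ n → f k ≡ g k) → d ∣ n → f d ≡ g d
  step zero rec 0∣n = ⊥-elim (<⇒≱ 1≤n (≤-reflexive (0∣⇒≡0 0∣n)))
  step (suc d) rec d∣n = trans (sym (ι-*-yes (suc d ∣? suc d) ∣-refl)) (trans (+-cancelˡ-≡ (∑ d (λ k → ι (k ∣? suc d) * f k)) _ _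
      (trans (sums (suc d) (s≤s z≤n) d∣n) (cong (_+ ι (suc d ∣? suc d) * g (suc d)) (sym lower)))) (ι-*-yes (suc d ∣? suc d) ∣-refl))
    where
    lower : ∑ d (λ k → ι (k ∣? suc d) * f k) ≡ ∑ d (λ k → ι (k ∣? suc d) * g k)
    lower = ∑-cong d λ k _ k≤d → ι-*-cong (k ∣? suc d) λ k∣ → rec (s≤s k≤d) (∣-trans k∣ d∣n)

count : ℕ → List (ℕ × ℕ) → ℕ
count d [] = 0
count d ((d′ , _) ∷ ls) = ι (d ≟ d′) + count d ls

count-++ : ∀ d ls ms → count d (ls ++ ms) ≡ count d ls + count d ms
count-++ d [] ms = refl
count-++ d (x ∷ ls) ms = trans (cong (_+_ (ι (d ≟ proj₁ x))) (count-++ d ls ms)) (sym (+-assoc (ι (d ≟ proj₁ x)) _ _))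

count-repeat : ∀ d N ls → count d (repeat N ls) ≡ N * count d ls
count-repeat d zero ls = refl
count-repeat d (suc N) ls = trans (count-++ d ls (repeat N ls)) (cong (_+_ (count d ls)) (count-repeat d N ls))

count-≤ : ∀ d {as bs ls} → Interleaving as bs ls → count d as ≤ count d ls
count-≤ d [] = z≤n
count-≤ d (consˡ il) = +-monoʳ-≤ _ (count-≤ d il)
count-≤ d (consʳ il) = ≤-trans (count-≤ d il) (m≤n+m _ _)

count-0 : ∀ {P : ℕ × ℕ → Set} d ls → All P ls → (∀ o → ¬ P (d , o)) → count d ls ≡ 0
count-0 d [] [] ¬P = refl
count-0 d ((d′ , o) ∷ ls) (q ∷ qs) ¬P = cong₂ _+_ (ι-no (d ≟ d′) λ { refl → ¬P o q }) (count-0 d ls qs ¬P)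

all-left : ∀ {P : ℕ × ℕ → Set} {as bs ls} → Interleaving as bs ls → All P ls → All P as
all-left [] [] = []
all-left (consˡ il) (q ∷ qs) = q ∷ all-left il qs
all-left (consʳ il) (q ∷ qs) = all-left il qs

all-++ : ∀ {P : ℕ × ℕ → Set} {ls ms} → All P ls → All P ms → All P (ls ++ ms)
all-++ [] rs = rs
all-++ (q ∷ qs) rs = q ∷ all-++ qs rs

all-repeat : ∀ {P : ℕ × ℕ → Set} N {ls} → All P ls → All P (repeat N ls)
all-repeat zero qs = []
all-repeat (suc N) qs = all-++ qs (all-repeat N qs)

weight-∑ : ∀ (u w : ℕ → ℕ) n ls → All (λ (d , o) → 1 ≤ d × d ≤ n × o ≡ w d) ls → weight u ls ≡ ∑ n (λ d → u d * (w d * count d ls))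
weight-∑ u w n [] [] = sym (∑-0 n λ d _ _ → trans (cong (u d *_) (*-zeroʳ (w d))) (*-zeroʳ (u d)))
weight-∑ u w n ((d′ , o) ∷ ls) ((1≤d , d≤n , o≡) ∷ qs) = sym (begin
  ∑ n (λ d → u d * (w d * (ι (d ≟ d′) + count d ls))) ≡⟨ ∑-ext n (λ d → lem (u d) (w d) (ι (d ≟ d′)) (count d ls)) ⟩
  ∑ n (λ d → ι (d ≟ d′) * (u d * w d) + u d * (w d * count d ls)) ≡⟨ ∑-+ n (λ d → ι (d ≟ d′) * (u d * w d)) (λ d → u d * (w d * count d ls)) ⟩
  ∑ n (λ d → ι (d ≟ d′) * (u d * w d)) + ∑ n (λ d → u d * (w d * count d ls)) ≡⟨ cong₂ _+_ (∑-δ n d′ (λ d → u d * w d) 1≤d d≤n) (sym (weight-∑ u w n ls qs)) ⟩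
  u d′ * w d′ + weight u ls ≡⟨ cong (λ z → u d′ * z + weight u ls) (sym o≡) ⟩
  u d′ * o + weight u ls ∎)
  where
  open ≡-Reasoning
  lem : ∀ u w i c → u * (w * (i + c)) ≡ i * (u * w) + u * (w * c)
  lem = solve-∀

-- Greedy choice: an entry is taken as long as its label is still demanded, and its demand is then
-- lowered by one.
select : ∀ ls (C : ℕ → ℕ) → (∀ d → C d ≤ count d ls) → ∃ λ as → ∃ λ bs → Interleaving as bs ls × (∀ d → count d as ≡ C d)
select [] C C≤ = [] , [] , [] , λ d → sym (n≤0⇒n≡0 (C≤ d))
select ((d′ , o) ∷ ls) C C≤ = cases (C d′) refl
  where
  Result = ∃ λ as → ∃ λ bs → Interleaving as bs ((d′ , o) ∷ ls) × (∀ d → count d as ≡ C d)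
  skip : C d′ ≡ 0 → ∀ d (x : Dec (d ≡ d′)) → C d ≤ ι x + count d ls → C d ≤ count d ls
  skip z d (yes refl) _ = subst (_≤ count d ls) (sym z) z≤n
  skip z d (no _) q = q
  take : ∀ m → C d′ ≡ suc m → ∀ d (x : Dec (d ≡ d′)) → ι x + (C d ∸ ι x) ≡ C d
  take m z d (yes refl) = m+[n∸m]≡n (subst (1 ≤_) (sym z) (s≤s z≤n))
  take m z d (no _) = refl
  cases : ∀ m → C d′ ≡ m → Result
  cases zero z = go (select ls C λ d → skip z d (d ≟ d′) (C≤ d))
    where
    go : (∃ λ as → ∃ λ bs → Interleaving as bs ls × (∀ d → count d as ≡ C d)) → Result
    go (as , bs , il , e) = as , (d′ , o) ∷ bs , consʳ il , e
  cases (suc m) z = go (select ls (λ d → C d ∸ ι (d ≟ d′)) λ d → m≤n+o⇒m∸n≤o (C d) (ι (d ≟ d′)) (C≤ d))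
    where
    go : (∃ λ as → ∃ λ bs → Interleaving as bs ls × (∀ d → count d as ≡ C d ∸ ι (d ≟ d′))) → Result
    go (as , bs , il , e) = (d′ , o) ∷ as , bs , consˡ il , λ d → trans (cong (_+_ (ι (d ≟ d′))) (e d)) (take m z d (d ≟ d′))

-- The bound by φ(d) / λ(d) is multiplied out, which avoids a quotient; λ(d) is positive for every
-- divisor d of a positive n.
Representation : ℕ → ℕ → Set
Representation n m = ∃ λ (c : ℕ → ℕ) → (∀ d → d ∣ n → c d * carmichael d ≤ φ d) × (sum (map (λ d → carmichael d * c d) (divisors n)) ≡ m)

∣⇒≥1 : ∀ {d n} → 1 ≤ n → d ∣ n → 1 ≤ d
∣⇒≥1 1≤n d∣n = n≢0⇒n>0 λ { refl → <⇒≱ 1≤n (≤-reflexive (0∣⇒≡0 d∣n)) }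

-- The factors whose label is d have total degree φ d, because both sides have the same divisor sums.
labelled-degree : ∀ {p n} → 1 ≤ n → (pat : Pattern p n) (w : ℕ → ℕ) → All (λ (d , o) → d ∣ n × o ≡ w d) (Pattern.list pat) →
                  ∀ d → d ∣ n → w d * count d (Pattern.list pat) ≡ φ d
labelled-degree {p} {n} 1≤n pat w ok = divisor-sums-determine n (λ d → w d * count d list) φ 1≤n λ e 1≤e e∣n →
    trans (sym (∑-divisors (λ d → w d * count d list) 1≤e (∣⇒≤ {{>-nonZero 1≤n}} e∣n)))
      (trans (sym (weight-∑ (λ d → ι (d ∣? e)) w n list bounds)) (trans (divisor-sum e e∣n) (sym (φ-divisor-sum e 1≤e))))
  where
  open Pattern pat
  bounds : All (λ (d , o) → 1 ≤ d × d ≤ n × o ≡ w d) list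
  bounds = All.map (λ (d∣n , e) → ∣⇒≥1 1≤n d∣n , ∣⇒≤ {{>-nonZero 1≤n}} d∣n , e) ok

-- Necessity: representations from a prime with orders λ(d).

module Necessity (n : ℕ) (1≤n : 1 ≤ n) (practical : lambdaPractical n) where

  represent : ∀ a → Coprime a n → (∀ d → 1 ≤ d → d ∣ n → ∀ k → a ^ k ≅ 1 [ d ] → carmichael d ∣ k) →
              ∀ p → Prime p → p ≅ a [ n ] → ∀ m → 1 ≤ m → m ≤ n → Representation n m
  represent a a⊥n univ p pp p≅a m 1≤m m≤n = go (divisor⇒selection m (practical p pp m 1≤m m≤n))
    where
    p⊥n : Coprime p n
    p⊥n = ≅-coprime p≅a a⊥n
    open Pattern (pattern-of p pp n 1≤n (coprime⇒∤ (prime≥2 pp) p⊥n))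
    -- The exponent λ(d) kills the unit p, so the order of p divides it; conversely p is congruent
    -- to the universal unit `a`, so λ(d) divides the order.
    order≡ : ∀ d o → d ∣ n → Order d p o → o ≡ carmichael d
    order≡ d o d∣n ord = ∣-antisym (Order.to ord (carmichael d) (proj₂ (carmichael-kills d 1≤d) p (coprime-∣ʳ d∣n p⊥n)))
        (univ d 1≤d d∣n o (≋-trans (≅-^ o (≅-∣ d∣n (≋-sym p≅a))) (Order.self ord)))
      where
      1≤d : 1 ≤ d
      1≤d = ∣⇒≥1 1≤n d∣n
    ok : All (λ (d , o) → d ∣ n × o ≡ carmichael d) list
    ok = All.map (λ {(d , o)} (d∣n , ord) → d∣n , order≡ d o d∣n ord) orders
    go : (∃ λ as → ∃ λ bs → Interleaving as bs list × weight (λ _ → 1) as ≡ m) → Representation n m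
    go (as , bs , il , e) = (λ d → count d as) , bound , trans (sum-divisors (λ d → carmichael d * count d as) n) (trans (∑-ext n term)
        (trans (sym (weight-∑ (λ _ → 1) carmichael n as (All.map (λ (d∣n , e) → ∣⇒≥1 1≤n d∣n , ∣⇒≤ {{>-nonZero 1≤n}} d∣n , e) ok-as))) e))
      where
      ok-as : All (λ (d , o) → d ∣ n × o ≡ carmichael d) as
      ok-as = all-left il ok
      bound : ∀ d → d ∣ n → count d as * carmichael d ≤ φ d
      bound d d∣n = ≤-trans (≤-reflexive (*-comm (count d as) (carmichael d))) (≤-trans (*-monoʳ-≤ (carmichael d) (count-≤ d il))
        (≤-reflexive (labelled-degree 1≤n (pattern-of p pp n 1≤n (coprime⇒∤ (prime≥2 pp) p⊥n)) carmichael ok d d∣n)))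
      term : ∀ d → ι (d ∣? n) * (carmichael d * count d as) ≡ 1 * (carmichael d * count d as)
      term d = helper (d ∣? n)
        where
        helper : (x : Dec (d ∣ n)) → ι x * (carmichael d * count d as) ≡ 1 * (carmichael d * count d as)
        helper (yes _) = refl
        helper (no d∤n) = sym (trans (*-identityˡ _) (trans (cong (carmichael d *_) (count-0 d as ok-as λ o q → d∤n (proj₁ q))) (*-zeroʳ (carmichael d))))

  necessity : ∀ m → 1 ≤ m → m ≤ n → Representation n m
  necessity = with-unit (universal-unit n 1≤n)
    where
    with-unit : (∃ λ a → Coprime a n × (∀ d → 1 ≤ d → d ∣ n → ∀ k → a ^ k ≅ 1 [ d ] → carmichael d ∣ k)) → ∀ m → 1 ≤ m → m ≤ n → Representation n m
    with-unit (a , a⊥n , univ) = with-prime (dirichlet n a 1≤n a⊥n)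
      where
      with-prime : (∃ λ p → Prime p × p ≅ a [ n ]) → ∀ m → 1 ≤ m → m ≤ n → Representation n m
      with-prime (p , pp , p≅a) = represent a a⊥n univ p pp p≅a

-- Sufficiency: divisors from representations.

module Sufficiency (p : ℕ) (pp : Prime p) (v n′ : ℕ) (p∤n′ : ¬ p ∣ n′) (1≤n′ : 1 ≤ n′) where

  private
    n : ℕ
    n = p ^ v * n′

    P≥1 : ∀ i → 1 ≤ p ^ i
    P≥1 i = m^n>0 p {{>-nonZero (prime-≥1 pp)}} i

    1≤n : 1 ≤ n
    1≤n = *-mono-≤ (P≥1 v) 1≤n′

    pattern′ : Pattern p n′
    pattern′ = pattern-of p pp n′ 1≤n′ p∤n′
    open Pattern pattern′

    P⊥ : ∀ i {d} → ¬ p ∣ d → Coprime (p ^ i) d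
    P⊥ i p∤d = coprime-^ˡ i (prime∤⇒coprime pp p∤d)

    opaque
      -- The largest divisor of d prime to p.
      free : ℕ → ℕ
      free zero = 0
      free (suc d) = proj₁ (proj₂ (strip p pp (suc d) (s≤s z≤n)))

      free-spec : ∀ d → 1 ≤ d → ∃ λ i → d ≡ p ^ i * free d × ¬ p ∣ free d × 1 ≤ free d
      free-spec (suc d) _ = let i , _ , rest = strip p pp (suc d) (s≤s z≤n) in i , rest

      -- The junk value 0 makes the order of p a function on all of ℕ, as the weights in `weight-∑`
      -- require.
      w : ℕ → ℕ
      w d = go (1 ≤? d) (coprime? p d)
        where
        go : Dec (1 ≤ d) → Dec (Coprime p d) → ℕ
        go (yes 1≤d) (yes p⊥d) = proj₁ (order d p 1≤d p⊥d)
        go _ _ = 0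

      w-order : ∀ d → 1 ≤ d → Coprime p d → Order d p (w d)
      w-order d 1≤d p⊥d with 1 ≤? d | coprime? p d
      ... | yes q | yes r = proj₁ (proj₂ (order d p q r))
      ... | no ¬q | _ = ⊥-elim (¬q 1≤d)
      ... | yes _ | no ¬r = ⊥-elim (¬r (λ {_} → p⊥d))

    free-∣ : ∀ d e → 1 ≤ d → d ∣ p ^ v * e → free d ∣ e
    free-∣ d e 1≤d d∣ = go (free-spec d 1≤d)
      where
      go : (∃ λ i → d ≡ p ^ i * free d × ¬ p ∣ free d × 1 ≤ free d) → free d ∣ e
      go (i , d≡ , p∤f , _) = coprime-divisor (coprime-sym (P⊥ v p∤f)) (∣-trans (divides (p ^ i) d≡) d∣)

    free-≥1 : ∀ d → 1 ≤ d → 1 ≤ free d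
    free-≥1 d 1≤d = proj₂ (proj₂ (proj₂ (free-spec d 1≤d)))

    ∣-from-free : ∀ d e → 1 ≤ d → d ∣ n → free d ∣ e → d ∣ p ^ v * e
    ∣-from-free d e 1≤d d∣n f∣e = go (free-spec d 1≤d)
      where
      go : (∃ λ i → d ≡ p ^ i * free d × ¬ p ∣ free d × 1 ≤ free d) → d ∣ p ^ v * e
      go (i , d≡ , _) = subst (_∣ p ^ v * e) (sym d≡) (*-pres-∣ p^i∣ f∣e)
        where
        p^i∣ : p ^ i ∣ p ^ v
        p^i∣ = coprime-divisor (P⊥ i p∤n′) (subst (p ^ i ∣_) (*-comm (p ^ v) n′) (∣-trans (subst (p ^ i ∣_) (sym d≡) (m∣m*n (free d))) d∣n))

    w∣carmichael : ∀ d → 1 ≤ d → w (free d) ∣ carmichael d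
    w∣carmichael d 1≤d = go (free-spec d 1≤d)
      where
      go : (∃ λ i → d ≡ p ^ i * free d × ¬ p ∣ free d × 1 ≤ free d) → w (free d) ∣ carmichael d
      go (i , d≡ , p∤f , 1≤f) = Order.to (w-order f 1≤f p⊥f) (carmichael d) (≋-trans (≅-^ (carmichael d) (≋-sym b≅p)) (≅-∣ (divides (p ^ i) d≡) (proj₂ (carmichael-kills d 1≤d) (p + f) b⊥d)))
        where
        f : ℕ
        f = free d
        p⊥f : Coprime p f
        p⊥f = prime∤⇒coprime pp p∤f
        -- p itself need not be a unit modulo d, but p + f is, and it agrees with p modulo f.
        b≅p : p + f ≅ p [ f ]
        b≅p = ≋-trans (≅-≡ (+-comm p f)) (≅-+N {p} {f})
        b⊥p : Coprime (p + f) p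
        b⊥p = ≅-coprime (≅-+N {f} {p}) (coprime-sym p⊥f)
        b⊥d : Coprime (p + f) d
        b⊥d = subst (Coprime (p + f)) (sym d≡) (coprime-sym (coprime-*ˡ (coprime-^ˡ i (coprime-sym b⊥p)) (coprime-sym (≅-coprime b≅p p⊥f))))

    ok : All (λ (d , o) → d ∣ n′ × o ≡ w d) list
    ok = All.map (λ {(d , o)} (d∣n , ord) → d∣n , order≡ d o d∣n ord) orders
      where
      order≡ : ∀ d o → d ∣ n′ → Order d p o → o ≡ w d
      order≡ d o d∣n ord = ∣-antisym (Order.to ord (w d) (Order.self ord′)) (Order.to ord′ o (Order.self ord))
        where
        ord′ : Order d p (w d)
        ord′ = w-order d (∣⇒≥1 1≤n′ d∣n) (coprime-∣ʳ d∣n (prime∤⇒coprime pp p∤n′))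

    δ-∣ : ∀ e k x → 1 ≤ e → ∑ e (λ i → ι (i ≟ k) * (ι (i ∣? e) * x)) ≡ ι (k ∣? e) * x
    δ-∣ e k x 1≤e = helper (k ∣? e)
      where
      helper : Dec (k ∣ e) → ∑ e (λ i → ι (i ≟ k) * (ι (i ∣? e) * x)) ≡ ι (k ∣? e) * x
      helper (yes k∣e) = ∑-δ e k (λ i → ι (i ∣? e) * x) (∣⇒≥1 1≤e k∣e) (∣⇒≤ {{>-nonZero 1≤e}} k∣e)
      helper (no k∤e) = trans (∑-0 e λ i _ _ → trans (ι-*-cong (i ≟ k) λ { refl → ι-*-no (k ∣? e) k∤e }) (*-zeroʳ (ι (i ≟ k)))) (sym (ι-*-no (k ∣? e) k∤e))

    F : ℕ → ℕ
    F d′ = ∑ n (λ d → ι (d′ ≟ free d) * (ι (d ∣? n) * φ d))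

    -- Both sides have divisor sum p^v e at each e ∣ n′, because the divisors d of n with p-free
    -- part dividing e are exactly the divisors of p^v e.
    F≡ : ∀ d′ → d′ ∣ n′ → F d′ ≡ p ^ v * φ d′
    F≡ = divisor-sums-determine n′ F (λ d′ → p ^ v * φ d′) 1≤n′ λ e 1≤e e∣n′ → trans (lhs e 1≤e e∣n′) (sym (rhs e 1≤e))
      where
      rhs : ∀ e → 1 ≤ e → ∑ e (λ d → ι (d ∣? e) * (p ^ v * φ d)) ≡ p ^ v * e
      rhs e 1≤e = trans (∑-ext e λ d → lem (ι (d ∣? e)) (p ^ v) (φ d)) (trans (sym (∑-*ˡ e (p ^ v) (λ d → ι (d ∣? e) * φ d))) (cong (p ^ v *_) (φ-divisor-sum e 1≤e)))
        where
        lem : ∀ a b c → a * (b * c) ≡ b * (a * c)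
        lem = solve-∀
      lhs : ∀ e → 1 ≤ e → e ∣ n′ → ∑ e (λ d′ → ι (d′ ∣? e) * F d′) ≡ p ^ v * e
      lhs e 1≤e e∣n′ = begin
        ∑ e (λ d′ → ι (d′ ∣? e) * F d′) ≡⟨ ∑-ext e (λ d′ → ∑-*ˡ n (ι (d′ ∣? e)) (λ d → ι (d′ ≟ free d) * (ι (d ∣? n) * φ d))) ⟩
        ∑ e (λ d′ → ∑ n (λ d → ι (d′ ∣? e) * (ι (d′ ≟ free d) * (ι (d ∣? n) * φ d)))) ≡⟨ ∑-swap e n (λ d′ d → ι (d′ ∣? e) * (ι (d′ ≟ free d) * (ι (d ∣? n) * φ d))) ⟩
        ∑ n (λ d → ∑ e (λ d′ → ι (d′ ∣? e) * (ι (d′ ≟ free d) * (ι (d ∣? n) * φ d)))) ≡⟨ ∑-ext n (λ d → ∑-ext e λ d′ → lem (ι (d′ ∣? e)) (ι (d′ ≟ free d)) (ι (d ∣? n) * φ d)) ⟩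
        ∑ n (λ d → ∑ e (λ d′ → ι (d′ ≟ free d) * (ι (d′ ∣? e) * (ι (d ∣? n) * φ d)))) ≡⟨ ∑-ext n (λ d → δ-∣ e (free d) (ι (d ∣? n) * φ d) 1≤e) ⟩
        ∑ n (λ d → ι (free d ∣? e) * (ι (d ∣? n) * φ d)) ≡⟨ ∑-cong n (λ d 1≤d _ → merge d 1≤d (free d ∣? e) (d ∣? n) (d ∣? p ^ v * e)) ⟩
        ∑ n (λ d → ι (d ∣? p ^ v * e) * φ d) ≡⟨ ∑-divisors φ 1≤pe (*-monoʳ-≤ (p ^ v) (∣⇒≤ {{>-nonZero 1≤n′}} e∣n′)) ⟩
        ∑ (p ^ v * e) (λ d → ι (d ∣? p ^ v * e) * φ d) ≡⟨ φ-divisor-sum (p ^ v * e) 1≤pe ⟩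
        p ^ v * e ∎
        where
        open ≡-Reasoning
        1≤pe : 1 ≤ p ^ v * e
        1≤pe = *-mono-≤ (P≥1 v) 1≤e
        lem : ∀ a b c → a * (b * c) ≡ b * (a * c)
        lem = solve-∀
        merge : ∀ d → 1 ≤ d → (x : Dec (free d ∣ e)) (y : Dec (d ∣ n)) (z : Dec (d ∣ p ^ v * e)) → ι x * (ι y * φ d) ≡ ι z * φ d
        merge d 1≤d x y (yes d∣) = trans (ι-*-yes x (free-∣ d e 1≤d d∣)) (cong (_* φ d) (ι-yes y (∣-trans d∣ (*-monoʳ-∣ (p ^ v) e∣n′))))
        merge d 1≤d (no _) y (no _) = refl
        merge d 1≤d (yes _) (no _) (no _) = refl
        merge d 1≤d (yes f∣e) (yes d∣n) (no d∤) = ⊥-elim (d∤ (∣-from-free d e 1≤d d∣n f∣e))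

  sufficiency : ∀ m → Representation n m → HasDivisorOfDegree p n m
  sufficiency m (c , bound , total) = go (select (repeat (p ^ v) list) demand demand≤)
    where
    opaque
      -- The number of factors spent on the d-th term: a factor labelled free d has degree w (free d).
      spend : ℕ → ℕ
      spend zero = 0
      spend d@(suc d-1) = share (d ∣? n)
        where
        share : Dec (d ∣ n) → ℕ
        share (yes _) = quotient (w∣carmichael d (s≤s z≤n)) * c d
        share (no _) = 0

      spend-yes : ∀ d → d ∣ n → w (free d) * spend d ≡ carmichael d * c d
      spend-yes zero 0∣n = ⊥-elim (<⇒≱ (∣⇒≥1 1≤n 0∣n) z≤n)
      spend-yes (suc d-1) d∣n with suc d-1 ∣? n
      ... | yes _ = trans (lem (w (free (suc d-1))) (quotient q) (c (suc d-1))) (cong (_* c (suc d-1)) (sym (_∣_.equality q)))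
        where
        q : w (free (suc d-1)) ∣ carmichael (suc d-1)
        q = w∣carmichael (suc d-1) (s≤s z≤n)
        lem : ∀ a b c → a * (b * c) ≡ b * a * c
        lem = solve-∀
      ... | no d∤n = ⊥-elim (d∤n d∣n)

      spend-no : ∀ d → ¬ d ∣ n → spend d ≡ 0
      spend-no zero _ = refl
      spend-no (suc d-1) d∤n with suc d-1 ∣? n
      ... | yes d∣n = ⊥-elim (d∤n d∣n)
      ... | no _ = refl

    -- All d with the same p-free part draw on the factors with that label, so their expenses add
    -- up.
    demand : ℕ → ℕ
    demand d′ = ∑ n (λ d → ι (d′ ≟ free d) * spend d)

    spend-cases : ∀ d (x : Dec (d ∣ n)) → w (free d) * spend d ≡ ι x * (carmichael d * c d)
    spend-cases d (yes d∣n) = trans (spend-yes d d∣n) (sym (*-identityˡ _))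
    spend-cases d (no d∤n) = trans (cong (w (free d) *_) (spend-no d d∤n)) (*-zeroʳ (w (free d)))

    w*demand : ∀ d′ → w d′ * demand d′ ≡ ∑ n (λ d → ι (d′ ≟ free d) * (w (free d) * spend d))
    w*demand d′ = trans (∑-*ˡ n (w d′) (λ d → ι (d′ ≟ free d) * spend d)) (∑-ext n λ d → trans (lem (w d′) (ι (d′ ≟ free d)) (spend d)) (ι-*-cong (d′ ≟ free d) λ q → cong (λ z → w z * spend d) q))
      where
      lem : ∀ a b c → a * (b * c) ≡ b * (a * c)
      lem = solve-∀

    -- Compare degrees: multiplied by w d′, the demand is at most the sum of φ(d) over the d ∣ n
    -- with p-free part d′. That sum is p^v φ(d′), the total degree of the p^v copies of the factors
    -- labelled d′.
    demand≤ : ∀ d′ → demand d′ ≤ count d′ (repeat (p ^ v) list)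
    demand≤ d′ = subst (demand d′ ≤_) (sym (count-repeat d′ (p ^ v) list)) (cases (d′ ∣? n′))
      where
      term≤ : ∀ d (x : Dec (d ∣ n)) → ι x * (carmichael d * c d) ≤ ι x * φ d
      term≤ d (yes d∣n) = *-monoʳ-≤ 1 (≤-trans (≤-reflexive (*-comm (carmichael d) (c d))) (bound d d∣n))
      term≤ d (no _) = z≤n
      cases : Dec (d′ ∣ n′) → demand d′ ≤ p ^ v * count d′ list
      cases (no d′∤) = ≤-trans (≤-reflexive (∑-0 n λ d 1≤d _ → unused d 1≤d (d ∣? n))) z≤n
        where
        unused : ∀ d → 1 ≤ d → Dec (d ∣ n) → ι (d′ ≟ free d) * spend d ≡ 0
        unused d 1≤d (yes d∣n) = ι-*-no (d′ ≟ free d) λ { refl → d′∤ (free-∣ d n′ 1≤d d∣n) }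
        unused d 1≤d (no d∤n) = trans (cong (ι (d′ ≟ free d) *_) (spend-no d d∤n)) (*-zeroʳ (ι (d′ ≟ free d)))
      cases (yes d′∣) = *-cancelˡ-≤ (w d′) {{>-nonZero (Order.pos (w-order d′ (∣⇒≥1 1≤n′ d′∣) (coprime-∣ʳ d′∣ (prime∤⇒coprime pp p∤n′))))}} (begin
        w d′ * demand d′ ≡⟨ w*demand d′ ⟩
        ∑ n (λ d → ι (d′ ≟ free d) * (w (free d) * spend d)) ≡⟨ ∑-ext n (λ d → cong (ι (d′ ≟ free d) *_) (spend-cases d (d ∣? n))) ⟩
        ∑ n (λ d → ι (d′ ≟ free d) * (ι (d ∣? n) * (carmichael d * c d))) ≤⟨ ∑-mono n (λ d _ _ → *-monoʳ-≤ (ι (d′ ≟ free d)) (term≤ d (d ∣? n))) ⟩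
        F d′ ≡⟨ F≡ d′ d′∣ ⟩
        p ^ v * φ d′ ≡⟨ cong (p ^ v *_) (sym (labelled-degree 1≤n′ pattern′ w ok d′ d′∣)) ⟩
        p ^ v * (w d′ * count d′ list) ≡⟨ lem (p ^ v) (w d′) (count d′ list) ⟩
        w d′ * (p ^ v * count d′ list) ∎)
        where
        open ≤-Reasoning
        lem : ∀ a b c → a * (b * c) ≡ b * (a * c)
        lem = solve-∀

    go : (∃ λ as → ∃ λ bs → Interleaving as bs (repeat (p ^ v) list) × (∀ d → count d as ≡ demand d)) → HasDivisorOfDegree p n m
    go (as , bs , il , counts) = subst (HasDivisorOfDegree p n) degree≡ (selection⇒divisor v as bs il)
      where
      collect : ∀ d → 1 ≤ d → (x : Dec (d ∣ n)) → ∑ n′ (λ d′ → ι (d′ ≟ free d) * (w (free d) * spend d)) ≡ ι x * (carmichael d * c d)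
      collect d 1≤d (yes d∣n) = trans (∑-δ n′ (free d) (λ _ → w (free d) * spend d) (free-≥1 d 1≤d) (∣⇒≤ {{>-nonZero 1≤n′}} (free-∣ d n′ 1≤d d∣n))) (spend-cases d (yes d∣n))
      collect d 1≤d (no d∤n) = ∑-0 n′ λ d′ _ _ → trans (cong (ι (d′ ≟ free d) *_) (spend-cases d (no d∤n))) (*-zeroʳ (ι (d′ ≟ free d)))
      degree≡ : weight (λ _ → 1) as ≡ m
      degree≡ = begin
        weight (λ _ → 1) as ≡⟨ weight-∑ (λ _ → 1) w n′ as (all-left il (all-repeat (p ^ v) (All.map (λ (d∣n , e) → ∣⇒≥1 1≤n′ d∣n , ∣⇒≤ {{>-nonZero 1≤n′}} d∣n , e) ok))) ⟩
        ∑ n′ (λ d′ → 1 * (w d′ * count d′ as)) ≡⟨ ∑-ext n′ (λ d′ → trans (*-identityˡ _) (trans (cong (w d′ *_) (counts d′)) (w*demand d′))) ⟩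
        ∑ n′ (λ d′ → ∑ n (λ d → ι (d′ ≟ free d) * (w (free d) * spend d))) ≡⟨ ∑-swap n′ n (λ d′ d → ι (d′ ≟ free d) * (w (free d) * spend d)) ⟩
        ∑ n (λ d → ∑ n′ (λ d′ → ι (d′ ≟ free d) * (w (free d) * spend d))) ≡⟨ ∑-cong n (λ d 1≤d _ → collect d 1≤d (d ∣? n)) ⟩
        ∑ n (λ d → ι (d ∣? n) * (carmichael d * c d)) ≡⟨ sym (sum-divisors (λ d → carmichael d * c d) n) ⟩
        sum (map (λ d → carmichael d * c d) (divisors n)) ≡⟨ total ⟩
        m ∎
        where open ≡-Reasoning

sufficient : ∀ n → 1 ≤ n → (∀ m → 1 ≤ m → m ≤ n → Representation n m) → lambdaPractical n
sufficient n 1≤n rep p pp k 1≤k k≤n = go (strip p pp n 1≤n)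
  where
  go : (∃ λ v → ∃ λ n′ → n ≡ p ^ v * n′ × ¬ p ∣ n′ × 1 ≤ n′) → HasDivisorOfDegree p n k
  go (v , n′ , n≡ , p∤n′ , 1≤n′) = subst (λ n → HasDivisorOfDegree p n k) (sym n≡)
    (Sufficiency.sufficiency p pp v n′ p∤n′ 1≤n′ k (subst (λ n → Representation n k) n≡ (rep k 1≤k k≤n)))

theorem3p1 : ∀ (n : ℕ) → 1 ≤ n →
  (lambdaPractical n ⇔
    (∀ (m : ℕ) → 1 ≤ m → m ≤ n →
      ∃ λ (c : ℕ → ℕ) →
        (∀ d → d ∣ n → c d * carmichael d ≤ φ d) ×
        (sum (map (λ d → carmichael d * c d) (divisors n)) ≡ m)))
theorem3p1 n 1≤n = mk⇔ (Necessity.necessity n 1≤n) (sufficient n 1≤n)
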